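{- Let $p$ be a sufficiently large prime and $\mathcal{A}$ a zero-free subset of $\mathbb{Z}/p\mathbb{Z}$ of the largest cardinality, and let $\delta(p)=[\sqrt{2p}]-\operatorname{card}(\mathcal{A})$ (which lies in $\{0,1\}$). Then there exists $d\in(\mathbb{Z}/p\mathbb{Z})^*$ such that $d\cdot\mathcal{A}$ is the union of sets $\mathcal{A}'$ and $\mathcal{A}''$ satisfying: (i) $\mathcal{A}'\subset[-2(1+\delta(p)),-1]_p$, $\mathcal{A}''\subset[1,p/2]_p$, $\mathcal{A}''\cap(-\mathcal{A}')=\emptyset$ and $\operatorname{card}(\mathcal{A}')\le1+\delta(p)$; (ii) $\mathcal{A}''$ contains the whole set $[5,\sqrt{2p}/5]_p$ with at most $\delta(p)$ exceptions; (iii) $(-\mathcal{A}')\cup\mathcal{A}''$ contains the whole set $[1,4]_p$ with at most $\delta(p)$ exceptions; (iv) $(d\cdot\mathcal{A})^{\sharp}$ contains the whole set $[3,s'']_p$ with at most $\delta(p)$ exceptions, where $s''=\sum_{a''\in\mathcal{A}''}|a''|_p$; (v) $\sum_{a'\in\mathcal{A}'}|a'|_p\le 2(1+\delta(p))$ and $\sum_{a''\in\mathcal{A}''}|a''|_p\le p-1+3\delta(p)$. Further, if $s''=\sum_{a''\in\mathcal{A}''}|a''|_p>p-1$, then $s(\sqrt{2p}):=\frac{[\sqrt{2p}]([\sqrt{2p}]+1)}{2}\in[p+2,p+7]$.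
   Context: For $\mathcal{A}\subset\mathbb{Z}/p\mathbb{Z}$, $\mathcal{A}^{\sharp}$ is the set of sums of the elements of nonempty subsets of $\mathcal{A}$; $\mathcal{A}$ is zero-free if $0\notin\mathcal{A}^{\sharp}$. Let $\sigma_p:\mathbb{Z}\to\mathbb{Z}/p\mathbb{Z}$ be the canonical projection; for $a\in\mathbb{Z}/p\mathbb{Z}$, $\bar a\in(-p/2,p/2]$ is the integer with $\sigma_p(\bar a)=a$ and $|a|_p=|\bar a|$; for real $x\le y$, $[x,y]_p=\sigma_p([x,y]\cap\mathbb{Z})$. $d\cdot\mathcal{A}=\{da:a\in\mathcal{A}\}$; $[t]$ is the integer part of $t$. -}

module Defs where

open import Data.Nat using (ℕ; zero; suc; _+_; _*_; _∸_; _≤_; _<_; _⊓_)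
open import Data.Nat.Properties using (_≤?_)
open import Data.Bool using (Bool; true; false)
open import Data.Fin using (Fin; toℕ) renaming (zero to fzero; suc to fsuc)
open import Data.Fin.Subset using (Subset; _∈_; _∉_; _⊆_; Nonempty; ∣_∣)
open import Data.Vec using ([]; _∷_)
open import Data.Product using (Σ; ∃; _×_)
open import Data.Sum using (_⊎_)
open import Relation.Nullary using (¬_; yes; no)
open import Relation.Binary.PropositionalEquality using (_≡_)
open import Function using (_∘_; _⇔_)

-- Elements of Z/pZ are represented by Fin p (the residue 0..p-1);
-- subsets of Z/pZ by Data.Fin.Subset.

ModEq : ℕ → ℕ → ℕ → Set
ModEq p x y = ∃ λ k → ∃ λ l → x + k * p ≡ y + l * p

isqrtGo : ℕ → ℕ → ℕ
isqrtGo m zero = zero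
isqrtGo m (suc k) with suc k * suc k ≤? m
... | yes _ = suc k
... | no  _ = isqrtGo m k

isqrt : ℕ → ℕ
isqrt m = isqrtGo m m

sumOver : ∀ {n} → (Fin n → ℕ) → Subset n → ℕ
sumOver f [] = 0
sumOver f (true ∷ B) = f fzero + sumOver (f ∘ fsuc) B
sumOver f (false ∷ B) = sumOver (f ∘ fsuc) B

sumSet : ∀ {n} → Subset n → ℕ
sumSet = sumOver toℕ

-- |a|_p = |ā| with ā ∈ (-p/2, p/2]
absp : (p : ℕ) → Fin p → ℕ
absp p a = toℕ a ⊓ (p ∸ toℕ a)

absSum : (p : ℕ) → Subset p → ℕ
absSum p = sumOver (absp p)

InSharp : (p : ℕ) → Subset p → ℕ → Set
InSharp p A x = ∃ λ (B : Subset p) → B ⊆ A × Nonempty B × ModEq p (sumSet B) x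

ZeroFree : (p : ℕ) → Subset p → Set
ZeroFree p A = ¬ InSharp p A 0

MaxZeroFree : (p : ℕ) → Subset p → Set
MaxZeroFree p A = ZeroFree p A × (∀ (B : Subset p) → ZeroFree p B → ∣ B ∣ ≤ ∣ A ∣)

IsDilate : (p : ℕ) → Fin p → Subset p → Subset p → Set
IsDilate p d A D = ∀ (x : Fin p) →
  (x ∈ D) ⇔ (∃ λ (a : Fin p) → a ∈ A × ModEq p (toℕ d * toℕ a) (toℕ x))

InNeg : (p : ℕ) → Subset p → Fin p → Set
InNeg p A y = ∃ λ (a : Fin p) → a ∈ A × ModEq p (toℕ y + toℕ a) 0

InRange : (p : ℕ) → ℕ → ℕ → Fin p → Set
InRange p lo hi y = ∃ λ n → lo ≤ n × n ≤ hi × ModEq p n (toℕ y)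

InNegRange : (p : ℕ) → ℕ → Fin p → Set
InNegRange p m y = ∃ λ k → 1 ≤ k × k ≤ m × ModEq p (toℕ y + k) 0

-- y ∈ [5, √(2p)/5]_p : integers n with 5 ≤ n and 25 n² ≤ 2p
InRangeSqrt : (p : ℕ) → Fin p → Set
InRangeSqrt p y = ∃ λ n → 5 ≤ n × 25 * (n * n) ≤ 2 * p × ModEq p n (toℕ y)

InRangeHalf : (p : ℕ) → Fin p → Set
InRangeHalf p y = ∃ λ n → 1 ≤ n × 2 * n ≤ p × ModEq p n (toℕ y)

ContainsExcept : (p : ℕ) → (Fin p → Set) → (Fin p → Set) → ℕ → Set
ContainsExcept p R S e = ∃ λ (E : Subset p) → ∣ E ∣ ≤ e ×
  (∀ (y : Fin p) → R y → y ∉ E → S y)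

-- Greedily adjoining the element of A that creates most new subset sums, one
-- reaches a set B of subset sums, with |B| ≫ p and 2|B| ≤ p, and a set R of at
-- least about three quarters of the elements of A none of which adds more than
-- (1 + o(1))|R| elements to B: otherwise the subset sums of two disjoint parts
-- of A would be too many for a zero-free set.  Hamidoune's isoperimetric method
-- then bounds the iterated sumsets of H = R ∪ -R ∪ {0} by those of a progression,
-- and a progression contained in them is refined until its difference e satisfies
-- R ⊆ [-D, D]·e with D close to |R|.  Divide by e and let T be the set of absolute
-- values of A.  It contains most of a long initial interval, so its subset sums are
-- almost all integers up to its sum, and zero-freeness bounds that sum by p + O(1).
-- Comparison with 1 + 2 + ⋯ shows that T misses at most δ(p) elements up to √(2p)/5;
-- hence its subset sums fill [0, ΣT] up to one gap g ≤ 2 and its mirror image ΣT - g.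
-- What remains is a finite check on the elements of T up to 7 and the remark
-- that p divides neither r(r + 1) nor (r - 1)(r + 2) for r = [√(2p)].

module Submission where

open import Defs
open import Algebra.Structures using (IsAbelianGroup)
open import Data.Bool using (Bool; true; false; if_then_else_; _∧_; _∨_; not)
import Data.Bool.Properties as Bool
open import Data.Empty using (⊥; ⊥-elim)
open import Data.Fin using (Fin; toℕ) renaming (zero to fzero; suc to fsuc)
open import Data.Fin.Properties using (toℕ-fromℕ<; toℕ-injective; toℕ<n)
import Data.Fin.Properties as Fin
import Data.Fin.Subset as Sub
open import Data.Fin.Subset using (Subset)
open import Data.Nat using (ℕ; zero; suc; _+_; _*_; _∸_; _^_; _⊓_; _/_; _%_; _≤_; _<_; _≤ᵇ_; _<ᵇ_; _≡ᵇ_; z≤n; s≤s; NonZero; >-nonZero)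
open import Data.Nat.Coprimality using (Coprime)
open import Data.Nat.Divisibility using (_∣_; divides; ∣⇒≤)
open import Data.Nat.DivMod using (m≡m%n+[m/n]*n; m%n<n)
open import Data.Nat.Induction using (<-wellFounded)
open import Data.Nat.Primality using (Prime; euclidsLemma; prime⇒irreducible)
open import Data.Nat.Properties
open import Data.Product using (Σ; ∃; _×_; _,_; proj₁; proj₂)
open import Data.Sum using (_⊎_; inj₁; inj₂; [_,_]′)
open import Data.Vec using (lookup; tabulate)
open import Data.Vec.Properties using (lookup∘tabulate; tabulate-cong)
open import Function using (_∘_; mk⇔)
open import Induction.WellFounded using (Acc; acc)
open import Relation.Binary.PropositionalEquality hiding (J)
open import Relation.Nullary using (¬_; Dec; yes; no; ⌊_⌋)
open import Relation.Nullary.Decidable using (_×-dec_; _⊎-dec_; ¬?)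

-- Let w = [|A|/8], so that p is about 32w². With s elements left the greedy step gains about s
-- sums; hence B has about (64 - 36)w²/2 = 14w² elements when 6w remain, and those 6w have about
-- 18w² sums of their own. Together this is p to first order, so gains that keep exceeding s by a
-- large enough lower-order term are contradictory: the stopping range 7w ≥ s ≥ 6w is tuned to this
-- balance. The fraction three quarters returns later: 6w distinct absolute values weigh about 18w²
-- > p/2, so even the largest absolute value can be adjoined to an interval of subset sums without
-- leaving a gap. Signs disappear through one identity. A set V of absolute values encodes the
-- subset of the dilate made of the positive elements in V and the negative ones outside V; its sum
-- is the weight of V minus the weight τ of all negative elements. Zero-freeness therefore says that
-- the set of negative elements is the only V with weight congruent to τ, and all later arguments
-- concern ordinary subset sums of T.

module LinearArithmetic where

  -- A reflective prover for inequalities over ℕ by Farkas certificates.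

  open import Data.Bool using (T)
  open import Data.Integer using (ℤ; +_; -[1+_]; ∣_∣) renaming (_+_ to _+ℤ_; _*_ to _*ℤ_; -_ to -ℤ_; _-_ to _-ℤ_)
  open import Data.List using (List; []; _∷_; map; foldr; _++_; length)
  open import Data.Maybe using (Maybe; just; nothing)
  open import Data.Vec using (Vec; []; _∷_)
  open import Data.Vec.N-ary
  open import Data.Unit using (⊤; tt)
  open import Data.Nat.Tactic.RingSolver using (solve-∀)

  infixl 6 _⊕_
  infixl 7 _⊗_
  infix 4 _⊴_ _⊲_ _≐_
  infixr 2 _⇒_
  infix 3 ⊢_

  data Expr : Set where
    κ : ℕ → Expr
    ν : ℕ → Expr
    _⊕_ _⊗_ : Expr → Expr → Expr

  data Rel : Set where
    _⊴_ _⊲_ _≐_ : Expr → Expr → Rel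

  data Problem : Set where
    _⇒_ : Rel → Problem → Problem
    ⊢_ : Rel → Problem
    ⊢⊥ : Problem

  Mono Env : Set
  Mono = List ℕ
  Env = List ℕ

  Poly : Set
  Poly = List (Mono × ℕ)

  at : Env → ℕ → ℕ
  at [] _ = 0
  at (x ∷ ρ) zero = x
  at (x ∷ ρ) (suc i) = at ρ i

  ⟦_⟧ : Expr → Env → ℕ
  ⟦ κ n ⟧ ρ = n
  ⟦ ν i ⟧ ρ = at ρ i
  ⟦ e ⊕ f ⟧ ρ = ⟦ e ⟧ ρ + ⟦ f ⟧ ρ
  ⟦ e ⊗ f ⟧ ρ = ⟦ e ⟧ ρ * ⟦ f ⟧ ρ

  ⟦_⟧ᵣ : Rel → Env → Set
  ⟦ e ⊴ f ⟧ᵣ ρ = ⟦ e ⟧ ρ ≤ ⟦ f ⟧ ρ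
  ⟦ e ⊲ f ⟧ᵣ ρ = ⟦ e ⟧ ρ < ⟦ f ⟧ ρ
  ⟦ e ≐ f ⟧ᵣ ρ = ⟦ e ⟧ ρ ≡ ⟦ f ⟧ ρ

  ⟦_⟧ₚ : Problem → Env → Set
  ⟦ r ⇒ p ⟧ₚ ρ = ⟦ r ⟧ᵣ ρ → ⟦ p ⟧ₚ ρ
  ⟦ ⊢ r ⟧ₚ ρ = ⟦ r ⟧ᵣ ρ
  ⟦ ⊢⊥ ⟧ₚ ρ = ⊥

  ⟦_⟧ᵐ : Mono → Env → ℕ
  ⟦ [] ⟧ᵐ ρ = 1
  ⟦ i ∷ m ⟧ᵐ ρ = at ρ i * ⟦ m ⟧ᵐ ρ

  ⟦_⟧ᴾ : Poly → Env → ℕ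
  ⟦ [] ⟧ᴾ ρ = 0
  ⟦ (m , c) ∷ p ⟧ᴾ ρ = c * ⟦ m ⟧ᵐ ρ + ⟦ p ⟧ᴾ ρ

  eqᵐ : Mono → Mono → Bool
  eqᵐ [] [] = true
  eqᵐ (i ∷ m) (j ∷ n) = (i ≡ᵇ j) ∧ eqᵐ m n
  eqᵐ _ _ = false

  eqᵐ-sound : ∀ m n → eqᵐ m n ≡ true → m ≡ n
  eqᵐ-sound [] [] _ = refl
  eqᵐ-sound (i ∷ m) (j ∷ n) e with i ≡ᵇ j in q
  ... | true = cong₂ _∷_ (≡ᵇ⇒≡ i j (subst T (sym q) tt)) (eqᵐ-sound m n e)

  ins : ℕ → Mono → Mono
  ins i [] = i ∷ []
  ins i (j ∷ m) = if i ≤ᵇ j then i ∷ j ∷ m else j ∷ ins i m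

  ins-sound : ∀ ρ i m → ⟦ ins i m ⟧ᵐ ρ ≡ at ρ i * ⟦ m ⟧ᵐ ρ
  ins-sound ρ i [] = refl
  ins-sound ρ i (j ∷ m) with i ≤ᵇ j
  ... | true = refl
  ... | false = trans (cong (at ρ j *_) (ins-sound ρ i m)) (swap (at ρ j) (at ρ i) (⟦ m ⟧ᵐ ρ))
    where
    swap : ∀ a b c → a * (b * c) ≡ b * (a * c)
    swap = solve-∀

  mulᵐ : Mono → Mono → Mono
  mulᵐ [] n = n
  mulᵐ (i ∷ m) n = ins i (mulᵐ m n)

  mulᵐ-sound : ∀ ρ m n → ⟦ mulᵐ m n ⟧ᵐ ρ ≡ ⟦ m ⟧ᵐ ρ * ⟦ n ⟧ᵐ ρ
  mulᵐ-sound ρ [] n = sym (+-identityʳ _)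
  mulᵐ-sound ρ (i ∷ m) n = trans (ins-sound ρ i (mulᵐ m n))
    (trans (cong (at ρ i *_) (mulᵐ-sound ρ m n)) (sym (*-assoc (at ρ i) _ _)))

  addTerm : Mono → ℕ → Poly → Poly
  addTerm m c [] = (m , c) ∷ []
  addTerm m c ((n , d) ∷ p) = if eqᵐ m n then (n , c + d) ∷ p else (n , d) ∷ addTerm m c p

  addTerm-sound : ∀ ρ m c p → ⟦ addTerm m c p ⟧ᴾ ρ ≡ c * ⟦ m ⟧ᵐ ρ + ⟦ p ⟧ᴾ ρ
  addTerm-sound ρ m c [] = refl
  addTerm-sound ρ m c ((n , d) ∷ p) with eqᵐ m n in q
  ... | true rewrite eqᵐ-sound m n q = lem c d (⟦ n ⟧ᵐ ρ) (⟦ p ⟧ᴾ ρ)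
    where
    lem : ∀ c d x y → (c + d) * x + y ≡ c * x + (d * x + y)
    lem = solve-∀
  ... | false rewrite addTerm-sound ρ m c p = lem (d * ⟦ n ⟧ᵐ ρ) (c * ⟦ m ⟧ᵐ ρ) (⟦ p ⟧ᴾ ρ)
    where
    lem : ∀ x y z → x + (y + z) ≡ y + (x + z)
    lem = solve-∀

  scaleAdd : ℕ → Poly → Poly → Poly
  scaleAdd k [] q = q
  scaleAdd k ((m , c) ∷ p) q = addTerm m (k * c) (scaleAdd k p q)

  scaleAdd-sound : ∀ ρ k p q → ⟦ scaleAdd k p q ⟧ᴾ ρ ≡ k * ⟦ p ⟧ᴾ ρ + ⟦ q ⟧ᴾ ρ
  scaleAdd-sound ρ k [] q = cong (_+ ⟦ q ⟧ᴾ ρ) (sym (*-zeroʳ k))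
  scaleAdd-sound ρ k ((m , c) ∷ p) q
    rewrite addTerm-sound ρ m (k * c) (scaleAdd k p q) | scaleAdd-sound ρ k p q
    = lem k c (⟦ m ⟧ᵐ ρ) (⟦ p ⟧ᴾ ρ) (⟦ q ⟧ᴾ ρ)
    where
    lem : ∀ k c x y z → k * c * x + (k * y + z) ≡ k * (c * x + y) + z
    lem = solve-∀

  mulTerm : Mono → ℕ → Poly → Poly → Poly
  mulTerm m c [] q = q
  mulTerm m c ((n , d) ∷ p) q = addTerm (mulᵐ m n) (c * d) (mulTerm m c p q)

  mulTerm-sound : ∀ ρ m c p q → ⟦ mulTerm m c p q ⟧ᴾ ρ ≡ c * ⟦ m ⟧ᵐ ρ * ⟦ p ⟧ᴾ ρ + ⟦ q ⟧ᴾ ρ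
  mulTerm-sound ρ m c [] q = cong (_+ ⟦ q ⟧ᴾ ρ) (sym (*-zeroʳ (c * ⟦ m ⟧ᵐ ρ)))
  mulTerm-sound ρ m c ((n , d) ∷ p) q
    rewrite addTerm-sound ρ (mulᵐ m n) (c * d) (mulTerm m c p q) | mulTerm-sound ρ m c p q | mulᵐ-sound ρ m n
    = lem c d (⟦ m ⟧ᵐ ρ) (⟦ n ⟧ᵐ ρ) (⟦ p ⟧ᴾ ρ) (⟦ q ⟧ᴾ ρ)
    where
    lem : ∀ c d x y z w → c * d * (x * y) + (c * x * z + w) ≡ c * x * (d * y + z) + w
    lem = solve-∀

  mulPoly : Poly → Poly → Poly
  mulPoly [] q = []
  mulPoly ((m , c) ∷ p) q = mulTerm m c q (mulPoly p q)

  mulPoly-sound : ∀ ρ p q → ⟦ mulPoly p q ⟧ᴾ ρ ≡ ⟦ p ⟧ᴾ ρ * ⟦ q ⟧ᴾ ρ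
  mulPoly-sound ρ [] q = refl
  mulPoly-sound ρ ((m , c) ∷ p) q rewrite mulTerm-sound ρ m c q (mulPoly p q) | mulPoly-sound ρ p q
    = sym (*-distribʳ-+ (⟦ q ⟧ᴾ ρ) (c * ⟦ m ⟧ᵐ ρ) (⟦ p ⟧ᴾ ρ))

  norm : Expr → Poly
  norm (κ n) = ([] , n) ∷ []
  norm (ν i) = (i ∷ [] , 1) ∷ []
  norm (e ⊕ f) = scaleAdd 1 (norm e) (norm f)
  norm (e ⊗ f) = mulPoly (norm e) (norm f)

  norm-sound : ∀ ρ e → ⟦ norm e ⟧ᴾ ρ ≡ ⟦ e ⟧ ρ
  norm-sound ρ (κ n) = lem n
    where
    lem : ∀ n → n * 1 + 0 ≡ n
    lem = solve-∀
  norm-sound ρ (ν i) = lem (at ρ i)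
    where
    lem : ∀ n → n * 1 + 0 + 0 ≡ n
    lem = solve-∀
  norm-sound ρ (e ⊕ f) rewrite scaleAdd-sound ρ 1 (norm e) (norm f) | norm-sound ρ e | norm-sound ρ f
    = cong (_+ ⟦ f ⟧ ρ) (+-identityʳ _)
  norm-sound ρ (e ⊗ f) rewrite mulPoly-sound ρ (norm e) (norm f) | norm-sound ρ e | norm-sound ρ f = refl

  coeffAndRest : Mono → Poly → ℕ × Poly
  coeffAndRest m [] = 0 , []
  coeffAndRest m ((n , d) ∷ p) = if eqᵐ m n then (d , p)
    else (proj₁ (coeffAndRest m p) , (n , d) ∷ proj₂ (coeffAndRest m p))

  coeffAndRest-sound : ∀ ρ m p →
    ⟦ p ⟧ᴾ ρ ≡ proj₁ (coeffAndRest m p) * ⟦ m ⟧ᵐ ρ + ⟦ proj₂ (coeffAndRest m p) ⟧ᴾ ρ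
  coeffAndRest-sound ρ m [] = refl
  coeffAndRest-sound ρ m ((n , d) ∷ p) with eqᵐ m n in q
  ... | true rewrite eqᵐ-sound m n q = refl
  ... | false = trans (cong (_+_ (d * ⟦ n ⟧ᵐ ρ)) (coeffAndRest-sound ρ m p))
    (lem (d * ⟦ n ⟧ᵐ ρ) (proj₁ (coeffAndRest m p) * ⟦ m ⟧ᵐ ρ) _)
    where
    lem : ∀ x y z → x + (y + z) ≡ y + (x + z)
    lem = solve-∀

  -- Coefficientwise comparison suffices because monomials take values in ℕ; this is how the
  -- nonnegativity of variables and products enters without being listed as a hypothesis.
  dominated : Poly → Poly → Bool
  dominated [] q = true
  dominated ((m , c) ∷ p) q = (c ≤ᵇ proj₁ (coeffAndRest m q)) ∧ dominated p (proj₂ (coeffAndRest m q))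

  dominated-sound : ∀ ρ p q → dominated p q ≡ true → ⟦ p ⟧ᴾ ρ ≤ ⟦ q ⟧ᴾ ρ
  dominated-sound ρ [] q _ = z≤n
  dominated-sound ρ ((m , c) ∷ p) q e with c ≤ᵇ proj₁ (coeffAndRest m q) in le
  ... | true = subst (_ ≤_) (sym (coeffAndRest-sound ρ m q))
    (+-mono-≤ (*-monoˡ-≤ (⟦ m ⟧ᵐ ρ) (≤ᵇ⇒≤ c _ (subst T (sym le) tt)))
              (dominated-sound ρ p (proj₂ (coeffAndRest m q)) e))

  -- An inequality as a pair of polynomials (smaller, larger).
  Ineq : Set
  Ineq = Poly × Poly

  Holds : Env → List Ineq → Set
  Holds ρ [] = ⊤
  Holds ρ ((p , q) ∷ is) = (⟦ p ⟧ᴾ ρ ≤ ⟦ q ⟧ᴾ ρ) × Holds ρ is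

  combine : List ℕ → List Ineq → Ineq
  combine (c ∷ cs) ((p , q) ∷ is) =
    scaleAdd c p (proj₁ (combine cs is)) , scaleAdd c q (proj₂ (combine cs is))
  combine _ _ = [] , []

  combine-sound : ∀ ρ cs is → Holds ρ is → ⟦ proj₁ (combine cs is) ⟧ᴾ ρ ≤ ⟦ proj₂ (combine cs is) ⟧ᴾ ρ
  combine-sound ρ [] is h = z≤n
  combine-sound ρ (c ∷ cs) [] h = z≤n
  combine-sound ρ (c ∷ cs) ((p , q) ∷ is) (h , hs)
    rewrite scaleAdd-sound ρ c p (proj₁ (combine cs is)) | scaleAdd-sound ρ c q (proj₂ (combine cs is))
    = +-mono-≤ (*-monoʳ-≤ c h) (combine-sound ρ cs is hs)

  -- The combination p ≤ q is absurd once 1 + q is dominated by p. Distinct monomials are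
  -- independent unknowns, so a nonlinear consequence is found only if the products that it needs
  -- are supplied; hence hypotheses such as `*-mono-≤ h h` in the calls below.
  refutes : List ℕ → List Ineq → Bool
  refutes cs is with combine cs is
  ... | p , q = dominated (addTerm [] 1 q) p

  refutes-sound : ∀ ρ cs is → refutes cs is ≡ true → Holds ρ is → ⊥
  refutes-sound ρ cs is e h = <-irrefl refl (≤-trans
    (subst (_≤ ⟦ proj₁ (combine cs is) ⟧ᴾ ρ) (addTerm-sound ρ [] 1 (proj₂ (combine cs is)))
      (dominated-sound ρ (addTerm [] 1 (proj₂ (combine cs is))) _ e))
    (combine-sound ρ cs is h))

  -- The multipliers are found by the simplex method with Bland's rule on the
  -- cone of Farkas certificates; the search needs no soundness proof, because
  -- its output goes through 'refutes'.
  gcdᶠ : ℕ → ℕ → ℕ → ℕ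
  gcdᶠ zero a b = 1
  gcdᶠ (suc f) a zero = a
  gcdᶠ (suc f) a (suc b) = gcdᶠ f (suc b) (a % suc b)

  Row : Set
  Row = ℕ × ℕ × List ℤ

  negative positive : ℤ → Bool
  negative (+ _) = false
  negative -[1+ _ ] = true
  positive (+ suc _) = true
  positive _ = false

  nthℤ : ℕ → List ℤ → ℤ
  nthℤ _ [] = + 0
  nthℤ zero (x ∷ _) = x
  nthℤ (suc i) (_ ∷ xs) = nthℤ i xs

  setℤ : ℕ → ℤ → List ℤ → List ℤ
  setℤ _ y [] = []
  setℤ zero y (_ ∷ xs) = y ∷ xs
  setℤ (suc i) y (x ∷ xs) = x ∷ setℤ i y xs

  setℕ : ℕ → ℕ → List ℕ → List ℕ
  setℕ _ y [] = []
  setℕ zero y (_ ∷ xs) = y ∷ xs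
  setℕ (suc i) y (x ∷ xs) = x ∷ setℕ i y xs

  divℤ : ℕ → ℤ → ℤ
  divℤ zero z = z
  divℤ (suc g) (+ n) = + (n / suc g)
  divℤ (suc g) -[1+ n ] = -ℤ (+ (suc n / suc g))

  divℕ : ℕ → ℕ → ℕ
  divℕ zero n = n
  divℕ (suc g) n = n / suc g

  reduceRow : Row → Row
  reduceRow (b , d , xs) = go (foldr (λ x g → gcdᶠ 200 ∣ x ∣ g) d xs)
    where
    go : ℕ → Row
    go 1 = b , d , xs
    go g = b , divℕ g d , map (divℤ g) xs

  entering : ℕ → List ℕ → List ℤ → Maybe (ℕ × ℕ)
  entering pos (i ∷ is) (x ∷ xs) with positive x | entering (suc pos) is xs
  ... | false | r = r
  ... | true | nothing = just (pos , i)
  ... | true | just (p , j) = if i <ᵇ j then just (pos , i) else just (p , j)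
  entering _ _ _ = nothing

  -- The constraints are homogeneous, so every ratio is 0 and the least index alone decides;
  -- degenerate pivots are the rule, and Bland's choice keeps them from cycling. When no row leaves,
  -- the entering column is an unbounded ray, and this ray is the certificate.
  leaving : ℕ → List Row → Maybe Row
  leaving e [] = nothing
  leaving e (r@(b , d , xs) ∷ rs) with negative (nthℤ e xs) | leaving e rs
  ... | false | m = m
  ... | true | nothing = just r
  ... | true | just r′@(b′ , _) = if b <ᵇ b′ then just r else just r′

  addℤs : ℤ → List ℤ → ℤ → List ℤ → List ℤ
  addℤs a (x ∷ xs) b (y ∷ ys) = (a *ℤ x +ℤ b *ℤ y) ∷ addℤs a xs b ys
  addℤs _ _ _ _ = []

  pivotRow : ℕ → Row → Row → Row
  pivotRow e (bᵣ , dᵣ , xsᵣ) (b , d , xs) with nthℤ e xs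
  ... | + 0 = b , d , xs
  ... | β = reduceRow (b , ∣ α ∣ * d , addℤs (+ ∣ α ∣) (setℤ e (+ 0) xs) β (setℤ e (-ℤ (+ dᵣ)) xsᵣ))
    where
    α = nthℤ e xsᵣ

  pivotRows : ℕ → ℕ → Row → List Row → List Row
  pivotRows e i r [] = []
  pivotRows e i r@(bᵣ , dᵣ , xsᵣ) (r′@(b , _) ∷ rs) =
    (if b ≡ᵇ bᵣ then reduceRow (i , ∣ nthℤ e xsᵣ ∣ , setℤ e (-ℤ (+ dᵣ)) xsᵣ) else pivotRow e r r′)
    ∷ pivotRows e i r rs

  valueOf : ℕ → ℕ → ℕ → ℕ → List Row → ℕ → ℕ
  valueOf e i scale v [] zero = 0
  valueOf e i scale v [] _ = if v ≡ᵇ i then scale else 0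
  valueOf e i scale v ((b , d , xs) ∷ rs) f =
    if v ≡ᵇ b then divℕ d (scale * ∣ nthℤ e xs ∣) else valueOf e i scale v rs f

  multipliers : ℕ → ℕ → ℕ → List Row → ℕ → List ℕ
  multipliers e i scale rs zero = []
  multipliers e i scale rs (suc n) = multipliers e i scale rs n ++ (valueOf e i scale n rs 1 ∷ [])

  simplex : ℕ → ℕ → List ℕ → Row → List Row → List ℕ
  simplex zero n ids obj rs = []
  simplex (suc fuel) n ids obj@(_ , _ , os) rs with entering 0 ids os
  ... | nothing = []
  ... | just (e , i) with leaving e rs
  ... | nothing = multipliers e i (foldr (λ r s → s * divℕ (gcdᶠ 200 s (proj₁ (proj₂ r))) (proj₁ (proj₂ r))) 1 rs) rs n
  ... | just r@(b , _) = simplex fuel n (setℕ e b ids) (pivotRow e r obj) (pivotRows e i r rs)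

  coeffℤ : Mono → Ineq → ℤ
  coeffℤ m (p , q) = + proj₁ (coeffAndRest m p) -ℤ + proj₁ (coeffAndRest m q)

  addMonos : Poly → List Mono → List Mono
  addMonos [] ms = ms
  addMonos (([] , _) ∷ p) ms = addMonos p ms
  addMonos ((m , _) ∷ p) ms = addMonos p (if elem ms then ms else m ∷ ms)
    where
    elem : List Mono → Bool
    elem [] = false
    elem (n ∷ ns) = if eqᵐ m n then true else elem ns

  -- One row for each nonconstant monomial demands that its combined coefficient on the smaller
  -- sides is at least that on the larger sides; the difference of the constant terms is the
  -- objective.
  certificate : List Ineq → List ℕ
  certificate is = simplex 100 (length is) (upTo 0 is) (0 , 1 , map (coeffℤ []) is)
    (rows (length is) (foldr (λ i ms → addMonos (proj₁ i) (addMonos (proj₂ i) ms)) [] is))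
    where
    upTo : ∀ {A : Set} → ℕ → List A → List ℕ
    upTo k [] = []
    upTo k (_ ∷ xs) = k ∷ upTo (suc k) xs
    rows : ℕ → List Mono → List Row
    rows k [] = []
    rows k (m ∷ ms) = (k , 1 , map (coeffℤ m) is) ∷ rows (suc k) ms

  strict : Expr → Expr
  strict e = κ 1 ⊕ e

  ineqs : Rel → List Ineq → List Ineq
  ineqs (e ⊴ f) is = (norm e , norm f) ∷ is
  ineqs (e ⊲ f) is = (norm (strict e) , norm f) ∷ is
  ineqs (e ≐ f) is = (norm e , norm f) ∷ (norm f , norm e) ∷ is

  norm-≤ : ∀ ρ e f → ⟦ e ⟧ ρ ≤ ⟦ f ⟧ ρ → ⟦ norm e ⟧ᴾ ρ ≤ ⟦ norm f ⟧ᴾ ρ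
  norm-≤ ρ e f = subst₂ _≤_ (sym (norm-sound ρ e)) (sym (norm-sound ρ f))

  ineqs-sound : ∀ ρ r is → ⟦ r ⟧ᵣ ρ → Holds ρ is → Holds ρ (ineqs r is)
  ineqs-sound ρ (e ⊴ f) is h hs = norm-≤ ρ e f h , hs
  ineqs-sound ρ (e ⊲ f) is h hs = norm-≤ ρ (strict e) f h , hs
  ineqs-sound ρ (e ≐ f) is h hs = norm-≤ ρ e f (≤-reflexive h) , norm-≤ ρ f e (≤-reflexive (sym h)) , hs

  refuted : List Ineq → Bool
  refuted is = refutes (certificate is) is

  refuted-sound : ∀ ρ is → refuted is ≡ true → Holds ρ is → ⊥
  refuted-sound ρ is = refutes-sound ρ (certificate is) is

  valid : Problem → List Ineq → Bool
  valid (r ⇒ p) is = valid p (ineqs r is)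
  valid (⊢ (e ⊴ f)) is = refuted (ineqs (f ⊲ e) is)
  valid (⊢ (e ⊲ f)) is = refuted (ineqs (f ⊴ e) is)
  valid (⊢ (e ≐ f)) is = refuted (ineqs (e ⊲ f) is) ∧ refuted (ineqs (f ⊲ e) is)
  valid ⊢⊥ is = refuted is

  valid-sound : ∀ ρ p is → valid p is ≡ true → Holds ρ is → ⟦ p ⟧ₚ ρ
  valid-sound ρ (r ⇒ p) is v hs h = valid-sound ρ p (ineqs r is) v (ineqs-sound ρ r is h hs)
  valid-sound ρ (⊢ (e ⊴ f)) is v hs =
    ≮⇒≥ λ h → refuted-sound ρ (ineqs (f ⊲ e) is) v (ineqs-sound ρ (f ⊲ e) is h hs)
  valid-sound ρ (⊢ (e ⊲ f)) is v hs =
    ≰⇒> λ h → refuted-sound ρ (ineqs (f ⊴ e) is) v (ineqs-sound ρ (f ⊴ e) is h hs)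
  valid-sound ρ (⊢ (e ≐ f)) is v hs with refuted (ineqs (e ⊲ f) is) in v₁ | refuted (ineqs (f ⊲ e) is) in v₂
  ... | true | true = ≤-antisym
    (≮⇒≥ λ h → refuted-sound ρ (ineqs (f ⊲ e) is) v₂ (ineqs-sound ρ (f ⊲ e) is h hs))
    (≮⇒≥ λ h → refuted-sound ρ (ineqs (e ⊲ f) is) v₁ (ineqs-sound ρ (e ⊲ f) is h hs))
  valid-sound ρ ⊢⊥ is v hs = refuted-sound ρ is v hs

  variables : ℕ → (n : ℕ) → Vec Expr n
  variables k zero = []
  variables k (suc n) = ν k ∷ variables (suc k) n

  Statementᴺ : (n : ℕ) → (Env → Set) → Set
  Statementᴺ zero P = P []
  Statementᴺ (suc n) P = ∀ x → Statementᴺ n (λ ρ → P (x ∷ ρ))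

  curryᴺ : (n : ℕ) (P : Env → Set) → (∀ ρ → P ρ) → Statementᴺ n P
  curryᴺ zero P h = h []
  curryᴺ (suc n) P h x = curryᴺ n (λ ρ → P (x ∷ ρ)) (λ ρ → h (x ∷ ρ))

  linarith : ∀ n (f : N-ary n Expr Problem) → {T (valid (f $ⁿ variables 0 n) [])} →
    Statementᴺ n ⟦ f $ⁿ variables 0 n ⟧ₚ
  linarith n f {v} = curryᴺ n ⟦ f $ⁿ variables 0 n ⟧ₚ λ ρ → valid-sound ρ (f $ⁿ variables 0 n) [] (T⇒≡ v) tt
    where
    T⇒≡ : ∀ {b} → T b → b ≡ true
    T⇒≡ {true} _ = refl

-- Finite sets as Boolean functions, counted by sums.

module FiniteSets where

  open LinearArithmetic
  open import Data.Nat.Coprimality using (coprime-Bézout)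
  open import Data.Nat.GCD using (module Bézout)
  open import Data.Fin.Subset.Properties using (anySubset?)
  open import Data.Fin.Permutation using (permutation)
  import Algebra.Properties.CommutativeMonoid.Sum as MonoidSum

  open MonoidSum +-0-commutativeMonoid public
    using (sum; sum-cong-≗; ∑-distrib-+; ∑-comm; sum-permute)

  sum-mono : ∀ {n} {f g : Fin n → ℕ} → (∀ i → f i ≤ g i) → sum f ≤ sum g
  sum-mono {zero} h = z≤n
  sum-mono {suc n} h = +-mono-≤ (h fzero) (sum-mono (h ∘ fsuc))

  sum-const : ∀ n c → sum {n} (λ _ → c) ≡ n * c
  sum-const zero c = refl
  sum-const (suc n) c = cong (c +_) (sum-const n c)

  sum-*ˡ : ∀ {n} c (f : Fin n → ℕ) → sum (λ i → c * f i) ≡ c * sum f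
  sum-*ˡ {zero} c f = sym (*-zeroʳ c)
  sum-*ˡ {suc n} c f = trans (cong (c * f fzero +_) (sum-*ˡ c (f ∘ fsuc))) (sym (*-distribˡ-+ c (f fzero) _))

  sum-<⇒∃ : ∀ {n} (f g : Fin n → ℕ) → sum f < sum g → ∃ λ i → f i < g i
  sum-<⇒∃ {suc n} f g h with f fzero <? g fzero
  ... | yes lt = fzero , lt
  ... | no ≮ with sum-<⇒∃ (f ∘ fsuc) (g ∘ fsuc)
      (+-cancelˡ-< (g fzero) _ _ (≤-<-trans (+-monoˡ-≤ (sum (f ∘ fsuc)) (≮⇒≥ ≮)) h))
  ... | i , lt = fsuc i , lt

  term≤sum : ∀ {n} (f : Fin n → ℕ) i → f i ≤ sum f
  term≤sum f fzero = m≤m+n _ _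
  term≤sum f (fsuc i) = ≤-trans (term≤sum (f ∘ fsuc) i) (m≤n+m _ _)

  sumTo : ℕ → (ℕ → ℕ) → ℕ
  sumTo zero f = 0
  sumTo (suc Q) f = sumTo Q f + f Q

  sum-bij : ∀ {n} (f : Fin n → ℕ) (φ ψ : Fin n → Fin n) → (∀ x → φ (ψ x) ≡ x) → (∀ x → ψ (φ x) ≡ x) →
    sum (λ i → f (φ i)) ≡ sum f
  sum-bij f φ ψ φψ ψφ = sym (sum-permute f (permutation φ ψ φψ ψφ))

  division : ∀ m d → 0 < d → ∃ λ q → q * d ≤ m × m < suc q * d
  division m d@(suc _) _ = m / d ,
    linarith 3 (λ m r q → m ≐ r ⊕ q ⇒ ⊢ q ⊴ m) m (m % d) (m / d * d) (m≡m%n+[m/n]*n m d) ,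
    linarith 4 (λ m r q d → m ≐ r ⊕ q ⇒ r ⊲ d ⇒ ⊢ m ⊲ d ⊕ q) m (m % d) (m / d * d) d (m≡m%n+[m/n]*n m d) (m%n<n m d)

  coprime-inverse : ∀ y i → 1 < i → Coprime y i → ∃ λ m → ∃ λ k → m * y ≡ 1 + k * i
  coprime-inverse y i 1<i c with coprime-Bézout c
  ... | Bézout.+- m k eq = m , k , sym eq
  ... | Bézout.-+ m zero eq = ⊥-elim (1+n≢0 eq)
  coprime-inverse y (suc zero) (s≤s ()) c | Bézout.-+ m (suc k) eq
  -- Here my ≡ -1; multiplying by the modulus minus 1 turns it into +1 while all quantities stay
  -- natural.
  coprime-inverse y (suc (suc i)) 1<i c | Bézout.-+ m (suc k) eq = m * suc i , k + i * suc k ,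
    linarith 4 (λ m y i k → (κ 1 ⊕ i) ⊗ (κ 1 ⊕ m ⊗ y) ≐ (κ 1 ⊕ i) ⊗ ((κ 1 ⊕ k) ⊗ (κ 2 ⊕ i)) ⇒
      ⊢ m ⊗ (κ 1 ⊕ i) ⊗ y ≐ κ 1 ⊕ (k ⊕ i ⊗ (κ 1 ⊕ k)) ⊗ (κ 2 ⊕ i)) m y i k (cong (suc i *_) eq)

  𝟙 : Bool → ℕ
  𝟙 true = 1
  𝟙 false = 0

  FSet : ℕ → Set
  FSet n = Fin n → Bool

  infix 4 _∈_ _∉_ _⊆_

  _∈_ _∉_ : ∀ {n} → Fin n → FSet n → Set
  x ∈ X = X x ≡ true
  x ∉ X = X x ≡ false

  _⊆_ : ∀ {n} → FSet n → FSet n → Set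
  X ⊆ Y = ∀ x → x ∈ X → x ∈ Y

  _∪_ _∩_ _∖_ : ∀ {n} → FSet n → FSet n → FSet n
  (X ∪ Y) x = X x ∨ Y x
  (X ∩ Y) x = X x ∧ Y x
  (X ∖ Y) x = X x ∧ not (Y x)

  ∁ : ∀ {n} → FSet n → FSet n
  ∁ X x = not (X x)

  ⁅_⁆ : ∀ {n} → Fin n → FSet n
  ⁅ a ⁆ x = ⌊ x Fin.≟ a ⌋

  # : ∀ {n} → FSet n → ℕ
  # X = sum (λ x → 𝟙 (X x))

  ∧-intro : ∀ {a b} → a ≡ true → b ≡ true → a ∧ b ≡ true
  ∧-intro refl refl = refl

  ∧-elim : ∀ {a b} → a ∧ b ≡ true → (a ≡ true) × (b ≡ true)
  ∧-elim {true} {true} _ = refl , refl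

  ∨-introˡ : ∀ {a b} → a ≡ true → a ∨ b ≡ true
  ∨-introˡ refl = refl

  ∨-introʳ : ∀ {a b} → b ≡ true → a ∨ b ≡ true
  ∨-introʳ {true} _ = refl
  ∨-introʳ {false} h = h

  ∨-elim : ∀ {a b} → a ∨ b ≡ true → (a ≡ true) ⊎ (b ≡ true)
  ∨-elim {true} _ = inj₁ refl
  ∨-elim {false} h = inj₂ h

  not-true : ∀ {a} → a ≡ false → not a ≡ true
  not-true refl = refl

  not-elim : ∀ {a} → not a ≡ true → a ≡ false
  not-elim {false} _ = refl

  ¬true⇒false : ∀ {a} → ¬ a ≡ true → a ≡ false
  ¬true⇒false {true} h = ⊥-elim (h refl)
  ¬true⇒false {false} _ = refl

  true≢false : ∀ {a} → a ≡ true → a ≡ false → ⊥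
  true≢false refl ()

  ∈? : ∀ {n} (X : FSet n) x → (x ∈ X) ⊎ (x ∉ X)
  ∈? X x with X x
  ... | true = inj₁ refl
  ... | false = inj₂ refl

  ⌊⌋-true : ∀ {P : Set} {d : Dec P} → ⌊ d ⌋ ≡ true → P
  ⌊⌋-true {d = yes p} _ = p

  ⌊⌋-intro : ∀ {P : Set} {d : Dec P} → P → ⌊ d ⌋ ≡ true
  ⌊⌋-intro {d = yes p} _ = refl
  ⌊⌋-intro {d = no ¬p} p = ⊥-elim (¬p p)

  𝟙≤1 : ∀ b → 𝟙 b ≤ 1
  𝟙≤1 true = ≤-refl
  𝟙≤1 false = z≤n

  𝟙-disjoint : ∀ a b → (a ≡ true → b ≡ true → ⊥) → 𝟙 (a ∨ b) ≡ 𝟙 a + 𝟙 b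
  𝟙-disjoint true true h = ⊥-elim (h refl refl)
  𝟙-disjoint true false _ = refl
  𝟙-disjoint false _ _ = refl

  𝟙-mono : ∀ {a b} → (a ≡ true → b ≡ true) → 𝟙 a ≤ 𝟙 b
  𝟙-mono {true} h rewrite h refl = ≤-refl
  𝟙-mono {false} h = z≤n

  #-mono : ∀ {n} (X Y : FSet n) → X ⊆ Y → # X ≤ # Y
  #-mono X Y h = sum-mono λ x → 𝟙-mono (h x)

  #-cong : ∀ {n} (X Y : FSet n) → X ≗ Y → # X ≡ # Y
  #-cong X Y h = sum-cong-≗ (cong 𝟙 ∘ h)

  #≤n : ∀ {n} (X : FSet n) → # X ≤ n
  #≤n {n} X = subst (# X ≤_) (trans (sum-const n 1) (*-identityʳ n)) (sum-mono λ x → 𝟙≤1 (X x))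

  #-∪-∩ : ∀ {n} (X Y : FSet n) → # (X ∪ Y) + # (X ∩ Y) ≡ # X + # Y
  #-∪-∩ X Y = trans (sym (∑-distrib-+ (𝟙 ∘ (X ∪ Y)) (𝟙 ∘ (X ∩ Y))))
    (trans (sum-cong-≗ λ x → lem (X x) (Y x)) (∑-distrib-+ (𝟙 ∘ X) (𝟙 ∘ Y)))
    where
    lem : ∀ a b → 𝟙 (a ∨ b) + 𝟙 (a ∧ b) ≡ 𝟙 a + 𝟙 b
    lem true true = refl
    lem true false = refl
    lem false true = refl
    lem false false = refl

  #-∩-∖ : ∀ {n} (X Y : FSet n) → # (X ∩ Y) + # (X ∖ Y) ≡ # X
  #-∩-∖ X Y = trans (sym (∑-distrib-+ (𝟙 ∘ (X ∩ Y)) (𝟙 ∘ (X ∖ Y)))) (sum-cong-≗ λ x → lem (X x) (Y x))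
    where
    lem : ∀ a b → 𝟙 (a ∧ b) + 𝟙 (a ∧ not b) ≡ 𝟙 a
    lem true true = refl
    lem true false = refl
    lem false _ = refl

  #-∁ : ∀ {n} (X : FSet n) → # X + # (∁ X) ≡ n
  #-∁ {n} X = trans (sym (∑-distrib-+ (𝟙 ∘ X) (𝟙 ∘ ∁ X))) (trans (sum-cong-≗ λ x → lem (X x)) (trans (sum-const n 1) (*-identityʳ n)))
    where
    lem : ∀ a → 𝟙 a + 𝟙 (not a) ≡ 1
    lem true = refl
    lem false = refl

  #-pos⇒∃ : ∀ {n} (X : FSet n) → 0 < # X → ∃ λ x → x ∈ X
  #-pos⇒∃ {n} X h with sum-<⇒∃ (λ _ → 0) (λ x → 𝟙 (X x)) (subst (_< # X) (sym (trans (sum-const n 0) (*-zeroʳ n))) h)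
  ... | x , lt = x , lem (X x) lt
    where
    lem : ∀ b → 0 < 𝟙 b → b ≡ true
    lem true _ = refl

  ∈⇒#-pos : ∀ {n} (X : FSet n) {x} → x ∈ X → 0 < # X
  ∈⇒#-pos X {x} h = ≤-trans (≤-reflexive (sym (cong 𝟙 h))) (term≤sum (λ x → 𝟙 (X x)) x)

  #-⊆-∉ : ∀ {n} (X Y : FSet n) {y} → X ⊆ Y → y ∈ Y → y ∉ X → # X < # Y
  #-⊆-∉ X Y {y} s yY yX = linarith 4 (λ x y i d → i ⊕ d ≐ y ⇒ κ 1 ⊴ d ⇒ x ⊴ i ⇒ ⊢ x ⊲ y) (# X) (# Y) (# (Y ∩ X)) (# (Y ∖ X))
    (#-∩-∖ Y X) (∈⇒#-pos (Y ∖ X) {y} (∧-intro yY (not-true yX))) (#-mono X (Y ∩ X) λ x xX → ∧-intro (s x xX) xX)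

  ⊆-#⇒⊇ : ∀ {n} (X Y : FSet n) → X ⊆ Y → # Y ≤ # X → Y ⊆ X
  ⊆-#⇒⊇ X Y s le y yY with ∈? X y
  ... | inj₁ h = h
  ... | inj₂ h = ⊥-elim (<⇒≱ (#-⊆-∉ X Y s yY h) le)

  #-empty : ∀ {n} (X : FSet n) → (∀ x → x ∈ X → ⊥) → # X ≡ 0
  #-empty X h = n≤0⇒n≡0 (≮⇒≥ λ p → h _ (proj₂ (#-pos⇒∃ X p)))

  sum-⁅⁆ : ∀ {n} (f : Fin n → ℕ) a → sum (λ x → f x * 𝟙 (⁅ a ⁆ x)) ≡ f a
  sum-⁅⁆ {suc n} f fzero = trans (cong₂ _+_ (*-identityʳ (f fzero))
    (trans (sum-cong-≗ (λ x → *-zeroʳ (f (fsuc x)))) (trans (sum-const n 0) (*-zeroʳ n)))) (+-identityʳ _)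
  sum-⁅⁆ {suc n} f (fsuc a) = trans (cong₂ _+_ (*-zeroʳ (f fzero)) (trans (sum-cong-≗ (λ x → cong (λ b → f (fsuc x) * 𝟙 b) (lem x)))
    (sum-⁅⁆ (f ∘ fsuc) a))) refl
    where
    lem : ∀ x → ⌊ fsuc x Fin.≟ fsuc a ⌋ ≡ ⌊ x Fin.≟ a ⌋
    lem x with x Fin.≟ a
    ... | yes _ = refl
    ... | no _ = refl

  #-⁅⁆ : ∀ {n} (a : Fin n) → # ⁅ a ⁆ ≡ 1
  #-⁅⁆ a = trans (sum-cong-≗ λ x → sym (*-identityˡ (𝟙 (⁅ a ⁆ x)))) (sum-⁅⁆ (λ _ → 1) a)

  ∈⁅⁆ : ∀ {n} (a : Fin n) → a ∈ ⁅ a ⁆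
  ∈⁅⁆ a = ⌊⌋-intro {d = a Fin.≟ a} refl

  ∈⁅⁆⇒≡ : ∀ {n} {a x : Fin n} → x ∈ ⁅ a ⁆ → x ≡ a
  ∈⁅⁆⇒≡ {a = a} {x} = ⌊⌋-true {d = x Fin.≟ a}

  ∉⁅⁆ : ∀ {n} {a x : Fin n} → ¬ x ≡ a → x ∉ ⁅ a ⁆
  ∉⁅⁆ h = ¬true⇒false (h ∘ ∈⁅⁆⇒≡)

  #-insert : ∀ {n} (X : FSet n) a → a ∉ X → # (X ∪ ⁅ a ⁆) ≡ suc (# X)
  #-insert X a h = linarith 4 (λ u i x s → u ⊕ i ≐ x ⊕ s ⇒ i ≐ κ 0 ⇒ s ≐ κ 1 ⇒ ⊢ u ≐ κ 1 ⊕ x) (# (X ∪ ⁅ a ⁆)) (# (X ∩ ⁅ a ⁆)) (# X) (# ⁅ a ⁆)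
    (#-∪-∩ X ⁅ a ⁆) (#-empty (X ∩ ⁅ a ⁆) λ x hx → true≢false (proj₁ (∧-elim {X x} hx))
      (trans (cong X (∈⁅⁆⇒≡ (proj₂ (∧-elim {X x} hx)))) h)) (#-⁅⁆ a)

  #-remove : ∀ {n} (X : FSet n) {a} → a ∈ X → # X ≡ suc (# (X ∖ ⁅ a ⁆))
  #-remove X {a} h = linarith 4 (λ x s i d → i ⊕ d ≐ x ⇒ i ≐ s ⇒ s ≐ κ 1 ⇒ ⊢ x ≐ κ 1 ⊕ d)
    (# X) (# ⁅ a ⁆) (# (X ∩ ⁅ a ⁆)) _ (#-∩-∖ X ⁅ a ⁆)
    (≤-antisym (#-mono (X ∩ ⁅ a ⁆) ⁅ a ⁆ λ x → proj₂ ∘ ∧-elim {X x})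
      (#-mono ⁅ a ⁆ (X ∩ ⁅ a ⁆) λ x xa → ∧-intro (trans (cong X (∈⁅⁆⇒≡ xa)) h) xa))
    (#-⁅⁆ a)

  #-two⇒∃ : ∀ {n} (X : FSet n) → 2 ≤ # X → ∃ λ x → ∃ λ y → x ∈ X × y ∈ X × ¬ x ≡ y
  #-two⇒∃ X h = second (#-pos⇒∃ X (≤-trans (s≤s z≤n) h))
    where
    second : (∃ λ x → x ∈ X) → ∃ λ x → ∃ λ y → x ∈ X × y ∈ X × ¬ x ≡ y
    second (x , xX) = third (#-pos⇒∃ (X ∖ ⁅ x ⁆) (≤-pred (≤-trans h (≤-reflexive (#-remove X xX)))))
      where
      third : (∃ λ y → y ∈ (X ∖ ⁅ x ⁆)) → ∃ λ x → ∃ λ y → x ∈ X × y ∈ X × ¬ x ≡ y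
      third (y , h) = x , y , xX , proj₁ (∧-elim {X y} h) ,
        λ { refl → true≢false (∈⁅⁆ x) (not-elim (proj₂ (∧-elim {X x} h))) }

  #-disjoint : ∀ {n} (X Y : FSet n) → (∀ x → x ∈ X → x ∈ Y → ⊥) → # X + # Y ≤ n
  #-disjoint {n} X Y h = linarith 4 (λ x y c n → x ⊕ c ≐ n ⇒ y ⊴ c ⇒ ⊢ x ⊕ y ⊴ n) (# X) (# Y) (# (∁ X)) n (#-∁ X)
    (#-mono Y (∁ X) λ x xY → not-true (¬true⇒false λ xX → h x xX xY))

  -- The search runs over vectors, so `P` and `μ` must respect pointwise equality before its outcome
  -- applies to Boolean functions.
  minimalSet : ∀ {n} (P : FSet n → Set) → (∀ X → Dec (P X)) → (μ : FSet n → ℕ) →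
    (∀ {X Y} → X ≗ Y → P X → P Y) → (∀ {X Y} → X ≗ Y → μ X ≡ μ Y) →
    ∀ X → P X → ∃ λ U → P U × (∀ Y → P Y → μ U ≤ μ Y)
  minimalSet {n} P P? μ P-resp μ-resp X PX = go X PX (<-wellFounded (μ X))
    where
    go : ∀ X → P X → Acc _<_ (μ X) → ∃ λ U → P U × (∀ Y → P Y → μ U ≤ μ Y)
    go X PX (acc rs) with anySubset? (λ V → P? (lookup V) ×-dec (μ (lookup V) <? μ X))
    ... | yes (V , PV , lt) = go (lookup V) PV (rs lt)
    ... | no ∄ = X , PX , λ Y PY → ≮⇒≥ λ lt → ∄ (tabulate Y ,
      P-resp (sym ∘ lookup∘tabulate Y) PY , subst (_< μ X) (μ-resp (sym ∘ lookup∘tabulate Y)) lt)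

-- Sets of naturals: counts, weights and intervals of subset sums.

module NaturalSets where

  open LinearArithmetic
  open FiniteSets

  NSet : Set
  NSet = ℕ → Bool

  infix 4 _⊑_

  _⊑_ : NSet → NSet → Set
  V ⊑ T = ∀ t → V t ≡ true → T t ≡ true

  _⊔ⁿ_ : NSet → NSet → NSet
  (V ⊔ⁿ W) t = V t ∨ W t

  below above : ℕ → NSet → NSet
  below m T t = T t ∧ (t <ᵇ m)
  above m T t = T t ∧ not (t <ᵇ m)

  single : ℕ → NSet
  single a t = t ≡ᵇ a

  ct wt : ℕ → NSet → ℕ
  ct m V = sumTo m (λ t → 𝟙 (V t))
  wt m V = sumTo m (λ t → t * 𝟙 (V t))

  sumTo-cong : ∀ m {f g : ℕ → ℕ} → (∀ t → t < m → f t ≡ g t) → sumTo m f ≡ sumTo m g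
  sumTo-cong zero h = refl
  sumTo-cong (suc m) h = cong₂ _+_ (sumTo-cong m λ t lt → h t (m<n⇒m<1+n lt)) (h m ≤-refl)

  sumTo-zero : ∀ m → sumTo m (λ _ → 0) ≡ 0
  sumTo-zero zero = refl
  sumTo-zero (suc m) = trans (+-identityʳ _) (sumTo-zero m)

  sumTo-suc : ∀ m (f : ℕ → ℕ) → sumTo (suc m) f ≡ f 0 + sumTo m (f ∘ suc)
  sumTo-suc zero f = +-comm 0 (f 0)
  sumTo-suc (suc m) f = trans (cong (_+ f (suc m)) (sumTo-suc m f)) (+-assoc (f 0) _ _)

  sumTo-mono : ∀ m {f g : ℕ → ℕ} → (∀ t → t < m → f t ≤ g t) → sumTo m f ≤ sumTo m g
  sumTo-mono zero h = z≤n
  sumTo-mono (suc m) h = +-mono-≤ (sumTo-mono m λ t lt → h t (m<n⇒m<1+n lt)) (h m ≤-refl)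

  sumTo-distrib-+ : ∀ m (f g : ℕ → ℕ) → sumTo m (λ t → f t + g t) ≡ sumTo m f + sumTo m g
  sumTo-distrib-+ zero f g = refl
  sumTo-distrib-+ (suc m) f g = linarith 5 (λ s a b x y → s ≐ a ⊕ b ⇒ ⊢ s ⊕ (x ⊕ y) ≐ a ⊕ x ⊕ (b ⊕ y))
    (sumTo m (λ t → f t + g t)) (sumTo m f) (sumTo m g) (f m) (g m) (sumTo-distrib-+ m f g)

  sumTo-≤ : ∀ {m m′} (f : ℕ → ℕ) → m ≤ m′ → sumTo m f ≤ sumTo m′ f
  sumTo-≤ {m} {m′} f le = subst (λ k → sumTo m f ≤ sumTo k f) (m∸n+n≡m le) (go (m′ ∸ m))
    where
    go : ∀ d → sumTo m f ≤ sumTo (d + m) f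
    go zero = ≤-refl
    go (suc d) = ≤-trans (go d) (m≤m+n _ _)

  sumTo-split : ∀ a b (f : ℕ → ℕ) → sumTo (a + b) f ≡ sumTo a f + sumTo b (λ i → f (a + i))
  sumTo-split a zero f = trans (cong (λ k → sumTo k f) (+-identityʳ a)) (sym (+-identityʳ _))
  sumTo-split a (suc b) f = trans (cong (λ k → sumTo k f) (+-suc a b)) (trans (cong (_+ f (a + b)) (sumTo-split a b f)) (+-assoc (sumTo a f) _ _))

  <ᵇ-true : ∀ {m n} → m < n → (m <ᵇ n) ≡ true
  <ᵇ-true {m} {n} lt with m <ᵇ n | <⇒<ᵇ lt
  ... | true | _ = refl

  <ᵇ-sound : ∀ {m n} → (m <ᵇ n) ≡ true → m < n
  <ᵇ-sound {m} {n} e = <ᵇ⇒< m n (subst Data.Bool.T (sym e) _)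

  <ᵇ-false : ∀ {m n} → n ≤ m → (m <ᵇ n) ≡ false
  <ᵇ-false le = ¬true⇒false λ e → <⇒≱ (<ᵇ-sound e) le

  ≡ᵇ-sound : ∀ {m n} → (m ≡ᵇ n) ≡ true → m ≡ n
  ≡ᵇ-sound {m} {n} e = ≡ᵇ⇒≡ m n (subst Data.Bool.T (sym e) _)

  ≡ᵇ-refl : ∀ m → (m ≡ᵇ m) ≡ true
  ≡ᵇ-refl zero = refl
  ≡ᵇ-refl (suc m) = ≡ᵇ-refl m

  below-elim : ∀ {m T t} → below m T t ≡ true → T t ≡ true × t < m
  below-elim {m} {T} {t} h = proj₁ (∧-elim {T t} h) , <ᵇ-sound (proj₂ (∧-elim {T t} h))

  below-intro : ∀ {m T t} → T t ≡ true → t < m → below m T t ≡ true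
  below-intro h lt = ∧-intro h (<ᵇ-true lt)

  above-elim : ∀ {m T t} → above m T t ≡ true → T t ≡ true × m ≤ t
  above-elim {m} {T} {t} h = proj₁ (∧-elim {T t} h) ,
    ≮⇒≥ λ lt → true≢false (<ᵇ-true lt) (not-elim (proj₂ (∧-elim {T t} h)))

  above-intro : ∀ {m T t} → T t ≡ true → m ≤ t → above m T t ≡ true
  above-intro h le = ∧-intro h (not-true (<ᵇ-false le))

  wt-cong : ∀ m {V W : NSet} → (∀ t → t < m → V t ≡ W t) → wt m V ≡ wt m W
  wt-cong m h = sumTo-cong m λ t lt → cong (λ b → t * 𝟙 b) (h t lt)

  ct-cong : ∀ m {V W : NSet} → (∀ t → t < m → V t ≡ W t) → ct m V ≡ ct m W
  ct-cong m h = sumTo-cong m λ t lt → cong 𝟙 (h t lt)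

  wt-⊔ : ∀ m V W → (∀ t → V t ≡ true → W t ≡ true → ⊥) → wt m (V ⊔ⁿ W) ≡ wt m V + wt m W
  wt-⊔ m V W dis = trans (sumTo-cong m λ t _ → trans (cong (t *_) (𝟙-disjoint (V t) (W t) (dis t))) (*-distribˡ-+ t (𝟙 (V t)) (𝟙 (W t))))
    (sumTo-distrib-+ m (λ t → t * 𝟙 (V t)) (λ t → t * 𝟙 (W t)))

  ct-⊔ : ∀ m V W → (∀ t → V t ≡ true → W t ≡ true → ⊥) → ct m (V ⊔ⁿ W) ≡ ct m V + ct m W
  ct-⊔ m V W dis = trans (sumTo-cong m λ t _ → 𝟙-disjoint (V t) (W t) (dis t)) (sumTo-distrib-+ m (𝟙 ∘ V) (𝟙 ∘ W))

  single-false : ∀ {a t} → ¬ t ≡ a → single a t ≡ false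
  single-false ne = ¬true⇒false (ne ∘ ≡ᵇ-sound)

  sumTo-single : ∀ m a (f : ℕ → ℕ) → a < m → sumTo m (λ t → f t * 𝟙 (single a t)) ≡ f a
  sumTo-single (suc m) a f (s≤s a≤m) = [ (λ lt → trans (cong₂ _+_ (sumTo-single m a f lt)
      (trans (cong (λ b → f m * 𝟙 b) (single-false {a} {m} λ { refl → <-irrefl refl lt })) (*-zeroʳ (f m)))) (+-identityʳ _)) ,
    (λ { refl → trans (cong₂ _+_ (trans (sumTo-cong m λ t lt → trans (cong (λ b → f t * 𝟙 b) (single-false {a} {t} λ { refl → <-irrefl refl lt })) (*-zeroʳ (f t))) (sumTo-zero m))
      (trans (cong (λ b → f m * 𝟙 b) (≡ᵇ-refl m)) (*-identityʳ (f m)))) refl }) ]′ (m≤n⇒m<n∨m≡n a≤m)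

  wt-single : ∀ m a → a < m → wt m (single a) ≡ a
  wt-single m a = sumTo-single m a (λ t → t)

  ct-single : ∀ m a → a < m → ct m (single a) ≡ 1
  ct-single m a lt = trans (sumTo-cong m λ t _ → sym (*-identityˡ (𝟙 (single a t)))) (sumTo-single m a (λ _ → 1) lt)

  remove : ℕ → NSet → NSet
  remove a T t = T t ∧ not (single a t)

  remove-elim : ∀ {a T t} → remove a T t ≡ true → T t ≡ true × ¬ t ≡ a
  remove-elim {a} {T} {t} h = proj₁ (∧-elim {T t} h) , λ { refl → true≢false (≡ᵇ-refl t) (not-elim (proj₂ (∧-elim {T t} h))) }

  remove-intro : ∀ {a T t} → T t ≡ true → ¬ t ≡ a → remove a T t ≡ true
  remove-intro h ne = ∧-intro h (not-true (single-false ne))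

  bool-ext : ∀ {a b} → (a ≡ true → b ≡ true) → (b ≡ true → a ≡ true) → a ≡ b
  bool-ext {true} f g = sym (f refl)
  bool-ext {false} {true} f g = g refl
  bool-ext {false} {false} f g = refl

  remove-⊔ : ∀ a T → T a ≡ true → ∀ t → T t ≡ (remove a T ⊔ⁿ single a) t
  remove-⊔ a T Ta t = bool-ext to from
    where
    to : T t ≡ true → (remove a T ⊔ⁿ single a) t ≡ true
    to h with t ≟ a
    ... | yes refl = ∨-introʳ {remove a T t} (≡ᵇ-refl t)
    ... | no ne = ∨-introˡ (remove-intro {a} {T} h ne)
    from : (remove a T ⊔ⁿ single a) t ≡ true → T t ≡ true
    from h = [ (λ r → proj₁ (remove-elim {a} {T} r)) , (λ s → trans (cong T (≡ᵇ-sound s)) Ta) ]′ (∨-elim {remove a T t} h)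

  remove-disjoint : ∀ a T t → remove a T t ≡ true → single a t ≡ true → ⊥
  remove-disjoint a T t r s = proj₂ (remove-elim {a} {T} r) (≡ᵇ-sound s)

  wt-remove : ∀ m a T → T a ≡ true → a < m → wt m T ≡ wt m (remove a T) + a
  wt-remove m a T Ta lt = trans (wt-cong m λ t _ → remove-⊔ a T Ta t)
    (trans (wt-⊔ m (remove a T) (single a) (remove-disjoint a T)) (cong (wt m (remove a T) +_) (wt-single m a lt)))

  ct-remove : ∀ m a T → T a ≡ true → a < m → ct m T ≡ ct m (remove a T) + 1
  ct-remove m a T Ta lt = trans (ct-cong m λ t _ → remove-⊔ a T Ta t)
    (trans (ct-⊔ m (remove a T) (single a) (remove-disjoint a T)) (cong (ct m (remove a T) +_) (ct-single m a lt)))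

  ct-remove-≤ : ∀ m a T → ct m T ≤ ct m (remove a T) + 1
  ct-remove-≤ m a T with ∈ᵇ (T a) | a <? m
    where
    ∈ᵇ : ∀ b → (b ≡ true) ⊎ (b ≡ false)
    ∈ᵇ true = inj₁ refl
    ∈ᵇ false = inj₂ refl
  ... | inj₁ Ta | yes lt = ≤-reflexive (ct-remove m a T Ta lt)
  ... | inj₁ Ta | no ≮ = ≤-trans (≤-reflexive (ct-cong m λ t lt → bool-ext (λ h → remove-intro {a} {T} h λ { refl → ≮ lt }) (λ h → proj₁ (remove-elim {a} {T} h)))) (m≤m+n _ 1)
  ... | inj₂ Ta | _ = ≤-trans (≤-reflexive (ct-cong m λ t lt → bool-ext (λ h → remove-intro {a} {T} h λ { refl → true≢false h Ta }) (λ h → proj₁ (remove-elim {a} {T} h)))) (m≤m+n _ 1)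

  ct≤ : ∀ m V → ct m V ≤ m
  ct≤ zero V = z≤n
  ct≤ (suc m) V = ≤-trans (+-mono-≤ (ct≤ m V) (𝟙≤1 (V m))) (≤-reflexive (+-comm m 1))

  ct+missing : ∀ m V → ct m V + ct m (not ∘ V) ≡ m
  ct+missing zero V = refl
  ct+missing (suc m) V = linarith 5 (λ a b m x y → a ⊕ b ≐ m ⇒ x ⊕ y ≐ κ 1 ⇒ ⊢ a ⊕ x ⊕ (b ⊕ y) ≐ κ 1 ⊕ m)
    (ct m V) (ct m (not ∘ V)) m (𝟙 (V m)) (𝟙 (not (V m))) (ct+missing m V) (one (V m))
    where
    one : ∀ b → 𝟙 b + 𝟙 (not b) ≡ 1
    one true = refl
    one false = refl

  wt-⊑ : ∀ m {V W} → V ⊑ W → wt m V ≤ wt m W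
  wt-⊑ m h = sumTo-mono m λ t _ → *-monoʳ-≤ t (𝟙-mono (h t))

  ≤wt : ∀ {m} V {t} → V t ≡ true → t < m → t ≤ wt m V
  ≤wt {m} V {t} h lt = ≤-trans (≤-reflexive (sym (wt-single m t lt))) (wt-⊑ m λ u e → trans (cong V (≡ᵇ-sound e)) h)

  wt-lower : ∀ m z V → (∀ t → V t ≡ true → z ≤ t) → ct m V * (2 * z) + ct m V * ct m V ≤ 2 * wt m V + ct m V
  wt-lower m z V h = proj₁ (go m)
    where
    Bound : ℕ → ℕ → ℕ → Set
    Bound m c w = (c * (2 * z) + c * c ≤ 2 * w + c) × ((c ≡ 0) ⊎ (c + z ≤ m))
    step : ∀ m c w b → V m ≡ b → Bound m c w → Bound (suc m) (c + 𝟙 b) (w + m * 𝟙 b)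
    step m c w false _ (le , r) = subst₂ (Bound (suc m)) (sym (+-identityʳ c)) (sym (trans (cong (w +_) (*-zeroʳ m)) (+-identityʳ w)))
      (le , [ inj₁ , (λ le → inj₂ (m≤n⇒m≤1+n le)) ]′ r)
    step m c w true e (le , r) = linarith 4 (λ c z w m → c ⊗ (κ 2 ⊗ z) ⊕ c ⊗ c ⊴ κ 2 ⊗ w ⊕ c ⇒ c ⊕ z ⊴ m ⇒
          ⊢ (c ⊕ κ 1) ⊗ (κ 2 ⊗ z) ⊕ (c ⊕ κ 1) ⊗ (c ⊕ κ 1) ⊴ κ 2 ⊗ (w ⊕ m ⊗ κ 1) ⊕ (c ⊕ κ 1)) c z w m le c+z≤m ,
        inj₂ (≤-trans (≤-reflexive (trans (+-assoc c 1 z) (+-suc c z))) (s≤s c+z≤m))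
      where
      c+z≤m : c + z ≤ m
      c+z≤m = [ (λ c≡0 → subst (λ c → c + z ≤ m) (sym c≡0) (h m e)) , (λ le → le) ]′ r
    go : ∀ m → Bound m (ct m V) (wt m V)
    go zero = z≤n , inj₁ refl
    go (suc m) = step m (ct m V) (wt m V) (V m) refl (go m)

  below-⊔-above : ∀ m T t → T t ≡ (below m T ⊔ⁿ above m T) t
  below-⊔-above m T t = lem (T t) (t <ᵇ m)
    where
    lem : ∀ a b → a ≡ (a ∧ b) ∨ (a ∧ not b)
    lem true true = refl
    lem true false = refl
    lem false _ = refl

  below-above-disjoint : ∀ m T t → below m T t ≡ true → above m T t ≡ true → ⊥
  below-above-disjoint m T t h₁ h₂ = <⇒≱ (proj₂ (below-elim {m} {T} h₁)) (proj₂ (above-elim {m} {T} h₂))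

  wt-below-above : ∀ N m T → wt N T ≡ wt N (below m T) + wt N (above m T)
  wt-below-above N m T = trans (wt-cong N λ t _ → below-⊔-above m T t) (wt-⊔ N (below m T) (above m T) (below-above-disjoint m T))

  ct-below-above : ∀ N m T → ct N T ≡ ct N (below m T) + ct N (above m T)
  ct-below-above N m T = trans (ct-cong N λ t _ → below-⊔-above m T t) (ct-⊔ N (below m T) (above m T) (below-above-disjoint m T))

  sumTo-below : ∀ N m (f : ℕ → ℕ) (g : ℕ → ℕ) → m ≤ N → (∀ t → t < m → f t ≡ g t) → (∀ t → m ≤ t → f t ≡ 0) → sumTo N f ≡ sumTo m g
  sumTo-below N m f g m≤N lo hi = trans (cong (λ k → sumTo k f) (sym (m+[n∸m]≡n m≤N))) (trans (sumTo-split m (N ∸ m) f)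
    (trans (cong₂ _+_ (sumTo-cong m lo) (zeros (N ∸ m) λ i → hi (m + i) (m≤m+n m i))) (+-identityʳ _)))
    where
    zeros : ∀ d {h : ℕ → ℕ} → (∀ i → h i ≡ 0) → sumTo d h ≡ 0
    zeros zero _ = refl
    zeros (suc d) {h} e = cong₂ _+_ (zeros d {h} e) (e d)

  wt-below : ∀ N m T → m ≤ N → wt N (below m T) ≡ wt m T
  wt-below N m T m≤N = sumTo-below N m (λ t → t * 𝟙 (below m T t)) (λ t → t * 𝟙 (T t)) m≤N
    (λ t lt → cong (λ b → t * 𝟙 b) (bool-ext (λ h → proj₁ (below-elim {m} {T} h)) (λ h → below-intro {m} {T} h lt)))
    (λ t le → trans (cong (λ b → t * 𝟙 b) (¬true⇒false λ h → <⇒≱ (proj₂ (below-elim {m} {T} h)) le)) (*-zeroʳ t))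

  ct-below : ∀ N m T → m ≤ N → ct N (below m T) ≡ ct m T
  ct-below N m T m≤N = sumTo-below N m (λ t → 𝟙 (below m T t)) (λ t → 𝟙 (T t)) m≤N
    (λ t lt → cong 𝟙 (bool-ext (λ h → proj₁ (below-elim {m} {T} h)) (λ h → below-intro {m} {T} h lt)))
    (λ t le → cong 𝟙 (¬true⇒false λ h → <⇒≱ (proj₂ (below-elim {m} {T} h)) le))

  -- Replacing e missing elements of [1, K] by elements beyond k raises the sum.
  wt-missing : ∀ N T K e k → suc K ≤ N → T 0 ≡ false → ct N T ≡ k → ct (suc K) T + e ≡ K →
    k * k + k + 2 * e * k + 2 * e * e ≤ 2 * wt N T + 2 * e * K
  wt-missing N T K e k K<N T0 #T #K = linarith 7 (λ k K e a c lo hi →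
      a ⊗ (κ 2 ⊗ κ 1) ⊕ a ⊗ a ⊴ κ 2 ⊗ lo ⊕ a ⇒ c ⊗ (κ 2 ⊗ (κ 1 ⊕ (a ⊕ e))) ⊕ c ⊗ c ⊴ κ 2 ⊗ hi ⊕ c ⇒
      ⊢ (a ⊕ c) ⊗ (a ⊕ c) ⊕ (a ⊕ c) ⊕ κ 2 ⊗ e ⊗ (a ⊕ c) ⊕ κ 2 ⊗ e ⊗ e ⊴ κ 2 ⊗ (lo ⊕ hi) ⊕ κ 2 ⊗ e ⊗ (a ⊕ e))
      k K e a c (wt N (below (suc K) T)) (wt N (above (suc K) T))
      (subst (λ a → a * (2 * 1) + a * a ≤ 2 * wt N (below (suc K) T) + a) a≡ (wt-lower N 1 (below (suc K) T) λ t h → pos t (proj₁ (below-elim {suc K} {T} h))))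
      (subst (λ K′ → c * (2 * suc K′) + c * c ≤ 2 * wt N (above (suc K) T) + c) (sym #K) (wt-lower N (suc K) (above (suc K) T) λ t h → proj₂ (above-elim {suc K} {T} h)))
    ⟫ λ h → subst₂ (λ k K → k * k + k + 2 * e * k + 2 * e * e ≤ 2 * wt N T + 2 * e * K) k≡ #K
      (subst (λ w → (a + c) * (a + c) + (a + c) + 2 * e * (a + c) + 2 * e * e ≤ 2 * w + 2 * e * (a + e)) (sym (wt-below-above N (suc K) T)) h)
    where
    infixl 1 _⟫_
    _⟫_ : ∀ {A B : Set} → A → (A → B) → B
    x ⟫ f = f x
    a c : ℕ
    a = ct (suc K) T
    c = ct N (above (suc K) T)
    a≡ : ct N (below (suc K) T) ≡ a
    a≡ = ct-below N (suc K) T K<N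
    k≡ : a + c ≡ k
    k≡ = trans (cong (_+ c) (sym a≡)) (trans (sym (ct-below-above N (suc K) T)) #T)
    pos : ∀ t → T t ≡ true → 1 ≤ t
    pos zero h = ⊥-elim (true≢false h T0)
    pos (suc t) _ = s≤s z≤n

  module Sums (N : ℕ) where

    Sum : NSet → ℕ → Set
    Sum T x = ∃ λ V → V ⊑ T × wt N V ≡ x

    Sum-mono : ∀ {T T′ x} → T ⊑ T′ → Sum T x → Sum T′ x
    Sum-mono s (V , sub , e) = V , (λ t h → s t (sub t h)) , e

    Sum-insert : ∀ {T x} m → m < N → T m ≡ false → Sum T x → Sum (T ⊔ⁿ single m) (x + m)
    Sum-insert {T} m lt Tm (V , sub , e) = V ⊔ⁿ single m ,
      (λ t h → [ (λ v → ∨-introˡ (sub t v)) , (λ s → ∨-introʳ {T t} s) ]′ (∨-elim {V t} h)) ,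
      trans (wt-⊔ N V (single m) λ t v s → true≢false (sub t v) (trans (cong T (≡ᵇ-sound s)) Tm)) (cong₂ _+_ e (wt-single N m lt))

    -- Adding the elements of T₂ in increasing order.
    adjoin : ∀ T₁ T₂ (C : ℕ → ℕ → Set) → (∀ t → T₁ t ≡ true → T₂ t ≡ true → ⊥) →
      (∀ x → C 0 x → Sum T₁ x) →
      (∀ t → T₂ t ≡ true → t < N → ∀ x → C (wt t T₂ + t) x → C (wt t T₂) x ⊎ ∃ λ y → y + t ≡ x × C (wt t T₂) y) →
      ∀ x → C (wt N T₂) x → Sum (T₁ ⊔ⁿ T₂) x
    adjoin T₁ T₂ C dis base next x c = Sum-mono (λ t h → [ (λ h₁ → ∨-introˡ h₁) , (λ h₂ → ∨-introʳ {T₁ t} (proj₁ (below-elim {N} {T₂} h₂))) ]′ (∨-elim {T₁ t} h))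
        (go N ≤-refl x c)
      where
      T₁₂ : ℕ → NSet
      T₁₂ m = T₁ ⊔ⁿ below m T₂
      grow : ∀ m → T₁₂ m ⊑ T₁₂ (suc m)
      grow m t h = [ (λ h₁ → ∨-introˡ h₁) , (λ h₂ → ∨-introʳ {T₁ t} (below-intro {suc m} {T₂} (proj₁ (below-elim {m} {T₂} h₂)) (m<n⇒m<1+n (proj₂ (below-elim {m} {T₂} h₂))))) ]′ (∨-elim {T₁ t} h)
      go : ∀ m → m ≤ N → ∀ x → C (wt m T₂) x → Sum (T₁₂ m) x
      go zero _ x c = Sum-mono (λ t h → ∨-introˡ h) (base x c)
      go (suc m) m<N x c = add (T₂ m) refl c
        where
        add : ∀ b → T₂ m ≡ b → C (wt m T₂ + m * 𝟙 b) x → Sum (T₁₂ (suc m)) x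
        add false _ c = Sum-mono (grow m) (go m (<⇒≤ m<N) x (subst (λ w → C w x) (trans (cong (wt m T₂ +_) (*-zeroʳ m)) (+-identityʳ _)) c))
        add true e c = [ (λ c′ → Sum-mono (grow m) (go m (<⇒≤ m<N) x c′)) ,
          (λ { (y , refl , c′) → Sum-mono sub (Sum-insert {T₁₂ m} m m<N fresh (go m (<⇒≤ m<N) y c′)) }) ]′
          (next m e m<N x (subst (λ w → C (wt m T₂ + w) x) (*-identityʳ m) c))
          where
          fresh : T₁₂ m m ≡ false
          fresh = ¬true⇒false λ h → [ (λ h₁ → dis m h₁ e) , (λ h₂ → <-irrefl refl (proj₂ (below-elim {m} {T₂} h₂))) ]′ (∨-elim {T₁ m} h)
          sub : (T₁₂ m ⊔ⁿ single m) ⊑ T₁₂ (suc m)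
          sub t h = [ grow m t , (λ s → ∨-introʳ {T₁ t} (below-intro {suc m} {T₂} (trans (cong T₂ (≡ᵇ-sound s)) e) (s≤s (≤-reflexive (≡ᵇ-sound s))))) ]′ (∨-elim {T₁₂ m t} h)

    Interval : NSet → ℕ → ℕ → Set
    Interval T a b = ∀ x → a ≤ x → x ≤ b → Sum T x

    -- Adjoining t turns [a, b] into [a, b + t] when the shifted copy starts at a + t ≤ b + 1. The
    -- elements are taken in increasing order, so b has already grown by the smaller ones.
    interval-adjoin : ∀ T₁ T₂ a b → (∀ t → T₁ t ≡ true → T₂ t ≡ true → ⊥) → Interval T₁ a b →
      (∀ t → T₂ t ≡ true → t < N → a + t ≤ suc (b + wt t T₂)) → Interval (T₁ ⊔ⁿ T₂) a (b + wt N T₂)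
    interval-adjoin T₁ T₂ a b dis base fits x a≤x x≤ = adjoin T₁ T₂ (λ w x → a ≤ x × x ≤ b + w) dis
      (λ x (lo , hi) → base x lo (≤-trans hi (≤-reflexive (+-identityʳ b)))) next x (a≤x , x≤)
      where
      next : ∀ t → T₂ t ≡ true → t < N → ∀ x → (a ≤ x × x ≤ b + (wt t T₂ + t)) →
        (a ≤ x × x ≤ b + wt t T₂) ⊎ ∃ λ y → y + t ≡ x × (a ≤ y × y ≤ b + wt t T₂)
      next t h lt x (lo , hi) with x ≤? b + wt t T₂
      ... | yes le = inj₁ (lo , le)
      ... | no gt = inj₂ (x ∸ t , m∸n+n≡m t≤x , linarith 4 (λ a t y x → a ⊕ t ⊴ x ⇒ y ⊕ t ≐ x ⇒ ⊢ a ⊴ y) a t (x ∸ t) x a+t≤x (m∸n+n≡m t≤x) ,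
          linarith 5 (λ b w t y x → x ⊴ b ⊕ (w ⊕ t) ⇒ y ⊕ t ≐ x ⇒ ⊢ y ⊴ b ⊕ w) b (wt t T₂) t (x ∸ t) x hi (m∸n+n≡m t≤x))
        where
        a+t≤x : a + t ≤ x
        a+t≤x = ≤-trans (fits t h lt) (≰⇒> gt)
        t≤x : t ≤ x
        t≤x = ≤-trans (m≤n+m t a) a+t≤x

    -- The n disjoint pairs (u + i, v + n - 1 - i) have equal sums. If none lies in `T`, each
    -- contains a nonmember, which gives n nonmembers in [u, v + n).
    symmetric-pair : ∀ T n u v → u + n ≤ v → (∃ λ t → ∃ λ t′ → u ≤ t × t < u + n × v ≤ t′ × t′ < v + n × T t ≡ true × T t′ ≡ true × suc (t + t′) ≡ u + v + n)
      ⊎ (ct u (not ∘ T) + n ≤ ct (v + n) (not ∘ T))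
    symmetric-pair T zero u v le = inj₂ (≤-trans (≤-reflexive (+-identityʳ _)) (sumTo-≤ (𝟙 ∘ not ∘ T) (≤-trans (≤-trans (≤-reflexive (sym (+-identityʳ u))) le) (m≤m+n v 0))))
    symmetric-pair T (suc n) u v le = split (T u) (T (v + n)) refl refl
      where
      Pair : ℕ → ℕ → ℕ → Set
      Pair n u v = ∃ λ t → ∃ λ t′ → u ≤ t × t < u + n × v ≤ t′ × t′ < v + n × T t ≡ true × T t′ ≡ true × suc (t + t′) ≡ u + v + n
      v+ : v + suc n ≡ suc (v + n)
      v+ = +-suc v n
      inner : Pair n (suc u) v ⊎ (ct (suc u) (not ∘ T) + n ≤ ct (v + n) (not ∘ T))
      inner = symmetric-pair T n (suc u) v (≤-trans (≤-reflexive (sym (+-suc u n))) le)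
      widen : Pair n (suc u) v → Pair (suc n) u v
      widen (t , t′ , a , b , c , d , e , f , g) = t , t′ , <⇒≤ a , ≤-trans b (≤-reflexive (sym (+-suc u n))) , c ,
        ≤-trans d (+-monoʳ-≤ v (n≤1+n n)) , e , f , trans g (linarith 3 (λ u v n → ⊢ κ 1 ⊕ u ⊕ v ⊕ n ≐ u ⊕ v ⊕ (κ 1 ⊕ n)) u v n)
      fail : 1 ≤ 𝟙 (not (T u)) + 𝟙 (not (T (v + n))) → Pair (suc n) u v ⊎ (ct u (not ∘ T) + suc n ≤ ct (v + suc n) (not ∘ T))
      fail one = [ (λ p → inj₁ (widen p)) , (λ h → inj₂ (subst (λ k → ct u (not ∘ T) + suc n ≤ ct k (not ∘ T)) (sym v+)
        (linarith 5 (λ c n d x y → κ 1 ⊴ x ⊕ y ⇒ c ⊕ x ⊕ n ⊴ d ⇒ ⊢ c ⊕ (κ 1 ⊕ n) ⊴ d ⊕ y) (ct u (not ∘ T)) n (ct (v + n) (not ∘ T)) (𝟙 (not (T u))) (𝟙 (not (T (v + n)))) one h))) ]′ inner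
      split : ∀ b b′ → T u ≡ b → T (v + n) ≡ b′ → Pair (suc n) u v ⊎ (ct u (not ∘ T) + suc n ≤ ct (v + suc n) (not ∘ T))
      split true true e e′ = inj₁ (u , v + n , ≤-refl , ≤-trans (s≤s (m≤m+n u n)) (≤-reflexive (sym (+-suc u n))) , m≤m+n v n , ≤-reflexive (sym v+) , e , e′ ,
        linarith 3 (λ u v n → ⊢ κ 1 ⊕ (u ⊕ (v ⊕ n)) ≐ u ⊕ v ⊕ (κ 1 ⊕ n)) u v n)
      split false _ e _ = fail (≤-trans (≤-reflexive (sym (cong (𝟙 ∘ not) e))) (m≤m+n _ _))
      split true false _ e = fail (≤-trans (≤-reflexive (sym (cong (𝟙 ∘ not) e))) (m≤n+m _ (𝟙 (not (T u)))))

-- The numerical scales of the inverse argument.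

module Constants where

  open LinearArithmetic
  open FiniteSets using (division)

  -- `L` is the excess of the gain of a shift over the number of remaining elements, `E` the excess
  -- finally allowed in length. `t` counts translates of an atom, `ℓ₀` is the length of a run found
  -- in 2H, `i₁` the number of such runs laid end to end, and `i₂` the number of further summands H
  -- that stretch the progression. `h₂` and `h₃` are precisions for `width`, whose relative error is
  -- 14/h.
  record Scales (w L E : ℕ) : Set where
    field
      t h₂ ℓ₀ i₁ i₂ h₃ : ℕ
      L≤w : L ≤ w
      E≤w : E ≤ w
      1000≤w : 1000 ≤ w
      15≤h₂ : 15 ≤ h₂
      h₂-small : suc h₂ * 32 ≤ w * 7
      h₂-large : w * 448 ≤ h₂ * L
      t-large : w * 14 + L * 5 + suc t * suc t ≤ t * L
      t-small : suc t ≤ w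
      ℓ₀-small : ℓ₀ * L ≤ w * 2
      0<i₁ : 0 < i₁
      i₁-large : w * 100 ≤ i₁ * ℓ₀
      i₁-small : i₁ * 4 * 464 ≤ w * 7
      i₁ℓ₀-small : i₁ * ℓ₀ ≤ w * w
      0<i₂ : 0 < i₂
      15≤h₃ : 15 ≤ h₃
      i₂-small : suc h₃ * (i₁ * 4 + i₂) * 16 ≤ w * 7
      i₂-large : i₁ * 4 * w * (h₃ * 16 + 224) + i₂ * L * (h₃ * 2 + 28) + i₂ * w * 196 ≤ i₂ * h₃ * E * 2

  -- `γ` is the gain per step in the second greedy phase and `q₀` the number of elements spent on
  -- each of the first two phases. `N₀` is both the number of sums reached by them and the distance
  -- from the full group at which growth stops.
  record Params (k w : ℕ) : Set where
    field
      γ q₀ N₀ h L E : ℕ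
      q≡ : q₀ ≡ 32 * γ
      N≡ : N₀ ≡ q₀ * γ
      0<γ : 0 < γ
      15≤h : 15 ≤ h
      14k≤hq : 14 * k ≤ h * q₀
      N-large : 2 * suc h * k ≤ N₀
      1000q≤w : q₀ * 1000 ≤ w
      L≡ : L ≡ q₀ * 100
      E-small : E * 1000 ≤ w
      scales : Scales w L E

  -- With γ = [w/C] and h = 4C, the condition `N-large` asks γ² to exceed a multiple of C · γC. So γ
  -- must be of order C² and w of order C³; the other conditions are milder.
  params : ∀ k w → k ≤ w * 9 → ∀ c b C h₃ z u → z ≡ 1000 → u ≡ 1000000 → h₃ ≡ 400000 → b ≡ 1000000000000 → c ≡ b * 100 → C ≡ c * 1600 →
    C * C * C * 100 ≤ w → Params k w
  params k w k≤9w c b C h₃ z u z≡ u≡ h₃≡ b≡ c≡ C≡ w-large =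
    build (division w C 0<C) (division w z (≤-trans (s≤s z≤n) (≤-reflexive (sym z≡)))) (ceiling (division w b 0<b)) (division w u (≤-trans (s≤s z≤n) (≤-reflexive (sym u≡))))
    where
    0<b : 0 < b
    0<b = ≤-trans (s≤s z≤n) (≤-reflexive (sym b≡))
    C-large : 100000000000000000 ≤ C
    C-large = linarith 3 (λ b c C → b ≐ κ 1000000000000 ⇒ c ≐ b ⊗ κ 100 ⇒ C ≐ c ⊗ κ 1600 ⇒ ⊢ κ 100000000000000000 ⊴ C) b c C b≡ c≡ C≡
    0<C : 0 < C
    0<C = ≤-trans (s≤s z≤n) C-large
    CC≥ : C * 100000000000000000 ≤ C * C
    CC≥ = *-monoʳ-≤ C C-large
    CCC≥ : C * C * 100000000000000000 ≤ C * C * C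
    CCC≥ = *-monoʳ-≤ (C * C) C-large
    w≥C : C * 100 ≤ w
    w≥C = linarith 4 (λ C CC CCC w → CCC ⊗ κ 100 ⊴ w ⇒ C ⊗ κ 100000000000000000 ⊴ CC ⇒ CC ⊗ κ 100000000000000000 ⊴ CCC ⇒ ⊢ C ⊗ κ 100 ⊴ w) C (C * C) (C * C * C) w w-large CC≥ CCC≥
    ceiling : (∃ λ i → i * b ≤ w × w < suc i * b) → ∃ λ i → 0 < i × w ≤ i * b × i * b ≤ w + b
    ceiling (i , lo , hi) = suc i , s≤s z≤n , <⇒≤ hi , ≤-trans (+-monoʳ-≤ b lo) (≤-reflexive (+-comm b w))
    build : (∃ λ γ → γ * C ≤ w × w < suc γ * C) → (∃ λ E → E * z ≤ w × w < suc E * z) → (∃ λ i → 0 < i × w ≤ i * b × i * b ≤ w + b) →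
      (∃ λ i → i * u ≤ w × w < suc i * u) → Params k w
    build (γ , γC≤ , γC>) (E , Ez≤ , Ez>) (i₁ , 0<i₁ , i₁≥ , i₁≤) (i₂ , i₂u≤ , i₂u>) = record
      { γ = γ ; q₀ = 32 * γ ; N₀ = 32 * γ * γ ; h = C * 4 ; L = 32 * γ * 100 ; E = E ; q≡ = refl ; N≡ = refl
      ; 0<γ = ≤-trans (s≤s z≤n) 100≤γ
      ; 15≤h = linarith 1 (λ C → κ 100000000000000000 ⊴ C ⇒ ⊢ κ 15 ⊴ C ⊗ κ 4) C C-large
      ; 14k≤hq = linarith 5 (λ k w γ C z → k ⊴ w ⊗ κ 9 ⇒ w ⊲ (κ 1 ⊕ γ) ⊗ C ⇒ C ⊗ κ 100 ⊴ C ⊗ γ ⇒ ⊢ κ 14 ⊗ k ⊴ C ⊗ κ 4 ⊗ (κ 32 ⊗ γ)) k w γ C 0 k≤9w γC> (*-monoʳ-≤ C 100≤γ)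
      ; N-large = linarith 4 (λ k w γ C →  (κ 2 ⊗ (κ 1 ⊕ C ⊗ κ 4)) ⊗ k ⊴ (κ 2 ⊗ (κ 1 ⊕ C ⊗ κ 4)) ⊗ (γ ⊗ C ⊗ κ 18) ⇒
            C ⊗ C ⊗ κ 99 ⊗ γ ⊴ γ ⊗ γ ⇒ C ⊗ γ ⊴ C ⊗ C ⊗ γ ⇒ ⊢ κ 2 ⊗ (κ 1 ⊕ C ⊗ κ 4) ⊗ k ⊴ κ 32 ⊗ γ ⊗ γ) k w γ C
          (*-monoʳ-≤ (2 * suc (C * 4)) (linarith 4 (λ k w γ C → k ⊴ w ⊗ κ 9 ⇒ w ⊲ (κ 1 ⊕ γ) ⊗ C ⇒ κ 1 ⊗ C ⊴ γ ⊗ C ⇒ ⊢ k ⊴ γ ⊗ C ⊗ κ 18) k w γ C k≤9w γC> (*-monoˡ-≤ C (≤-trans (s≤s z≤n) 100≤γ))))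
          (*-monoˡ-≤ γ γ-large) (*-monoˡ-≤ γ (m≤m*n C C {{>-nonZero 0<C}}))
      ; 1000q≤w = linarith 3 (λ γ C w → γ ⊗ κ 100000000000000000 ⊴ γ ⊗ C ⇒ γ ⊗ C ⊴ w ⇒ ⊢ κ 32 ⊗ γ ⊗ κ 1000 ⊴ w) γ C w γC≥ γC≤
      ; L≡ = refl ; E-small = E≤
      ; scales = record
        -- C = 1600c makes ℓ₀L = 3200cγ = 2γC at most 2w, and c = 100b with i₁ ≥ w/b makes i₁ℓ₀ at
        -- least 100w.
        { t = C ; h₂ = C ; ℓ₀ = c ; i₁ = i₁ ; i₂ = i₂ ; h₃ = h₃
        ; L≤w = linarith 3 (λ γ C w → γ ⊗ κ 100000000000000000 ⊴ γ ⊗ C ⇒ γ ⊗ C ⊴ w ⇒ ⊢ κ 32 ⊗ γ ⊗ κ 100 ⊴ w) γ C w γC≥ γC≤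
        ; E≤w = linarith 2 (λ E w → E ⊗ κ 1000 ⊴ w ⇒ ⊢ E ⊴ w) E w E≤
        ; 1000≤w = linarith 2 (λ C w → C ⊗ κ 100 ⊴ w ⇒ κ 100000000000000000 ⊴ C ⇒ ⊢ κ 1000 ⊴ w) C w w≥C C-large
        ; 15≤h₂ = linarith 1 (λ C → κ 100000000000000000 ⊴ C ⇒ ⊢ κ 15 ⊴ C) C C-large
        ; h₂-small = linarith 2 (λ C w → C ⊗ κ 100 ⊴ w ⇒ κ 100000000000000000 ⊴ C ⇒ ⊢ (κ 1 ⊕ C) ⊗ κ 32 ⊴ w ⊗ κ 7) C w w≥C C-large
        ; h₂-large = linarith 3 (λ w γ C → w ⊲ (κ 1 ⊕ γ) ⊗ C ⇒ κ 1 ⊗ C ⊴ γ ⊗ C ⇒ ⊢ w ⊗ κ 448 ⊴ C ⊗ (κ 32 ⊗ γ ⊗ κ 100)) w γ C γC> (*-monoˡ-≤ C (≤-trans (s≤s z≤n) 100≤γ))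
        ; t-large = linarith 3 (λ w γ C → w ⊲ (κ 1 ⊕ γ) ⊗ C ⇒ κ 1 ⊗ C ⊴ γ ⊗ C ⇒ C ⊗ C ⊗ κ 99 ⊴ γ ⇒ γ ⊗ κ 100000000000000000 ⊴ γ ⊗ C ⇒ κ 100000000000000000 ⊴ C ⇒
              C ⊗ κ 100000000000000000 ⊴ C ⊗ C ⇒
              ⊢ w ⊗ κ 14 ⊕ κ 32 ⊗ γ ⊗ κ 100 ⊗ κ 5 ⊕ (κ 1 ⊕ C) ⊗ (κ 1 ⊕ C) ⊴ C ⊗ (κ 32 ⊗ γ ⊗ κ 100))
            w γ C γC> (*-monoˡ-≤ C (≤-trans (s≤s z≤n) 100≤γ)) γ-large γC≥ C-large CC≥
        ; t-small = linarith 2 (λ C w → C ⊗ κ 100 ⊴ w ⇒ κ 100000000000000000 ⊴ C ⇒ ⊢ κ 1 ⊕ C ⊴ w) C w w≥C C-large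
        ; ℓ₀-small = linarith 4 (λ c γ C w → γ ⊗ C ≐ γ ⊗ (c ⊗ κ 1600) ⇒ γ ⊗ C ⊴ w ⇒ ⊢ c ⊗ (κ 32 ⊗ γ ⊗ κ 100) ⊴ w ⊗ κ 2) c γ C w (cong (γ *_) C≡) γC≤
        ; 0<i₁ = 0<i₁
        ; i₁-large = linarith 4 (λ w i b c → w ⊴ i ⊗ b ⇒ i ⊗ c ≐ i ⊗ (b ⊗ κ 100) ⇒ ⊢ w ⊗ κ 100 ⊴ i ⊗ c) w i₁ b c i₁≥ (cong (i₁ *_) c≡)
        ; i₁-small = linarith 2 (λ i w → i ⊗ κ 1000000000000 ⊴ w ⊕ κ 1000000000000 ⇒ κ 1000000000000000000 ⊴ w ⇒ ⊢ i ⊗ κ 4 ⊗ κ 464 ⊴ w ⊗ κ 7) i₁ w i₁b≤ w-big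
        ; i₁ℓ₀-small = linarith 4 (λ i b c w → i ⊗ c ≐ i ⊗ (b ⊗ κ 100) ⇒ i ⊗ b ⊴ w ⊕ b ⇒ b ≐ κ 1000000000000 ⇒ w ⊗ κ 1000000000000000000 ⊴ w ⊗ w ⇒ κ 1000000000000000000 ⊴ w ⇒ ⊢ i ⊗ c ⊴ w ⊗ w)
            i₁ b c w (cong (i₁ *_) c≡) i₁≤ b≡ (*-monoʳ-≤ w w-big) w-big
        ; 0<i₂ = linarith 2 (λ i w → w ⊲ i ⊗ κ 1000000 ⊕ κ 1000000 ⇒ κ 1000000000000000000 ⊴ w ⇒ ⊢ κ 0 ⊲ i) i₂ w i₂> w-big
        ; 15≤h₃ = linarith 1 (λ h → h ≐ κ 400000 ⇒ ⊢ κ 15 ⊴ h) h₃ h₃≡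
        ; i₂-small = linarith 4 (λ h i₁ i₂ w → h ⊗ i₁ ≐ i₁ ⊗ κ 400000 ⇒ h ⊗ i₂ ≐ i₂ ⊗ κ 400000 ⇒ i₁ ⊗ κ 1000000000000 ⊴ w ⊕ κ 1000000000000 ⇒ i₂ ⊗ κ 1000000 ⊴ w ⇒
              κ 1000000000000000000 ⊴ w ⇒ ⊢ (κ 1 ⊕ h) ⊗ (i₁ ⊗ κ 4 ⊕ i₂) ⊗ κ 16 ⊴ w ⊗ κ 7)
            h₃ i₁ i₂ w (h₃* i₁) (h₃* i₂) i₁b≤ i₂≤ w-big
        ; i₂-large = subst (λ h → i₁ * 4 * w * (h * 16 + 224) + i₂ * (32 * γ * 100) * (h * 2 + 28) + i₂ * w * 196 ≤ i₂ * h * E * 2) (sym h₃≡) i₂-large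
        }
      }
      where
      γ-large : C * C * 99 ≤ γ
      γ-large = *-cancelʳ-≤ (C * C * 99) γ C {{>-nonZero 0<C}} (linarith 5 (λ C γ w CC CCC → CCC ⊗ κ 100 ⊴ w ⇒ w ⊲ (κ 1 ⊕ γ) ⊗ C ⇒ CCC ≐ C ⊗ C ⊗ C ⇒ C ⊗ κ 100000000000000000 ⊴ CC ⇒ CC ⊗ κ 100000000000000000 ⊴ CCC ⇒
        ⊢ C ⊗ C ⊗ κ 99 ⊗ C ⊴ γ ⊗ C) C γ w (C * C) (C * C * C) w-large γC> refl CC≥ CCC≥)
      100≤γ : 100 ≤ γ
      100≤γ = linarith 3 (λ C CC γ → CC ⊗ κ 99 ⊴ γ ⇒ C ⊗ κ 100000000000000000 ⊴ CC ⇒ κ 100000000000000000 ⊴ C ⇒ ⊢ κ 100 ⊴ γ) C (C * C) γ γ-large CC≥ C-large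
      γC≥ : γ * 100000000000000000 ≤ γ * C
      γC≥ = *-monoʳ-≤ γ C-large
      w-big : 1000000000000000000 ≤ w
      w-big = linarith 2 (λ C w → C ⊗ κ 100 ⊴ w ⇒ κ 100000000000000000 ⊴ C ⇒ ⊢ κ 1000000000000000000 ⊴ w) C w w≥C C-large
      i₁b≤ : i₁ * 1000000000000 ≤ w + 1000000000000
      i₁b≤ = subst (λ b → i₁ * b ≤ w + b) b≡ i₁≤
      h₃* : ∀ i → h₃ * i ≡ i * 400000
      h₃* i = trans (*-comm h₃ i) (cong (i *_) h₃≡)
      E≤ : E * 1000 ≤ w
      E≤ = ≤-trans (≤-reflexive (cong (E *_) (sym z≡))) Ez≤
      E> : w < E * 1000 + 1000
      E> = linarith 3 (λ w E z → w ⊲ (κ 1 ⊕ E) ⊗ z ⇒ E ⊗ z ≐ E ⊗ κ 1000 ⇒ z ≐ κ 1000 ⇒ ⊢ w ⊲ E ⊗ κ 1000 ⊕ κ 1000) w E z Ez> (cong (E *_) z≡) z≡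
      i₂≤ : i₂ * 1000000 ≤ w
      i₂≤ = ≤-trans (≤-reflexive (cong (i₂ *_) (sym u≡))) i₂u≤
      i₂> : w < i₂ * 1000000 + 1000000
      i₂> = linarith 3 (λ w E z → w ⊲ (κ 1 ⊕ E) ⊗ z ⇒ E ⊗ z ≐ E ⊗ κ 1000000 ⇒ z ≐ κ 1000000 ⇒ ⊢ w ⊲ E ⊗ κ 1000000 ⊕ κ 1000000) w i₂ u i₂u> (cong (i₂ *_) u≡) u≡
      i₂≥ : i₁ * 500000 ≤ i₂
      i₂≥ = linarith 3 (λ i₁ i₂ w → i₁ ⊗ κ 1000000000000 ⊴ w ⊕ κ 1000000000000 ⇒ w ⊲ i₂ ⊗ κ 1000000 ⊕ κ 1000000 ⇒ κ 1000000000000000000 ⊴ w ⇒ ⊢ i₁ ⊗ κ 500000 ⊴ i₂) i₁ i₂ w i₁b≤ i₂> w-big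
      i₂-large : i₁ * 4 * w * (400000 * 16 + 224) + i₂ * (32 * γ * 100) * (400000 * 2 + 28) + i₂ * w * 196 ≤ i₂ * 400000 * E * 2
      i₂-large = linarith 5 (λ i₁ i₂ w γ E → i₁ ⊗ κ 500000 ⊗ w ⊴ i₂ ⊗ w ⇒ i₂ ⊗ (γ ⊗ κ 100000000000000000) ⊴ i₂ ⊗ w ⇒ i₂ ⊗ w ⊴ i₂ ⊗ (E ⊗ κ 1000 ⊕ κ 1000) ⇒
          i₂ ⊗ κ 1000000000000000000 ⊴ i₂ ⊗ w ⇒
          ⊢ i₁ ⊗ κ 4 ⊗ w ⊗ κ 6400224 ⊕ i₂ ⊗ (κ 32 ⊗ γ ⊗ κ 100) ⊗ κ 800028 ⊕ i₂ ⊗ w ⊗ κ 196 ⊴ i₂ ⊗ κ 400000 ⊗ E ⊗ κ 2)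
        i₁ i₂ w γ E (*-monoˡ-≤ w i₂≥) (*-monoʳ-≤ i₂ (≤-trans γC≥ γC≤)) (*-monoʳ-≤ i₂ (<⇒≤ E>)) (*-monoʳ-≤ i₂ w-big)

  -- 100C³ with C = 1.6 · 10^17 is about 4.1 · 10^53: this is the origin of 10^54.
  params-large : ∀ k w → k ≤ w * 9 → 10 ^ 54 ≤ w → Params k w
  params-large k w k≤9w w-large = params k w k≤9w 100000000000000 1000000000000 160000000000000000 400000 1000 1000000 refl refl refl refl refl refl
    (≤-trans (≤ᵇ⇒≤ (160000000000000000 * 160000000000000000 * 160000000000000000 * 100) (10 ^ 54) _) w-large)

-- Translates and atoms in a finite group in which no nonzero translation fixes a proper nonempty
-- set.

module Isoperimetry (n : ℕ) (_∙_ : Fin n → Fin n → Fin n) (ε : Fin n) (_⁻¹ : Fin n → Fin n)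
  (isAbelianGroup : IsAbelianGroup _≡_ _∙_ ε _⁻¹)
  (simple : ∀ (X : FiniteSets.FSet n) a → ¬ a ≡ ε → (∀ x → X x ≡ true → X (x ∙ a) ≡ true) → ∀ x y → X x ≡ true → X y ≡ true) where

  open FiniteSets

  open LinearArithmetic
  open import Algebra.Bundles using (AbelianGroup)

  𝔾 : AbelianGroup _ _
  𝔾 = record { isAbelianGroup = isAbelianGroup }

  open AbelianGroup 𝔾 public using (assoc; comm; identityˡ; identityʳ; inverseˡ; inverseʳ)
  open import Algebra.Properties.AbelianGroup 𝔾 public using (⁻¹-involutive; ε⁻¹≈ε; ⁻¹-∙-comm)

  x∙a∙a⁻¹ : ∀ x a → (x ∙ a) ∙ (a ⁻¹) ≡ x
  x∙a∙a⁻¹ x a = trans (assoc x a (a ⁻¹)) (trans (cong (x ∙_) (inverseʳ a)) (identityʳ x))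

  x∙a⁻¹∙a : ∀ x a → (x ∙ (a ⁻¹)) ∙ a ≡ x
  x∙a⁻¹∙a x a = trans (assoc x (a ⁻¹) a) (trans (cong (x ∙_) (inverseˡ a)) (identityʳ x))

  x∙[y∙x⁻¹] : ∀ x y → x ∙ (y ∙ (x ⁻¹)) ≡ y
  x∙[y∙x⁻¹] x y = trans (comm x _) (x∙a⁻¹∙a y x)

  ∙-swap : ∀ a b c → (a ∙ b) ∙ c ≡ (a ∙ c) ∙ b
  ∙-swap a b c = trans (assoc a b c) (trans (cong (a ∙_) (comm b c)) (sym (assoc a c b)))

  ∙-cancelʳ : ∀ a {x y} → x ∙ a ≡ y ∙ a → x ≡ y
  ∙-cancelʳ a {x} {y} e = trans (sym (x∙a∙a⁻¹ x a)) (trans (cong (_∙ (a ⁻¹)) e) (x∙a∙a⁻¹ y a))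

  ∙⁻¹≡ε : ∀ {x y} → x ∙ (y ⁻¹) ≡ ε → x ≡ y
  ∙⁻¹≡ε {x} {y} e = ∙-cancelʳ (y ⁻¹) (trans e (sym (inverseʳ y)))

  sum-shift : ∀ (f : Fin n → ℕ) a → sum (λ x → f (x ∙ a)) ≡ sum f
  sum-shift f a = sum-bij f (_∙ a) (_∙ (a ⁻¹)) (λ x → x∙a⁻¹∙a x a) (λ x → x∙a∙a⁻¹ x a)

  infixl 7 _⊹_

  _⊹_ : FSet n → Fin n → FSet n
  (X ⊹ a) x = X (x ∙ (a ⁻¹))

  #-⊹ : ∀ X a → # (X ⊹ a) ≡ # X
  #-⊹ X a = sum-shift (𝟙 ∘ X) (a ⁻¹)

  ∈-⊹ : ∀ X {x} a → x ∈ X → (x ∙ a) ∈ (X ⊹ a)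
  ∈-⊹ X {x} a h = trans (cong X (x∙a∙a⁻¹ x a)) h

  -- `stay X a` counts the representations of a as a difference in X, and `out X a` the elements
  -- gained by uniting X with its translate. As `out` is even and subadditive in a, a bound for it
  -- on a set of shifts passes to the iterated sumsets.
  stay out : FSet n → Fin n → ℕ
  stay X a = # λ x → X x ∧ X (x ∙ a)
  out X a = # λ x → X x ∧ not (X (x ∙ a))

  stay+out : ∀ X a → stay X a + out X a ≡ # X
  stay+out X a = #-∩-∖ X (λ x → X (x ∙ a))

  out-ε : ∀ X → out X ε ≡ 0
  out-ε X = trans (sum-cong-≗ λ x → cong 𝟙 (lem x)) (trans (sum-const n 0) (*-zeroʳ n))
    where
    lem : ∀ x → X x ∧ not (X (x ∙ ε)) ≡ false
    lem x rewrite identityʳ x with X x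
    ... | true = refl
    ... | false = refl

  stay-⁻¹ : ∀ X a → stay X (a ⁻¹) ≡ stay X a
  stay-⁻¹ X a = trans (sym (sum-shift (λ x → 𝟙 (X x ∧ X (x ∙ (a ⁻¹)))) a))
    (sum-cong-≗ λ x → cong 𝟙 (trans (cong (λ y → X (x ∙ a) ∧ X y) (x∙a∙a⁻¹ x a)) (Bool.∧-comm (X (x ∙ a)) (X x))))

  out-⁻¹ : ∀ X a → out X (a ⁻¹) ≡ out X a
  out-⁻¹ X a = +-cancelˡ-≡ (stay X a) _ _
    (trans (cong (_+ out X (a ⁻¹)) (sym (stay-⁻¹ X a))) (trans (stay+out X (a ⁻¹)) (sym (stay+out X a))))

  -- An x that leaves X under a ∙ b leaves it at the first shift, or else x ∙ a leaves it at the
  -- second.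
  out-∙ : ∀ X a b → out X (a ∙ b) ≤ out X a + out X b
  out-∙ X a b = ≤-trans (sum-mono (λ x → lem x)) (≤-reflexive
    (trans (∑-distrib-+ (λ x → 𝟙 (X x ∧ not (X (x ∙ a)))) (λ x → 𝟙 (X (x ∙ a) ∧ not (X ((x ∙ a) ∙ b)))))
      (cong (out X a +_) (sum-shift (λ x → 𝟙 (X x ∧ not (X (x ∙ b)))) a))))
    where
    bool : ∀ p q r → 𝟙 (p ∧ not r) ≤ 𝟙 (p ∧ not q) + 𝟙 (q ∧ not r)
    bool true true true = z≤n
    bool true true false = s≤s z≤n
    bool true false true = z≤n
    bool true false false = s≤s z≤n
    bool false q r = z≤n
    lem : ∀ x → 𝟙 (X x ∧ not (X (x ∙ (a ∙ b)))) ≤ 𝟙 (X x ∧ not (X (x ∙ a))) + 𝟙 (X (x ∙ a) ∧ not (X ((x ∙ a) ∙ b)))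
    lem x rewrite sym (assoc x a b) = bool (X x) (X (x ∙ a)) (X ((x ∙ a) ∙ b))

  sum-stay : ∀ X → sum (stay X) ≡ # X * # X
  sum-stay X = trans (∑-comm (λ a x → 𝟙 (X x ∧ X (x ∙ a))))
    (trans (sum-cong-≗ row) (trans (sum-*ˡ (# X) (𝟙 ∘ X)) refl))
    where
    𝟙-∧ : ∀ b c → 𝟙 (b ∧ c) ≡ 𝟙 b * 𝟙 c
    𝟙-∧ true c = sym (+-identityʳ _)
    𝟙-∧ false c = refl
    row : ∀ x → sum (λ a → 𝟙 (X x ∧ X (x ∙ a))) ≡ # X * 𝟙 (X x)
    row x = trans (sum-cong-≗ λ a → trans (𝟙-∧ (X x) (X (x ∙ a))) (cong (λ y → 𝟙 (X x) * 𝟙 (X y)) (comm x a)))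
      (trans (sum-*ˡ (𝟙 (X x)) (λ a → 𝟙 (X (a ∙ x))))
        (trans (cong (𝟙 (X x) *_) (sum-shift (𝟙 ∘ X) x)) (*-comm (𝟙 (X x)) (# X))))

  -- Translation is a bijection, so as many elements leave X as enter it. This allows a set of more
  -- than n/2 sums to be traded for its complement.
  out-∁ : ∀ X a → out (∁ X) a ≡ out X a
  out-∁ X a = +-cancelˡ-≡ (stay X a) _ _ (trans (sym (∑-distrib-+ (λ x → 𝟙 (X x ∧ X (x ∙ a))) _))
    (trans (sum-cong-≗ λ x → lem (X x) (X (x ∙ a))) (trans (sum-shift (𝟙 ∘ X) a) (sym (stay+out X a)))))
    where
    lem : ∀ p q → 𝟙 (p ∧ q) + 𝟙 (not p ∧ not (not q)) ≡ 𝟙 q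
    lem true q = +-identityʳ _
    lem false true = refl
    lem false false = refl

  #-∪-⊹ : ∀ X a → # (X ∪ (X ⊹ a)) ≡ # X + out X a
  #-∪-⊹ X a = linarith 6 (λ u i x o s sh → u ⊕ i ≐ x ⊕ sh ⇒ sh ≐ x ⇒ s ⊕ o ≐ x ⇒ i ≐ s ⇒ ⊢ u ≐ x ⊕ o)
    (# (X ∪ (X ⊹ a))) (# (X ∩ (X ⊹ a))) (# X) (out X a) (stay X a) (# (X ⊹ a))
    (#-∪-∩ X (X ⊹ a)) (#-⊹ X a) (stay+out X a) (stay-⁻¹ X a)

  infixl 6 _⊞_

  _⊞_ : FSet n → FSet n → FSet n
  (X ⊞ Y) z = ⌊ Fin.any? (λ x → (X x ∧ Y (z ∙ (x ⁻¹))) Bool.≟ true) ⌋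

  ⊞-intro : ∀ X Y {x y} → x ∈ X → y ∈ Y → (x ∙ y) ∈ (X ⊞ Y)
  ⊞-intro X Y {x} {y} hx hy = ⌊⌋-intro {d = Fin.any? (λ z → (X z ∧ Y ((x ∙ y) ∙ (z ⁻¹))) Bool.≟ true)}
    (x , ∧-intro hx (trans (cong Y (trans (cong (_∙ (x ⁻¹)) (comm x y)) (x∙a∙a⁻¹ y x))) hy))

  ⊞-elim : ∀ X Y {z} → z ∈ (X ⊞ Y) → ∃ λ x → ∃ λ y → x ∈ X × y ∈ Y × z ≡ x ∙ y
  ⊞-elim X Y {z} h with ⌊⌋-true {d = Fin.any? (λ x → (X x ∧ Y (z ∙ (x ⁻¹))) Bool.≟ true)} h
  ... | x , e = x , z ∙ (x ⁻¹) , proj₁ (∧-elim {X x} e) , proj₂ (∧-elim {X x} e) , sym (x∙[y∙x⁻¹] x z)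

  ⊞-mono : ∀ X X′ Y → X ⊆ X′ → (X ⊞ Y) ⊆ (X′ ⊞ Y)
  ⊞-mono X X′ Y s z h with ⊞-elim X Y h
  ... | x , y , hx , hy , refl = ⊞-intro X′ Y (s x hx) hy

  ⊞-#-cong : ∀ X X′ Y → X ≗ X′ → # (X ⊞ Y) ≡ # (X′ ⊞ Y)
  ⊞-#-cong X X′ Y e = ≤-antisym
    (#-mono (X ⊞ Y) (X′ ⊞ Y) (⊞-mono X X′ Y λ x → trans (sym (e x))))
    (#-mono (X′ ⊞ Y) (X ⊞ Y) (⊞-mono X′ X Y λ x → trans (e x)))

  Symmetric : FSet n → Set
  Symmetric X = ∀ x → x ∈ X → (x ⁻¹) ∈ X

  ⁻¹-∙ : ∀ a b → (a ∙ b) ⁻¹ ≡ (a ⁻¹) ∙ (b ⁻¹)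
  ⁻¹-∙ a b = sym (⁻¹-∙-comm a b)

  #-⊞-⊹ : ∀ X H a → # ((X ⊹ a) ⊞ H) ≤ # (X ⊞ H)
  #-⊞-⊹ X H a = ≤-trans (#-mono ((X ⊹ a) ⊞ H) ((X ⊞ H) ⊹ a) sub) (≤-reflexive (#-⊹ (X ⊞ H) a))
    where
    sub : ((X ⊹ a) ⊞ H) ⊆ ((X ⊞ H) ⊹ a)
    sub z hz with ⊞-elim (X ⊹ a) H hz
    ... | x , y , hx , hy , refl = trans (cong (X ⊞ H) (∙-swap x y (a ⁻¹))) (⊞-intro X H hx hy)

  -- The isoperimetric method of Hamidoune: a set U minimising |U + H| - |U|, and
  -- of least cardinality among those, meets its translates in few points.
  module Atoms (H : FSet n) (H-sym : Symmetric H) (ε∈H : ε ∈ H) (m : ℕ) (0<m : 0 < m) where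

    bd : FSet n → ℕ
    bd X = # (X ⊞ H)

    #≤bd : ∀ X → # X ≤ bd X
    #≤bd X = #-mono X (X ⊞ H) λ x hx → subst (_∈ (X ⊞ H)) (identityʳ x) (⊞-intro X H hx ε∈H)

    Admissible : FSet n → Set
    Admissible X = m ≤ # X × bd X + m ≤ n

    -- The lexicographic order on (|X + H| - |X|, |X|) as one number; the factor n + 1 works because
    -- |X| ≤ n.
    μ : FSet n → ℕ
    μ X = (bd X ∸ # X) * suc n + # X

    IsAtom : FSet n → Set
    IsAtom U = Admissible U × (∀ Y → Admissible Y → μ U ≤ μ Y)

    atom-exists : ∀ X → Admissible X → ∃ IsAtom
    atom-exists = minimalSet Admissible (λ X → (m ≤? # X) ×-dec (bd X + m ≤? n)) μ
      (λ {X} {Y} e (p , q) → subst (m ≤_) (#-cong X Y e) p , subst (λ k → k + m ≤ n) (⊞-#-cong X Y H e) q)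
      (λ {X} {Y} e → cong₂ (λ a b → (a ∸ b) * suc n + b) (⊞-#-cong X Y H e) (#-cong X Y e))

    lex : ∀ a b x y → a * suc n + x ≤ b * suc n + y → y ≤ n → a ≤ b × (a ≡ b → x ≤ y)
    lex a b x y h y≤n = ≮⇒≥ bad , λ { refl → +-cancelˡ-≤ (a * suc n) x y h }
      where
      bad : ¬ b < a
      bad lt = linarith 5 (λ p q x y n → p ⊕ x ⊴ q ⊕ y ⇒ κ 1 ⊕ n ⊕ q ⊴ p ⇒ y ⊴ n ⇒ ⊢⊥)
        (a * suc n) (b * suc n) x y n h (*-monoˡ-≤ (suc n) lt) y≤n

    module _ {U : FSet n} (atom : IsAtom U) where

      compare : ∀ Y → Admissible Y → bd U + # Y ≤ bd Y + # U × (bd Y + # U ≤ bd U + # Y → # U ≤ # Y)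
      compare Y a with lex _ _ _ _ (proj₂ atom Y a) (#≤n Y)
      ... | d≤ , eq = linarith 6 (λ bu bY u y du dy → du ⊴ dy ⇒ bu ≐ u ⊕ du ⇒ bY ≐ y ⊕ dy ⇒ ⊢ bu ⊕ y ⊴ bY ⊕ u)
          (bd U) (bd Y) (# U) (# Y) _ _ d≤ (split U) (split Y) ,
        λ h → eq (≤-antisym d≤ (linarith 6 (λ bu bY u y du dy → bY ⊕ u ⊴ bu ⊕ y ⇒ bu ≐ u ⊕ du ⇒ bY ≐ y ⊕ dy ⇒ ⊢ dy ⊴ du)
          (bd U) (bd Y) (# U) (# Y) _ _ h (split U) (split Y)))
        where
        split : ∀ X → bd X ≡ # X + (bd X ∸ # X)
        split X = sym (m+[n∸m]≡n (#≤bd X))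

      submodular : ∀ X Y → bd (X ∪ Y) + bd (X ∩ Y) ≤ bd X + bd Y
      submodular X Y = linarith 6 (λ u i u′ i′ x y → u ⊴ u′ ⇒ i ⊴ i′ ⇒ u′ ⊕ i′ ≐ x ⊕ y ⇒ ⊢ u ⊕ i ⊴ x ⊕ y)
        (bd (X ∪ Y)) (bd (X ∩ Y)) (# ((X ⊞ H) ∪ (Y ⊞ H))) (# ((X ⊞ H) ∩ (Y ⊞ H))) (bd X) (bd Y)
        (#-mono ((X ∪ Y) ⊞ H) ((X ⊞ H) ∪ (Y ⊞ H)) sub∪) (#-mono ((X ∩ Y) ⊞ H) ((X ⊞ H) ∩ (Y ⊞ H)) sub∩)
        (#-∪-∩ (X ⊞ H) (Y ⊞ H))
        where
        sub∪ : ((X ∪ Y) ⊞ H) ⊆ ((X ⊞ H) ∪ (Y ⊞ H))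
        sub∪ z hz with ⊞-elim (X ∪ Y) H hz
        ... | x , h , hx , hh , refl with ∨-elim {X x} hx
        ... | inj₁ p = ∨-introˡ (⊞-intro X H p hh)
        ... | inj₂ p = ∨-introʳ (⊞-intro Y H p hh)
        sub∩ : ((X ∩ Y) ⊞ H) ⊆ ((X ⊞ H) ∩ (Y ⊞ H))
        sub∩ z hz with ⊞-elim (X ∩ Y) H hz
        ... | x , h , hx , hh , refl = ∧-intro (⊞-intro X H (proj₁ (∧-elim {X x} hx)) hh)
          (⊞-intro Y H (proj₂ (∧-elim {X x} hx)) hh)

      dual : FSet n
      dual = ∁ (U ⊞ H)

      -- H being symmetric, dual + H misses U; minimality of U against its dual bounds |U|.
      atom-small : bd U + # U ≤ n
      atom-small = linarith 4 (λ bu u d n → bu ⊕ d ≐ n ⇒ u ⊴ d ⇒ ⊢ bu ⊕ u ⊴ n) (bd U) (# U) (# dual) n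
        (#-∁ (U ⊞ H)) (proj₂ (compare dual dual-adm)
          (linarith 5 (λ bu u d bd n → bu ⊕ d ≐ n ⇒ bd ⊕ u ⊴ n ⇒ ⊢ bd ⊕ u ⊴ bu ⊕ d) (bd U) (# U) (# dual) (bd dual) n
            (#-∁ (U ⊞ H)) bd-dual))
        where
        bd-dual : bd dual + # U ≤ n
        bd-dual = #-disjoint (dual ⊞ H) U λ z hz hU → absurd z hU (⊞-elim dual H hz)
          where
          absurd : ∀ z → z ∈ U → (∃ λ x → ∃ λ h → x ∈ dual × h ∈ H × z ≡ x ∙ h) → ⊥
          absurd z hU (x , h , hx , hh , refl) = true≢false
            (subst (_∈ (U ⊞ H)) (x∙a∙a⁻¹ x h) (⊞-intro U H hU (H-sym h hh))) (not-elim hx)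
        dual-adm : Admissible dual
        dual-adm = linarith 4 (λ bu d m n → bu ⊕ d ≐ n ⇒ bu ⊕ m ⊴ n ⇒ ⊢ m ⊴ d) (bd U) (# dual) m n
            (#-∁ (U ⊞ H)) (proj₂ (proj₁ atom)) ,
          linarith 4 (λ b u m n → b ⊕ u ⊴ n ⇒ m ⊴ u ⇒ ⊢ b ⊕ m ⊴ n) (bd dual) (# U) m n bd-dual (proj₁ (proj₁ atom))

      -- Suppose I = U ∩ (U + a) were smaller than U. By submodularity the excesses |X + H| - |X| of
      -- I and of the union add up to at most twice that of U. The union is admissible, by
      -- `atom-small`, so its excess is not below that of U; then I attains the minimum with fewer
      -- elements than U.
      atom-∩ : ∀ a → m ≤ # (U ∩ (U ⊹ a)) → U ⊆ (U ⊹ a)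
      atom-∩ a m≤I x xU = proj₂ (∧-elim {U x} (⊆-#⇒⊇ I U (λ y → proj₁ ∘ ∧-elim {U y}) (≮⇒≥ absurd) x xU))
        where
        I V : FSet n
        I = U ∩ (U ⊹ a)
        V = U ∪ (U ⊹ a)
        bdI≤ : bd I ≤ bd U
        bdI≤ = #-mono (I ⊞ H) (U ⊞ H) (⊞-mono I U H λ y → proj₁ ∘ ∧-elim {U y})
        absurd : ¬ # I < # U
        absurd lt = <⇒≱ strictI (proj₁ (compare V V-adm) ≤⟩ card)
          where
          strictI : bd U + # I < bd I + # U
          strictI = ≰⇒> λ h → <⇒≱ lt (proj₂ (compare I
            (m≤I , ≤-trans (+-monoˡ-≤ m bdI≤) (proj₂ (proj₁ atom)))) h)
          sub : bd V + bd I ≤ bd U + bd U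
          sub = ≤-trans (submodular U (U ⊹ a)) (+-monoʳ-≤ (bd U) (#-⊞-⊹ U H a))
          cards : # V + # I ≡ # U + # U
          cards = trans (#-∪-∩ U (U ⊹ a)) (cong (# U +_) (#-⊹ U a))
          V-adm : Admissible V
          V-adm = ≤-trans (proj₁ (proj₁ atom)) (#-mono U V λ y → ∨-introˡ) ,
            linarith 8 (λ bj bi bu u i m n j → bj ⊕ bi ⊴ bu ⊕ bu ⇒ bu ⊕ i ⊲ bi ⊕ u ⇒ bu ⊕ u ⊴ n ⇒ m ⊴ i ⇒ ⊢ bj ⊕ m ⊴ n)
              (bd V) (bd I) (bd U) (# U) (# I) m n (# V) sub strictI atom-small m≤I
          _≤⟩_ : bd U + # V ≤ bd V + # U → (bd U + # V ≤ bd V + # U → bd I + # U ≤ bd U + # I) → bd I + # U ≤ bd U + # I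
          h ≤⟩ f = f h
          card : bd U + # V ≤ bd V + # U → bd I + # U ≤ bd U + # I
          card h = linarith 6 (λ bj bi bu u i j → bj ⊕ bi ⊴ bu ⊕ bu ⇒ bu ⊕ j ⊴ bj ⊕ u ⇒ j ⊕ i ≐ u ⊕ u ⇒ ⊢ bi ⊕ u ⊴ bu ⊕ i)
            (bd V) (bd I) (bd U) (# U) (# I) (# V) sub h cards

      -- Otherwise U is closed under a nonzero translation, hence the whole group, against |U + H| +
      -- m ≤ n.
      atom-∩< : ∀ a → ¬ a ≡ ε → # (U ∩ (U ⊹ a)) < m
      atom-∩< a a≢ε = ≰⇒> λ le → full le
        where
        full : m ≤ # (U ∩ (U ⊹ a)) → ⊥
        full le = contradict (#-pos⇒∃ U (≤-trans 0<m (proj₁ (proj₁ atom))))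
          where
          closed : ∀ x → x ∈ U → (x ∙ (a ⁻¹)) ∈ U
          closed = atom-∩ a le
          a⁻¹≢ε : ¬ (a ⁻¹) ≡ ε
          a⁻¹≢ε e = a≢ε (trans (sym (⁻¹-involutive a)) (trans (cong _⁻¹ e) ε⁻¹≈ε))
          contradict : (∃ λ x → x ∈ U) → ⊥
          contradict (x , xU) = <⇒≱ (≤-trans (+-monoʳ-< n 0<m) (≤-reflexive refl)) (≤-trans (+-monoˡ-≤ m n≤bd) (≤-trans (proj₂ (proj₁ atom)) (≤-reflexive (sym (+-identityʳ n)))))
            where
            n≤bd : n ≤ bd U
            n≤bd = ≤-trans (≤-reflexive (trans (sym (*-identityʳ n)) (sym (sum-const n 1))))
              (sum-mono λ y → ≤-reflexive (sym (cong 𝟙 (subst (_∈ (U ⊞ H)) (identityʳ y)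
                (⊞-intro U H (simple U (a ⁻¹) a⁻¹≢ε closed x y xU) ε∈H)))))

      bd-atom≤ : ∀ X → Admissible X → bd U + # X ≤ bd X + # U
      bd-atom≤ X a = proj₁ (compare X a)

  -- Cauchy–Davenport for a symmetric summand, from the atoms with m = 1.
  cauchy-davenport : ∀ H → Symmetric H → ε ∈ H → ∀ X → 0 < # X →
    ∀ c → c ≤ n → suc c ≤ # X + # H → c ≤ # (X ⊞ H)
  cauchy-davenport H H-sym ε∈H X 0<X c c≤n c≤ with # (X ⊞ H) + 1 ≤? n
  ... | no ≰ = ≤-trans c≤n (≤-pred (≤-trans (≰⇒> ≰) (≤-reflexive (+-comm _ 1))))
  ... | yes le = bound (atom-exists X (0<X , le))
    where
    open Atoms H H-sym ε∈H 1 (s≤s z≤n)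
    bound : ∃ IsAtom → c ≤ bd X
    bound (U , atom) = linarith 6 (λ c x h bx bu u → κ 1 ⊕ c ⊴ x ⊕ h ⇒ bu ⊕ x ⊴ bx ⊕ u ⇒ h ⊴ bu ⇒ u ⊴ κ 1 ⇒ ⊢ c ⊴ bx)
      c (# X) (# H) (bd X) (bd U) (# U) c≤ (bd-atom≤ atom X (0<X , le)) (h≤ (#-pos⇒∃ U (proj₁ (proj₁ atom)))) (≮⇒≥ two)
      where
      h≤ : (∃ λ u → u ∈ U) → # H ≤ bd U
      h≤ (u , uU) = ≤-trans (≤-reflexive (sym (#-⊹ H u))) (#-mono (H ⊹ u) (U ⊞ H)
        λ x hx → subst (_∈ (U ⊞ H)) (x∙[y∙x⁻¹] u x) (⊞-intro U H uU hx))
      two : ¬ 1 < # U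
      two 1<U = absurd (#-two⇒∃ U 1<U)
        where
        absurd : (∃ λ x → ∃ λ y → x ∈ U × y ∈ U × ¬ x ≡ y) → ⊥
        absurd (x , y , xU , yU , x≢y) = <⇒≱ (atom-∩< atom (x ∙ (y ⁻¹)) λ e → x≢y (∙⁻¹≡ε e))
          (∈⇒#-pos (U ∩ (U ⊹ (x ∙ (y ⁻¹)))) {x} (∧-intro xU
            (trans (cong U (trans (cong (x ∙_) (trans (⁻¹-∙ x (y ⁻¹)) (cong ((x ⁻¹) ∙_) (⁻¹-involutive y))))
              (trans (sym (assoc x (x ⁻¹) y)) (trans (cong (_∙ y) (inverseʳ x)) (identityˡ y))))) yU)))

  pow : FSet n → ℕ → FSet n
  pow G zero = ⁅ ε ⁆
  pow G (suc i) = pow G i ⊞ G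

  module _ (G : FSet n) (ε∈G : ε ∈ G) where

    ε∈pow : ∀ i → ε ∈ pow G i
    ε∈pow zero = ∈⁅⁆ ε
    ε∈pow (suc i) = subst (_∈ pow G (suc i)) (identityʳ ε) (⊞-intro (pow G i) G (ε∈pow i) ε∈G)

    pow-+ : ∀ i j {x y} → x ∈ pow G i → y ∈ pow G j → (x ∙ y) ∈ pow G (i + j)
    pow-+ i zero {x} {y} hx hy = subst₂ (λ z k → z ∈ pow G k) (trans (sym (identityʳ x)) (cong (x ∙_) (sym (∈⁅⁆⇒≡ hy)))) (sym (+-identityʳ i)) hx
    pow-+ i (suc j) {x} hx hy with ⊞-elim (pow G j) G hy
    ... | z , g , hz , hg , refl = subst₂ (λ w k → w ∈ pow G k) (assoc x z g) (sym (+-suc i j))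
      (⊞-intro (pow G (i + j)) G (pow-+ i j hx hz) hg)

    pow-mono : ∀ {i j} → i ≤ j → pow G i ⊆ pow G j
    pow-mono {i} {j} i≤j x hx = subst₂ (λ w k → w ∈ pow G k) (identityʳ x) (m+[n∸m]≡n i≤j)
      (pow-+ i (j ∸ i) hx (ε∈pow (j ∸ i)))

    out-pow : ∀ B v → (∀ x → x ∈ G → out B x ≤ v) → ∀ i x → x ∈ pow G i → out B x ≤ i * v
    out-pow B v h zero x hx = ≤-reflexive (trans (cong (out B) (∈⁅⁆⇒≡ hx)) (out-ε B))
    out-pow B v h (suc i) x hx with ⊞-elim (pow G i) G hx
    ... | y , g , hy , hg , refl = ≤-trans (out-∙ B y g) (≤-trans (+-mono-≤ (out-pow B v h i y hy) (h g hg))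
      (≤-reflexive (+-comm (i * v) v)))

    module _ (G-sym : Symmetric G) where

      pow-sym : ∀ i → Symmetric (pow G i)
      pow-sym zero x hx = trans (cong ⁅ ε ⁆ (trans (cong _⁻¹ (∈⁅⁆⇒≡ hx)) ε⁻¹≈ε)) (∈⁅⁆ ε)
      pow-sym (suc i) x hx with ⊞-elim (pow G i) G hx
      ... | y , g , hy , hg , refl = subst (_∈ pow G (suc i)) (⁻¹-∙-comm y g) (⊞-intro (pow G i) G (pow-sym i y hy) (G-sym g hg))

      -- Iterated Cauchy-Davenport; the minimum of n and 1 + ig is expressed by an arbitrary c below
      -- both.
      pow-# : ∀ {g} → suc g ≤ # G → ∀ i c → c ≤ n → c ≤ suc (i * g) → c ≤ # (pow G i)
      pow-# hg zero c _ c≤ = ≤-trans c≤ (≤-reflexive (sym (#-⁅⁆ ε)))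
      pow-# {g} hg (suc i) c c≤n c≤ = cauchy-davenport G G-sym ε∈G (pow G i)
        (∈⇒#-pos (pow G i) (ε∈pow i)) c c≤n
        (≤-trans (s≤s (m≤n+m∸n c g)) (linarith 4 (λ d g p G → d ⊴ p ⇒ κ 1 ⊕ g ⊴ G ⇒ ⊢ κ 1 ⊕ (g ⊕ d) ⊴ p ⊕ G) (c ∸ g) g (# (pow G i)) (# G)
          (pow-# hg i (c ∸ g) (≤-trans (m∸n≤m c g) c≤n) (≤-trans (∸-monoˡ-≤ g c≤)
            (≤-reflexive (trans (cong (_∸ g) (sym (+-suc g (i * g)))) (m+n∸m≡n g (suc (i * g))))))) hg))

  sum-sumTo : ∀ Q (f : Fin n → ℕ → ℕ) → sum (λ x → sumTo Q (f x)) ≡ sumTo Q (λ i → sum (λ x → f x i))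
  sum-sumTo zero f = trans (sum-const n 0) (*-zeroʳ n)
  sum-sumTo (suc Q) f = trans (∑-distrib-+ (λ x → sumTo Q (f x)) (λ x → f x Q)) (cong (_+ sum (λ x → f x Q)) (sum-sumTo Q f))

  module _ (B G : FSet n) (ε∈G : ε ∈ G) (v : ℕ) (small : ∀ x → x ∈ G → out B x ≤ v) where

    private
      count : ℕ → Fin n → ℕ
      count Q x = sumTo Q (λ i → 𝟙 (pow G i x))

    -- If j is the first index with x ∈ jG, then `out B x` ≤ jv while `count Q x` is at most Q - j.
    -- The second alternative is that no such j lies below Q.
    count-out : ∀ Q x → (v * count Q x + out B x ≤ Q * v) ⊎ (count Q x ≡ 0)
    count-out zero x = inj₂ refl
    count-out (suc Q) x with count-out Q x | ∈? (pow G Q) x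
    ... | inj₁ h | inj₁ e rewrite e = inj₁ (linarith 5 (λ v c o q vc → v ⊗ c ⊕ o ⊴ q ⇒ ⊢ v ⊗ (c ⊕ κ 1) ⊕ o ⊴ v ⊕ q) v (count Q x) (out B x) (Q * v) 0 h)
    ... | inj₁ h | inj₂ e rewrite e = inj₁ (linarith 4 (λ v c o q → v ⊗ c ⊕ o ⊴ q ⇒ ⊢ v ⊗ (c ⊕ κ 0) ⊕ o ⊴ v ⊕ q) v (count Q x) (out B x) (Q * v) h)
    ... | inj₂ h | inj₂ e rewrite e = inj₂ (trans (+-identityʳ _) h)
    ... | inj₂ h | inj₁ e rewrite e | h = inj₁ (linarith 3 (λ v o q → o ⊴ q ⇒ ⊢ v ⊗ κ 1 ⊕ o ⊴ v ⊕ q) v (out B x) (Q * v)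
      (out-pow G ε∈G B v small Q x e))

    sum-pow : ∀ Q → Q * v ≤ # B → v * sumTo Q (λ i → # (pow G i)) ≤ # B * # B
    sum-pow Q le = ≤-trans (≤-reflexive (trans (cong (v *_) (sym (sum-sumTo Q (λ x i → 𝟙 (pow G i x)))))
      (sym (sum-*ˡ v (count Q))))) (≤-trans (sum-mono stay≥) (≤-reflexive (sum-stay B)))
      where
      stay≥ : ∀ x → v * count Q x ≤ stay B x
      stay≥ x with count-out Q x
      ... | inj₁ h = linarith 5 (λ c o q b s → c ⊕ o ⊴ q ⇒ q ⊴ b ⇒ s ⊕ o ≐ b ⇒ ⊢ c ⊴ s) (v * count Q x) (out B x) (Q * v) (# B) (stay B x)
        h le (stay+out B x)
      ... | inj₂ h rewrite h = ≤-trans (≤-reflexive (*-zeroʳ v)) z≤n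

  -- The arithmetic series: twice the sum of j over [h, h + Q) is 2hQ + Q² - Q, with the subtracted
  -- term moved across.
  sumTo-linear : ∀ h w Q (f : ℕ → ℕ) → (∀ i → i < Q → suc (w * (h + i)) ≤ f (h + i)) →
    2 * sumTo h f + 2 * Q + w * (2 * h * Q + Q * Q) ≤ 2 * sumTo (h + Q) f + w * Q
  sumTo-linear h w zero f _ = linarith 4 (λ s t h w → s ≐ t ⇒ ⊢ κ 2 ⊗ s ⊕ κ 0 ⊕ w ⊗ (κ 2 ⊗ h ⊗ κ 0 ⊕ κ 0) ⊴ κ 2 ⊗ t ⊕ w ⊗ κ 0)
    (sumTo h f) (sumTo (h + 0) f) h w (cong (λ k → sumTo k f) (sym (+-identityʳ h)))
  sumTo-linear h w (suc Q) f lb rewrite +-suc h Q = linarith 6 (λ s h w q t x →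
    κ 2 ⊗ s ⊕ κ 2 ⊗ q ⊕ w ⊗ (κ 2 ⊗ h ⊗ q ⊕ q ⊗ q) ⊴ κ 2 ⊗ t ⊕ w ⊗ q ⇒ κ 1 ⊕ w ⊗ (h ⊕ q) ⊴ x ⇒
    ⊢ κ 2 ⊗ s ⊕ κ 2 ⊗ (κ 1 ⊕ q) ⊕ w ⊗ (κ 2 ⊗ h ⊗ (κ 1 ⊕ q) ⊕ (κ 1 ⊕ q) ⊗ (κ 1 ⊕ q)) ⊴ κ 2 ⊗ (t ⊕ x) ⊕ w ⊗ (κ 1 ⊕ q))
    (sumTo h f) h w Q (sumTo (h + Q) f) (f (h + Q))
    (sumTo-linear h w Q f (λ i lt → lb i (m<n⇒m<1+n lt))) (lb Q ≤-refl)

  module _ (B G : FSet n) (ε∈G : ε ∈ G) (G-sym : Symmetric G) (v : ℕ) (0<v : 0 < v)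
    (small : ∀ x → x ∈ G → out B x ≤ v) (2B≤n : 2 * # B ≤ n) where

    private
      -- `sum-pow` for 2(h + 1) summands: growth by 2v per step already exhausts |B|²/v up to lower
      -- order, so the additional e(h + 1)²/2 must fit into the error. The surplus e is used only
      -- for i ≤ h, where 1 + (2v + e)i stays below n because e ≤ 2v and 4(h + 1)v ≤ 2|B| ≤ n;
      -- further on only 2v per step is safe.
      width-core : ∀ h e → 2 * suc h * v ≤ # B → # B ≤ 2 * (2 + h) * v → e ≤ 2 * v → suc (2 * v + e) ≤ # G → e * h ≤ 28 * v
      width-core h e lo hi e≤ hg = *-cancelʳ-≤ (e * h) (28 * v) (suc h)
        (linarith 6 (λ S S′ v h e z →
          κ 2 ⊗ κ 0 ⊕ κ 2 ⊗ (κ 1 ⊕ h) ⊕ (κ 2 ⊗ v ⊕ e) ⊗ (κ 2 ⊗ κ 0 ⊗ (κ 1 ⊕ h) ⊕ (κ 1 ⊕ h) ⊗ (κ 1 ⊕ h)) ⊴ κ 2 ⊗ S ⊕ (κ 2 ⊗ v ⊕ e) ⊗ (κ 1 ⊕ h) ⇒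
          κ 2 ⊗ S ⊕ κ 2 ⊗ (κ 1 ⊕ h) ⊕ κ 2 ⊗ v ⊗ (κ 2 ⊗ (κ 1 ⊕ h) ⊗ (κ 1 ⊕ h) ⊕ (κ 1 ⊕ h) ⊗ (κ 1 ⊕ h)) ⊴ κ 2 ⊗ S′ ⊕ κ 2 ⊗ v ⊗ (κ 1 ⊕ h) ⇒
          S′ ⊴ κ 4 ⊗ (κ 2 ⊕ h) ⊗ (κ 2 ⊕ h) ⊗ v ⇒
          ⊢ e ⊗ h ⊗ (κ 1 ⊕ h) ⊴ κ 28 ⊗ v ⊗ (κ 1 ⊕ h))
          (sumTo (suc h) c) (sumTo (suc h + suc h) c) v h e 0
          (sumTo-linear 0 (2 * v + e) (suc h) c first)
          (sumTo-linear (suc h) (2 * v) (suc h) c second)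
          (*-cancelˡ-≤ v {{>-nonZero 0<v}} (≤-trans (sum-pow B G ε∈G v small (suc h + suc h)
              (≤-trans (≤-reflexive (lem h v)) lo))
            (≤-trans (*-mono-≤ hi hi) (linarith 2 (λ h v → ⊢ (κ 2 ⊗ (κ 2 ⊕ h) ⊗ v) ⊗ (κ 2 ⊗ (κ 2 ⊕ h) ⊗ v) ⊴ v ⊗ (κ 4 ⊗ (κ 2 ⊕ h) ⊗ (κ 2 ⊕ h) ⊗ v)) h v)))))
        where
        c : ℕ → ℕ
        c i = # (pow G i)
        lem : ∀ h v → (suc h + suc h) * v ≡ 2 * suc h * v
        lem = linarith 2 λ h v → ⊢ (κ 1 ⊕ h ⊕ (κ 1 ⊕ h)) ⊗ v ≐ κ 2 ⊗ (κ 1 ⊕ h) ⊗ v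
        first : ∀ i → i < suc h → suc ((2 * v + e) * i) ≤ c i
        first i (s≤s i≤h) = pow-# G ε∈G G-sym hg i _
          (linarith 8 (λ v e i h b n ei vi → b ⊴ n ⇒ κ 2 ⊗ (κ 2 ⊗ (κ 1 ⊕ h) ⊗ v) ⊴ b ⇒ ei ⊴ vi ⊗ κ 2 ⇒ vi ⊴ v ⊗ h ⇒ κ 1 ⊴ v ⇒ ei ≐ e ⊗ i ⇒ vi ≐ v ⊗ i ⇒
              ⊢ κ 1 ⊕ (κ 2 ⊗ v ⊕ e) ⊗ i ⊴ n)
            v e i h (2 * # B) n (e * i) (v * i) 2B≤n (*-monoʳ-≤ 2 lo) (≤-trans (*-monoˡ-≤ i e≤) (≤-reflexive (l2 v i))) (*-monoʳ-≤ v i≤h) 0<v refl refl)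
          (s≤s (≤-reflexive (*-comm (2 * v + e) i)))
          where
          l2 : ∀ v i → 2 * v * i ≡ v * i * 2
          l2 = linarith 2 λ v i → ⊢ κ 2 ⊗ v ⊗ i ≐ v ⊗ i ⊗ κ 2
        second : ∀ i → i < suc h → suc (2 * v * (suc h + i)) ≤ c (suc h + i)
        second i (s≤s i≤h) = pow-# G ε∈G G-sym hg (suc h + i) _
          (linarith 5 (λ v i h b n → b ⊴ n ⇒ κ 2 ⊗ (κ 2 ⊗ (κ 1 ⊕ h) ⊗ v) ⊴ b ⇒ v ⊗ i ⊴ v ⊗ h ⇒ κ 1 ⊴ v ⇒ ⊢ κ 1 ⊕ κ 2 ⊗ v ⊗ (κ 1 ⊕ h ⊕ i) ⊴ n)
            v i h (2 * # B) n 2B≤n (*-monoʳ-≤ 2 lo) (*-monoʳ-≤ v i≤h) 0<v)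
          (linarith 4 (λ v e h i → ⊢ κ 1 ⊕ κ 2 ⊗ v ⊗ (κ 1 ⊕ h ⊕ i) ⊴ κ 1 ⊕ (κ 1 ⊕ h ⊕ i) ⊗ (κ 2 ⊗ v ⊕ e)) v e h i)

    -- With r(x) = |B ∩ (B - x)| one has Σ r(x) = |B|², while r ≥ |B| - iv on the
    -- i-fold sumset of G, which has at least 1 + i(|G| - 1) elements.
    width : ∀ g h → 15 ≤ h → 2 * suc h * v ≤ # B → suc g ≤ # G → g * h ≤ 2 * v * h + 28 * v
    width g h 15≤h lo hg = split (≤-total g (2 * v)) (division (# B) (2 * v) (≤-trans 0<v (m≤m+n v _)))
      where
      module _ (e q : ℕ) (ge : 2 * v + e ≡ g) (q≤ : q * (2 * v) ≤ # B) (q> : # B < suc q * (2 * v)) where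
        h<q : suc h ≤ q
        h<q = ≮⇒≥ λ lt → linarith 4 (λ b h v q → κ 2 ⊗ (κ 1 ⊕ h) ⊗ v ⊴ b ⇒ b ⊲ (κ 1 ⊕ q) ⊗ (κ 2 ⊗ v) ⇒ q ⊗ v ⊴ h ⊗ v ⇒ ⊢⊥)
          (# B) h v q lo q> (*-monoˡ-≤ v (≤-pred lt))
        -- The precision h is raised to the value fitted to |B|, so that both bounds on |B| in
        -- `width-core` hold; a smaller h only weakens the conclusion.
        core : ∀ q → q * (2 * v) ≤ # B → # B < suc q * (2 * v) → suc h ≤ q → ∀ e′ → e′ ≤ e → e′ ≤ 2 * v → e′ * h ≤ 28 * v
        core (suc q) q≤ q> (s≤s h≤q) e′ e′≤e e′≤ = ≤-trans (*-monoʳ-≤ e′ h≤q)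
          (width-core q e′
            (linarith 3 (λ q v b → (κ 1 ⊕ q) ⊗ (κ 2 ⊗ v) ⊴ b ⇒ ⊢ κ 2 ⊗ (κ 1 ⊕ q) ⊗ v ⊴ b) q v (# B) q≤)
            (linarith 3 (λ q v b → b ⊲ (κ 2 ⊕ q) ⊗ (κ 2 ⊗ v) ⇒ ⊢ b ⊴ κ 2 ⊗ (κ 2 ⊕ q) ⊗ v) q v (# B) q>)
            e′≤ (≤-trans (s≤s (≤-trans (+-monoʳ-≤ (2 * v) e′≤e) (≤-reflexive ge))) hg))
        done : (e ≤ 2 * v) ⊎ (2 * v ≤ e) → g * h ≤ 2 * v * h + 28 * v
        done (inj₁ e≤) = subst (λ z → z * h ≤ 2 * v * h + 28 * v) ge
          (linarith 3 (λ v e h → e ⊗ h ⊴ κ 28 ⊗ v ⇒ ⊢ (κ 2 ⊗ v ⊕ e) ⊗ h ⊴ κ 2 ⊗ v ⊗ h ⊕ κ 28 ⊗ v)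
            v e h (core q q≤ q> h<q e ≤-refl e≤))
        -- A surplus above 2v is cut down to 2v; then 2vh ≤ 28v, that is h ≤ 14. Hence the
        -- requirement 15 ≤ h.
        done (inj₂ ≤e) = ⊥-elim (linarith 3 (λ v h w → κ 2 ⊗ v ⊗ h ⊴ κ 28 ⊗ v ⇒ κ 15 ⊗ v ⊴ h ⊗ v ⇒ κ 1 ⊴ v ⇒ ⊢⊥)
          v h 0 (core q q≤ q> h<q (2 * v) ≤e ≤-refl) (*-monoˡ-≤ v 15≤h) 0<v)
      split : (g ≤ 2 * v) ⊎ (2 * v ≤ g) → (∃ λ q → q * (2 * v) ≤ # B × # B < suc q * (2 * v)) → g * h ≤ 2 * v * h + 28 * v
      split (inj₁ g≤) _ = ≤-trans (*-monoˡ-≤ h g≤) (m≤m+n _ _)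
      split (inj₂ 2v≤g) (q , q≤ , q>) = done _ q (m+[n∸m]≡n 2v≤g) q≤ q> (≤-total _ (2 * v))

-- Greedy extraction of subset sums from a zero-free set.

module GreedyExtraction (n : ℕ) (_∙_ : Fin n → Fin n → Fin n) (ε : Fin n) (_⁻¹ : Fin n → Fin n)
  (isAbelianGroup : IsAbelianGroup _≡_ _∙_ ε _⁻¹)
  (simple : ∀ (X : FiniteSets.FSet n) a → ¬ a ≡ ε → (∀ x → X x ≡ true → X (x ∙ a) ≡ true) → ∀ x y → X x ≡ true → X y ≡ true)
  (odd : ∀ x → (x ∙ x) ≡ ε → x ≡ ε) where

  open FiniteSets

  open LinearArithmetic
  open Isoperimetry n _∙_ ε _⁻¹ isAbelianGroup simple

  ∖-intro : ∀ (X : FSet n) {x y} → x ∈ X → ¬ x ≡ y → x ∈ (X ∖ ⁅ y ⁆)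
  ∖-intro X hx ne = ∧-intro hx (not-true (∉⁅⁆ ne))

  ∖-elim : ∀ (X : FSet n) {x y} → x ∈ (X ∖ ⁅ y ⁆) → x ∈ X × ¬ x ≡ y
  ∖-elim X {x} h = proj₁ (∧-elim {X x} h) , λ { refl → true≢false (∈⁅⁆ x) (not-elim (proj₂ (∧-elim {X x} h))) }

  data SubSum : FSet n → Fin n → Set where
    empty : ∀ {R} → SubSum R ε
    add : ∀ {R} y x → y ∈ R → SubSum (R ∖ ⁅ y ⁆) x → SubSum R (x ∙ y)

  ZeroSumFree : FSet n → Set
  ZeroSumFree A = ∀ y x → y ∈ A → SubSum (A ∖ ⁅ y ⁆) x → ¬ (x ∙ y) ≡ ε

  SubSum-mono : ∀ {P Q x} → P ⊆ Q → SubSum P x → SubSum Q x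
  SubSum-mono s empty = empty
  SubSum-mono {P} {Q} s (add y x hy d) = add y x (s y hy)
    (SubSum-mono (λ z hz → ∖-intro Q (s z (proj₁ (∖-elim P hz))) (proj₂ (∖-elim P hz))) d)

  SubSum-∪ : ∀ {P Q A b c} → SubSum P b → SubSum Q c → P ⊆ A → Q ⊆ A → (∀ x → x ∈ P → x ∈ Q → ⊥) → SubSum A (b ∙ c)
  SubSum-∪ {c = c} empty d _ sQ _ = subst (SubSum _) (sym (identityˡ c)) (SubSum-mono sQ d)
  SubSum-∪ {P} {Q} {A} {c = c} (add y x hy d′) d sP sQ dis = subst (SubSum A) (∙-swap x c y)
    (add y (x ∙ c) (sP y hy) (SubSum-∪ d′ d
      (λ z hz → ∖-intro A (sP z (proj₁ (∖-elim P hz))) (proj₂ (∖-elim P hz)))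
      (λ z hz → ∖-intro A (sQ z hz) (λ { refl → dis z hy hz }))
      (λ z hz → dis z (proj₁ (∖-elim P hz)))))

  no-zero-sum : ∀ {A P Q b c} → ZeroSumFree A → SubSum P b → SubSum Q c → P ⊆ A → Q ⊆ A →
    (∀ x → x ∈ P → x ∈ Q → ⊥) → b ∙ c ≡ ε → b ≡ ε
  no-zero-sum zf empty _ _ _ _ _ = refl
  no-zero-sum {A} {P} {Q} {c = c} zf (add y x hy d′) d sP sQ dis e = ⊥-elim (zf y (x ∙ c) (sP y hy)
    (SubSum-∪ d′ d
      (λ z hz → ∖-intro A (sP z (proj₁ (∖-elim P hz))) (proj₂ (∖-elim P hz)))
      (λ z hz → ∖-intro A (sQ z hz) (λ { refl → dis z hy hz }))
      (λ z hz → dis z (proj₁ (∖-elim P hz))))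
    (trans (∙-swap x c y) e))

  _⁻¹ˢ : FSet n → FSet n
  (X ⁻¹ˢ) x = X (x ⁻¹)

  #-⁻¹ˢ : ∀ X → # (X ⁻¹ˢ) ≡ # X
  #-⁻¹ˢ X = sum-bij (𝟙 ∘ X) _⁻¹ _⁻¹ ⁻¹-involutive ⁻¹-involutive

  -- B and -C meet only in the identity: any other common element would give a vanishing sum over
  -- two disjoint parts of A.
  complementary-sums : ∀ {A R B C} → ZeroSumFree A → R ⊆ A → ε ∈ C →
    (∀ x → x ∈ B → SubSum (A ∖ R) x) → (∀ x → x ∈ C → SubSum R x) → # B + # C ≤ suc n
  complementary-sums {A} {R} {B} {C} zf R⊆A ε∈C hB hC = linarith 5 (λ b c c′ d n → b ⊕ d ⊴ n ⇒ c′ ≐ κ 1 ⊕ d ⇒ c′ ≐ c ⇒ ⊢ b ⊕ c ⊴ κ 1 ⊕ n)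
    (# B) (# C) (# (C ⁻¹ˢ)) (# ((C ⁻¹ˢ) ∖ ⁅ ε ⁆)) n
    (#-disjoint B ((C ⁻¹ˢ) ∖ ⁅ ε ⁆) λ x xB xC → proj₂ (∖-elim (C ⁻¹ˢ) xC)
      (no-zero-sum zf (hB x xB) (hC (x ⁻¹) (proj₁ (∖-elim (C ⁻¹ˢ) xC))) (λ z → proj₁ ∘ ∧-elim {A z}) R⊆A
        (λ z h₁ h₂ → true≢false h₂ (not-elim (proj₂ (∧-elim {A z} h₁)))) (inverseʳ x)))
    (#-remove (C ⁻¹ˢ) (trans (cong C ε⁻¹≈ε) ε∈C)) (#-⁻¹ˢ C)

  Antisymmetric : FSet n → Set
  Antisymmetric R = ∀ x → x ∈ R → (x ⁻¹) ∈ R → ⊥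

  Antisymmetric-mono : ∀ {P Q} → P ⊆ Q → Antisymmetric Q → Antisymmetric P
  Antisymmetric-mono s a x hx hx′ = a x (s x hx) (s (x ⁻¹) hx′)

  ε∉ : ∀ {R} → Antisymmetric R → ∀ x → x ∈ R → ¬ x ≡ ε
  ε∉ {R} a x hx refl = a x hx (trans (cong R ε⁻¹≈ε) hx)

  zeroSumFree⇒antisymmetric : ∀ {A} → ZeroSumFree A → Antisymmetric A
  zeroSumFree⇒antisymmetric {A} zf x hx hx′ with (x ⁻¹) Fin.≟ x
  ... | yes e = zf x ε hx empty (trans (identityˡ x) (odd x (trans (cong (x ∙_) (sym e)) (inverseʳ x))))
  ... | no ne = zf x (ε ∙ (x ⁻¹)) hx (add (x ⁻¹) ε (∖-intro A hx′ ne) empty) (trans (cong (_∙ x) (identityˡ _)) (inverseˡ x))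

  module Hull (R : FSet n) (anti : Antisymmetric R) where

    H : FSet n
    H = ⁅ ε ⁆ ∪ (R ∪ (R ⁻¹ˢ))

    ε∈H : ε ∈ H
    ε∈H = ∨-introˡ (∈⁅⁆ ε)

    R⊆H : R ⊆ H
    R⊆H x hx = ∨-introʳ {⁅ ε ⁆ x} (∨-introˡ hx)

    H-elim : ∀ {P : Fin n → Set} → P ε → (∀ x → x ∈ R → P x) → (∀ x → x ∈ R → P (x ⁻¹)) → ∀ x → x ∈ H → P x
    H-elim {P} pε pos neg x hx with ∨-elim {⁅ ε ⁆ x} hx
    ... | inj₁ e = subst P (sym (∈⁅⁆⇒≡ e)) pε
    ... | inj₂ h with ∨-elim {R x} h
    ... | inj₁ p = pos x p
    ... | inj₂ p = subst P (⁻¹-involutive x) (neg (x ⁻¹) p)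

    H-sym : Symmetric H
    H-sym = H-elim {λ x → (x ⁻¹) ∈ H} (trans (cong H ε⁻¹≈ε) ε∈H)
      (λ x hx → ∨-introʳ {⁅ ε ⁆ (x ⁻¹)} (∨-introʳ {R (x ⁻¹)} (trans (cong R (⁻¹-involutive x)) hx)))
      (λ x hx → trans (cong H (⁻¹-involutive x)) (R⊆H x hx))

    #-H : # H ≡ suc (2 * # R)
    #-H = linarith 6 (λ H R U ε i j → H ⊕ i ≐ ε ⊕ U ⇒ U ⊕ j ≐ R ⊕ R ⇒ ε ≐ κ 1 ⇒ i ≐ κ 0 ⇒ j ≐ κ 0 ⇒ ⊢ H ≐ κ 1 ⊕ κ 2 ⊗ R)
      (# H) (# R) (# (R ∪ (R ⁻¹ˢ))) (# ⁅ ε ⁆) (# (⁅ ε ⁆ ∩ (R ∪ (R ⁻¹ˢ)))) (# (R ∩ (R ⁻¹ˢ)))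
      (#-∪-∩ ⁅ ε ⁆ (R ∪ (R ⁻¹ˢ))) (trans (#-∪-∩ R (R ⁻¹ˢ)) (cong (# R +_) (#-⁻¹ˢ R))) (#-⁅⁆ ε)
      (none (⁅ ε ⁆ ∩ (R ∪ (R ⁻¹ˢ))) λ x hx → e∉ x (∈⁅⁆⇒≡ (proj₁ (∧-elim {⁅ ε ⁆ x} hx))) (∨-elim {R x} (proj₂ (∧-elim {⁅ ε ⁆ x} hx))))
      (none (R ∩ (R ⁻¹ˢ)) λ x hx → anti x (proj₁ (∧-elim {R x} hx)) (proj₂ (∧-elim {R x} hx)))
      where
      none : ∀ X → (∀ x → x ∈ X → ⊥) → # X ≡ 0
      none X h = n≤0⇒n≡0 (≮⇒≥ λ p → h _ (proj₂ (#-pos⇒∃ X p)))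
      e∉ : ∀ x → x ≡ ε → (x ∈ R) ⊎ (x ∈ (R ⁻¹ˢ)) → ⊥
      e∉ x e (inj₁ h) = ε∉ {R} anti x h e
      e∉ x e (inj₂ h) = ε∉ {R} anti (x ⁻¹) h (trans (cong _⁻¹ e) ε⁻¹≈ε)

    out-H : ∀ B v → (∀ x → x ∈ R → out B x ≤ v) → ∀ x → x ∈ H → out B x ≤ v
    out-H B v h = H-elim {λ x → out B x ≤ v} (≤-trans (≤-reflexive (out-ε B)) z≤n) h
      (λ x hx → ≤-trans (≤-reflexive (out-⁻¹ B x)) (h x hx))

  large-out? : ∀ R B v → (∃ λ x → x ∈ R × v < out B x) ⊎ (∀ x → x ∈ R → out B x ≤ v)
  large-out? R B v with Fin.any? (λ x → (R x Bool.≟ true) ×-dec (v <? out B x))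
  ... | yes h = inj₁ h
  ... | no ∄ = inj₂ λ x hx → ≮⇒≥ λ lt → ∄ (x , hx , lt)

  -- If no shift by R gained more than v, `width` for the hull of R, which has 1 + 2|R| elements,
  -- would bound 2|R|. It is applied to B or to its complement, whichever has at most n/2 elements.
  grow : ∀ R → Antisymmetric R → ∀ B h v → 15 ≤ h → 0 < v → 2 * suc h * v ≤ # B → 2 * suc h * v + # B ≤ n →
    2 * v * h + 28 * v < 2 * # R * h → ∃ λ x → x ∈ R × v < out B x
  grow R anti B h v 15≤h 0<v lo hi lt with large-out? R B v
  ... | inj₁ found = found
  ... | inj₂ all = ⊥-elim (<⇒≱ lt (half (≤-total (# B) (# (∁ B)))))
    where
    open Hull R anti
    apply : ∀ X → (∀ x → x ∈ R → out X x ≤ v) → 2 * # X ≤ n → 2 * suc h * v ≤ # X → 2 * # R * h ≤ 2 * v * h + 28 * v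
    apply X small 2X≤n lo = width X H ε∈H H-sym v 0<v (out-H X v small) 2X≤n (2 * # R) h 15≤h lo (≤-reflexive (sym #-H))
    half : (# B ≤ # (∁ B)) ⊎ (# (∁ B) ≤ # B) → 2 * # R * h ≤ 2 * v * h + 28 * v
    half (inj₁ le) = apply B all (linarith 3 (λ b c n → b ⊕ c ≐ n ⇒ b ⊴ c ⇒ ⊢ κ 2 ⊗ b ⊴ n) (# B) (# (∁ B)) n (#-∁ B) le) lo
    half (inj₂ le) = apply (∁ B) (λ x hx → ≤-trans (≤-reflexive (out-∁ B x)) (all x hx))
      (linarith 3 (λ b c n → b ⊕ c ≐ n ⇒ c ⊴ b ⇒ ⊢ κ 2 ⊗ c ⊴ n) (# B) (# (∁ B)) n (#-∁ B) le)
      (linarith 4 (λ b c n m → b ⊕ c ≐ n ⇒ m ⊕ b ⊴ n ⇒ ⊢ m ⊴ c) (# B) (# (∁ B)) n (2 * suc h * v) (#-∁ B) hi)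

  record Stage (A : FSet n) (s : ℕ) : Set where
    field
      R B : FSet n
      R⊆A : R ⊆ A
      #R : # R ≡ s
      ε∈B : ε ∈ B
      sums : ∀ x → x ∈ B → SubSum (A ∖ R) x

  open Stage public

  start : ∀ A → Stage A (# A)
  start A = record { R = A ; B = ⁅ ε ⁆ ; R⊆A = λ x h → h ; #R = refl ; ε∈B = ∈⁅⁆ ε
    ; sums = λ x h → subst (SubSum _) (sym (∈⁅⁆⇒≡ h)) empty }

  step : ∀ {A s} (st : Stage A (suc s)) y → y ∈ R st → ∃ λ (st′ : Stage A s) → # (B st′) ≡ # (B st) + out (B st) y
  step {A} {s} st y hy = record { R = R′ ; B = B st ∪ (B st ⊹ y) ; R⊆A = λ x h → R⊆A st x (proj₁ (∖-elim (R st) h))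
    ; #R = suc-injective (trans (sym (#-remove (R st) hy)) (#R st)) ; ε∈B = ∨-introˡ (ε∈B st) ; sums = sums′ } , #-∪-⊹ (B st) y
    where
    R′ : FSet n
    R′ = R st ∖ ⁅ y ⁆
    out-of : ∀ {x} → x ∈ (A ∖ R st) → x ∈ A × x ∉ R st
    out-of {x} h = proj₁ (∧-elim {A x} h) , not-elim (proj₂ (∧-elim {A x} h))
    into : ∀ {x} → x ∈ A → x ∉ R st → x ∈ (A ∖ R′)
    into {x} hA hR = ∧-intro hA (not-true (¬true⇒false λ h → true≢false (proj₁ (∖-elim (R st) h)) hR))
    sums′ : ∀ x → x ∈ (B st ∪ (B st ⊹ y)) → SubSum (A ∖ R′) x
    sums′ x h with ∨-elim {B st x} h
    ... | inj₁ p = SubSum-mono (λ z hz → into (proj₁ (out-of hz)) (proj₂ (out-of hz))) (sums st x p)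
    ... | inj₂ p = subst (SubSum (A ∖ R′)) (x∙a⁻¹∙a x y) (add y (x ∙ (y ⁻¹))
      (∧-intro (R⊆A st y hy) (not-true (¬true⇒false λ h′ → proj₂ (∖-elim (R st) h′) refl)))
      (SubSum-mono (λ z hz → ∖-intro (A ∖ R′) (into (proj₁ (out-of hz)) (proj₂ (out-of hz)))
        (λ { refl → true≢false hy (proj₂ (out-of hz)) })) (sums st (x ∙ (y ⁻¹)) p)))

  loop : ∀ {A} (I : ℕ → ℕ → Set) (Exit : Set) lo →
    (∀ s → lo ≤ s → (st : Stage A (suc s)) → I (suc s) (# (B st)) →
      Exit ⊎ ∃ λ x → x ∈ R st × I s (# (B st) + out (B st) x)) →
    ∀ u (st : Stage A (u + lo)) → I (u + lo) (# (B st)) → Exit ⊎ ∃ λ (st′ : Stage A lo) → I lo (# (B st′))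
  loop I Exit lo oracle zero st inv = inj₂ (st , inv)
  loop I Exit lo oracle (suc u) st inv = continue (oracle (u + lo) (m≤n+m lo u) st inv)
    where
    continue : Exit ⊎ (∃ λ x → x ∈ R st × I (u + lo) (# (B st) + out (B st) x)) → _
    continue (inj₁ e) = inj₁ e
    continue (inj₂ (x , hx , inv′)) = loop I Exit lo oracle u (proj₁ (step st x hx))
      (subst (I (u + lo)) (sym (proj₂ (step st x hx))) inv′)

  ∃-of-size : ∀ (X : FSet n) {s} → # X ≡ suc s → ∃ λ x → x ∈ X
  ∃-of-size X e = #-pos⇒∃ X (≤-trans (s≤s z≤n) (≤-reflexive (sym e)))

  out-pos : ∀ B x → ε ∈ B → ¬ x ≡ ε → # B < n → 0 < out B x
  out-pos B x ε∈B x≢ε lt = ≰⇒> λ le → <⇒≱ lt (full (closed (n≤0⇒n≡0 le)))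
    where
    closed : out B x ≡ 0 → ∀ y → y ∈ B → (y ∙ x) ∈ B
    closed e y hy with ∈? B (y ∙ x)
    ... | inj₁ h = h
    ... | inj₂ h = ⊥-elim (<⇒≱ (∈⇒#-pos (λ z → B z ∧ not (B (z ∙ x))) {y} (∧-intro hy (not-true h))) (≤-reflexive e))
    full : (∀ y → y ∈ B → (y ∙ x) ∈ B) → n ≤ # B
    full c = ≤-trans (≤-reflexive (trans (sym (*-identityʳ n)) (sym (sum-const n 1))))
      (sum-mono λ y → ≤-reflexive (sym (cong 𝟙 (simple B x x≢ε c ε y ε∈B))))

  module Run (k γ q N h : ℕ) (q≡ : q ≡ 32 * γ) (N≡ : N ≡ q * γ) (0<γ : 0 < γ) (15≤h : 15 ≤ h) (14k≤hq : 14 * k ≤ h * q)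
    (N-large : 2 * suc h * k ≤ N) where

    1≤q : 1 ≤ q
    1≤q = ≤-trans 0<γ (≤-trans (m≤n*m γ 32) (≤-reflexive (sym q≡)))

    q≤N : q ≤ N
    q≤N = ≤-trans (m≤m*n q γ {{>-nonZero 0<γ}}) (≤-reflexive (sym N≡))

    module _ (A : FSet n) (anti : Antisymmetric A) (A≤k : # A ≤ k) where

      -- So close to the full group `grow` no longer applies. Reaching this point leaves the loops,
      -- and counting the sums of a disjoint part of A always refutes it in the end.
      Cap : ℕ → Set
      Cap lo = ∃ λ s → lo ≤ s × (∃ λ (st : Stage A s) → n < # (B st) + N)

      stage-anti : ∀ {s} (st : Stage A s) → Antisymmetric (R st)
      stage-anti st = Antisymmetric-mono (R⊆A st) anti

      stage-≤ : ∀ {s} (st : Stage A s) → s ≤ k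
      stage-≤ st = ≤-trans (≤-reflexive (sym (#R st))) (≤-trans (#-mono (R st) A (R⊆A st)) A≤k)

      N-pos : γ ≤ N
      N-pos = ≤-trans (m≤n*m γ q {{>-nonZero 1≤q}}) (≤-reflexive (sym N≡))

      capped? : ∀ {s} (st : Stage A s) → (n < # (B st) + N) ⊎ (# (B st) + N ≤ n)
      capped? st with # (B st) + N ≤? n
      ... | yes p = inj₂ p
      ... | no p = inj₁ (≰⇒> p)

      Step : (ℕ → ℕ → Set) → ℕ → (s : ℕ) → Stage A (suc s) → Set
      Step I lo s st = Cap lo ⊎ ∃ λ x → x ∈ R st × I s (# (B st) + out (B st) x)

      uncapped : ∀ (I : ℕ → ℕ → Set) lo s → lo ≤ s → (st : Stage A (suc s)) →
        (# (B st) + N ≤ n → ∃ λ x → x ∈ R st × I s (# (B st) + out (B st) x)) → Step I lo s st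
      uncapped I lo s lo≤s st f = decide (capped? st)
        where
        decide : (n < # (B st) + N) ⊎ (# (B st) + N ≤ n) → Step I lo s st
        decide (inj₁ c) = inj₁ (suc s , ≤-trans lo≤s (n≤1+n s) , st , c)
        decide (inj₂ c) = inj₂ (f c)

      I₁ : ℕ → ℕ → Set
      I₁ s b = suc (# A) ≤ s + b

      -- One new sum per element: B contains the identity and is not everything. After q elements B
      -- has q = 2 · 16 · γ elements, the size that `grow` asks for with h = 15 and v = γ.
      phase₁ : ∀ lo s → lo ≤ s → (st : Stage A (suc s)) → I₁ (suc s) (# (B st)) → Step I₁ lo s st
      phase₁ lo s lo≤s st inv = uncapped I₁ lo s lo≤s st λ c → advance c (∃-of-size (R st) (#R st))
        where
        advance : # (B st) + N ≤ n → (∃ λ x → x ∈ R st) → ∃ λ x → x ∈ R st × I₁ s (# (B st) + out (B st) x)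
        advance c (x , hx) = x , hx , linarith 4 (λ a s b o → κ 1 ⊕ a ⊴ κ 1 ⊕ s ⊕ b ⇒ κ 0 ⊲ o ⇒ ⊢ κ 1 ⊕ a ⊴ s ⊕ (b ⊕ o))
          (# A) s (# (B st)) (out (B st) x) inv
          (out-pos (B st) x (ε∈B st) (ε∉ {R st} (stage-anti st) x hx)
            (≤-trans (≤-trans (≤-reflexive (+-comm 1 _)) (+-monoʳ-≤ (# (B st)) (≤-trans 0<γ N-pos))) c))

      I₂ : ℕ → ℕ → ℕ → Set
      I₂ m s b = (q ≤ b) × (m * γ ≤ b + s * γ)

      -- Each step now gains more than γ, so q further elements give qγ = N sums, enough for `grow`
      -- with any v ≤ k.
      phase₂ : ∀ lo m → q ≤ lo → ∀ s → lo ≤ s → (st : Stage A (suc s)) → I₂ m (suc s) (# (B st)) → Step (I₂ m) lo s st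
      phase₂ lo m q≤lo s lo≤s st (q≤b , inv) = uncapped (I₂ m) lo s lo≤s st λ c → advance
          (grow (R st) (stage-anti st) (B st) 15 γ ≤-refl 0<γ (≤-trans (≤-reflexive (sym q≡)) q≤b)
            (≤-trans (+-monoˡ-≤ (# (B st)) (≤-trans (≤-reflexive (sym q≡)) q≤N)) (≤-trans (≤-reflexive (+-comm N _)) c))
            (linarith 4 (λ γ s r l → κ 32 ⊗ γ ⊴ l ⇒ l ⊴ s ⇒ r ≐ κ 1 ⊕ s ⇒ ⊢ κ 2 ⊗ γ ⊗ κ 15 ⊕ κ 28 ⊗ γ ⊲ κ 2 ⊗ r ⊗ κ 15)
              γ s (# (R st)) lo (≤-trans (≤-reflexive (sym q≡)) q≤lo) lo≤s (#R st)))
        where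
        advance : (∃ λ x → x ∈ R st × γ < out (B st) x) → ∃ λ x → x ∈ R st × I₂ m s (# (B st) + out (B st) x)
        advance (x , hx , lt) = x , hx , ≤-trans q≤b (m≤m+n _ _) ,
          linarith 5 (λ mγ b sγ o γ → mγ ⊴ b ⊕ (γ ⊕ sγ) ⇒ γ ⊲ o ⇒ ⊢ mγ ⊴ b ⊕ o ⊕ sγ) (m * γ) (# (B st)) (s * γ) (out (B st) x) γ inv lt

      I₃ : ℕ → ℕ → ℕ → Set
      I₃ m s b = (N ≤ b) × (m * m + 2 * q * s ≤ 2 * b + s * s + 2 * q * m)

      -- The gain exceeds v = s - q, so that |B| follows (m² - s²)/2. The loss q pays for the finite
      -- precision h, by 14k ≤ hq.
      phase₃ : ∀ lo m → suc q ≤ lo → ∀ s → lo ≤ s → (st : Stage A (suc s)) → I₃ m (suc s) (# (B st)) → Step (I₃ m) lo s st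
      phase₃ lo m q<lo s lo≤s st (N≤b , inv) = uncapped (I₃ m) lo s lo≤s st λ c → next c (s ∸ q) (m+[n∸m]≡n (≤-trans (<⇒≤ q<lo) lo≤s))
        where
        next : # (B st) + N ≤ n → ∀ v → q + v ≡ s → ∃ λ x → x ∈ R st × I₃ m s (# (B st) + out (B st) x)
        next c v e = advance (grow (R st) (stage-anti st) (B st) h v 15≤h
          (linarith 4 (λ q v s lo → q ⊕ v ≐ s ⇒ κ 1 ⊕ q ⊴ lo ⇒ lo ⊴ s ⇒ ⊢ κ 0 ⊲ v) q v s lo e q<lo lo≤s)
          (≤-trans 2hv≤N N≤b) (≤-trans (≤-trans (+-monoˡ-≤ (# (B st)) 2hv≤N) (≤-reflexive (+-comm N _))) c)
          (linarith 6 (λ v h q k s r → κ 14 ⊗ k ⊴ h ⊗ q ⇒ v ⊴ k ⇒ κ 15 ⊴ h ⇒ r ⊗ h ≐ h ⊕ q ⊗ h ⊕ v ⊗ h ⇒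
              ⊢ κ 2 ⊗ v ⊗ h ⊕ κ 28 ⊗ v ⊲ κ 2 ⊗ r ⊗ h)
            v h q k s (# (R st)) 14k≤hq v≤k 15≤h
            (trans (cong (_* h) (trans (#R st) (cong suc (sym e)))) (linarith 3 (λ q v h → ⊢ (κ 1 ⊕ (q ⊕ v)) ⊗ h ≐ h ⊕ q ⊗ h ⊕ v ⊗ h) q v h))))
          where
          v≤k : v ≤ k
          v≤k = ≤-trans (m≤n+m v q) (≤-trans (≤-reflexive e) (≤-trans (n≤1+n s) (stage-≤ st)))
          2hv≤N : 2 * suc h * v ≤ N
          2hv≤N = ≤-trans (*-monoʳ-≤ (2 * suc h) v≤k) N-large
          advance : (∃ λ x → x ∈ R st × v < out (B st) x) → ∃ λ x → x ∈ R st × I₃ m s (# (B st) + out (B st) x)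
          advance (x , hx , lt) = x , hx , ≤-trans N≤b (m≤m+n _ _) ,
            linarith 6 (λ m q s b o v → m ⊗ m ⊕ κ 2 ⊗ q ⊗ (κ 1 ⊕ s) ⊴ κ 2 ⊗ b ⊕ (κ 1 ⊕ s) ⊗ (κ 1 ⊕ s) ⊕ κ 2 ⊗ q ⊗ m ⇒ v ⊲ o ⇒ q ⊕ v ≐ s ⇒
              ⊢ m ⊗ m ⊕ κ 2 ⊗ q ⊗ s ⊴ κ 2 ⊗ (b ⊕ o) ⊕ s ⊗ s ⊕ κ 2 ⊗ q ⊗ m)
              m q s (# (B st)) (out (B st) x) v inv lt e

      Reached : (ℕ → ℕ → Set) → ℕ → Set
      Reached I lo = ∃ λ (st : Stage A lo) → I lo (# (B st))

      run : ∀ u lo → suc q ≤ lo → # A ≡ q + (q + (u + lo)) → Cap lo ⊎ Reached (I₃ (u + lo)) lo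
      run u lo q<lo e = after₁ (loop I₁ (Cap lo) (q + (u + lo))
          (λ s l → phase₁ lo s (≤-trans (m≤n+m lo u) (≤-trans (m≤n+m (u + lo) q) l))) q (subst (Stage A) e (start A))
          (inv₁ _ e))
        where
        q≤ : q ≤ u + lo
        q≤ = ≤-trans (<⇒≤ q<lo) (m≤n+m lo u)
        inv₁ : ∀ a (e : # A ≡ a) → suc (# A) ≤ a + # (B (subst (Stage A) e (start A)))
        inv₁ _ refl = ≤-reflexive (trans (+-comm 1 _) (cong (# A +_) (sym (#-⁅⁆ ε))))
        after₂ : Cap lo ⊎ Reached (I₂ (q + (u + lo))) (u + lo) → Cap lo ⊎ Reached (I₃ (u + lo)) lo
        after₂ (inj₁ c) = inj₁ c
        after₂ (inj₂ (st , _ , inv)) = loop (I₃ (u + lo)) (Cap lo) lo (phase₃ lo (u + lo) q<lo) u st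
          (≤-trans (≤-reflexive N≡) (linarith 4 (λ q γ t b → (q ⊕ t) ⊗ γ ⊴ b ⊕ t ⊗ γ ⇒ ⊢ q ⊗ γ ⊴ b) q γ (u + lo) (# (B st)) inv) ,
           linarith 3 (λ m q b → ⊢ m ⊗ m ⊕ κ 2 ⊗ q ⊗ m ⊴ κ 2 ⊗ b ⊕ m ⊗ m ⊕ κ 2 ⊗ q ⊗ m) (u + lo) q (# (B st)))
        after₁ : Cap lo ⊎ Reached I₁ (q + (u + lo)) → Cap lo ⊎ Reached (I₃ (u + lo)) lo
        after₁ (inj₁ c) = inj₁ c
        after₁ (inj₂ (st , inv)) = after₂ (loop (I₂ (q + (u + lo))) (Cap lo) (u + lo)
          (λ s l st i → lift (phase₂ (u + lo) (q + (u + lo)) q≤ s l st i)) q st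
          (linarith 4 (λ a q t b → κ 1 ⊕ a ⊴ q ⊕ t ⊕ b ⇒ a ≐ q ⊕ (q ⊕ t) ⇒ ⊢ q ⊴ b) (# A) q (u + lo) (# (B st)) inv e ,
           m≤n+m _ _))
          where
          lift : ∀ {P : Set} → Cap (u + lo) ⊎ P → Cap lo ⊎ P
          lift (inj₂ p) = inj₂ p
          lift (inj₁ (s , l , r)) = inj₁ (s , ≤-trans (m≤n+m lo u) l , r)

    module _ (w : ℕ) (1000q≤w : q * 1000 ≤ w) (k≤9w : k ≤ w * 9) where

      -- All but q + 1 elements of R are spent on the three phases, and (6w)²/2 = 18w² is the
      -- resulting size up to terms of order qw.
      many-sums : ∀ R → Antisymmetric R → w * 6 ≤ # R → # R ≤ k →
        ∃ λ C → ε ∈ C × (∀ x → x ∈ C → SubSum R x) × ((n < # C + N) ⊎ (w * w * 36 ≤ # C * 2 + q * w * 60))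
      many-sums R anti 6w≤ R≤k = go (# R ∸ (q + q + suc q)) (m+[n∸m]≡n (≤-trans
          (linarith 2 (λ q w → q ⊗ κ 1000 ⊴ w ⇒ κ 1 ⊴ q ⇒ ⊢ q ⊕ q ⊕ (κ 1 ⊕ q) ⊴ w ⊗ κ 6) q w 1000q≤w 1≤q) 6w≤))
        where
        Many : Set
        Many = ∃ λ C → ε ∈ C × (∀ x → x ∈ C → SubSum R x) × ((n < # C + N) ⊎ (w * w * 36 ≤ # C * 2 + q * w * 60))
        all : ∀ {s} (st : Stage R s) x → x ∈ B st → SubSum R x
        all st x hx = SubSum-mono (λ z → proj₁ ∘ ∧-elim {R z}) (sums st x hx)
        go : ∀ u → q + q + suc q + u ≡ # R → Many
        go u e = finish (run R anti R≤k u (suc q) ≤-refl (trans (sym e) (linarith 2 (λ q u → ⊢ q ⊕ q ⊕ (κ 1 ⊕ q) ⊕ u ≐ q ⊕ (q ⊕ (u ⊕ (κ 1 ⊕ q)))) q u)))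
          where
          m≡ : q + q + (u + suc q) ≡ # R
          m≡ = trans (linarith 2 (λ q u → ⊢ q ⊕ q ⊕ (u ⊕ (κ 1 ⊕ q)) ≐ q ⊕ q ⊕ (κ 1 ⊕ q) ⊕ u) q u) e
          m≥ : w * 6 ≤ q + q + (u + suc q)
          m≥ = ≤-trans 6w≤ (≤-reflexive (sym m≡))
          finish : Cap R anti R≤k (suc q) ⊎ Reached R anti R≤k (I₃ R anti R≤k (u + suc q)) (suc q) → Many
          finish (inj₁ (_ , _ , st , c)) = B st , ε∈B st , all st , inj₁ c
          finish (inj₂ (st , _ , inv)) = B st , ε∈B st , all st , inj₂
            (linarith 4 (λ w q t b →
              t ⊗ t ⊕ κ 2 ⊗ q ⊗ (κ 1 ⊕ q) ⊴ κ 2 ⊗ b ⊕ (κ 1 ⊕ q) ⊗ (κ 1 ⊕ q) ⊕ κ 2 ⊗ q ⊗ t ⇒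
              (w ⊗ κ 6) ⊗ (w ⊗ κ 6) ⊴ (q ⊕ q ⊕ t) ⊗ (q ⊕ q ⊕ t) ⇒ q ⊗ (q ⊕ q ⊕ t) ⊴ q ⊗ (w ⊗ κ 9) ⇒
              q ⊗ κ 1000 ⊴ w ⇒ κ 1 ⊴ q ⇒ q ⊗ (q ⊗ κ 1000) ⊴ q ⊗ w ⇒ q ⊴ q ⊗ q ⇒
              ⊢ w ⊗ w ⊗ κ 36 ⊴ b ⊗ κ 2 ⊕ q ⊗ w ⊗ κ 60)
              w q (u + suc q) (# (B st)) inv (*-mono-≤ m≥ m≥) (*-monoʳ-≤ q (≤-trans (≤-reflexive m≡) (≤-trans R≤k k≤9w))) 1000q≤w 1≤q
              (*-monoʳ-≤ q 1000q≤w) (m≤m*n q q {{>-nonZero 1≤q}}))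

      record Found (A : FSet n) (L : ℕ) : Set where
        field
          s : ℕ
          6w≤s : w * 6 ≤ s
          s≤7w : s ≤ w * 7
          stage : Stage A s
          large : w * w * 7 ≤ # (B stage)
          half : # (B stage) * 2 ≤ n
          small-out : ∀ x → x ∈ R stage → out (B stage) x ≤ s + L

      module _ (A : FSet n) (zf : ZeroSumFree A) (#A : # A ≡ k) (8w≤k : w * 8 ≤ k) (k≤8w+7 : k ≤ w * 8 + 7)
        (n-upper : n * 2 ≤ k * k + k * 4 + 3) (n-lower : k * k ≤ n * 4) (L : ℕ) (L≡ : L ≡ q * 100) where

        private
          anti : Antisymmetric A
          anti = zeroSumFree⇒antisymmetric zf

          A≤k : # A ≤ k
          A≤k = ≤-reflexive #A

          qw≤ww : q * w * 1000 ≤ w * w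
          qw≤ww = ≤-trans (linarith 2 (λ q w → ⊢ q ⊗ w ⊗ κ 1000 ⊴ q ⊗ κ 1000 ⊗ w) q w) (*-monoˡ-≤ w 1000q≤w)

          w≤qw : w ≤ q * w
          w≤qw = m≤n*m w q {{>-nonZero 1≤q}}

          γ≤q : γ ≤ q
          γ≤q = ≤-trans (m≤n*m γ 32) (≤-reflexive (sym q≡))

          N≤ww : N * 1000 ≤ w * w
          N≤ww = linarith 4 (λ N qq qw ww → N ⊴ qq ⇒ qq ⊗ κ 1000 ⊴ qw ⇒ qw ⊗ κ 1000 ⊴ ww ⇒ ⊢ N ⊗ κ 1000 ⊴ ww) N (q * q) (q * w) (w * w)
            (≤-trans (≤-reflexive N≡) (*-monoʳ-≤ q γ≤q))
            (≤-trans (≤-reflexive (*-assoc q q 1000)) (*-monoʳ-≤ q 1000q≤w)) qw≤ww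

          1≤w : 1 ≤ w
          1≤w = linarith 2 (λ q w → q ⊗ κ 1000 ⊴ w ⇒ κ 1 ⊴ q ⇒ ⊢ κ 1 ⊴ w) q w 1000q≤w 1≤q

          1≤qw : 1 ≤ q * w
          1≤qw = ≤-trans 1≤w w≤qw

          Complement : ∀ {s} → Stage A s → Set
          Complement st = ∃ λ c → # (B st) + c ≤ suc n × ((n < c + N) ⊎ (w * w * 36 ≤ c * 2 + q * w * 60))

          complement : ∀ {s} (st : Stage A s) → w * 6 ≤ s → Complement st
          complement st 6w≤ = build (many-sums (R st) (Antisymmetric-mono (R⊆A st) anti) (≤-trans 6w≤ (≤-reflexive (sym (#R st))))
              (≤-trans (#-mono (R st) A (R⊆A st)) A≤k))
            where
            build : _ → Complement st
            build (C , ε∈C , all , c) = # C , complementary-sums zf (R⊆A st) ε∈C (sums st) all , c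

          kk≥ : (w * 8) * (w * 8) ≤ k * k
          kk≥ = *-mono-≤ 8w≤k 8w≤k

          uncappable : ∀ {lo} → w * 6 ≤ lo → Cap A anti A≤k lo → ⊥
          uncappable 6w≤lo (s , lo≤s , st , cap) = contra (complement st (≤-trans 6w≤lo lo≤s))
            where
            contra : Complement st → ⊥
            contra (c , b+c , inj₁ c-cap) = linarith 6 (λ n b c N k w → n ⊲ b ⊕ N ⇒ b ⊕ c ⊴ κ 1 ⊕ n ⇒ n ⊲ c ⊕ N ⇒
                (w ⊗ κ 8) ⊗ (w ⊗ κ 8) ⊴ k ⊗ k ⇒ k ⊗ k ⊴ n ⊗ κ 4 ⇒ N ⊗ κ 1000 ⊴ w ⊗ w ⇒ ⊢⊥)
              n (# (B st)) c N k w cap b+c c-cap kk≥ n-lower N≤ww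
            contra (c , b+c , inj₂ c-large) = linarith 6 (λ n b c N q w → n ⊲ b ⊕ N ⇒ b ⊕ c ⊴ κ 1 ⊕ n ⇒ w ⊗ w ⊗ κ 36 ⊴ c ⊗ κ 2 ⊕ q ⊗ w ⊗ κ 60 ⇒
                q ⊗ w ⊗ κ 1000 ⊴ w ⊗ w ⇒ N ⊗ κ 1000 ⊴ w ⊗ w ⇒ κ 1 ⊴ q ⊗ w ⇒ ⊢⊥)
              n (# (B st)) c N q w cap b+c c-large qw≤ww N≤ww 1≤qw

          kk≤ : k * k ≤ (w * 8 + 7) * (w * 8 + 7)
          kk≤ = *-mono-≤ k≤8w+7 k≤8w+7

          half-size : ∀ {s} (st : Stage A s) → w * 6 ≤ s → w * w * 7 ≤ # (B st) → # (B st) * 2 ≤ n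
          half-size st 6w≤s large = use (complement st 6w≤s)
            where
            use : Complement st → # (B st) * 2 ≤ n
            use (c , b+c , inj₁ c-cap) = ⊥-elim (linarith 6 (λ n b c N qw ww → b ⊕ c ⊴ κ 1 ⊕ n ⇒ n ⊲ c ⊕ N ⇒
                ww ⊗ κ 7 ⊴ b ⇒ N ⊗ κ 1000 ⊴ ww ⇒ κ 1 ⊴ qw ⇒ qw ⊗ κ 1000 ⊴ ww ⇒ ⊢⊥)
              n (# (B st)) c N (q * w) (w * w) b+c c-cap large N≤ww 1≤qw qw≤ww)
            use (c , b+c , inj₂ c-large) = linarith 6 (λ n b c k q w → b ⊕ c ⊴ κ 1 ⊕ n ⇒ w ⊗ w ⊗ κ 36 ⊴ c ⊗ κ 2 ⊕ q ⊗ w ⊗ κ 60 ⇒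
                q ⊗ w ⊗ κ 1000 ⊴ w ⊗ w ⇒ w ⊴ q ⊗ w ⇒ κ 1 ⊴ q ⊗ w ⇒ n ⊗ κ 2 ⊴ k ⊗ k ⊕ k ⊗ κ 4 ⊕ κ 3 ⇒
                k ⊗ k ⊴ (w ⊗ κ 8 ⊕ κ 7) ⊗ (w ⊗ κ 8 ⊕ κ 7) ⇒ k ⊴ w ⊗ κ 8 ⊕ κ 7 ⇒ ⊢ b ⊗ κ 2 ⊴ n)
              n (# (B st)) c k q w b+c c-large qw≤ww w≤qw 1≤qw n-upper kk≤ k≤8w+7

          m : ℕ
          m = k ∸ (q + q)

          k≡ : q + (q + m) ≡ k
          k≡ = trans (sym (+-assoc q q m)) (m+[n∸m]≡n (≤-trans (linarith 2 (λ q w → q ⊗ κ 1000 ⊴ w ⇒ ⊢ q ⊕ q ⊴ w ⊗ κ 8) q w 1000q≤w) 8w≤k))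

          u : ℕ
          u = m ∸ w * 7

          m≡ : u + w * 7 ≡ m
          m≡ = m∸n+n≡m (linarith 4 (λ q w m k → q ⊗ κ 1000 ⊴ w ⇒ q ⊕ (q ⊕ m) ≐ k ⇒ w ⊗ κ 8 ⊴ k ⇒ ⊢ w ⊗ κ 7 ⊴ m) q w m k 1000q≤w k≡ 8w≤k)

          6w≤7w : w * 6 ≤ w * 7
          6w≤7w = *-monoʳ-≤ w (n≤1+n 6)

          -- The invariant of steps that gain more than s + L. The terms in L cancel at s = 7w; at s
          -- = 6w a surplus of 2Lw has accumulated on the left.
          I₄ : ℕ → ℕ → Set
          I₄ s b = (w * w * 7 ≤ b) × (m * m + L * (w * 14) ≤ b * 2 + s * s + q * m * 2 + L * s * 2)

          mm≥ : (w * 8) * (w * 8) ≤ (q + (q + m)) * (q + (q + m))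
          mm≥ = ≤-trans kk≥ (≤-reflexive (sym (cong₂ _*_ k≡ k≡)))

          qm≤ : q * (q + (q + m)) ≤ q * (w * 8 + 7)
          qm≤ = *-monoʳ-≤ q (≤-trans (≤-reflexive k≡) k≤8w+7)

          q≤qw : q ≤ q * w
          q≤qw = m≤m*n q w {{>-nonZero 1≤w}}

          begin₄ : ∀ (b : ℕ) → m * m + 2 * q * (w * 7) ≤ 2 * b + (w * 7) * (w * 7) + 2 * q * m → I₄ (w * 7) b
          begin₄ b inv =
            linarith 4 (λ m q w b → m ⊗ m ⊕ κ 2 ⊗ q ⊗ (w ⊗ κ 7) ⊴ κ 2 ⊗ b ⊕ (w ⊗ κ 7) ⊗ (w ⊗ κ 7) ⊕ κ 2 ⊗ q ⊗ m ⇒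
                (w ⊗ κ 8) ⊗ (w ⊗ κ 8) ⊴ (q ⊕ (q ⊕ m)) ⊗ (q ⊕ (q ⊕ m)) ⇒ q ⊗ (q ⊕ (q ⊕ m)) ⊴ q ⊗ (w ⊗ κ 8 ⊕ κ 7) ⇒
                q ⊴ q ⊗ w ⇒ q ⊗ w ⊗ κ 1000 ⊴ w ⊗ w ⇒ ⊢ w ⊗ w ⊗ κ 7 ⊴ b)
              m q w b inv mm≥ qm≤ q≤qw qw≤ww ,
            linarith 5 (λ m q w b L → m ⊗ m ⊕ κ 2 ⊗ q ⊗ (w ⊗ κ 7) ⊴ κ 2 ⊗ b ⊕ (w ⊗ κ 7) ⊗ (w ⊗ κ 7) ⊕ κ 2 ⊗ q ⊗ m ⇒
                ⊢ m ⊗ m ⊕ L ⊗ (w ⊗ κ 14) ⊴ b ⊗ κ 2 ⊕ (w ⊗ κ 7) ⊗ (w ⊗ κ 7) ⊕ q ⊗ m ⊗ κ 2 ⊕ L ⊗ (w ⊗ κ 7) ⊗ κ 2)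
              m q w b L inv

          phase₄ : ∀ s → w * 6 ≤ s → s < w * 7 → (st : Stage A (suc s)) → I₄ (suc s) (# (B st)) →
            Found A L ⊎ ∃ λ x → x ∈ R st × I₄ s (# (B st) + out (B st) x)
          phase₄ s 6w≤s s<7w st (large , inv) = decide (large-out? (R st) (B st) (suc s + L))
            where
            decide : (∃ λ x → x ∈ R st × suc s + L < out (B st) x) ⊎ (∀ x → x ∈ R st → out (B st) x ≤ suc s + L) →
              Found A L ⊎ ∃ λ x → x ∈ R st × I₄ s (# (B st) + out (B st) x)
            decide (inj₂ all) = inj₁ record { s = suc s ; 6w≤s = ≤-trans 6w≤s (n≤1+n s) ; s≤7w = s<7w ; stage = st ; large = large
              ; half = half-size st (≤-trans 6w≤s (n≤1+n s)) large ; small-out = all }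
            decide (inj₁ (x , hx , lt)) = inj₂ (x , hx , ≤-trans large (m≤m+n _ _) ,
              linarith 6 (λ z b s o qm L → z ⊴ b ⊗ κ 2 ⊕ (κ 1 ⊕ s) ⊗ (κ 1 ⊕ s) ⊕ qm ⊕ L ⊗ (κ 1 ⊕ s) ⊗ κ 2 ⇒ κ 1 ⊕ s ⊕ L ⊲ o ⇒
                  ⊢ z ⊴ (b ⊕ o) ⊗ κ 2 ⊕ s ⊗ s ⊕ qm ⊕ L ⊗ s ⊗ κ 2)
                (m * m + L * (w * 14)) (# (B st)) s (out (B st) x) (q * m * 2) L inv lt)

          -- To first order 2|B| ≥ (64 - 36)w² and 2|C| ≥ 36w² exhaust 2n = 64w² exactly. The
          -- surplus 2Lw = 200qw then outweighs all errors of order qw, which is why L = 100q.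
          end₄ : (∃ λ (st : Stage A (w * 6)) → I₄ (w * 6) (# (B st))) → ⊥
          end₄ (st , large , inv) = use (complement st ≤-refl)
            where
            use : Complement st → ⊥
            use (c , b+c , inj₁ c-cap) = linarith 6 (λ n b c N qw ww → b ⊕ c ⊴ κ 1 ⊕ n ⇒ n ⊲ c ⊕ N ⇒
                ww ⊗ κ 7 ⊴ b ⇒ N ⊗ κ 1000 ⊴ ww ⇒ κ 1 ⊴ qw ⇒ qw ⊗ κ 1000 ⊴ ww ⇒ ⊢⊥)
              n (# (B st)) c N (q * w) (w * w) b+c c-cap large N≤ww 1≤qw qw≤ww
            use (c , b+c , inj₂ c-large) = linarith 7 (λ n b c m q w L →
                b ⊕ c ⊴ κ 1 ⊕ n ⇒ w ⊗ w ⊗ κ 36 ⊴ c ⊗ κ 2 ⊕ q ⊗ w ⊗ κ 60 ⇒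
                m ⊗ m ⊕ L ⊗ (w ⊗ κ 14) ⊴ b ⊗ κ 2 ⊕ (w ⊗ κ 6) ⊗ (w ⊗ κ 6) ⊕ q ⊗ m ⊗ κ 2 ⊕ L ⊗ (w ⊗ κ 6) ⊗ κ 2 ⇒
                L ⊗ w ≐ q ⊗ κ 100 ⊗ w ⇒
                n ⊗ κ 2 ⊴ (q ⊕ (q ⊕ m)) ⊗ (q ⊕ (q ⊕ m)) ⊕ (q ⊕ (q ⊕ m)) ⊗ κ 4 ⊕ κ 3 ⇒
                q ⊗ (q ⊕ (q ⊕ m)) ⊴ q ⊗ (w ⊗ κ 8 ⊕ κ 7) ⇒ q ⊕ (q ⊕ m) ⊴ w ⊗ κ 8 ⊕ κ 7 ⇒
                q ⊴ q ⊗ w ⇒ w ⊴ q ⊗ w ⇒ q ⊗ κ 1000 ⊴ w ⇒ κ 1 ⊴ q ⇒ ⊢⊥)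
              n (# (B st)) c m q w L b+c c-large inv (cong (_* w) L≡)
              (≤-trans n-upper (≤-reflexive (cong (λ k → k * k + k * 4 + 3) (sym k≡))))
              qm≤ (≤-trans (≤-reflexive k≡) k≤8w+7) q≤qw w≤qw 1000q≤w 1≤q

          after₃ : Cap A anti A≤k (w * 7) ⊎ Reached A anti A≤k (I₃ A anti A≤k (u + w * 7)) (w * 7) → Found A L
          after₃ (inj₁ c) = ⊥-elim (uncappable 6w≤7w c)
          after₃ (inj₂ (st , _ , inv)) = conclude (loop (λ s b → s ≤ w * 7 × I₄ s b) (Found A L) (w * 6)
              (λ s l st i → lift s {st} (phase₄ s l (proj₁ i) st (proj₂ i)) (proj₁ i)) w (subst (Stage A) 7w≡ st)
              (≤-reflexive (sym 7w≡) , inv′ _ 7w≡))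
            where
            7w≡ : w * 7 ≡ w + w * 6
            7w≡ = linarith 1 (λ w → ⊢ w ⊗ κ 7 ≐ w ⊕ w ⊗ κ 6) w
            inv′ : ∀ t (e : w * 7 ≡ t) → I₄ t (# (B (subst (Stage A) e st)))
            inv′ _ refl = begin₄ (# (B st)) (subst (λ m → m * m + 2 * q * (w * 7) ≤ 2 * # (B st) + (w * 7) * (w * 7) + 2 * q * m) m≡ inv)
            lift : ∀ s {st : Stage A (suc s)} → Found A L ⊎ (∃ λ x → x ∈ R st × I₄ s (# (B st) + out (B st) x)) → suc s ≤ w * 7 →
              Found A L ⊎ (∃ λ x → x ∈ R st × (s ≤ w * 7 × I₄ s (# (B st) + out (B st) x)))
            lift s (inj₁ f) _ = inj₁ f
            lift s (inj₂ (x , hx , i)) le = inj₂ (x , hx , ≤-trans (n≤1+n s) le , i)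
            conclude : Found A L ⊎ (∃ λ (st : Stage A (w * 6)) → (w * 6 ≤ w * 7) × I₄ (w * 6) (# (B st))) → Found A L
            conclude (inj₁ f) = f
            conclude (inj₂ (st , _ , i)) = ⊥-elim (end₄ (st , i))

        found : Found A L
        found = after₃ (run A anti A≤k u (w * 7)
          (linarith 2 (λ q w → q ⊗ κ 1000 ⊴ w ⇒ κ 1 ⊴ q ⇒ ⊢ κ 1 ⊕ q ⊴ w ⊗ κ 7) q w 1000q≤w 1≤q)
          (trans #A (trans (sym k≡) (cong (λ z → q + (q + z)) (sym m≡)))))

-- Lengthening a progression inside an iterated sumset until it measures all of H.

module Stretching (n : ℕ) (_∙_ : Fin n → Fin n → Fin n) (ε : Fin n) (_⁻¹ : Fin n → Fin n)
  (isAbelianGroup : IsAbelianGroup _≡_ _∙_ ε _⁻¹)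
  (simple : ∀ (X : FiniteSets.FSet n) a → ¬ a ≡ ε → (∀ x → X x ≡ true → X (x ∙ a) ≡ true) → ∀ x y → X x ≡ true → X y ≡ true) where

  open FiniteSets

  open LinearArithmetic
  open Isoperimetry n _∙_ ε _⁻¹ isAbelianGroup simple

  mult : ℕ → Fin n → Fin n
  mult zero a = ε
  mult (suc m) a = mult m a ∙ a

  mult-+ : ∀ i j a → mult (i + j) a ≡ mult i a ∙ mult j a
  mult-+ zero j a = sym (identityˡ _)
  mult-+ (suc i) j a = trans (cong (_∙ a) (mult-+ i j a)) (∙-swap (mult i a) (mult j a) a)

  mult-* : ∀ i j a → mult (i * j) a ≡ mult i (mult j a)
  mult-* zero j a = refl
  mult-* (suc i) j a = trans (mult-+ j (i * j) a) (trans (comm _ _) (cong (_∙ mult j a) (mult-* i j a)))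

  mult-⁻¹ : ∀ i a → mult i (a ⁻¹) ≡ mult i a ⁻¹
  mult-⁻¹ zero a = sym ε⁻¹≈ε
  mult-⁻¹ (suc i) a = trans (cong (_∙ (a ⁻¹)) (mult-⁻¹ i a)) (⁻¹-∙-comm (mult i a) a)

  mult-∙ : ∀ i a b → mult i (a ∙ b) ≡ mult i a ∙ mult i b
  mult-∙ zero a b = sym (identityˡ ε)
  mult-∙ (suc i) a b = trans (cong (_∙ (a ∙ b)) (mult-∙ i a b)) (trans (sym (assoc _ a b))
    (trans (cong (_∙ b) (∙-swap (mult i a) (mult i b) a)) (assoc _ _ b)))

  mult-ε : ∀ i → mult i ε ≡ ε
  mult-ε zero = refl
  mult-ε (suc i) = trans (identityʳ _) (mult-ε i)

  mult-∸ : ∀ {i j} a → j ≤ i → mult i a ∙ (mult j a ⁻¹) ≡ mult (i ∸ j) a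
  mult-∸ {i} {j} a j≤i = trans (cong (_∙ (mult j a ⁻¹)) (trans (cong (λ k → mult k a) (sym (m∸n+n≡m j≤i))) (mult-+ (i ∸ j) j a)))
    (x∙a∙a⁻¹ _ _)

  mult-∸⁻¹ : ∀ {i j} a → i ≤ j → (mult i a ∙ (mult j a ⁻¹)) ⁻¹ ≡ mult (j ∸ i) a
  mult-∸⁻¹ {i} {j} a i≤j = trans (⁻¹-∙ (mult i a) (mult j a ⁻¹)) (trans (cong ((mult i a ⁻¹) ∙_) (⁻¹-involutive _))
    (trans (comm _ _) (mult-∸ a i≤j)))

  -- 'y' is the absolute value of 'h' in units of 'e'.
  Length : Fin n → Fin n → ℕ → Set
  Length e h y = (h ≡ mult y e) ⊎ ((h ⁻¹) ≡ mult y e)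

  mult-difference : ∀ e x x′ → ∃ λ y → y ≤ x + x′ × (∀ ℓ → x ≤ ℓ → x′ ≤ ℓ → y ≤ ℓ) × Length e (mult x e ∙ (mult x′ e ⁻¹)) y
  mult-difference e x x′ with ≤-total x′ x
  ... | inj₁ le = x ∸ x′ , ≤-trans (m∸n≤m x x′) (m≤m+n x x′) , (λ ℓ h _ → ≤-trans (m∸n≤m x x′) h) , inj₁ (mult-∸ e le)
  ... | inj₂ le = x′ ∸ x , ≤-trans (m∸n≤m x′ x) (m≤n+m x′ x) , (λ ℓ _ h → ≤-trans (m∸n≤m x′ x) h) , inj₂ (mult-∸⁻¹ e le)

  Length? : ∀ e h ℓ → Dec (∃ λ y → y < suc ℓ × Length e h y)
  Length? e h ℓ = anyUpTo? (λ y → (h Fin.≟ mult y e) ⊎-dec ((h ⁻¹) Fin.≟ mult y e)) (suc ℓ)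

  least : ∀ {P : ℕ → Set} → (∀ i → Dec (P i)) → ∀ c →
    (∀ i → 0 < i → i < c → ¬ P i) ⊎ (∃ λ i → 0 < i × i < c × P i × (∀ i′ → 0 < i′ → i′ < i → ¬ P i′))
  least P? zero = inj₁ λ i _ ()
  least {P} P? (suc c) with least P? c
  ... | inj₂ (i , 0<i , i<c , r) = inj₂ (i , 0<i , m<n⇒m<1+n i<c , r)
  ... | inj₁ none with P? c | 0 <? c
  ... | no ¬p | _ = inj₁ λ i 0<i i<c p → [ (λ lt → none i 0<i lt p) , (λ { refl → ¬p p }) ]′ (m≤n⇒m<n∨m≡n (≤-pred i<c))
  ... | yes p | yes 0<c = inj₂ (c , 0<c , ≤-refl , p , none)
  ... | yes p | no 0≮c = inj₁ λ i 0<i i<c _ → 0≮c (≤-trans 0<i (≤-pred i<c))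

  Cover : ℕ → ℕ → ℕ → ℕ → Set
  Cover i y ℓ x = ∃ λ a → ∃ λ b → a ≤ i × b ≤ ℓ × ((x ≡ a * y + b * i) ⊎ (x + b * i ≡ a * y))

  -- Choose a ≤ i with ay ≡ x modulo i. Then x - ay is a multiple of i, and since x and ay both lie
  -- in [0, iℓ], the quotient is at most ℓ in absolute value.
  cover : ∀ i y ℓ x → 1 < i → Coprime y i → y ≤ ℓ → x ≤ i * ℓ → Cover i y ℓ x
  cover i y ℓ x 1<i cop y≤ℓ x≤ = invert (coprime-inverse y i 1<i cop)
    where
    instance
      i≢0 : NonZero i
      i≢0 = >-nonZero (<⇒≤ 1<i)
    module _ (a k t : ℕ) (a≤i : a ≤ i) (key : a * y + t * y * i ≡ x + x * k * i) where
      split : (t * y ≤ x * k) ⊎ (x * k ≤ t * y) → Cover i y ℓ x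
      split (inj₁ le) = a , x * k ∸ t * y , a≤i , bound , inj₂ e
        where
        e : x + (x * k ∸ t * y) * i ≡ a * y
        e = linarith 6 (λ x ay ty xk d i → ay ⊕ ty ⊗ i ≐ x ⊕ xk ⊗ i ⇒ (d ⊕ ty) ⊗ i ≐ xk ⊗ i ⇒ ⊢ x ⊕ d ⊗ i ≐ ay)
          x (a * y) (t * y) (x * k) (x * k ∸ t * y) i key (cong (_* i) (m∸n+n≡m le))
        bound : x * k ∸ t * y ≤ ℓ
        bound = ≤-trans (*-cancelʳ-≤ (x * k ∸ t * y) y i (≤-trans (m≤n+m _ x) (≤-trans (≤-reflexive e)
          (≤-trans (*-monoˡ-≤ y a≤i) (≤-reflexive (*-comm i y)))))) y≤ℓ
      split (inj₂ le) = a , t * y ∸ x * k , a≤i , bound , inj₁ e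
        where
        e : x ≡ a * y + (t * y ∸ x * k) * i
        e = linarith 6 (λ x ay ty xk d i → ay ⊕ ty ⊗ i ≐ x ⊕ xk ⊗ i ⇒ (d ⊕ xk) ⊗ i ≐ ty ⊗ i ⇒ ⊢ x ≐ ay ⊕ d ⊗ i)
          x (a * y) (t * y) (x * k) (t * y ∸ x * k) i key (cong (_* i) (m∸n+n≡m le))
        bound : t * y ∸ x * k ≤ ℓ
        bound = *-cancelʳ-≤ (t * y ∸ x * k) ℓ i (≤-trans (m≤n+m _ (a * y)) (≤-trans (≤-reflexive (sym e)) (≤-trans x≤ (≤-reflexive (*-comm i ℓ)))))
    invert : (∃ λ m → ∃ λ k → m * y ≡ 1 + k * i) → Cover i y ℓ x
    invert (m , k , my) = reduce (division (x * m) i (<⇒≤ 1<i))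
      where
      reduce : (∃ λ t → t * i ≤ x * m × x * m < suc t * i) → Cover i y ℓ x
      reduce (t , lo , hi) = split a k t
        (linarith 4 (λ a t i z → a ⊕ t ⊗ i ≐ z ⇒ z ⊲ i ⊕ t ⊗ i ⇒ ⊢ a ⊴ i) a t i (x * m) eq hi)
        (linarith 7 (λ a y t i x k m → (a ⊕ t ⊗ i) ⊗ y ≐ x ⊗ m ⊗ y ⇒ x ⊗ (m ⊗ y) ≐ x ⊗ (κ 1 ⊕ k ⊗ i) ⇒
          ⊢ a ⊗ y ⊕ t ⊗ y ⊗ i ≐ x ⊕ x ⊗ k ⊗ i) a y t i x k m (cong (_* y) eq) (cong (x *_) my))
        (≤-total (t * y) (x * k))
        where
        a : ℕ
        a = x * m ∸ t * i
        eq : a + t * i ≡ x * m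
        eq = m∸n+n≡m lo

  seg : Fin n → ℕ → FSet n
  seg e zero = ⁅ ε ⁆
  seg e (suc ℓ) = seg e ℓ ∪ ⁅ mult (suc ℓ) e ⁆

  seg-elim : ∀ e ℓ {z} → z ∈ seg e ℓ → ∃ λ x → x ≤ ℓ × z ≡ mult x e
  seg-elim e zero h = 0 , z≤n , ∈⁅⁆⇒≡ h
  seg-elim e (suc ℓ) {z} h with ∨-elim {seg e ℓ z} h
  ... | inj₂ p = suc ℓ , ≤-refl , ∈⁅⁆⇒≡ p
  ... | inj₁ p with seg-elim e ℓ p
  ... | x , x≤ , eq = x , m≤n⇒m≤1+n x≤ , eq

  module _ (torsion : ∀ i x → 0 < i → i < n → mult i x ≡ ε → x ≡ ε) where

    mult-injective : ∀ {e} → ¬ e ≡ ε → ∀ {i j} → i < j → j < n → ¬ mult j e ≡ mult i e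
    mult-injective {e} e≢ε {i} {j} i<j j<n eq = e≢ε (torsion (j ∸ i) e (m<n⇒0<n∸m i<j) (≤-<-trans (m∸n≤m j i) j<n)
      (trans (sym (mult-∸ e (<⇒≤ i<j))) (trans (cong (_∙ (mult i e ⁻¹)) eq) (inverseʳ _))))

    mult-cancel : ∀ {i x y} → 0 < i → i < n → mult i x ≡ mult i y → x ≡ y
    mult-cancel {i} {x} {y} 0<i i<n eq = ∙⁻¹≡ε (torsion i (x ∙ (y ⁻¹)) 0<i i<n
      (trans (mult-∙ i x (y ⁻¹)) (trans (cong₂ _∙_ eq (mult-⁻¹ i y)) (inverseʳ _))))

    #-seg : ∀ {e} → ¬ e ≡ ε → ∀ ℓ → ℓ < n → # (seg e ℓ) ≡ suc ℓ
    #-seg e≢ε zero _ = #-⁅⁆ ε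
    #-seg {e} e≢ε (suc ℓ) lt = trans (#-insert (seg e ℓ) (mult (suc ℓ) e) (¬true⇒false new)) (cong suc (#-seg e≢ε ℓ (<⇒≤ lt)))
      where
      new : ¬ mult (suc ℓ) e ∈ seg e ℓ
      new h = absurd (seg-elim e ℓ h)
        where
        absurd : (∃ λ x → x ≤ ℓ × mult (suc ℓ) e ≡ mult x e) → ⊥
        absurd (x , x≤ , eq) = mult-injective e≢ε (s≤s x≤) lt eq

    module Progressions (divide : ∀ i → 0 < i → i < n → ∀ e → ∃ λ e′ → mult i e′ ≡ e)
      (H : FSet n) (ε∈H : ε ∈ H) (H-sym : Symmetric H) where

      mult-pow : ∀ {h j} → h ∈ pow H j → ∀ a → mult a h ∈ pow H (a * j)
      mult-pow hh zero = ∈⁅⁆ ε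
      mult-pow {h} {j} hh (suc a) = subst (λ k → mult (suc a) h ∈ pow H k) (+-comm (a * j) j) (pow-+ H ε∈H (a * j) j (mult-pow hh a) hh)

      pow-1 : H ⊆ pow H 1
      pow-1 x hx = subst (_∈ pow H 1) (identityˡ x) (⊞-intro ⁅ ε ⁆ H (∈⁅⁆ ε) hx)

      mult-pow-1 : ∀ {h} → h ∈ H → ∀ a → mult a h ∈ pow H a
      mult-pow-1 {h} hh a = subst (λ k → mult a h ∈ pow H k) (*-identityʳ a) (mult-pow (pow-1 _ hh) a)

      -- Translates of a progression by the multiples of h cannot all be disjoint.
      module Pigeonhole (e h : Fin n) (e≢ε : ¬ e ≡ ε) (h∈H : h ∈ H) (ℓ : ℕ) (ℓ<n : ℓ < n) where

        Collision : ℕ → Set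
        Collision i = ∃ λ y → y < suc ℓ × Length e (mult i h) y

        translates : ℕ → FSet n
        translates zero x = false
        translates (suc c) = translates c ∪ (seg e ℓ ⊹ mult c h)

        translates-elim : ∀ c {z} → z ∈ translates c → ∃ λ a → a < c × (∃ λ x → x ≤ ℓ × z ≡ mult x e ∙ mult a h)
        translates-elim (suc c) {z} hz = split (∨-elim {translates c z} hz)
          where
          split : (z ∈ translates c) ⊎ (z ∈ (seg e ℓ ⊹ mult c h)) → ∃ λ a → a < suc c × (∃ λ x → x ≤ ℓ × z ≡ mult x e ∙ mult a h)
          split (inj₁ p) = let (a , a<c , r) = translates-elim c p in a , m<n⇒m<1+n a<c , r
          split (inj₂ p) = let (x , x≤ , eq) = seg-elim e ℓ p in c , ≤-refl , x , x≤ ,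
            trans (sym (x∙a⁻¹∙a z (mult c h))) (cong (_∙ mult c h) eq)

        #-translates : ∀ c → (∀ i → 0 < i → i < c → ¬ Collision i) → # (translates c) ≡ c * suc ℓ
        #-translates zero _ = #-empty (translates zero) λ x ()
        #-translates (suc c) free = linarith 6 (λ u i t s c ℓ → u ⊕ i ≐ t ⊕ s ⇒ i ≐ κ 0 ⇒ t ≐ c ⊗ (κ 1 ⊕ ℓ) ⇒ s ≐ κ 1 ⊕ ℓ ⇒
            ⊢ u ≐ κ 1 ⊕ ℓ ⊕ c ⊗ (κ 1 ⊕ ℓ))
          (# (translates (suc c))) (# (translates c ∩ new)) (# (translates c)) (# new) c ℓ
          (#-∪-∩ (translates c) new) (#-empty (translates c ∩ new) disjoint)
          (#-translates c λ i 0<i i<c → free i 0<i (m<n⇒m<1+n i<c))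
          (trans (#-⊹ (seg e ℓ) (mult c h)) (#-seg e≢ε ℓ ℓ<n))
          where
          new : FSet n
          new = seg e ℓ ⊹ mult c h
          disjoint : ∀ z → z ∈ (translates c ∩ new) → ⊥
          disjoint z hz = clash (translates-elim c (proj₁ (∧-elim {translates c z} hz))) (seg-elim e ℓ (proj₂ (∧-elim {translates c z} hz)))
            where
            clash : (∃ λ a → a < c × (∃ λ x → x ≤ ℓ × z ≡ mult x e ∙ mult a h)) →
              (∃ λ x → x ≤ ℓ × z ∙ (mult c h ⁻¹) ≡ mult x e) → ⊥
            clash (a , a<c , x , x≤ , eq) (x′ , x′≤ , eq′) = free (c ∸ a) (m<n⇒0<n∸m a<c) (s≤s (m∸n≤m c a))
              (found (mult-difference e x x′))
              where
              diff : mult (c ∸ a) h ≡ mult x e ∙ (mult x′ e ⁻¹)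
              diff = ∙-cancelʳ (mult a h) (trans (cong (_∙ mult a h) (sym (mult-∸ h (<⇒≤ a<c)))) (trans (x∙a⁻¹∙a (mult c h) (mult a h))
                (sym (trans (∙-swap (mult x e) (mult x′ e ⁻¹) (mult a h)) (trans (cong (_∙ (mult x′ e ⁻¹)) (sym eq))
                  (trans (cong (λ w → z ∙ (w ⁻¹)) (sym eq′)) (trans (cong (z ∙_) (trans (⁻¹-∙ z (mult c h ⁻¹)) (cong ((z ⁻¹) ∙_) (⁻¹-involutive _))))
                    (trans (sym (assoc z (z ⁻¹) _)) (trans (cong (_∙ mult c h) (inverseʳ z)) (identityˡ _))))))))))
              found : (∃ λ y → y ≤ x + x′ × (∀ ℓ → x ≤ ℓ → x′ ≤ ℓ → y ≤ ℓ) × Length e (mult x e ∙ (mult x′ e ⁻¹)) y) → Collision (c ∸ a)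
              found (y , _ , y≤ , len) = y , s≤s (y≤ ℓ x≤ x′≤) , subst (λ z → Length e z y) (sym diff) len

        translates-⊆ : ∀ j → (∀ x → x ≤ ℓ → mult x e ∈ pow H j) → ∀ c → translates (suc c) ⊆ pow H (j + c)
        translates-⊆ j ap c z hz = inside (translates-elim (suc c) hz)
          where
          inside : (∃ λ a → a < suc c × (∃ λ x → x ≤ ℓ × z ≡ mult x e ∙ mult a h)) → z ∈ pow H (j + c)
          inside (a , s≤s a≤c , x , x≤ , eq) = subst (_∈ pow H (j + c)) (sym eq)
            (pow-+ H ε∈H j c (ap x x≤) (pow-mono H ε∈H a≤c _ (mult-pow-1 h∈H a)))

        collision : ∀ j c → (∀ x → x ≤ ℓ → mult x e ∈ pow H j) → # (pow H (j + c)) < suc c * suc ℓ →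
          ∃ λ i → 0 < i × i < suc c × Collision i × (∀ i′ → 0 < i′ → i′ < i → ¬ Collision i′)
        collision j c ap lt = pick (least (λ i → Length? e (mult i h) ℓ) (suc c))
          where
          pick : _ → _
          pick (inj₂ r) = r
          pick (inj₁ free) = ⊥-elim (<⇒≱ lt (≤-trans (≤-reflexive (sym (#-translates (suc c) free)))
            (#-mono (translates (suc c)) (pow H (j + c)) (translates-⊆ j ap c))))

      AP : ℕ → ℕ → Fin n → Set
      AP j ℓ e = ∀ x → x ≤ ℓ → mult x e ∈ pow H j

      -- If i h = y e with i minimal, then gcd(y, i) = 1; for e = i e′ the element
      -- h = y e′ together with the multiples of e yields all multiples of e′.
      refine : ∀ e h → ¬ e ≡ ε → ∀ j ℓ i y → AP j ℓ e → h ∈ H → 1 < i → i < n → y ≤ ℓ → mult i h ≡ mult y e →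
        (∀ i′ → 0 < i′ → i′ < i → ∀ y′ → y′ ≤ ℓ → ¬ mult i′ h ≡ mult y′ e) →
        ∃ λ e′ → ¬ e′ ≡ ε × AP (i + j) (i * ℓ) e′
      refine e h e≢ε j ℓ i y ap h∈H 1<i i<n y≤ℓ eq minimal = refined (divide i 0<i i<n e)
        where
        0<i : 0 < i
        0<i = <⇒≤ 1<i
        coprime : Coprime y i
        coprime {zero} (divides _ y≡ , divides q′ i≡) = ⊥-elim (<⇒≱ 0<i (≤-reflexive (trans i≡ (*-zeroʳ q′))))
        coprime {suc zero} _ = refl
        coprime {suc (suc d)} (divides y′ refl , divides zero refl) = ⊥-elim (<-irrefl refl 0<i)
        coprime {suc (suc d)} (divides y′ refl , divides i′@(suc _) refl) = ⊥-elim (minimal i′ (s≤s z≤n)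
          (m<m*n i′ (suc (suc d)) (s≤s (s≤s z≤n))) y′ (≤-trans (m≤m*n y′ (suc (suc d))) y≤ℓ)
          (mult-cancel {suc (suc d)} (s≤s z≤n) (≤-<-trans (m≤n*m (suc (suc d)) i′) i<n)
            (trans (sym (mult-* (suc (suc d)) i′ h)) (trans (cong (λ k → mult k h) (*-comm (suc (suc d)) i′))
              (trans eq (trans (cong (λ k → mult k e) (*-comm y′ (suc (suc d)))) (mult-* (suc (suc d)) y′ e)))))))
        refined : (∃ λ e′ → mult i e′ ≡ e) → ∃ λ e′ → ¬ e′ ≡ ε × AP (i + j) (i * ℓ) e′
        refined (e′ , ie′) = e′ , (λ { refl → e≢ε (trans (sym ie′) (mult-ε i)) }) , λ x x≤ → covered x (cover i y ℓ x 1<i coprime y≤ℓ x≤)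
          where
          h≡ : h ≡ mult y e′
          h≡ = mult-cancel 0<i i<n (trans eq (trans (cong (mult y) (sym ie′)) (trans (sym (mult-* y i e′))
            (trans (cong (λ k → mult k e′) (*-comm y i)) (mult-* i y e′)))))
          ah : ∀ a → mult (a * y) e′ ≡ mult a h
          ah a = trans (mult-* a y e′) (cong (mult a) (sym h≡))
          be : ∀ b → mult (b * i) e′ ≡ mult b e
          be b = trans (mult-* b i e′) (cong (mult b) ie′)
          covered : ∀ x → (∃ λ a → ∃ λ b → a ≤ i × b ≤ ℓ × ((x ≡ a * y + b * i) ⊎ (x + b * i ≡ a * y))) → mult x e′ ∈ pow H (i + j)
          covered x (a , b , a≤i , b≤ℓ , inj₁ refl) = subst (_∈ pow H (i + j))
            (trans (sym (cong₂ _∙_ (ah a) (be b))) (sym (mult-+ (a * y) (b * i) e′)))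
            (pow-+ H ε∈H i j (pow-mono H ε∈H a≤i _ (mult-pow-1 h∈H a)) (ap b b≤ℓ))
          covered x (a , b , a≤i , b≤ℓ , inj₂ sum≡) = subst (_∈ pow H (i + j))
            (trans (cong (_∙ (mult b e ⁻¹)) (trans (sym (ah a)) (trans (cong (λ k → mult k e′) (sym sum≡)) (trans (mult-+ x (b * i) e′) (cong (mult x e′ ∙_) (be b))))))
              (x∙a∙a⁻¹ _ _))
            (pow-+ H ε∈H i j (pow-mono H ε∈H a≤i _ (mult-pow-1 h∈H a)) (pow-sym H ε∈H H-sym j _ (ap b b≤ℓ)))

      module _ (J S : ℕ) (0<S : 0 < S) (pow≤S : # (pow H J) ≤ S) (S<n : S < n) where

        Straight : Set
        Straight = ∃ λ e → ∃ λ ℓ → ¬ e ≡ ε × AP J ℓ e × (∀ h → h ∈ H → ∃ λ y → y ≤ ℓ × Length e h y)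

        -- `d` summands are still available. A minimal collision i costs i of them and multiplies
        -- the length by i; it is at least 2 because h itself is too long. As i · dℓ ≥ 2iS and iℓ ≤
        -- S, the new product (d - i) · iℓ is at least iS ≥ 2S, so the invariant survives while d
        -- decreases.
        straighten : ∀ d → Acc _<_ d → ∀ j ℓ e → j + d ≡ J → 2 * S ≤ d * ℓ → ℓ < n → ¬ e ≡ ε → AP j ℓ e → Straight
        straighten d (acc rs) j ℓ e jd 2S≤ ℓ<n e≢ε ap = decide (Fin.any? λ h → (H h Bool.≟ true) ×-dec ¬? (Length? e h ℓ))
          where
          decide : Dec (∃ λ h → h ∈ H × ¬ (∃ λ y → y < suc ℓ × Length e h y)) → Straight
          decide (no ∄) = e , ℓ , e≢ε , (λ x x≤ → pow-mono H ε∈H (≤-trans (m≤m+n j d) (≤-reflexive jd)) _ (ap x x≤)) , λ h hh → within h hh (Length? e h ℓ)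
            where
            within : ∀ h → h ∈ H → Dec (∃ λ y → y < suc ℓ × Length e h y) → ∃ λ y → y ≤ ℓ × Length e h y
            within h hh (yes (y , s≤s y≤ , len)) = y , y≤ , len
            within h hh (no ¬len) = ⊥-elim (∄ (h , hh , ¬len))
          decide (yes (h , hh , far)) = search (division S (suc ℓ) (s≤s z≤n))
            where
            open Pigeonhole e h e≢ε hh ℓ ℓ<n
            search : (∃ λ c → c * suc ℓ ≤ S × S < suc c * suc ℓ) → Straight
            search (c , c≤ , c>) = improve (collision j c ap (≤-<-trans (≤-trans
                (#-mono (pow H (j + c)) (pow H J) (pow-mono H ε∈H (≤-trans (+-monoʳ-≤ j c≤d) (≤-reflexive jd)))) pow≤S) c>))
              where
              c≤d : c ≤ d
              c≤d = ≮⇒≥ λ lt → linarith 4 (λ S d ℓ c → κ 2 ⊗ S ⊴ d ⊗ ℓ ⇒ c ⊗ (κ 1 ⊕ ℓ) ⊴ S ⇒ (κ 1 ⊕ d) ⊗ (κ 1 ⊕ ℓ) ⊴ c ⊗ (κ 1 ⊕ ℓ) ⇒ ⊢⊥)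
                S d ℓ c 2S≤ c≤ (*-monoˡ-≤ (suc ℓ) lt)
              improve : (∃ λ i → 0 < i × i < suc c × Collision i × (∀ i′ → 0 < i′ → i′ < i → ¬ Collision i′)) → Straight
              improve (suc zero , _ , _ , (y , y< , len) , _) = ⊥-elim (far (y , y< , subst (λ z → Length e z y) (identityˡ h) len))
              improve (i@(suc (suc i′)) , 0<i , s≤s i≤c , (y , s≤s y≤ℓ , len) , minimal) = again (signed len)
                where
                iℓ≤S : i * ℓ ≤ S
                iℓ≤S = ≤-trans (*-mono-≤ i≤c (n≤1+n ℓ)) c≤
                i<n : i < n
                i<n = ≤-<-trans (≤-trans (m≤m*n i (suc ℓ)) (≤-trans (*-monoˡ-≤ (suc ℓ) i≤c) c≤)) S<n
                d≡ : i + (d ∸ i) ≡ d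
                d≡ = m+[n∸m]≡n (≤-trans i≤c c≤d)
                signed : Length e (mult i h) y → ∃ λ e′ → ¬ e′ ≡ ε × AP (i + j) (i * ℓ) e′
                signed (inj₁ eq) = refine e h e≢ε j ℓ i y ap hh (s≤s (s≤s z≤n)) i<n y≤ℓ eq λ k 0<k k<i y′ y′≤ eq′ → minimal k 0<k k<i (y′ , s≤s y′≤ , inj₁ eq′)
                signed (inj₂ eq) = refine e (h ⁻¹) e≢ε j ℓ i y ap (H-sym h hh) (s≤s (s≤s z≤n)) i<n y≤ℓ (trans (mult-⁻¹ i h) eq)
                  λ k 0<k k<i y′ y′≤ eq′ → minimal k 0<k k<i (y′ , s≤s y′≤ , inj₂ (trans (sym (mult-⁻¹ k h)) eq′))
                again : (∃ λ e′ → ¬ e′ ≡ ε × AP (i + j) (i * ℓ) e′) → Straight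
                again (e′ , e′≢ε , ap′) = straighten (d ∸ i) (rs (∸-monoʳ-< 0<i (≤-trans i≤c c≤d))) (i + j) (i * ℓ) e′
                  (trans (linarith 3 (λ i j d → ⊢ i ⊕ j ⊕ d ≐ j ⊕ (i ⊕ d)) i j (d ∸ i)) (trans (cong (j +_) d≡) jd))
                  (linarith 5 (λ S i d iℓ z → i ⊗ (κ 2 ⊗ S) ⊴ i ⊗ z ⇒ i ⊗ z ≐ (i ⊕ d) ⊗ iℓ ⇒ i ⊗ iℓ ⊴ i ⊗ S ⇒ κ 2 ⊗ S ⊴ i ⊗ S ⇒ ⊢ κ 2 ⊗ S ⊴ d ⊗ iℓ)
                    S i (d ∸ i) (i * ℓ) (d * ℓ) (*-monoʳ-≤ i 2S≤)
                    (trans (linarith 3 (λ i d ℓ → ⊢ i ⊗ (d ⊗ ℓ) ≐ d ⊗ (i ⊗ ℓ)) i d ℓ) (cong (_* (i * ℓ)) (sym d≡)))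
                    (*-monoʳ-≤ i iℓ≤S) (*-monoˡ-≤ S {2} {i} (s≤s (s≤s z≤n))))
                  (≤-<-trans iℓ≤S S<n) e′≢ε ap′

        module _ (s E i₂ : ℕ) (wide : 2 * (i₂ * suc (s + E)) < n) (narrow : # (pow H (J + i₂)) ≤ 2 * (i₂ * suc (s + E))) where

          -- An element of length y puts ye into H, and y ≤ ℓ means that each further summand H
          -- extends the progression by y without gaps. If y > s + E, then (J + i₂)H contains the
          -- multiples of e from -X to X with X = i₂(s + E + 1), one element more than `narrow`
          -- permits.
          short : Straight → ∃ λ e → ¬ e ≡ ε × (∀ h → h ∈ H → ∃ λ y → y ≤ s + E × Length e h y)
          short (e , ℓ , e≢ε , ap , lengths) = e , e≢ε , λ h hh → bound h hh (lengths h hh)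
            where
            bound : ∀ h → h ∈ H → (∃ λ y → y ≤ ℓ × Length e h y) → ∃ λ y → y ≤ s + E × Length e h y
            bound h hh (y , y≤ℓ , len) = y , ≮⇒≥ absurd , len
              where
              ye∈H : Length e h y → mult y e ∈ H
              ye∈H (inj₁ eq) = trans (cong H (sym eq)) hh
              ye∈H (inj₂ eq) = trans (cong H (sym eq)) (H-sym h hh)
              long : ∀ i x → x ≤ ℓ + i * y → mult x e ∈ pow H (J + i)
              long zero x x≤ = subst (λ k → mult x e ∈ pow H k) (sym (+-identityʳ J)) (ap x (≤-trans x≤ (≤-reflexive (+-identityʳ ℓ))))
              long (suc i) x x≤ with ≤-total x y
              ... | inj₁ x≤y = pow-mono H ε∈H (m≤m+n J (suc i)) _ (ap x (≤-trans x≤y y≤ℓ))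
              ... | inj₂ y≤x = subst₂ (λ z k → z ∈ pow H k) (trans (sym (mult-+ (x ∸ y) y e)) (cong (λ k → mult k e) (m∸n+n≡m y≤x))) (sym (+-suc J i))
                (⊞-intro (pow H (J + i)) H (long i (x ∸ y) (≤-trans (∸-monoˡ-≤ y x≤)
                  (≤-reflexive (trans (cong (_∸ y) (linarith 3 (λ ℓ y iy → ⊢ ℓ ⊕ (y ⊕ iy) ≐ y ⊕ (ℓ ⊕ iy)) ℓ y (i * y))) (m+n∸m≡n y (ℓ + i * y)))))) (ye∈H len))
              absurd : ¬ s + E < y
              absurd lt = <⇒≱ (≤-reflexive (sym (trans (#-⊹ (seg e (2 * X)) (mult X e ⁻¹)) (#-seg e≢ε (2 * X) wide))))
                (≤-trans (#-mono (seg e (2 * X) ⊹ (mult X e ⁻¹)) (pow H (J + i₂)) inside) narrow)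
                where
                X : ℕ
                X = i₂ * suc (s + E)
                reach : ∀ x → x ≤ X → mult x e ∈ pow H (J + i₂)
                reach x x≤ = long i₂ x (≤-trans x≤ (≤-trans (*-monoʳ-≤ i₂ lt) (m≤n+m _ ℓ)))
                inside : (seg e (2 * X) ⊹ (mult X e ⁻¹)) ⊆ pow H (J + i₂)
                inside z hz = place (seg-elim e (2 * X) hz)
                  where
                  place : (∃ λ x → x ≤ 2 * X × z ∙ ((mult X e ⁻¹) ⁻¹) ≡ mult x e) → z ∈ pow H (J + i₂)
                  place (x , x≤ , eq) = subst (_∈ pow H (J + i₂)) (sym z≡) (sign (≤-total X x))
                    where
                    z≡ : z ≡ mult x e ∙ (mult X e ⁻¹)
                    z≡ = trans (sym (x∙a∙a⁻¹ z (mult X e))) (cong (_∙ (mult X e ⁻¹)) (trans (cong (z ∙_) (sym (⁻¹-involutive _))) eq))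
                    sign : (X ≤ x) ⊎ (x ≤ X) → mult x e ∙ (mult X e ⁻¹) ∈ pow H (J + i₂)
                    sign (inj₁ le) = subst (_∈ pow H (J + i₂)) (sym (mult-∸ e le)) (reach (x ∸ X) (≤-trans (∸-monoˡ-≤ X x≤)
                      (≤-reflexive (trans (cong (λ k → X + k ∸ X) (+-identityʳ X)) (m+n∸m≡n X X)))))
                    sign (inj₂ le) = subst (_∈ pow H (J + i₂)) (trans (cong _⁻¹ (sym (mult-∸⁻¹ e le))) (⁻¹-involutive _))
                      (pow-sym H ε∈H H-sym (J + i₂) _ (reach (X ∸ x) (m∸n≤m X x)))

-- The inverse theorem: small gain under every shift of R forces R into a short progression.

module InverseTheorem (n : ℕ) (_∙_ : Fin n → Fin n → Fin n) (ε : Fin n) (_⁻¹ : Fin n → Fin n)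
  (isAbelianGroup : IsAbelianGroup _≡_ _∙_ ε _⁻¹)
  (simple : ∀ (X : FiniteSets.FSet n) a → ¬ a ≡ ε → (∀ x → X x ≡ true → X (x ∙ a) ≡ true) → ∀ x y → X x ≡ true → X y ≡ true)
  (odd : ∀ x → (x ∙ x) ≡ ε → x ≡ ε) where

  open FiniteSets

  open LinearArithmetic
  open Isoperimetry n _∙_ ε _⁻¹ isAbelianGroup simple
  open GreedyExtraction n _∙_ ε _⁻¹ isAbelianGroup simple odd
  open Stretching n _∙_ ε _⁻¹ isAbelianGroup simple
  open Constants

  module Bonferroni (U : FSet n) (thin : ∀ a → ¬ a ≡ ε → # (U ∩ (U ⊹ a)) < 2) where

    translates-∩ : ∀ w y → ¬ y ≡ w → # ((U ⊹ w) ∩ (U ⊹ y)) ≤ 1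
    translates-∩ w y y≢w = ≤-trans (≤-reflexive (trans (sym (sum-shift (λ z → 𝟙 (U (z ∙ (w ⁻¹)) ∧ U (z ∙ (y ⁻¹)))) w))
      (sum-cong-≗ λ z → cong₂ (λ a b → 𝟙 (U a ∧ U b)) (x∙a∙a⁻¹ z w) (lem z))))
      (≤-pred (thin (y ∙ (w ⁻¹)) λ e → y≢w (∙⁻¹≡ε e)))
      where
      lem : ∀ z → (z ∙ w) ∙ (y ⁻¹) ≡ z ∙ ((y ∙ (w ⁻¹)) ⁻¹)
      lem z = trans (assoc z w (y ⁻¹)) (cong (z ∙_) (trans (comm w (y ⁻¹))
        (sym (trans (⁻¹-∙ y (w ⁻¹)) (cong ((y ⁻¹) ∙_) (⁻¹-involutive w))))))

    ⊞-∩-⊹ : ∀ W y → y ∉ W → # ((U ⊞ W) ∩ (U ⊹ y)) ≤ # W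
    ⊞-∩-⊹ W y y∉W = ≤-trans (sum-mono covered) (≤-trans (≤-reflexive (∑-comm (λ z w → 𝟙 (W w ∧ ((U ⊹ w) z ∧ (U ⊹ y) z)))))
      (sum-mono column))
      where
      covered : ∀ z → 𝟙 ((U ⊞ W) z ∧ (U ⊹ y) z) ≤ sum (λ w → 𝟙 (W w ∧ ((U ⊹ w) z ∧ (U ⊹ y) z)))
      covered z = bound ((U ⊞ W) z ∧ (U ⊹ y) z) refl
        where
        bound : ∀ b → (U ⊞ W) z ∧ (U ⊹ y) z ≡ b → 𝟙 b ≤ sum (λ w → 𝟙 (W w ∧ ((U ⊹ w) z ∧ (U ⊹ y) z)))
        bound false _ = z≤n
        bound true e = witness (⊞-elim U W (proj₁ (∧-elim {(U ⊞ W) z} e)))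
          where
          witness : (∃ λ x → ∃ λ w → x ∈ U × w ∈ W × z ≡ x ∙ w) → 1 ≤ sum (λ w → 𝟙 (W w ∧ ((U ⊹ w) z ∧ (U ⊹ y) z)))
          witness (x , w , xU , wW , eq) = ∈⇒#-pos (λ w → W w ∧ ((U ⊹ w) z ∧ (U ⊹ y) z)) {w}
            (∧-intro wW (∧-intro (trans (cong (λ v → U (v ∙ (w ⁻¹))) eq) (∈-⊹ U w xU)) (proj₂ (∧-elim {(U ⊞ W) z} e))))
      column : ∀ w → sum (λ z → 𝟙 (W w ∧ ((U ⊹ w) z ∧ (U ⊹ y) z))) ≤ 𝟙 (W w)
      column w = bound (W w) refl
        where
        bound : ∀ b → W w ≡ b → sum (λ z → 𝟙 (b ∧ ((U ⊹ w) z ∧ (U ⊹ y) z))) ≤ 𝟙 b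
        bound false _ = ≤-reflexive (trans (sum-const n 0) (*-zeroʳ n))
        bound true wW = translates-∩ w y λ { refl → true≢false wW y∉W }

    -- Distinct translates of U share at most one point, so a new one meets the t translates already
    -- taken in at most t points; t² is a crude bound for the total loss.
    bonferroni : ∀ H t → t ≤ # H → ∃ λ W → W ⊆ H × # W ≡ t × t * # U ≤ # (U ⊞ W) + t * t
    bonferroni H zero _ = (λ _ → false) , (λ x ()) , #-empty {n} (λ _ → false) (λ x ()) , z≤n
    bonferroni H (suc t) t<H = extend (bonferroni H t (<⇒≤ t<H))
      where
      extend : (∃ λ W → W ⊆ H × # W ≡ t × t * # U ≤ # (U ⊞ W) + t * t) →
        ∃ λ W → W ⊆ H × # W ≡ suc t × suc t * # U ≤ # (U ⊞ W) + suc t * suc t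
      extend (W , W⊆H , #W , many) = choose (#-pos⇒∃ (H ∖ W)
        (linarith 4 (λ i d h w → i ⊕ d ≐ h ⇒ i ⊴ w ⇒ w ⊲ h ⇒ ⊢ κ 0 ⊲ d) (# (H ∩ W)) (# (H ∖ W)) (# H) (# W)
          (#-∩-∖ H W) (#-mono (H ∩ W) W λ x → proj₂ ∘ ∧-elim {H x}) (≤-<-trans (≤-reflexive #W) t<H)))
        where
        choose : (∃ λ y → y ∈ (H ∖ W)) → ∃ λ W → W ⊆ H × # W ≡ suc t × suc t * # U ≤ # (U ⊞ W) + suc t * suc t
        choose (y , hy) = W′ , sub , trans (#-insert W y y∉W) (cong suc #W) ,
          linarith 8 (λ t u V V′ i c w x → t ⊗ u ⊴ V ⊕ t ⊗ t ⇒ c ⊕ i ≐ V ⊕ x ⇒ x ≐ u ⇒ i ⊴ w ⇒ w ≐ t ⇒ c ⊴ V′ ⇒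
              ⊢ (κ 1 ⊕ t) ⊗ u ⊴ V′ ⊕ (κ 1 ⊕ t) ⊗ (κ 1 ⊕ t))
            t (# U) (# (U ⊞ W)) (# (U ⊞ W′)) (# ((U ⊞ W) ∩ (U ⊹ y))) (# ((U ⊞ W) ∪ (U ⊹ y))) (# W) (# (U ⊹ y))
            many (#-∪-∩ (U ⊞ W) (U ⊹ y)) (#-⊹ U y) (⊞-∩-⊹ W y y∉W) #W (#-mono ((U ⊞ W) ∪ (U ⊹ y)) (U ⊞ W′) inside)
          where
          W′ : FSet n
          W′ = W ∪ ⁅ y ⁆
          y∉W : y ∉ W
          y∉W = not-elim (proj₂ (∧-elim {H y} hy))
          sub : W′ ⊆ H
          sub x hx = [ W⊆H x , (λ e → trans (cong H (∈⁅⁆⇒≡ e)) (proj₁ (∧-elim {H y} hy))) ]′ (∨-elim {W x} hx)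
          inside : ((U ⊞ W) ∪ (U ⊹ y)) ⊆ (U ⊞ W′)
          inside z hz = [ (λ h → old (⊞-elim U W h)) , (λ h → subst (_∈ (U ⊞ W′)) (x∙a⁻¹∙a z y) (⊞-intro U W′ h (∨-introʳ {W y} (∈⁅⁆ y)))) ]′ (∨-elim {(U ⊞ W) z} hz)
            where
            old : (∃ λ x → ∃ λ w → x ∈ U × w ∈ W × z ≡ x ∙ w) → z ∈ (U ⊞ W′)
            old (x , w , xU , wW , refl) = ⊞-intro U W′ xU (∨-introˡ wW)

  module _ (H : FSet n) (H-sym : Symmetric H) (ε∈H : ε ∈ H) where

    -- For a 2-atom U, |U + H| exceeds |U| by at most 2s + 5L, because H itself does. By
    -- `bonferroni` with t + 1 translates, |U| ≤ L. For distinct a and b in U both H + a and H + b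
    -- lie in U + H, so the shift by a - b moves at most 6L elements out of H.
    small-shift : ∀ s L t → # H ≡ suc (2 * s) → # (H ⊞ H) ≤ 1 + s * 4 + L * 5 → # (H ⊞ H) + 2 ≤ n → 0 < s →
      s * 2 + L * 5 + suc t * suc t ≤ t * L → suc t ≤ # H → ∃ λ u → ¬ u ≡ ε × out H u ≤ L * 6
    small-shift s L t #H doubling proper 0<s t-large t≤ = use (atom-exists H H-adm)
      where
      open Atoms H H-sym ε∈H 2 (s≤s z≤n)
      H-adm : Admissible H
      H-adm = linarith 2 (λ h s → h ≐ κ 1 ⊕ κ 2 ⊗ s ⇒ κ 0 ⊲ s ⇒ ⊢ κ 2 ⊴ h) (# H) s #H 0<s , proper
      use : ∃ IsAtom → ∃ λ u → ¬ u ≡ ε × out H u ≤ L * 6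
      use (U , atom) = difference (#-two⇒∃ U (proj₁ (proj₁ atom)))
        where
        open Bonferroni U (atom-∩< atom)
        bdU : bd U ≤ # U + s * 2 + L * 5
        bdU = linarith 6 (λ bu u bh h s L → bu ⊕ h ⊴ bh ⊕ u ⇒ bh ⊴ κ 1 ⊕ s ⊗ κ 4 ⊕ L ⊗ κ 5 ⇒ h ≐ κ 1 ⊕ κ 2 ⊗ s ⇒ ⊢ bu ⊴ u ⊕ s ⊗ κ 2 ⊕ L ⊗ κ 5)
          (bd U) (# U) (bd H) (# H) s L (bd-atom≤ atom H H-adm) doubling #H
        #U≤ : # U ≤ L
        #U≤ = bound (bonferroni H (suc t) t≤)
          where
          bound : (∃ λ W → W ⊆ H × # W ≡ suc t × suc t * # U ≤ # (U ⊞ W) + suc t * suc t) → # U ≤ L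
          bound (W , W⊆H , _ , many) = ≮⇒≥ λ lt → linarith 7 (λ t u V b s L tL → (κ 1 ⊕ t) ⊗ u ⊴ V ⊕ (κ 1 ⊕ t) ⊗ (κ 1 ⊕ t) ⇒ V ⊴ b ⇒
              b ⊴ u ⊕ s ⊗ κ 2 ⊕ L ⊗ κ 5 ⇒ s ⊗ κ 2 ⊕ L ⊗ κ 5 ⊕ (κ 1 ⊕ t) ⊗ (κ 1 ⊕ t) ⊴ t ⊗ L ⇒ t ⊗ (κ 1 ⊕ L) ⊴ t ⊗ u ⇒ κ 1 ⊴ t ⇒ ⊢⊥)
            t (# U) (# (U ⊞ W)) (bd U) s L 0 many
            (#-mono (U ⊞ W) (U ⊞ H) λ z hz → let (x , w , xU , wW , eq) = ⊞-elim U W hz in subst (_∈ (U ⊞ H)) (sym eq) (⊞-intro U H xU (W⊆H w wW)))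
            bdU t-large (*-monoʳ-≤ t lt) (pos t t-large)
            where
            pos : ∀ t → s * 2 + L * 5 + suc t * suc t ≤ t * L → 1 ≤ t
            pos zero h = ⊥-elim (<⇒≱ (≤-trans (s≤s z≤n) (m≤n+m 1 (s * 2 + L * 5))) h)
            pos (suc t) h = s≤s z≤n
        difference : (∃ λ a → ∃ λ b → a ∈ U × b ∈ U × ¬ a ≡ b) → ∃ λ u → ¬ u ≡ ε × out H u ≤ L * 6
        difference (a , b , aU , bU , a≢b) = a ∙ (b ⁻¹) , (λ e → a≢b (∙⁻¹≡ε e)) ,
          linarith 7 (λ o h p b u s L → p ≐ h ⊕ o ⇒ p ⊴ b ⇒ b ⊴ u ⊕ s ⊗ κ 2 ⊕ L ⊗ κ 5 ⇒ u ⊴ L ⇒ h ≐ κ 1 ⊕ κ 2 ⊗ s ⇒ ⊢ o ⊴ L ⊗ κ 6)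
            (out H u) (# H) (# pair) (bd U) (# U) s L (#-∪-⊹ H u)
            (≤-trans (≤-reflexive (sym (#-⊹ pair b))) (#-mono (pair ⊹ b) (U ⊞ H) inside)) bdU #U≤ #H
          where
          u : Fin n
          u = a ∙ (b ⁻¹)
          pair : FSet n
          pair = H ∪ (H ⊹ u)
          inside : (pair ⊹ b) ⊆ (U ⊞ H)
          inside z hz = [ (λ h → subst (_∈ (U ⊞ H)) (x∙[y∙x⁻¹] b z) (⊞-intro U H bU h)) ,
            (λ h → subst (_∈ (U ⊞ H)) (trans (cong (λ v → a ∙ v) lem) (x∙[y∙x⁻¹] a z)) (⊞-intro U H aU h)) ]′ (∨-elim {H (z ∙ (b ⁻¹))} hz)
            where
            lem : (z ∙ (b ⁻¹)) ∙ (u ⁻¹) ≡ z ∙ (a ⁻¹)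
            lem = trans (cong ((z ∙ (b ⁻¹)) ∙_) (trans (⁻¹-∙ a (b ⁻¹)) (trans (cong ((a ⁻¹) ∙_) (⁻¹-involutive b)) (comm _ _))))
              (trans (sym (assoc _ b (a ⁻¹))) (cong (_∙ (a ⁻¹)) (x∙a⁻¹∙a z b)))

    runs : Fin n → ℕ → FSet n
    runs u zero = H
    runs u (suc i) x = runs u i x ∧ H (x ∙ mult (suc i) u)

    runs-elim : ∀ u ℓ x → x ∈ runs u ℓ → ∀ i → i ≤ ℓ → (x ∙ mult i u) ∈ H
    runs-elim u zero x hx zero _ = trans (cong H (identityʳ x)) hx
    runs-elim u (suc ℓ) x hx i i≤ = [ (λ lt → runs-elim u ℓ x (proj₁ (∧-elim {runs u ℓ x} hx)) i (≤-pred lt)) ,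
      (λ { refl → proj₂ (∧-elim {runs u ℓ x} hx) }) ]′ (m≤n⇒m<n∨m≡n i≤)

    #-runs : ∀ u ℓ → # H ≤ # (runs u ℓ) + ℓ * out H u
    #-runs u zero = m≤m+n _ _
    #-runs u (suc ℓ) = linarith 5 (λ h r r′ ℓo o → h ⊴ r ⊕ ℓo ⇒ r ⊴ r′ ⊕ o ⇒ ⊢ h ⊴ r′ ⊕ (o ⊕ ℓo))
      (# H) (# (runs u ℓ)) (# (runs u (suc ℓ))) (ℓ * out H u) (out H u) (#-runs u ℓ)
      (≤-trans (≤-reflexive (sym (#-∩-∖ (runs u ℓ) (λ x → H (x ∙ mult (suc ℓ) u)))))
        (+-monoʳ-≤ (# (runs u (suc ℓ))) (≤-trans (#-mono (runs u ℓ ∖ (λ x → H (x ∙ mult (suc ℓ) u))) lost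
            λ x hx → ∧-intro (runs-elim u ℓ x (proj₁ (∧-elim {runs u ℓ x} hx)) ℓ ≤-refl)
              (trans (cong (λ y → not (H y)) (assoc x (mult ℓ u) u)) (proj₂ (∧-elim {runs u ℓ x} hx))))
          (≤-reflexive (sum-shift (λ x → 𝟙 (H x ∧ not (H (x ∙ u)))) (mult ℓ u))))))
      where
      lost : FSet n
      lost x = H (x ∙ mult ℓ u) ∧ not (H ((x ∙ mult ℓ u) ∙ u))

    -- Each step of a run costs at most `out H u` starting points, so some run x, x + u, ..., x + ℓu
    -- stays in H; iu is a difference of two of its members.
    run-differences : ∀ u ℓ → ℓ * out H u < # H → ∀ i → i ≤ ℓ → mult i u ∈ pow H 2
    run-differences u ℓ lt i i≤ = use (#-pos⇒∃ (runs u ℓ) (+-cancelʳ-< (ℓ * out H u) 0 (# (runs u ℓ)) (≤-trans lt (#-runs u ℓ))))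
      where
      use : (∃ λ x → x ∈ runs u ℓ) → mult i u ∈ pow H 2
      use (x , hx) = subst (_∈ pow H 2) (trans (cong (_∙ (x ⁻¹)) (comm x (mult i u))) (x∙a∙a⁻¹ (mult i u) x))
        (⊞-intro (pow H 1) H (subst (_∈ pow H 1) (identityˡ _) (⊞-intro ⁅ ε ⁆ H (∈⁅⁆ ε) (runs-elim u ℓ x hx i i≤)))
          (H-sym x (subst (_∈ H) (identityʳ x) (runs-elim u ℓ x hx 0 z≤n))))

  module _ (torsion : ∀ i x → 0 < i → i < n → mult i x ≡ ε → x ≡ ε)
    (divide : ∀ i → 0 < i → i < n → ∀ e → ∃ λ e′ → mult i e′ ≡ e)
    (w s L E : ℕ) (R B : FSet n) (anti : Antisymmetric R) (#R : # R ≡ s) (6w≤s : w * 6 ≤ s) (s≤7w : s ≤ w * 7)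
    (B-large : w * w * 7 ≤ # B) (B-half : # B * 2 ≤ n) (B-out : ∀ x → x ∈ R → out B x ≤ s + L) (scales : Scales w L E) where

    private
      open Scales scales
      open Hull R anti

      v J S X : ℕ
      v = s + L
      J = i₁ * 4
      S = J * w * 25
      X = i₂ * suc (s + E)

      v≤8w : v ≤ w * 8
      v≤8w = linarith 3 (λ s L w → s ⊴ w ⊗ κ 7 ⇒ L ⊴ w ⇒ ⊢ s ⊕ L ⊴ w ⊗ κ 8) s L w s≤7w L≤w

      0<s : 0 < s
      0<s = linarith 2 (λ s w → w ⊗ κ 6 ⊴ s ⇒ κ 1000 ⊴ w ⇒ ⊢ κ 0 ⊲ s) s w 6w≤s 1000≤w

      #H : # H ≡ suc (2 * s)
      #H = trans #-H (cong (λ k → suc (2 * k)) #R)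

      14ww≤n : w * w * 14 ≤ n
      14ww≤n = linarith 3 (λ w b n → w ⊗ w ⊗ κ 7 ⊴ b ⇒ b ⊗ κ 2 ⊴ n ⇒ ⊢ w ⊗ w ⊗ κ 14 ⊴ n) w (# B) n B-large B-half

      1000w≤ww : w * 1000 ≤ w * w
      1000w≤ww = *-monoʳ-≤ w 1000≤w

      -- By subadditivity `out B` is at most jv on jH, so `width` bounds |jH| by about 2jv with
      -- relative error 14/h.
      pow-bound : ∀ j h → 0 < j → 15 ≤ h → suc h * j * 16 ≤ w * 7 → ∀ g → suc g ≤ # (pow H j) →
        g * h ≤ 2 * (j * v) * h + 28 * (j * v)
      pow-bound j h 0<j 15≤h room g hg = width B (pow H j) (ε∈pow H ε∈H j) (pow-sym H ε∈H H-sym j) (j * v)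
        (*-mono-≤ 0<j (≤-trans 0<s (m≤m+n s L)))
        (λ x hx → out-pow H ε∈H B v (out-H B v B-out) j x hx)
        (≤-trans (≤-reflexive (*-comm 2 (# B))) B-half) g h 15≤h fits hg
        where
        fits : 2 * suc h * (j * v) ≤ # B
        fits = linarith 6 (λ w b h j v z → w ⊗ w ⊗ κ 7 ⊴ b ⇒ (κ 1 ⊕ h) ⊗ j ⊗ κ 16 ⊗ w ⊴ w ⊗ κ 7 ⊗ w ⇒
            ((κ 1 ⊕ h) ⊗ j) ⊗ v ⊴ ((κ 1 ⊕ h) ⊗ j) ⊗ (w ⊗ κ 8) ⇒ ⊢ κ 2 ⊗ (κ 1 ⊕ h) ⊗ (j ⊗ v) ⊴ b)
          w (# B) h j v 0 B-large (*-monoˡ-≤ w room) (*-monoʳ-≤ (suc h * j) v≤8w)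

      size : ∀ (Y : FSet n) → 0 < # Y → ∃ λ g → suc g ≡ # Y
      size Y h = # Y ∸ 1 , m+[n∸m]≡n h

      pow-pos : ∀ j → 0 < # (pow H j)
      pow-pos j = ∈⇒#-pos (pow H j) (ε∈pow H ε∈H j)

      doubling : # (H ⊞ H) ≤ 1 + s * 4 + L * 5
      doubling = ≤-trans (#-mono (H ⊞ H) (pow H 2) sub) (bound (size (pow H 2) (pow-pos 2)))
        where
        sub : (H ⊞ H) ⊆ pow H 2
        sub z hz = let (x , y , hx , hy , eq) = ⊞-elim H H hz in subst (_∈ pow H 2) (sym eq)
          (⊞-intro (pow H 1) H (subst (_∈ pow H 1) (identityˡ x) (⊞-intro ⁅ ε ⁆ H (∈⁅⁆ ε) hx)) hy)
        bound : (∃ λ g → suc g ≡ # (pow H 2)) → # (pow H 2) ≤ 1 + s * 4 + L * 5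
        bound (g , eq) = ≤-trans (≤-reflexive (sym eq)) (s≤s (*-cancelʳ-≤ g (s * 4 + L * 5) h₂ {{>-nonZero (≤-trans (s≤s z≤n) 15≤h₂)}}
          (linarith 5 (λ g h s L w → g ⊗ h ⊴ κ 2 ⊗ (κ 2 ⊗ (s ⊕ L)) ⊗ h ⊕ κ 28 ⊗ (κ 2 ⊗ (s ⊕ L)) ⇒ w ⊗ κ 448 ⊴ h ⊗ L ⇒ s ⊕ L ⊴ w ⊗ κ 8 ⇒
              ⊢ g ⊗ h ⊴ (s ⊗ κ 4 ⊕ L ⊗ κ 5) ⊗ h)
            g h₂ s L w (pow-bound 2 h₂ (s≤s z≤n) 15≤h₂ (≤-trans (≤-reflexive (*-assoc (suc h₂) 2 16)) h₂-small) g (≤-reflexive eq))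
            h₂-large v≤8w)))

      proper : # (H ⊞ H) + 2 ≤ n
      proper = linarith 6 (λ d s L w n ww → d ⊴ κ 1 ⊕ s ⊗ κ 4 ⊕ L ⊗ κ 5 ⇒ s ⊴ w ⊗ κ 7 ⇒ L ⊴ w ⇒ ww ⊗ κ 14 ⊴ n ⇒ w ⊗ κ 1000 ⊴ ww ⇒ κ 1000 ⊴ w ⇒
          ⊢ d ⊕ κ 2 ⊴ n)
        (# (H ⊞ H)) s L w n (w * w) doubling s≤7w L≤w 14ww≤n 1000w≤ww 1000≤w

      short-step : ∃ λ u → ¬ u ≡ ε × out H u ≤ L * 6
      short-step = small-shift H H-sym ε∈H s L t #H doubling proper 0<s
        (linarith 5 (λ s w L tt tL → s ⊴ w ⊗ κ 7 ⇒ w ⊗ κ 14 ⊕ L ⊗ κ 5 ⊕ tt ⊴ tL ⇒ ⊢ s ⊗ κ 2 ⊕ L ⊗ κ 5 ⊕ tt ⊴ tL)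
          s w L (suc t * suc t) (t * L) s≤7w t-large)
        (linarith 4 (λ t w s h → κ 1 ⊕ t ⊴ w ⇒ w ⊗ κ 6 ⊴ s ⇒ h ≐ κ 1 ⊕ κ 2 ⊗ s ⇒ ⊢ κ 1 ⊕ t ⊴ h) t w s (# H) t-small 6w≤s #H)

      open Progressions torsion divide H ε∈H H-sym

      0<S : 0 < S
      0<S = *-mono-≤ {1} {J * w} {1} {25} (*-mono-≤ {1} {J} {1} {w} (*-mono-≤ {1} {i₁} {1} {4} 0<i₁ (s≤s z≤n)) (≤-trans (s≤s z≤n) 1000≤w)) (s≤s z≤n)

      pow≤S : # (pow H J) ≤ S
      pow≤S = bound (size (pow H J) (pow-pos J))
        where
        bound : (∃ λ g → suc g ≡ # (pow H J)) → # (pow H J) ≤ S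
        bound (g , eq) = ≤-trans (≤-reflexive (sym eq)) (linarith 4 (λ g J v w →
            g ⊗ κ 28 ⊴ κ 2 ⊗ (J ⊗ v) ⊗ κ 28 ⊕ κ 28 ⊗ (J ⊗ v) ⇒ J ⊗ v ⊴ J ⊗ (w ⊗ κ 8) ⇒ κ 1 ⊴ J ⊗ w ⇒ ⊢ κ 1 ⊕ g ⊴ J ⊗ w ⊗ κ 25)
          g J v w (pow-bound J 28 0<J (m≤m+n 15 13) (≤-trans (linarith 1 (λ J → ⊢ κ 29 ⊗ J ⊗ κ 16 ⊴ J ⊗ κ 464) J) i₁-small) g (≤-reflexive eq))
          (*-monoʳ-≤ J v≤8w) (*-mono-≤ 0<J (≤-trans (s≤s z≤n) 1000≤w)))
          where
          0<J : 0 < J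
          0<J = *-mono-≤ {1} {i₁} {1} {4} 0<i₁ (s≤s z≤n)

      0<ww : 1 ≤ w * w
      0<ww = *-mono-≤ (≤-trans (s≤s z≤n) 1000≤w) (≤-trans (s≤s z≤n) 1000≤w)

      S<n : S < n
      S<n = linarith 3 (λ J w n → J ⊗ κ 464 ⊗ w ⊴ w ⊗ κ 7 ⊗ w ⇒ w ⊗ w ⊗ κ 14 ⊴ n ⇒ κ 1 ⊴ w ⊗ w ⇒ ⊢ J ⊗ w ⊗ κ 25 ⊲ n)
        J w n (*-monoˡ-≤ w i₁-small) 14ww≤n 0<ww

      -- 2H contains the multiples of u up to ℓ₀; i₁ such runs end to end use 2i₁ summands, half of
      -- the budget J = 4i₁. The initial condition of `straighten` then reads 200i₁w ≤ 2i₁ · i₁ℓ₀,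
      -- whence i₁ℓ₀ ≥ 100w.
      straight : Straight J S 0<S pow≤S S<n
      straight = begin short-step
        where
        begin : (∃ λ u → ¬ u ≡ ε × out H u ≤ L * 6) → Straight J S 0<S pow≤S S<n
        begin (u , u≢ε , out≤) = straighten J S 0<S pow≤S S<n (i₁ * 2) (<-wellFounded _) (i₁ * 2) (i₁ * ℓ₀) u
            (linarith 1 (λ i → ⊢ i ⊗ κ 2 ⊕ i ⊗ κ 2 ≐ i ⊗ κ 4) i₁)
            (linarith 3 (λ i w z → i ⊗ (w ⊗ κ 100) ⊴ i ⊗ z ⇒ ⊢ κ 2 ⊗ (i ⊗ κ 4 ⊗ w ⊗ κ 25) ⊴ i ⊗ κ 2 ⊗ z) i₁ w (i₁ * ℓ₀) (*-monoʳ-≤ i₁ i₁-large))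
            (linarith 3 (λ l ww n → l ⊴ ww ⇒ ww ⊗ κ 14 ⊴ n ⇒ κ 1 ⊴ ww ⇒ ⊢ l ⊲ n) (i₁ * ℓ₀) (w * w) n i₁ℓ₀-small 14ww≤n 0<ww)
            u≢ε (long i₁)
          where
          short-run : ∀ i → i ≤ ℓ₀ → mult i u ∈ pow H 2
          short-run = run-differences H H-sym ε∈H u ℓ₀ (linarith 6 (λ ℓo ℓL h s w L → ℓo ⊴ ℓL ⊗ κ 6 ⇒ ℓL ⊴ w ⊗ κ 2 ⇒ w ⊗ κ 6 ⊴ s ⇒ h ≐ κ 1 ⊕ κ 2 ⊗ s ⇒ ⊢ ℓo ⊲ h)
            (ℓ₀ * out H u) (ℓ₀ * L) (# H) s w L
            (≤-trans (*-monoʳ-≤ ℓ₀ out≤) (≤-reflexive (sym (*-assoc ℓ₀ L 6)))) ℓ₀-small 6w≤s #H)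
          long : ∀ i x → x ≤ i * ℓ₀ → mult x u ∈ pow H (i * 2)
          long zero x x≤ = subst (λ k → mult k u ∈ ⁅ ε ⁆) (sym (n≤0⇒n≡0 x≤)) (∈⁅⁆ ε)
          long (suc i) x x≤ with ≤-total x ℓ₀
          ... | inj₁ le = pow-mono H ε∈H {2} {suc i * 2} (s≤s (s≤s z≤n)) _ (short-run x le)
          ... | inj₂ ge = subst (_∈ pow H (suc i * 2)) (trans (sym (mult-+ ℓ₀ (x ∸ ℓ₀) u)) (cong (λ k → mult k u) (m+[n∸m]≡n ge)))
            (pow-+ H ε∈H 2 (i * 2) (short-run ℓ₀ ≤-refl) (long i (x ∸ ℓ₀) (≤-trans (∸-monoˡ-≤ ℓ₀ x≤) (≤-reflexive (m+n∸m≡n ℓ₀ (i * ℓ₀))))))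

      i₂w≤ : i₂ * w * 256 ≤ w * w * 7
      i₂w≤ = linarith 5 (λ i w J z h → (κ 1 ⊕ h) ⊗ (J ⊕ i) ⊗ κ 16 ⊗ w ⊴ w ⊗ κ 7 ⊗ w ⇒ κ 15 ⊗ ((J ⊕ i) ⊗ w) ⊴ h ⊗ ((J ⊕ i) ⊗ w) ⇒ ⊢ i ⊗ w ⊗ κ 256 ⊴ w ⊗ w ⊗ κ 7)
        i₂ w J 0 h₃ (*-monoˡ-≤ w i₂-small) (*-monoˡ-≤ ((J + i₂) * w) 15≤h₃)

      wide : 2 * X < n
      wide = linarith 6 (λ i s E w n X → X ≐ i ⊗ (κ 1 ⊕ (s ⊕ E)) ⇒ i ⊗ (κ 1 ⊕ (s ⊕ E)) ⊴ i ⊗ (w ⊗ κ 9) ⇒ i ⊗ w ⊗ κ 256 ⊴ w ⊗ w ⊗ κ 7 ⇒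
          w ⊗ w ⊗ κ 14 ⊴ n ⇒ κ 1 ⊴ w ⊗ w ⇒ ⊢ κ 2 ⊗ X ⊲ n)
        i₂ s E w n X refl (*-monoʳ-≤ i₂ (linarith 3 (λ s E w → s ⊴ w ⊗ κ 7 ⇒ E ⊴ w ⇒ κ 1000 ⊴ w ⇒ ⊢ κ 1 ⊕ (s ⊕ E) ⊴ w ⊗ κ 9) s E w s≤7w E≤w 1000≤w))
        i₂w≤ 14ww≤n 0<ww

      -- With `i₂` far larger than `J`, |(J + i₂)H| is about 2i₂s, and the allowance 2i₂E covers
      -- what `J`, `L` and the precision `h₃` contribute.
      narrow : # (pow H (J + i₂)) ≤ 2 * X
      narrow = ≮⇒≥ λ lt → linarith 8 (λ i s E h L w J v →
          κ 2 ⊗ (i ⊗ (κ 1 ⊕ (s ⊕ E))) ⊗ h ⊴ κ 2 ⊗ ((J ⊕ i) ⊗ (s ⊕ L)) ⊗ h ⊕ κ 28 ⊗ ((J ⊕ i) ⊗ (s ⊕ L)) ⇒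
          J ⊗ (s ⊕ L) ⊗ h ⊴ J ⊗ (w ⊗ κ 8) ⊗ h ⇒ J ⊗ (s ⊕ L) ⊴ J ⊗ (w ⊗ κ 8) ⇒ i ⊗ s ⊴ i ⊗ (w ⊗ κ 7) ⇒
          J ⊗ w ⊗ (h ⊗ κ 16 ⊕ κ 224) ⊕ i ⊗ L ⊗ (h ⊗ κ 2 ⊕ κ 28) ⊕ i ⊗ w ⊗ κ 196 ⊴ i ⊗ h ⊗ E ⊗ κ 2 ⇒ κ 1 ⊴ i ⊗ h ⇒ ⊢⊥)
        i₂ s E h₃ L w J v (pow-bound (J + i₂) h₃ (≤-trans 0<i₂ (m≤n+m i₂ J)) 15≤h₃ i₂-small (2 * X) lt)
        (*-monoˡ-≤ h₃ (*-monoʳ-≤ J v≤8w)) (*-monoʳ-≤ J v≤8w) (*-monoʳ-≤ i₂ s≤7w) i₂-large (*-mono-≤ 0<i₂ (≤-trans (s≤s z≤n) 15≤h₃))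

    inverse : ∃ λ e → ¬ e ≡ ε × (∀ x → x ∈ R → ∃ λ y → y ≤ s + E × Length e x y)
    inverse = let (e , e≢ε , lengths) = short J S 0<S pow≤S S<n s E i₂ wide narrow straight in e , e≢ε , λ x hx → lengths x (R⊆H x hx)

-- The additive group of Z/pZ.

module Residues (p : ℕ) (prime : Prime p) (2<p : 2 < p) where

  open LinearArithmetic
  open FiniteSets
  open import Data.Nat.DivMod using (_mod_; [m+kn]%n≡m%n; %-distribˡ-+; m<n⇒m%n≡m; n%n≡0)
  open import Data.Nat.Divisibility using (m%n≡0⇒n∣m)
  open import Data.Nat.Coprimality using (prime⇒coprime) renaming (sym to coprime-sym)

  instance
    p≢0 : NonZero p
    p≢0 = >-nonZero (≤-trans (s≤s z≤n) 2<p)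

  0<p : 0 < p
  0<p = ≤-trans (s≤s z≤n) 2<p

  π : ℕ → Fin p
  π m = m mod p

  toℕ-π : ∀ m → toℕ (π m) ≡ m % p
  toℕ-π m = toℕ-fromℕ< (m%n<n m p)

  π-cong : ∀ {m n} → m % p ≡ n % p → π m ≡ π n
  π-cong {m} {n} e = toℕ-injective (trans (toℕ-π m) (trans e (sym (toℕ-π n))))

  π-toℕ : ∀ x → π (toℕ x) ≡ x
  π-toℕ x = toℕ-injective (trans (toℕ-π (toℕ x)) (m<n⇒m%n≡m (toℕ<n x)))

  toℕ-π-< : ∀ {m} → m < p → toℕ (π m) ≡ m
  toℕ-π-< {m} lt = trans (toℕ-π m) (m<n⇒m%n≡m lt)

  π-+kp : ∀ m k → π (m + k * p) ≡ π m
  π-+kp m k = π-cong ([m+kn]%n≡m%n m k p)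

  π-elim : ∀ {m n} → π m ≡ π n → ∃ λ k → ∃ λ l → m + k * p ≡ n + l * p
  π-elim {m} {n} e = n / p , m / p , linarith 6 (λ m n r r′ a b → m ≐ r ⊕ a ⇒ n ≐ r′ ⊕ b ⇒ r ≐ r′ ⇒ ⊢ m ⊕ b ≐ n ⊕ a)
    m n (m % p) (n % p) (m / p * p) (n / p * p) (m≡m%n+[m/n]*n m p) (m≡m%n+[m/n]*n n p)
    (trans (sym (toℕ-π m)) (trans (cong toℕ e) (toℕ-π n)))

  π-intro : ∀ {m n} k l → m + k * p ≡ n + l * p → π m ≡ π n
  π-intro {m} {n} k l e = trans (sym (π-+kp m k)) (trans (cong π e) (π-+kp n l))

  π-decomposition : ∀ m → ∃ λ k → m ≡ toℕ (π m) + k * p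
  π-decomposition m = m / p , trans (m≡m%n+[m/n]*n m p) (cong (_+ m / p * p) (sym (toℕ-π m)))

  infixl 6 _∙_

  _∙_ : Fin p → Fin p → Fin p
  x ∙ y = π (toℕ x + toℕ y)

  ε : Fin p
  ε = π 0

  infix 8 _⁻¹

  _⁻¹ : Fin p → Fin p
  x ⁻¹ = π (p ∸ toℕ x)

  π-∙ : ∀ m n → π m ∙ π n ≡ π (m + n)
  π-∙ m n = π-cong (trans (cong₂ (λ a b → (a + b) % p) (toℕ-π m) (toℕ-π n)) (sym (%-distribˡ-+ m n p)))

  ∙-comm : ∀ x y → x ∙ y ≡ y ∙ x
  ∙-comm x y = cong π (+-comm (toℕ x) (toℕ y))

  ∙-assoc : ∀ x y z → (x ∙ y) ∙ z ≡ x ∙ (y ∙ z)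
  ∙-assoc x y z = trans (cong ((x ∙ y) ∙_) (sym (π-toℕ z))) (trans (π-∙ (toℕ x + toℕ y) (toℕ z))
    (trans (cong π (+-assoc (toℕ x) (toℕ y) (toℕ z))) (trans (sym (π-∙ (toℕ x) (toℕ y + toℕ z))) (cong (_∙ (y ∙ z)) (π-toℕ x)))))

  ∙-identityˡ : ∀ x → ε ∙ x ≡ x
  ∙-identityˡ x = trans (cong (ε ∙_) (sym (π-toℕ x))) (trans (π-∙ 0 (toℕ x)) (π-toℕ x))

  π-p : π p ≡ ε
  π-p = π-cong (trans (n%n≡0 p) (sym (m<n⇒m%n≡m 0<p)))

  ∙-inverseˡ : ∀ x → x ⁻¹ ∙ x ≡ ε
  ∙-inverseˡ x = trans (cong (x ⁻¹ ∙_) (sym (π-toℕ x))) (trans (π-∙ (p ∸ toℕ x) (toℕ x)) (trans (cong π (m∸n+n≡m (<⇒≤ (toℕ<n x)))) π-p))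

  isAbelianGroup : IsAbelianGroup _≡_ _∙_ ε _⁻¹
  isAbelianGroup = record
    { isGroup = record
      { isMonoid = record
        { isSemigroup = record { isMagma = record { isEquivalence = isEquivalence ; ∙-cong = cong₂ _∙_ } ; assoc = ∙-assoc }
        ; identity = ∙-identityˡ , λ x → trans (∙-comm x ε) (∙-identityˡ x) }
      ; inverse = ∙-inverseˡ , λ x → trans (∙-comm x (x ⁻¹)) (∙-inverseˡ x)
      ; ⁻¹-cong = cong _⁻¹ }
    ; comm = ∙-comm }

  unit-inverse : ∀ a → 0 < a → a < p → ∃ λ m → ∃ λ k → m * a ≡ 1 + k * p
  unit-inverse a 0<a a<p = coprime-inverse a p (≤-trans (s≤s (s≤s z≤n)) 2<p)
    (coprime-sym (prime⇒coprime prime {{>-nonZero 0<a}} a<p))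

  ≢ε⇒pos : ∀ {x} → ¬ x ≡ ε → 0 < toℕ x
  ≢ε⇒pos {x} ne = n≢0⇒n>0 λ e → ne (trans (sym (π-toℕ x)) (cong π e))

  π-*ˡ : ∀ c m → π (c * toℕ (π m)) ≡ π (c * m)
  π-*ˡ c m with π-decomposition m
  ... | k , e = sym (trans (cong (λ n → π (c * n)) e) (trans (cong π (linarith 4 (λ c t k p → ⊢ c ⊗ (t ⊕ k ⊗ p) ≐ c ⊗ t ⊕ c ⊗ k ⊗ p) c (toℕ (π m)) k p)) (π-+kp _ (c * k))))

  -- A nonzero a is a unit, so y is reached from x by adding a exactly (y - x)/a times.
  simple : ∀ (X : FSet p) a → ¬ a ≡ ε → (∀ x → x ∈ X → (x ∙ a) ∈ X) → ∀ x y → x ∈ X → y ∈ X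
  simple X a a≢ε closed x y hx with unit-inverse (toℕ a) (≢ε⇒pos a≢ε) (toℕ<n a)
  ... | m , k , e = subst (_∈ X) reach (iterate (c * m))
    where
    c : ℕ
    c = toℕ y + (p ∸ toℕ x)
    iterate : ∀ i → (x ∙ π (i * toℕ a)) ∈ X
    iterate zero = subst (_∈ X) (sym (trans (∙-comm x ε) (∙-identityˡ x))) hx
    iterate (suc i) = subst (_∈ X) (trans (∙-assoc x (π (i * toℕ a)) a) (cong (x ∙_) (trans (cong (π (i * toℕ a) ∙_) (sym (π-toℕ a)))
      (trans (π-∙ (i * toℕ a) (toℕ a)) (cong π (+-comm (i * toℕ a) (toℕ a))))))) (closed _ (iterate i))
    reach : x ∙ π (c * m * toℕ a) ≡ y
    reach = trans (cong₂ _∙_ (sym (π-toℕ x)) (trans (cong π (linarith 6 (λ c m a k p z → c ⊗ (m ⊗ a) ≐ c ⊗ (κ 1 ⊕ k ⊗ p) ⇒ ⊢ c ⊗ m ⊗ a ≐ c ⊕ c ⊗ k ⊗ p)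
        c m (toℕ a) k p 0 (cong (c *_) e))) (π-+kp c (c * k))))
      (trans (π-∙ (toℕ x) c) (trans (cong π (linarith 4 (λ x y d p → d ⊕ x ≐ p ⇒ ⊢ x ⊕ (y ⊕ d) ≐ y ⊕ κ 1 ⊗ p) (toℕ x) (toℕ y) (p ∸ toℕ x) p (m∸n+n≡m (<⇒≤ (toℕ<n x)))))
        (trans (π-+kp (toℕ y) 1) (π-toℕ y))))

  p∣⇒ε : ∀ m → π m ≡ ε → p ∣ m
  p∣⇒ε m e = m%n≡0⇒n∣m m p (trans (sym (toℕ-π m)) (trans (cong toℕ e) (toℕ-π-< 0<p)))

  torsion-free : ∀ i x → 0 < i → i < p → π (i * toℕ x) ≡ ε → x ≡ ε
  torsion-free i x 0<i i<p e with euclidsLemma i (toℕ x) prime (p∣⇒ε (i * toℕ x) e)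
  ... | inj₁ p∣i = ⊥-elim (<⇒≱ i<p (∣⇒≤ {{>-nonZero 0<i}} p∣i))
  ... | inj₂ p∣x with toℕ x in eq
  ... | zero = trans (sym (π-toℕ x)) (cong π eq)
  ... | suc n = ⊥-elim (<⇒≱ (subst (_< p) eq (toℕ<n x)) (∣⇒≤ p∣x))

  odd : ∀ x → x ∙ x ≡ ε → x ≡ ε
  odd x e = torsion-free 2 x (s≤s z≤n) 2<p (trans (cong (λ k → π (toℕ x + k)) (+-identityʳ (toℕ x))) e)

  open Isoperimetry p _∙_ ε _⁻¹ isAbelianGroup simple public
  open GreedyExtraction p _∙_ ε _⁻¹ isAbelianGroup simple odd public
  open Stretching p _∙_ ε _⁻¹ isAbelianGroup simple public
  open InverseTheorem p _∙_ ε _⁻¹ isAbelianGroup simple odd public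

  mult-π : ∀ i x → mult i x ≡ π (i * toℕ x)
  mult-π zero x = refl
  mult-π (suc i) x = trans (cong₂ _∙_ (mult-π i x) (sym (π-toℕ x))) (trans (π-∙ (i * toℕ x) (toℕ x)) (cong π (+-comm (i * toℕ x) (toℕ x))))

  torsion : ∀ i x → 0 < i → i < p → mult i x ≡ ε → x ≡ ε
  torsion i x 0<i i<p e = torsion-free i x 0<i i<p (trans (sym (mult-π i x)) e)

  divide : ∀ i → 0 < i → i < p → ∀ x → ∃ λ y → mult i y ≡ x
  divide i 0<i i<p x = quotient (unit-inverse i 0<i i<p)
    where
    quotient : (∃ λ m → ∃ λ k → m * i ≡ 1 + k * p) → ∃ λ y → mult i y ≡ x
    quotient (m , k , e) = π (m * toℕ x) , trans (mult-π i (π (m * toℕ x))) (trans (π-*ˡ i (m * toℕ x))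
      (trans (cong π multiple) (trans (π-+kp (toℕ x) (k * toℕ x)) (π-toℕ x))))
      where
      multiple : i * (m * toℕ x) ≡ toℕ x + k * toℕ x * p
      multiple = linarith 5 (λ i m x k p → m ⊗ i ⊗ x ≐ (κ 1 ⊕ k ⊗ p) ⊗ x ⇒ ⊢ i ⊗ (m ⊗ x) ≐ x ⊕ k ⊗ x ⊗ p) i m (toℕ x) k p (cong (_* toℕ x) e)

  gsum : FSet p → ℕ
  gsum B = sum (λ x → toℕ x * 𝟙 (B x))

  gsum-insert : ∀ B y → y ∉ B → gsum (B ∪ ⁅ y ⁆) ≡ gsum B + toℕ y
  gsum-insert B y y∉ = trans (sum-cong-≗ λ x → trans (cong (toℕ x *_) (lem x)) (*-distribˡ-+ (toℕ x) (𝟙 (B x)) (𝟙 (⁅ y ⁆ x))))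
    (trans (∑-distrib-+ (λ x → toℕ x * 𝟙 (B x)) (λ x → toℕ x * 𝟙 (⁅ y ⁆ x))) (cong (gsum B +_) (sum-⁅⁆ toℕ y)))
    where
    lem : ∀ x → 𝟙 (B x ∨ ⁅ y ⁆ x) ≡ 𝟙 (B x) + 𝟙 (⁅ y ⁆ x)
    lem x = 𝟙-disjoint (B x) (⁅ y ⁆ x) λ hB hy → true≢false hB (trans (cong B (∈⁅⁆⇒≡ hy)) y∉)

  π-gsum-insert : ∀ B y {x} → y ∉ B → π (gsum B) ≡ x → π (gsum (B ∪ ⁅ y ⁆)) ≡ x ∙ y
  π-gsum-insert B y y∉ e = trans (cong π (gsum-insert B y y∉)) (trans (sym (π-∙ (gsum B) (toℕ y))) (cong₂ _∙_ e (π-toℕ y)))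

  SubSum⇒gsum : ∀ {R x} → SubSum R x → ∃ λ B → B ⊆ R × π (gsum B) ≡ x
  SubSum⇒gsum empty = (λ _ → false) , (λ x ()) , cong π gsum-∅
    where
    gsum-∅ : gsum (λ _ → false) ≡ 0
    gsum-∅ = trans (sum-cong-≗ {p} λ x → *-zeroʳ (toℕ x)) (trans (sum-const p 0) (*-zeroʳ p))
  SubSum⇒gsum {R} (add y x hy d) = extend (SubSum⇒gsum d)
    where
    extend : (∃ λ B → B ⊆ (R ∖ ⁅ y ⁆) × π (gsum B) ≡ x) → ∃ λ B → B ⊆ R × π (gsum B) ≡ x ∙ y
    extend (B , B⊆ , e) = B ∪ ⁅ y ⁆ , (λ z hz → [ (λ h → proj₁ (∖-elim R (B⊆ z h))) , (λ h → trans (cong R (∈⁅⁆⇒≡ h)) hy) ]′ (∨-elim {B z} hz)) ,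
      π-gsum-insert B y (¬true⇒false λ h → proj₂ (∖-elim R (B⊆ y h)) refl) e

  ZeroFreeᶠ : FSet p → Set
  ZeroFreeᶠ A = ∀ B → B ⊆ A → π (gsum B) ≡ ε → ∀ x → x ∉ B

  zeroFree⇒zeroSumFree : ∀ {A} → ZeroFreeᶠ A → ZeroSumFree A
  zeroFree⇒zeroSumFree {A} zf y x hy d e = absurd (SubSum⇒gsum d)
    where
    absurd : (∃ λ B → B ⊆ (A ∖ ⁅ y ⁆) × π (gsum B) ≡ x) → ⊥
    absurd (B , B⊆ , eq) = true≢false (∨-introʳ {B y} (∈⁅⁆ y)) (zf (B ∪ ⁅ y ⁆)
      (λ z hz → [ (λ h → proj₁ (∖-elim A (B⊆ z h))) , (λ h → trans (cong A (∈⁅⁆⇒≡ h)) hy) ]′ (∨-elim {B z} hz))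
      (trans (π-gsum-insert B y (¬true⇒false λ h → proj₂ (∖-elim A (B⊆ y h)) refl) eq) e) y)

-- Intervals of subset sums and the bound on the total absolute value.

module SignedSums where

  open LinearArithmetic
  open FiniteSets
  open NaturalSets

  wt≤square : ∀ m V → wt m V ≤ m * m
  wt≤square zero V = z≤n
  wt≤square (suc m) V = linarith 3 (λ w m x → w ⊴ m ⊗ m ⇒ x ⊴ m ⊗ κ 1 ⇒ ⊢ w ⊕ x ⊴ (κ 1 ⊕ m) ⊗ (κ 1 ⊕ m)) (wt m V) m (m * 𝟙 (V m))
    (wt≤square m V) (*-monoʳ-≤ m (𝟙≤1 (V m)))

  ct≤wt : ∀ m V → V 0 ≡ false → ct m V ≤ wt m V
  ct≤wt m V V0 = sumTo-mono m λ t _ → lem t (V t) refl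
    where
    lem : ∀ t b → V t ≡ b → 𝟙 b ≤ t * 𝟙 b
    lem t false _ = z≤n
    lem zero true e = ⊥-elim (true≢false e V0)
    lem (suc t) true _ = s≤s z≤n

  triangular : ∀ m V → V 0 ≡ false → ct m V * ct m V + ct m V ≤ 2 * wt m V
  triangular m V V0 = linarith 2 (λ c w → c ⊗ κ 2 ⊕ c ⊗ c ⊴ κ 2 ⊗ w ⊕ c ⇒ ⊢ c ⊗ c ⊕ c ⊴ κ 2 ⊗ w) (ct m V) (wt m V)
    (wt-lower m 1 V λ { zero h → ⊥-elim (true≢false h V0) ; (suc t) _ → s≤s z≤n })

  Missing : NSet → ℕ → ℕ → Set
  Missing T K e = T 0 ≡ false × ct (suc K) T + e ≡ K

  -- The additional 1 is the nonmember 0.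
  missing-count : ∀ {T K e} → Missing T K e → ct (suc K) (not ∘ T) ≡ suc e
  missing-count {T} {K} {e} (_ , eq) = linarith 4 (λ c m K e → c ⊕ m ≐ κ 1 ⊕ K ⇒ c ⊕ e ≐ K ⇒ ⊢ m ≐ κ 1 ⊕ e)
    (ct (suc K) T) (ct (suc K) (not ∘ T)) K e (ct+missing (suc K) T) eq

  missing-zero : ∀ {T K e} → Missing T K e → ∀ m → 0 < m → 1 ≤ ct m (not ∘ T)
  missing-zero {T} (T0 , _) m 0<m = ≤-trans (≤-reflexive (sym (cong (𝟙 ∘ not) T0))) (sumTo-≤ (𝟙 ∘ not ∘ T) 0<m)

  module _ (N : ℕ) where
    open Sums N

    module Long (T : NSet) (K e z : ℕ) (missing : Missing T K e) (z≡ : z ≡ (e + 1) * 10) (3z≤K : z * 3 ≤ K) (K<N : suc K ≤ N)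
      (far : ∀ t → T t ≡ true → t < N → K < t → t ≤ wt t (above (suc (z * 3)) T)) where

      private
        W Sm Lg : NSet
        W = below (suc (z * 3)) (above z T)
        Sm = below z T
        Lg = above (suc (z * 3)) T

        a σ : ℕ
        a = z + z + e + e + 1
        σ = wt z T

        2e<z : e + e + 1 ≤ z
        2e<z = linarith 2 (λ e z → z ≐ (e ⊕ κ 1) ⊗ κ 10 ⇒ ⊢ e ⊕ e ⊕ κ 1 ⊴ z) e z z≡

        0<z : 0 < z
        0<z = ≤-trans (m≤n+m 1 (e + e)) 2e<z

        T0 : T 0 ≡ false
        T0 = proj₁ missing

        ct-not≤ : ∀ m → m ≤ suc K → ct m (not ∘ T) ≤ suc e
        ct-not≤ m le = ≤-trans (sumTo-≤ (𝟙 ∘ not ∘ T) le) (≤-reflexive (missing-count {T} missing))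

        -- e + 1 pairs with sum x lie inside [z, 3z]; if all of them failed, e + 1 elements besides
        -- 0 would be missing.
        window : Interval W a (z * 4)
        window x a≤x x≤ = pair (symmetric-pair T (suc e) z (x ∸ (z + e)) (linarith 4 (λ z e x v → z ⊕ z ⊕ e ⊕ e ⊕ κ 1 ⊴ x ⇒ v ⊕ (z ⊕ e) ≐ x ⇒ ⊢ z ⊕ (κ 1 ⊕ e) ⊴ v) z e x v a≤x v≡))
          where
          v : ℕ
          v = x ∸ (z + e)
          v≡ : v + (z + e) ≡ x
          v≡ = m∸n+n≡m (linarith 3 (λ z e x → z ⊕ z ⊕ e ⊕ e ⊕ κ 1 ⊴ x ⇒ ⊢ z ⊕ e ⊴ x) z e x a≤x)
          top : v + suc e ≤ suc (z * 3)
          top = linarith 4 (λ z e x v → x ⊴ z ⊗ κ 4 ⇒ v ⊕ (z ⊕ e) ≐ x ⇒ ⊢ v ⊕ (κ 1 ⊕ e) ⊴ κ 1 ⊕ z ⊗ κ 3) z e x v x≤ v≡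
          pair : (∃ λ t → ∃ λ t′ → z ≤ t × t < z + suc e × v ≤ t′ × t′ < v + suc e × T t ≡ true × T t′ ≡ true × suc (t + t′) ≡ z + v + suc e)
            ⊎ (ct z (not ∘ T) + suc e ≤ ct (v + suc e) (not ∘ T)) → Sum W x
          pair (inj₂ h) = ⊥-elim (<⇒≱ (+-monoˡ-≤ (suc e) (missing-zero {T} missing z 0<z)) (≤-trans h (ct-not≤ (v + suc e) (≤-trans top (s≤s 3z≤K)))))
          pair (inj₁ (t , t′ , z≤t , t< , v≤t′ , t′< , Tt , Tt′ , eq)) = V , sub , weight
            where
            V : NSet
            V = single t ⊔ⁿ single t′
            t<t′ : t < t′
            t<t′ = ≤-trans t< (≤-trans (linarith 4 (λ z e x v → z ⊕ z ⊕ e ⊕ e ⊕ κ 1 ⊴ x ⇒ v ⊕ (z ⊕ e) ≐ x ⇒ ⊢ z ⊕ (κ 1 ⊕ e) ⊴ v) z e x v a≤x v≡) v≤t′)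
            t′≤ : t′ < suc (z * 3)
            t′≤ = ≤-trans t′< top
            inW : ∀ {u} → T u ≡ true → z ≤ u → u < suc (z * 3) → W u ≡ true
            inW Tu le lt = below-intro {suc (z * 3)} {above z T} (above-intro {z} {T} Tu le) lt
            sub : V ⊑ W
            sub u h = [ (λ s → subst (λ r → W r ≡ true) (sym (≡ᵇ-sound {u} {t} s)) (inW Tt z≤t (<-trans t<t′ t′≤))) ,
              (λ s → subst (λ r → W r ≡ true) (sym (≡ᵇ-sound {u} {t′} s)) (inW Tt′ (≤-trans z≤t (<⇒≤ t<t′)) t′≤)) ]′ (∨-elim {single t u} h)
            t′<N : t′ < N
            t′<N = ≤-trans t′≤ (≤-trans (s≤s 3z≤K) K<N)
            weight : wt N V ≡ x
            weight = trans (wt-⊔ N (single t) (single t′) λ u s s′ → <-irrefl (trans (sym (≡ᵇ-sound {u} {t} s)) (≡ᵇ-sound {u} {t′} s′)) t<t′)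
              (trans (cong₂ _+_ (wt-single N t (<-trans t<t′ t′<N)) (wt-single N t′ t′<N))
                (linarith 6 (λ t t′ z v e x → κ 1 ⊕ (t ⊕ t′) ≐ z ⊕ v ⊕ (κ 1 ⊕ e) ⇒ v ⊕ (z ⊕ e) ≐ x ⇒ ⊢ t ⊕ t′ ≐ x) t t′ z v e x eq v≡))

        z≤N : z ≤ N
        z≤N = ≤-trans (m≤m*n z 3) (≤-trans 3z≤K (≤-trans (n≤1+n K) K<N))

        W-elim : ∀ {t} → W t ≡ true → T t ≡ true × z ≤ t × t < suc (z * 3)
        W-elim {t} h = let (h₁ , lt) = below-elim {suc (z * 3)} {above z T} h ; (Tt , le) = above-elim {z} {T} h₁ in Tt , le , lt

        with-small : Interval (W ⊔ⁿ Sm) a (z * 4 + σ)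
        with-small = subst (λ w → Interval (W ⊔ⁿ Sm) a (z * 4 + w)) (wt-below N z T z≤N)
          (interval-adjoin W Sm a (z * 4) (λ t h h′ → <⇒≱ (proj₂ (below-elim {z} {T} h′)) (proj₁ (proj₂ (W-elim h)))) window
            λ t h _ → linarith 4 (λ z e t w → e ⊕ e ⊕ κ 1 ⊴ z ⇒ t ⊲ z ⇒ ⊢ z ⊕ z ⊕ e ⊕ e ⊕ κ 1 ⊕ t ⊴ κ 1 ⊕ (z ⊗ κ 4 ⊕ w)) z e t (wt t Sm) 2e<z (proj₂ (below-elim {z} {T} h)))

        ct-Lg : ∀ t → t ≤ suc K → suc (z * 3) ≤ t → t ≤ ct t Lg + (z * 3 + e + 1)
        ct-Lg t t≤ 3z<t = linarith 7 (λ t m c l b z e → c ⊕ m ≐ t ⇒ m ⊴ κ 1 ⊕ e ⇒ c ≐ b ⊕ l ⇒ b ⊴ z ⊗ κ 3 ⇒ ⊢ t ⊴ l ⊕ (z ⊗ κ 3 ⊕ e ⊕ κ 1))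
          t (ct t (not ∘ T)) (ct t T) (ct t Lg) (ct t (below (suc (z * 3)) T)) z e (ct+missing t T) (ct-not≤ t t≤) (ct-below-above t (suc (z * 3)) T)
          (≤-trans (≤-reflexive (ct-below t (suc (z * 3)) T 3z<t)) (linarith 3 (λ c m z → c ⊕ m ≐ κ 1 ⊕ z ⇒ κ 1 ⊴ m ⇒ ⊢ c ⊴ z)
            (ct (suc (z * 3)) T) (ct (suc (z * 3)) (not ∘ T)) (z * 3) (ct+missing (suc (z * 3)) T) (missing-zero {T} missing (suc (z * 3)) (s≤s z≤n))))

        -- An element just above 3z is longer than the interval [a, 4z], whose length is below 2z.
        -- The elements below z supply the difference.
        σ-large : z + e + e + e + 2 ≤ σ
        σ-large = linarith 5 (λ z e σ c cc → z ≐ (e ⊕ κ 1) ⊗ κ 10 ⇒ z ⊴ c ⊕ (κ 1 ⊕ e) ⇒ c ⊗ c ⊕ c ⊴ κ 2 ⊗ σ ⇒ c ⊗ κ 9 ⊴ c ⊗ c ⇒ ⊢ z ⊕ e ⊕ e ⊕ e ⊕ κ 2 ⊴ σ)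
          z e σ (ct z T) 0 z≡ c≥ (triangular z T T0) (*-monoʳ-≤ (ct z T) (linarith 3 (λ z e c → z ≐ (e ⊕ κ 1) ⊗ κ 10 ⇒ z ⊴ c ⊕ (κ 1 ⊕ e) ⇒ ⊢ κ 9 ⊴ c) z e (ct z T) z≡ c≥))
          where
          c≥ : z ≤ ct z T + suc e
          c≥ = linarith 4 (λ z c m e → c ⊕ m ≐ z ⇒ m ⊴ κ 1 ⊕ e ⇒ ⊢ z ⊴ c ⊕ (κ 1 ⊕ e)) z (ct z T) (ct z (not ∘ T)) e (ct+missing z T)
            (ct-not≤ z (≤-trans (m≤m*n z 3) (m≤n⇒m≤1+n 3z≤K)))

        Lg0 : Lg 0 ≡ false
        Lg0 = ¬true⇒false λ h → true≢false (proj₁ (above-elim {suc (z * 3)} {T} h)) T0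

        with-large : Interval ((W ⊔ⁿ Sm) ⊔ⁿ Lg) a (z * 4 + σ + wt N Lg)
        with-large = interval-adjoin (W ⊔ⁿ Sm) Lg a (z * 4 + σ)
          (λ t h h′ → <⇒≱ ([ (λ w → proj₂ (proj₂ (W-elim w))) , (λ s → ≤-trans (proj₂ (below-elim {z} {T} s)) (≤-trans (m≤m*n z 3) (n≤1+n _))) ]′ (∨-elim {W t} h)) (proj₂ (above-elim {suc (z * 3)} {T} h′)))
          with-small fits
          where
          fits : ∀ t → Lg t ≡ true → t < N → a + t ≤ suc (z * 4 + σ + wt t Lg)
          fits t h t<N = split (≤-<-connex t K)
            where
            3z<t : suc (z * 3) ≤ t
            3z<t = proj₂ (above-elim {suc (z * 3)} {T} h)
            split : (t ≤ K) ⊎ (K < t) → a + t ≤ suc (z * 4 + σ + wt t Lg)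
            split (inj₁ t≤K) = linarith 6 (λ z e t σ w c → t ⊴ c ⊕ (z ⊗ κ 3 ⊕ e ⊕ κ 1) ⇒ c ⊴ w ⇒ z ⊕ e ⊕ e ⊕ e ⊕ κ 2 ⊴ σ ⇒
                ⊢ z ⊕ z ⊕ e ⊕ e ⊕ κ 1 ⊕ t ⊴ κ 1 ⊕ (z ⊗ κ 4 ⊕ σ ⊕ w))
              z e t σ (wt t Lg) (ct t Lg) (ct-Lg t (m≤n⇒m≤1+n t≤K) 3z<t) (ct≤wt t Lg Lg0) σ-large
            split (inj₂ K<t) = linarith 5 (λ z e t σ w → t ⊴ w ⇒ e ⊕ e ⊕ κ 1 ⊴ z ⇒ ⊢ z ⊕ z ⊕ e ⊕ e ⊕ κ 1 ⊕ t ⊴ κ 1 ⊕ (z ⊗ κ 4 ⊕ σ ⊕ w))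
              z e t σ (wt t Lg) (far t (proj₁ (above-elim {suc (z * 3)} {T} h)) t<N K<t) 2e<z

      -- The elements up to 3z weigh at most (3z + 1)², so the interval misses only a part of the
      -- range that is bounded in terms of e.
      long-interval : ∃ λ a → ∃ λ b → Interval T a b × wt N T + a ≤ b + suc (z * 3) * suc (z * 3)
      long-interval = a , z * 4 + σ + wt N Lg , (λ x lo hi → Sum-mono sub (with-large x lo hi)) ,
        linarith 7 (λ w W l σ z e s → w ⊴ s ⊕ l ⇒ e ⊕ e ⊕ κ 1 ⊴ z ⇒ s ⊴ (κ 1 ⊕ z ⊗ κ 3) ⊗ (κ 1 ⊕ z ⊗ κ 3) ⇒
            ⊢ w ⊕ (z ⊕ z ⊕ e ⊕ e ⊕ κ 1) ⊴ z ⊗ κ 4 ⊕ σ ⊕ l ⊕ (κ 1 ⊕ z ⊗ κ 3) ⊗ (κ 1 ⊕ z ⊗ κ 3))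
          (wt N T) 0 (wt N Lg) σ z e (wt N (below (suc (z * 3)) T)) (≤-reflexive (wt-below-above N (suc (z * 3)) T)) 2e<z
          (≤-trans (≤-reflexive (wt-below N (suc (z * 3)) T (≤-trans (s≤s 3z≤K) K<N))) (wt≤square (suc (z * 3)) T))
        where
        sub : ((W ⊔ⁿ Sm) ⊔ⁿ Lg) ⊑ T
        sub t h = [ (λ h₁ → [ (λ w → proj₁ (W-elim w)) , (λ s → proj₁ (below-elim {z} {T} s)) ]′ (∨-elim {W t} h₁)) ,
          (λ l → proj₁ (above-elim {suc (z * 3)} {T} l)) ]′ (∨-elim {(W ⊔ⁿ Sm) t} h)

  _≡[_]_ : ℕ → ℕ → ℕ → Set
  x ≡[ p ] y = ∃ λ c → (x ≡ y + c * p) ⊎ (x + c * p ≡ y)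

  residue : ∀ p → 0 < p → ∀ a y → ∃ λ x → a ≤ x × x < a + p × x ≡[ p ] y
  residue p 0<p a y = split (≤-total a y)
    where
    split : (a ≤ y) ⊎ (y ≤ a) → ∃ λ x → a ≤ x × x < a + p × x ≡[ p ] y
    split (inj₁ a≤y) = let (c , lo , hi) = division (y ∸ a) p 0<p in
      y ∸ c * p ,
      linarith 5 (λ a y d cp x → d ⊕ a ≐ y ⇒ cp ⊴ d ⇒ x ⊕ cp ≐ y ⇒ ⊢ a ⊴ x) a y (y ∸ a) (c * p) (y ∸ c * p) (m∸n+n≡m a≤y) lo (m∸n+n≡m (≤-trans lo (m∸n≤m y a))) ,
      linarith 6 (λ a y d cp x p → d ⊕ a ≐ y ⇒ d ⊲ p ⊕ cp ⇒ x ⊕ cp ≐ y ⇒ ⊢ x ⊲ a ⊕ p) a y (y ∸ a) (c * p) (y ∸ c * p) p (m∸n+n≡m a≤y) hi (m∸n+n≡m (≤-trans lo (m∸n≤m y a))) ,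
      c , inj₂ (m∸n+n≡m (≤-trans lo (m∸n≤m y a)))
    split (inj₂ y≤a) = let (c , lo , hi) = division (a ∸ y + (p ∸ 1)) p 0<p in
      y + c * p ,
      linarith 5 (λ a y d cp p → d ⊕ y ≐ a ⇒ d ⊕ p ⊲ κ 1 ⊕ p ⊕ cp ⇒ ⊢ a ⊴ y ⊕ cp) a y (a ∸ y) (c * p) (p ∸ 1) (m∸n+n≡m y≤a)
        (≤-trans hi (≤-reflexive (cong (_+ c * p) (sym (m+[n∸m]≡n 0<p))))) ,
      linarith 6 (λ a y d cp p′ p → d ⊕ y ≐ a ⇒ cp ⊴ d ⊕ p′ ⇒ κ 1 ⊕ p′ ≐ p ⇒ ⊢ y ⊕ cp ⊲ a ⊕ p) a y (a ∸ y) (c * p) (p ∸ 1) p (m∸n+n≡m y≤a) lo (m+[n∸m]≡n 0<p) ,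
      c , inj₁ refl

  -- A dilate of a zero-free set, written in absolute values: T = Pos ∪ Neg.
  module Signed (p N : ℕ) (0<p : 0 < p) (Pos Neg : NSet)
    (disjoint : ∀ t → Pos t ≡ true → Neg t ≡ true → ⊥)
    (bounded : ∀ t → (Pos ⊔ⁿ Neg) t ≡ true → t < N)
    (zero-free : ∀ V → V ⊑ (Pos ⊔ⁿ Neg) → wt N V ≡[ p ] wt N Neg → ∀ t → V t ≡ Neg t) where

    open Sums N

    T : NSet
    T = Pos ⊔ⁿ Neg

    τ : ℕ
    τ = wt N Neg

    remove⊑ : ∀ y → remove y T ⊑ T
    remove⊑ y t h = proj₁ (remove-elim {y} {T} h)

    -- An interval of p sums meets every residue class. If y is negative, take a sum congruent to τ:
    -- its set must be `Neg`, yet it omits y. If y is positive, take one congruent to τ - y and add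
    -- y: the set must be `Neg`, yet it contains y.
    no-cover : ∀ y a b → T y ≡ true → Interval (remove y T) a b → b + 1 < a + p
    no-cover y a b Ty int = ≰⇒> λ le → [ pos le , neg le ]′ (∨-elim {Pos y} Ty)
      where
      y<N : y < N
      y<N = bounded y Ty
      y∉ : ∀ {x} (s : Sum (remove y T) x) → proj₁ s y ≡ false
      y∉ (V , sub , _) = ¬true⇒false λ h → proj₂ (remove-elim {y} {T} (sub y h)) refl
      neg : a + p ≤ b + 1 → Neg y ≡ true → ⊥
      neg le Ny = use (residue p 0<p a τ)
        where
        use : (∃ λ x → a ≤ x × x < a + p × x ≡[ p ] τ) → ⊥
        use (x , lo , hi , cong≡) = contra (int x lo (≤-pred (≤-trans (≤-trans hi le) (≤-reflexive (+-comm b 1)))))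
          where
          contra : Sum (remove y T) x → ⊥
          contra s@(V , sub , e) = true≢false Ny (trans (sym (zero-free V (λ t h → remove⊑ y t (sub t h)) (subst (_≡[ p ] τ) (sym e) cong≡) y)) (y∉ s))
      pos : a + p ≤ b + 1 → Pos y ≡ true → ⊥
      pos le Py = use (residue p 0<p (a + y) τ)
        where
        use : (∃ λ x → a + y ≤ x × x < a + y + p × x ≡[ p ] τ) → ⊥
        use (x , lo , hi , cong≡) = contra (int (x ∸ y)
            (linarith 4 (λ a y x d → a ⊕ y ⊴ x ⇒ d ⊕ y ≐ x ⇒ ⊢ a ⊴ d) a y x (x ∸ y) lo x-y)
            (linarith 6 (λ a y x d b p → x ⊲ a ⊕ y ⊕ p ⇒ d ⊕ y ≐ x ⇒ a ⊕ p ⊴ b ⊕ κ 1 ⇒ ⊢ d ⊴ b) a y x (x ∸ y) b p hi x-y le))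
          where
          x-y : x ∸ y + y ≡ x
          x-y = m∸n+n≡m (≤-trans (m≤n+m y a) lo)
          contra : Sum (remove y T) (x ∸ y) → ⊥
          contra s@(V , sub , e) = disjoint y Py (trans (sym (zero-free (V ⊔ⁿ single y)
              (λ t h → [ (λ v → remove⊑ y t (sub t v)) , (λ s → trans (cong T (≡ᵇ-sound s)) Ty) ]′ (∨-elim {V t} h))
              (subst (_≡[ p ] τ) (sym weight) cong≡) y)) (∨-introʳ {V y} (≡ᵇ-refl y)))
            where
            weight : wt N (V ⊔ⁿ single y) ≡ x
            weight = trans (wt-⊔ N V (single y) λ t v s → true≢false v (trans (cong V (≡ᵇ-sound s)) (y∉ (V , sub , e))))
              (trans (cong₂ _+_ e (wt-single N y y<N)) x-y)

    module FewMissing (k K w s E : ℕ) (T0 : T 0 ≡ false) (#T : ct N T ≡ k) (dense : s ≤ ct (suc (s + E)) T) (Y<N : suc (s + E) ≤ N)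
      (8w≤k : w * 8 ≤ k) (k≤8w+7 : k ≤ w * 8 + 7) (6w≤s : w * 6 ≤ s) (s≤7w : s ≤ w * 7) (E-small : E * 1000 ≤ w) (w-large : 1000000 ≤ w)
      (p-upper : p * 2 ≤ k * k + k * 4 + 3) (N-upper : N * 2 ≤ p + 1) (2K≤k : K * 2 ≤ k) (k≤2K+1 : k ≤ K * 2 + 1) where

      private
        e : ℕ
        e = K ∸ ct (suc K) T

        ct≤K : ct (suc K) T ≤ K
        ct≤K = linarith 3 (λ c m K → c ⊕ m ≐ κ 1 ⊕ K ⇒ κ 1 ⊴ m ⇒ ⊢ c ⊴ K) (ct (suc K) T) (ct (suc K) (not ∘ T)) K (ct+missing (suc K) T)
          (≤-trans (≤-reflexive (sym (cong (𝟙 ∘ not) T0))) (sumTo-≤ {1} {suc K} (𝟙 ∘ not ∘ T) (s≤s z≤n)))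

        missing : Missing T K e
        missing = T0 , m+[n∸m]≡n ct≤K

        e≤E : e ≤ E
        e≤E = linarith 6 (λ e E s m m′ c → m ≐ κ 1 ⊕ e ⇒ m ⊴ m′ ⇒ c ⊕ m′ ≐ κ 1 ⊕ (s ⊕ E) ⇒ s ⊴ c ⇒ ⊢ e ⊴ E)
          e E s (ct (suc K) (not ∘ T)) (ct (suc (s + E)) (not ∘ T)) (ct (suc (s + E)) T) (missing-count {T} missing)
          (sumTo-≤ {suc K} {suc (s + E)} (𝟙 ∘ not ∘ T) (s≤s K≤Y)) (ct+missing (suc (s + E)) T) dense
          where
          K≤Y : K ≤ s + E
          K≤Y = linarith 5 (λ K k w s E → K ⊗ κ 2 ⊴ k ⇒ k ⊴ w ⊗ κ 8 ⊕ κ 7 ⇒ w ⊗ κ 6 ⊴ s ⇒ κ 1000000 ⊴ w ⇒ ⊢ K ⊴ s ⊕ E) K k w s E 2K≤k k≤8w+7 6w≤s w-large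

        e-small : e * 1000 ≤ w
        e-small = ≤-trans (*-monoˡ-≤ 1000 e≤E) E-small

        w≤K : w * 3 ≤ K
        w≤K = linarith 3 (λ K k w → k ⊴ K ⊗ κ 2 ⊕ κ 1 ⇒ w ⊗ κ 8 ⊴ k ⇒ κ 1000000 ⊴ w ⇒ ⊢ w ⊗ κ 3 ⊴ K) K k w k≤2K+1 8w≤k w-large

        K<N : suc K ≤ N
        K<N = linarith 6 (λ K k w s E N → K ⊗ κ 2 ⊴ k ⇒ k ⊴ w ⊗ κ 8 ⊕ κ 7 ⇒ w ⊗ κ 6 ⊴ s ⇒ κ 1000000 ⊴ w ⇒ κ 1 ⊕ (s ⊕ E) ⊴ N ⇒ ⊢ κ 1 ⊕ K ⊴ N)
          K k w s E N 2K≤k k≤8w+7 6w≤s w-large Y<N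

        -- The e missing elements cannot fill [1, e + 1]. Such a y is sacrificed to `no-cover`,
        -- which costs at most e + 1 in weight.
        small-element : ∃ λ y → y < suc (suc e) × T y ≡ true
        small-element with anyUpTo? (λ y → T y Bool.≟ true) (suc (suc e))
        ... | yes r = r
        ... | no ∄ = ⊥-elim (1+n≰n (≤-trans (≤-reflexive (sym all)) (≤-trans (sumTo-≤ {suc (suc e)} {suc K} (𝟙 ∘ not ∘ T)
            (linarith 3 (λ e w K → e ⊗ κ 1000 ⊴ w ⇒ w ⊗ κ 3 ⊴ K ⇒ κ 1000000 ⊴ w ⇒ ⊢ κ 2 ⊕ e ⊴ κ 1 ⊕ K) e w K e-small w≤K w-large))
          (≤-reflexive (missing-count {T} missing)))))
          where
          all : ct (suc (suc e)) (not ∘ T) ≡ suc (suc e)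
          all = ≤-antisym (ct≤ (suc (suc e)) (not ∘ T)) (linarith 3 (λ c m e → c ⊕ m ≐ e ⇒ c ≐ κ 0 ⇒ ⊢ e ⊴ m) (ct (suc (suc e)) T) (ct (suc (suc e)) (not ∘ T)) (suc (suc e))
            (ct+missing (suc (suc e)) T) (trans (sumTo-cong (suc (suc e)) λ t lt → cong 𝟙 (¬true⇒false λ h → ∄ (t , lt , h))) (zeros (suc (suc e)))))
            where
            zeros : ∀ m → sumTo m (λ _ → 0) ≡ 0
            zeros zero = refl
            zeros (suc m) = trans (+-identityʳ _) (zeros m)

        module _ (y : ℕ) (y≤ : y < suc (suc e)) (Ty : T y ≡ true) where

          T′ : NSet
          T′ = remove y T

          z Z : ℕ
          z = (suc e + 1) * 10
          Z = suc (z * 3)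

          Z≡ : Z ≡ e * 30 + 61
          Z≡ = linarith 1 (λ e → ⊢ κ 1 ⊕ (κ 1 ⊕ e ⊕ κ 1) ⊗ κ 10 ⊗ κ 3 ≐ e ⊗ κ 30 ⊕ κ 61) e

          Z-small : Z * 30 ≤ w
          Z-small = linarith 3 (λ Z e w → Z ≐ e ⊗ κ 30 ⊕ κ 61 ⇒ e ⊗ κ 1000 ⊴ w ⇒ κ 1000000 ⊴ w ⇒ ⊢ Z ⊗ κ 30 ⊴ w) Z e w Z≡ e-small w-large

          T′0 : T′ 0 ≡ false
          T′0 = ¬true⇒false λ h → true≢false (remove⊑ y 0 h) T0

          missing′ : Missing T′ K (suc e)
          missing′ = T′0 , linarith 4 (λ c c′ e K → c ⊕ e ≐ K ⇒ c ≐ c′ ⊕ κ 1 ⇒ ⊢ c′ ⊕ (κ 1 ⊕ e) ≐ K) (ct (suc K) T) (ct (suc K) T′) e K (proj₂ missing)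
            (ct-remove (suc K) y T Ty (linarith 4 (λ y e w K → y ⊲ κ 2 ⊕ e ⇒ e ⊗ κ 1000 ⊴ w ⇒ w ⊗ κ 3 ⊴ K ⇒ κ 1000000 ⊴ w ⇒ ⊢ y ⊲ κ 1 ⊕ K) y e w K y≤ e-small w≤K w-large))

          Lg : NSet
          Lg = above Z T′

          Lg0 : Lg 0 ≡ false
          Lg0 = ¬true⇒false λ h → true≢false (proj₁ (above-elim {Z} {T′} h)) T′0

          -- Few elements are lost below Z, so the weight grows quadratically.
          far-weight : ∀ m c → Z ≤ m → c + Z ≤ ct m T′ → ∀ t → m ≤ t → t * 2 ≤ c * c → t ≤ wt t Lg
          far-weight m c Z≤m c≤ t m≤t t≤ = linarith 4 (λ t w cc c → t ⊗ κ 2 ⊴ cc ⇒ cc ⊕ c ⊴ κ 2 ⊗ w ⇒ ⊢ t ⊴ w) t (wt t Lg) (c * c) c t≤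
            (≤-trans (+-mono-≤ (*-mono-≤ c≤Lg c≤Lg) c≤Lg) (triangular t Lg Lg0))
            where
            c≤Lg : c ≤ ct t Lg
            c≤Lg = ≤-trans (linarith 5 (λ c Z T b l → c ⊕ Z ⊴ T ⇒ T ≐ b ⊕ l ⇒ b ⊴ Z ⇒ ⊢ c ⊴ l) c Z (ct m T′) (ct m (below Z T′)) (ct m Lg) c≤
              (ct-below-above m Z T′) (≤-trans (≤-reflexive (ct-below m Z T′ Z≤m)) (ct≤ Z T′))) (sumTo-≤ (𝟙 ∘ Lg) m≤t)

          Z≤K : Z ≤ K
          Z≤K = linarith 3 (λ Z w K → Z ⊗ κ 30 ⊴ w ⇒ w ⊗ κ 3 ⊴ K ⇒ ⊢ Z ⊴ K) Z w K Z-small w≤K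

          -- Up to s + E the elements below K outweigh t. Beyond, t is only known to be at most
          -- about p/2, or 16w². The elements up to s + E number at least 6w, and without those
          -- below Z they still weigh more than (5.9w)²/2 > 17w²; three quarters of A are needed
          -- here.
          far : ∀ t → T′ t ≡ true → t < N → K < t → t ≤ wt t Lg
          far t _ t<N K<t = split (≤-<-connex t (s + E))
            where
            split : (t ≤ s + E) ⊎ (s + E < t) → t ≤ wt t Lg
            split (inj₁ t≤Y) = far-weight (suc K) (w * 2) (m≤n⇒m≤1+n Z≤K)
              (linarith 5 (λ w Z c e K → c ⊕ (κ 1 ⊕ e) ≐ K ⇒ w ⊗ κ 3 ⊴ K ⇒ Z ⊗ κ 30 ⊴ w ⇒ e ⊗ κ 1000 ⊴ w ⇒ κ 1000000 ⊴ w ⇒ ⊢ w ⊗ κ 2 ⊕ Z ⊴ c) w Z (ct (suc K) T′) e K (proj₂ missing′) w≤K Z-small e-small w-large)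
              t K<t (linarith 4 (λ t s E w → t ⊴ s ⊕ E ⇒ s ⊴ w ⊗ κ 7 ⇒ E ⊗ κ 1000 ⊴ w ⇒ w ⊗ κ 1000000 ⊴ w ⊗ w ⇒ ⊢ t ⊗ κ 2 ⊴ (w ⊗ κ 2) ⊗ (w ⊗ κ 2)) t s E w t≤Y s≤7w E-small (*-monoʳ-≤ w w-large))
            split (inj₂ Y<t) = far-weight (suc (s + E)) (s ∸ suc Z)
              (linarith 4 (λ Z w s E → Z ⊗ κ 30 ⊴ w ⇒ w ⊗ κ 6 ⊴ s ⇒ ⊢ Z ⊴ κ 1 ⊕ (s ⊕ E)) Z w s E Z-small 6w≤s)
              (linarith 5 (λ c Z s T T′ → c ⊕ (κ 1 ⊕ Z) ≐ s ⇒ s ⊴ T ⇒ T ⊴ T′ ⊕ κ 1 ⇒ ⊢ c ⊕ Z ⊴ T′) (s ∸ suc Z) Z s (ct (suc (s + E)) T) (ct (suc (s + E)) T′) s-Z dense (ct-remove-≤ (suc (s + E)) y T))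
              t Y<t (linarith 7 (λ t N p k w c z → t ⊲ N ⇒ N ⊗ κ 2 ⊴ p ⊕ κ 1 ⇒ p ⊗ κ 2 ⊴ k ⊗ k ⊕ k ⊗ κ 4 ⊕ κ 3 ⇒ k ⊗ k ⊴ (w ⊗ κ 8 ⊕ κ 7) ⊗ (w ⊗ κ 8 ⊕ κ 7) ⇒
                  k ⊴ w ⊗ κ 8 ⊕ κ 7 ⇒ (w ⊗ κ 59) ⊗ (w ⊗ κ 59) ⊴ (c ⊗ κ 10) ⊗ (c ⊗ κ 10) ⇒ w ⊗ κ 1000000 ⊴ w ⊗ w ⇒ κ 1000000 ⊴ w ⇒ ⊢ t ⊗ κ 2 ⊴ c ⊗ c)
                t N p k w (s ∸ suc Z) 0 t<N N-upper p-upper (*-mono-≤ k≤8w+7 k≤8w+7) k≤8w+7 (*-mono-≤ c≥ c≥) (*-monoʳ-≤ w w-large) w-large)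
              where
              s-Z : s ∸ suc Z + suc Z ≡ s
              s-Z = m∸n+n≡m (linarith 3 (λ Z w s → Z ⊗ κ 30 ⊴ w ⇒ w ⊗ κ 6 ⊴ s ⇒ κ 1000000 ⊴ w ⇒ ⊢ κ 1 ⊕ Z ⊴ s) Z w s Z-small 6w≤s w-large)
              c≥ : w * 59 ≤ (s ∸ suc Z) * 10
              c≥ = linarith 4 (λ c Z s w → c ⊕ (κ 1 ⊕ Z) ≐ s ⇒ w ⊗ κ 6 ⊴ s ⇒ Z ⊗ κ 30 ⊴ w ⇒ κ 1000000 ⊴ w ⇒ ⊢ w ⊗ κ 59 ⊴ c ⊗ κ 10) (s ∸ suc Z) Z s w s-Z 6w≤s Z-small w-large

          weight-bound : wt N T ≤ p + Z * Z + e
          weight-bound = bound (Long.long-interval N T′ K (suc e) z missing′ refl (≤-trans (n≤1+n _) Z≤K) K<N far)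
            where
            bound : (∃ λ a → ∃ λ b → Interval T′ a b × wt N T′ + a ≤ b + Z * Z) → wt N T ≤ p + Z * Z + e
            bound (a , b , int , le) = linarith 8 (λ t t′ y a b zz p e → t ≐ t′ ⊕ y ⇒ t′ ⊕ a ⊴ b ⊕ zz ⇒ b ⊕ κ 1 ⊲ a ⊕ p ⇒ y ⊲ κ 2 ⊕ e ⇒ ⊢ t ⊴ p ⊕ zz ⊕ e)
              (wt N T) (wt N T′) y a b (Z * Z) p e (wt-remove N y T Ty (bounded y Ty)) le (no-cover y a b Ty int) y≤

        weight : wt N T ≤ p + (e * 30 + 61) * (e * 30 + 61) + e
        weight = let (y , y≤ , Ty) = small-element in subst (λ Z → wt N T ≤ p + Z * Z + e) (Z≡ y y≤ Ty) (weight-bound y y≤ Ty)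

        -- Each element missing up to K costs about k - K ≥ k/2 in weight, while 2p exceeds k² + k
        -- by at most 3k + 3. As e ≤ w/1000, the error (30e + 61)² cannot compensate.
        e≤4 : e ≤ 4
        e≤4 = ≮⇒≥ λ 4<e → linarith 7 (λ k e K t p w z →
            k ⊗ k ⊕ k ⊕ κ 2 ⊗ e ⊗ k ⊕ κ 2 ⊗ e ⊗ e ⊴ κ 2 ⊗ t ⊕ κ 2 ⊗ e ⊗ K ⇒ e ⊗ (K ⊗ κ 2) ⊴ e ⊗ k ⇒
            t ⊴ p ⊕ (e ⊗ κ 30 ⊕ κ 61) ⊗ (e ⊗ κ 30 ⊕ κ 61) ⊕ e ⇒ p ⊗ κ 2 ⊴ k ⊗ k ⊕ k ⊗ κ 4 ⊕ κ 3 ⇒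
            e ⊗ (e ⊗ κ 1000) ⊴ e ⊗ w ⇒ e ⊗ (w ⊗ κ 8) ⊴ e ⊗ k ⇒ κ 5 ⊗ k ⊴ e ⊗ k ⇒ e ⊗ κ 1000000 ⊴ e ⊗ w ⇒ w ⊗ κ 8 ⊴ k ⇒ κ 1000000 ⊴ w ⇒ ⊢⊥)
            k e K (wt N T) p w 0 (wt-missing N T K e k K<N T0 #T (proj₂ missing)) (*-monoʳ-≤ e 2K≤k) weight p-upper
            (*-monoʳ-≤ e e-small) (*-monoʳ-≤ e 8w≤k) (*-monoˡ-≤ k 4<e) (*-monoʳ-≤ e w-large) 8w≤k w-large

      -- (30 · 4 + 61)² + 4 = 32765.
      few-missing : wt N T ≤ p + 33000
      few-missing = linarith 4 (λ t p e ee → t ⊴ p ⊕ (e ⊗ κ 30 ⊕ κ 61) ⊗ (e ⊗ κ 30 ⊕ κ 61) ⊕ e ⇒ e ⊴ κ 4 ⇒ e ⊗ e ⊴ κ 4 ⊗ κ 4 ⇒ ⊢ t ⊴ p ⊕ κ 33000)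
        (wt N T) p e 0 weight e≤4 (*-mono-≤ e≤4 e≤4)

-- Finite checks on the small elements and the exact set of subset sums.

module Endgame where

  open LinearArithmetic
  open FiniteSets
  open NaturalSets
  open SignedSums
  open import Data.List using (List; []; _∷_; length)

  all-lists any-lists : ℕ → (List Bool → Bool) → Bool
  all-lists zero P = P []
  all-lists (suc n) P = all-lists n (λ bs → P (true ∷ bs)) ∧ all-lists n (λ bs → P (false ∷ bs))
  any-lists zero P = P []
  any-lists (suc n) P = any-lists n (λ bs → P (true ∷ bs)) ∨ any-lists n (λ bs → P (false ∷ bs))

  all-lists-sound : ∀ n P → all-lists n P ≡ true → ∀ bs → length bs ≡ n → P bs ≡ true
  all-lists-sound zero P h [] _ = h
  all-lists-sound (suc n) P h (true ∷ bs) e = all-lists-sound n _ (proj₁ (∧-elim {all-lists n (λ bs → P (true ∷ bs))} h)) bs (suc-injective e)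
  all-lists-sound (suc n) P h (false ∷ bs) e = all-lists-sound n _ (proj₂ (∧-elim {all-lists n (λ bs → P (true ∷ bs))} h)) bs (suc-injective e)

  any-lists-sound : ∀ n P → any-lists n P ≡ true → ∃ λ bs → length bs ≡ n × P bs ≡ true
  any-lists-sound zero P h = [] , refl , h
  any-lists-sound (suc n) P h with ∨-elim {any-lists n (λ bs → P (true ∷ bs))} h
  ... | inj₁ h₁ = let (bs , e , p) = any-lists-sound n _ h₁ in true ∷ bs , cong suc e , p
  ... | inj₂ h₂ = let (bs , e , p) = any-lists-sound n _ h₂ in false ∷ bs , cong suc e , p

  -- A list of Booleans records which of i, i + 1, … belong to a set.
  weightˡ : ℕ → List Bool → ℕ
  weightˡ i [] = 0
  weightˡ i (b ∷ bs) = i * 𝟙 b + weightˡ (suc i) bs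

  countˡ : List Bool → ℕ
  countˡ [] = 0
  countˡ (b ∷ bs) = 𝟙 b + countˡ bs

  member : List Bool → NSet
  member [] t = false
  member (b ∷ bs) zero = b
  member (b ∷ bs) (suc t) = member bs t

  bits : NSet → ℕ → ℕ → List Bool
  bits T i zero = []
  bits T i (suc n) = T i ∷ bits T (suc i) n

  member-bits : ∀ T i n t → t < n → member (bits T i n) t ≡ T (i + t)
  member-bits T i (suc n) zero _ = cong T (sym (+-identityʳ i))
  member-bits T i (suc n) (suc t) (s≤s lt) = trans (member-bits T (suc i) n t lt) (cong T (sym (+-suc i t)))

  member-long : ∀ bs t → length bs ≤ t → member bs t ≡ false
  member-long [] t _ = refl
  member-long (b ∷ bs) (suc t) (s≤s le) = member-long bs t le

  weightˡ-member : ∀ i bs → sumTo (length bs) (λ t → (i + t) * 𝟙 (member bs t)) ≡ weightˡ i bs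
  weightˡ-member i [] = refl
  weightˡ-member i (b ∷ bs) = trans (sumTo-suc (length bs) (λ t → (i + t) * 𝟙 (member (b ∷ bs) t)))
    (cong₂ _+_ (cong (_* 𝟙 b) (+-identityʳ i)) (trans (sumTo-cong (length bs) λ t _ → cong (_* 𝟙 (member bs t)) (+-suc i t)) (weightˡ-member (suc i) bs)))

  countˡ-member : ∀ bs → sumTo (length bs) (λ t → 𝟙 (member bs t)) ≡ countˡ bs
  countˡ-member [] = refl
  countˡ-member (b ∷ bs) = trans (sumTo-suc (length bs) (λ t → 𝟙 (member (b ∷ bs) t))) (cong (𝟙 b +_) (countˡ-member bs))

  wt-member : ∀ N bs → length bs < N → wt N (member (false ∷ bs)) ≡ weightˡ 1 bs
  wt-member N bs lt = trans (sumTo-below N (suc (length bs)) f f lt (λ _ _ → refl)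
      λ t le → trans (cong (λ b → t * 𝟙 b) (member-long (false ∷ bs) t le)) (*-zeroʳ t))
    (trans (sumTo-suc (length bs) f) (weightˡ-member 1 bs))
    where
    f : ℕ → ℕ
    f t = t * 𝟙 (member (false ∷ bs) t)

  _⊆ˡ_ _≡ˡ_ : List Bool → List Bool → Bool
  [] ⊆ˡ [] = true
  (a ∷ as) ⊆ˡ (b ∷ bs) = (not a ∨ b) ∧ (as ⊆ˡ bs)
  _ ⊆ˡ _ = false
  [] ≡ˡ [] = true
  (a ∷ as) ≡ˡ (b ∷ bs) = (not a ∨ b) ∧ ((not b ∨ a) ∧ (as ≡ˡ bs))
  _ ≡ˡ _ = false

  ⊆ˡ-sound : ∀ as bs → as ⊆ˡ bs ≡ true → ∀ t → member as t ≡ true → member bs t ≡ true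
  ⊆ˡ-sound (a ∷ as) (b ∷ bs) h t with ∧-elim {not a ∨ b} h
  ⊆ˡ-sound (true ∷ as) (true ∷ bs) h zero | _ = λ _ → refl
  ⊆ˡ-sound (a ∷ as) (b ∷ bs) h (suc t) | _ , h₂ = ⊆ˡ-sound as bs h₂ t

  ≡ˡ-complete : ∀ as bs → length as ≡ length bs → (∀ t → member as t ≡ member bs t) → as ≡ˡ bs ≡ true
  ≡ˡ-complete [] [] _ _ = refl
  ≡ˡ-complete (a ∷ as) (b ∷ bs) e h = ∧-intro (imp (h 0)) (∧-intro (imp (sym (h 0))) (≡ˡ-complete as bs (suc-injective e) (h ∘ suc)))
    where
    imp : ∀ {a b} → a ≡ b → not a ∨ b ≡ true
    imp {true} refl = refl
    imp {false} refl = refl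

  missingˡ : List Bool → ℕ
  missingˡ bs = countˡ (Data.List.map not bs)

  second : List Bool → Bool
  second (_ ∷ b ∷ _) = b
  second _ = true

  -- ts and ns are the elements of T and Neg among 1, …, 7.
  Small : ℕ → List Bool → List Bool → Bool
  Small δ ts ns = (weightˡ 1 ns ≤ᵇ 2 * (1 + δ)) ∧ ((countˡ ns ≤ᵇ 1 + δ) ∧ (second ts ∨ (weightˡ 1 ns ≤ᵇ 3)))

  second-sum : List Bool → List Bool → List Bool → Bool
  second-sum ts ns vs = (vs ⊆ˡ ts) ∧ ((weightˡ 1 vs ≡ᵇ weightˡ 1 ns) ∧ not (vs ≡ˡ ns))

  pad : List Bool → List Bool
  pad ns = ns Data.List.++ (false ∷ false ∷ false ∷ [])

  -- Either the negative elements satisfy the required bounds, or the elements of T up to 7 contain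
  -- a second set of the same weight, which zero-freeness forbids. Only 1, ..., 4 can be negative,
  -- so 4 bits are padded to 7.
  dichotomy : ℕ → List Bool → List Bool → Bool
  dichotomy δ ts ns = not (missingˡ ts ≤ᵇ δ) ∨ (not (pad ns ⊆ˡ ts) ∨ (Small δ ts (pad ns) ∨ any-lists 7 (second-sum ts (pad ns))))

  dichotomy₀ : all-lists 7 (λ ts → all-lists 4 (dichotomy 0 ts)) ≡ true
  dichotomy₀ = refl

  dichotomy₁ : all-lists 7 (λ ts → all-lists 4 (dichotomy 1 ts)) ≡ true
  dichotomy₁ = refl

  -- The smaller of the two sums that {2, 3, 4} or {1, 3, 4} fails to represent; 0 stands for no
  -- gap.
  gap : List Bool → ℕ
  gap (false ∷ _) = 1
  gap (true ∷ false ∷ _) = 2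
  gap _ = 0

  up-to : ℕ → (ℕ → Bool) → Bool
  up-to zero P = true
  up-to (suc n) P = P n ∧ up-to n P

  up-to-sound : ∀ n P → up-to n P ≡ true → ∀ x → x < n → P x ≡ true
  up-to-sound (suc n) P h x x<n with ∧-elim {P n} h
  ... | h₁ , h₂ = [ up-to-sound n P h₂ x , (λ { refl → h₁ }) ]′ (m≤n⇒m<n∨m≡n (≤-pred x<n))

  ordinaryˡ : ℕ → ℕ → ℕ → Bool
  ordinaryˡ q x σ = (q ≡ᵇ 0) ∨ (not (x ≡ᵇ q) ∧ not (x + q ≡ᵇ σ))

  representable : List Bool → ℕ → Bool
  representable ts x = not (x ≤ᵇ weightˡ 1 ts) ∨ (not (ordinaryˡ (gap ts) x (weightˡ 1 ts)) ∨ any-lists 4 (λ vs → (vs ⊆ˡ ts) ∧ (weightˡ 1 vs ≡ᵇ x)))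

  -- The gap is 1 for {2, 3, 4}, of weight 9, and 2 for {1, 3, 4}, of weight 8. In the gapless cases
  -- only a lower bound for the weight is kept.
  profile : List Bool → Bool
  profile ts = ((gap ts ≡ᵇ 0) ∧ (6 ≤ᵇ weightˡ 1 ts + missingˡ ts)) ∨
    ((missingˡ ts ≡ᵇ 1) ∧ (((gap ts ≡ᵇ 1) ∧ (weightˡ 1 ts ≡ᵇ 9)) ∨ ((gap ts ≡ᵇ 2) ∧ (weightˡ 1 ts ≡ᵇ 8))))

  initial-segment : all-lists 4 (λ ts → not (missingˡ ts ≤ᵇ 1) ∨ (profile ts ∧ up-to 11 (representable ts))) ≡ true
  initial-segment = refl

  weightˡ-max : all-lists 4 (λ ts → weightˡ 1 ts <ᵇ 11) ≡ true
  weightˡ-max = refl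

  ∨-not : ∀ {a b} → not a ∨ b ≡ true → a ≡ true → b ≡ true
  ∨-not {true} h refl = h

  ≤ᵇ-true : ∀ {m n} → m ≤ n → (m ≤ᵇ n) ≡ true
  ≤ᵇ-true {m} {n} le with m ≤ᵇ n | ≤⇒≤ᵇ le
  ... | true | _ = refl

  ≤ᵇ-sound : ∀ {m n} → (m ≤ᵇ n) ≡ true → m ≤ n
  ≤ᵇ-sound {m} {n} e = ≤ᵇ⇒≤ m n (subst Data.Bool.T (sym e) _)

  -- Complementation makes the subset sums symmetric about σ/2, so the gap q comes with its mirror
  -- image σ - q.
  Ordinary : ℕ → ℕ → ℕ → Set
  Ordinary q x σ = (q ≡ 0) ⊎ (¬ x ≡ q × ¬ x + q ≡ σ)

  ordinaryˡ-complete : ∀ q x σ → Ordinary q x σ → ordinaryˡ q x σ ≡ true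
  ordinaryˡ-complete q x σ (inj₁ refl) = refl
  ordinaryˡ-complete q x σ (inj₂ (a , b)) = ∨-introʳ {q ≡ᵇ 0} (∧-intro (not-true (¬true⇒false (a ∘ ≡ᵇ-sound))) (not-true (¬true⇒false (b ∘ ≡ᵇ-sound))))

  Profile : ℕ → ℕ → ℕ → Set
  Profile q σ₄ miss = (q ≡ 0 × 6 ≤ σ₄ + miss) ⊎ (miss ≡ 1 × ((q ≡ 1 × σ₄ ≡ 9) ⊎ (q ≡ 2 × σ₄ ≡ 8)))

  profile-sound : ∀ ts → profile ts ≡ true → Profile (gap ts) (weightˡ 1 ts) (missingˡ ts)
  profile-sound ts h with ∨-elim {(gap ts ≡ᵇ 0) ∧ (6 ≤ᵇ weightˡ 1 ts + missingˡ ts)} h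
  ... | inj₁ h₁ = inj₁ (≡ᵇ-sound (proj₁ (∧-elim {gap ts ≡ᵇ 0} h₁)) , ≤ᵇ-sound (proj₂ (∧-elim {gap ts ≡ᵇ 0} h₁)))
  ... | inj₂ h₂ with ∧-elim {missingˡ ts ≡ᵇ 1} h₂
  ... | m , h₃ with ∨-elim {(gap ts ≡ᵇ 1) ∧ (weightˡ 1 ts ≡ᵇ 9)} h₃
  ... | inj₁ a = inj₂ (≡ᵇ-sound m , inj₁ (≡ᵇ-sound (proj₁ (∧-elim {gap ts ≡ᵇ 1} a)) , ≡ᵇ-sound (proj₂ (∧-elim {gap ts ≡ᵇ 1} a))))
  ... | inj₂ a = inj₂ (≡ᵇ-sound m , inj₂ (≡ᵇ-sound (proj₁ (∧-elim {gap ts ≡ᵇ 2} a)) , ≡ᵇ-sound (proj₂ (∧-elim {gap ts ≡ᵇ 2} a))))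

  -- Two missing elements besides 0 are tolerated up to M, though only one below 5, so that the
  -- result applies to T and also to T without one element u ≥ 5.
  module Cover (N : ℕ) (U : NSet) (M r : ℕ) (U0 : U 0 ≡ false) (few : ∀ m → m ≤ suc M → ct m (not ∘ U) ≤ 3) (few₅ : ct 5 (not ∘ U) ≤ 2)
    (max : ∀ t → U t ≡ true → t ≤ r * 3) (r<5M+5 : r < M * 5 + 5) (M-large : 100000 ≤ M) (M<N : M < N) where

    open Sums N

    ts : List Bool
    ts = bits U 1 4

    q σ₄ miss : ℕ
    q = gap ts
    σ₄ = weightˡ 1 ts
    miss = missingˡ ts

    private
      U₁ U₂ : NSet
      U₁ = below 5 U
      U₂ = above 5 U

      5≤N : 5 ≤ N
      5≤N = ≤-trans (m≤m+n 5 99995) (≤-trans M-large (<⇒≤ M<N))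

      miss≡ : ct 5 (not ∘ U) ≡ 1 + miss
      miss≡ = linarith 5 (λ a b c d e → a ≐ κ 1 ⇒ ⊢ κ 0 ⊕ a ⊕ b ⊕ c ⊕ d ⊕ e ≐ κ 1 ⊕ (b ⊕ (c ⊕ (d ⊕ (e ⊕ κ 0)))))
        (𝟙 (not (U 0))) (𝟙 (not (U 1))) (𝟙 (not (U 2))) (𝟙 (not (U 3))) (𝟙 (not (U 4))) (cong (𝟙 ∘ not) U0)

      miss≤1 : miss ≤ 1
      miss≤1 = ≤-pred (≤-trans (≤-reflexive (sym miss≡)) few₅)

      checked : profile ts ∧ up-to 11 (representable ts) ≡ true
      checked = ∨-not {missingˡ ts ≤ᵇ 1} (all-lists-sound 4 (λ ts → not (missingˡ ts ≤ᵇ 1) ∨ (profile ts ∧ up-to 11 (representable ts))) initial-segment ts refl) (≤ᵇ-true miss≤1)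

      σ₄≡ : wt 5 U ≡ σ₄
      σ₄≡ = linarith 4 (λ b c d e → ⊢ κ 0 ⊕ κ 0 ⊕ κ 1 ⊗ b ⊕ κ 2 ⊗ c ⊕ κ 3 ⊗ d ⊕ κ 4 ⊗ e ≐ κ 1 ⊗ b ⊕ (κ 2 ⊗ c ⊕ (κ 3 ⊗ d ⊕ (κ 4 ⊗ e ⊕ κ 0))))
        (𝟙 (U 1)) (𝟙 (U 2)) (𝟙 (U 3)) (𝟙 (U 4))

    gap-profile : Profile q σ₄ miss
    gap-profile = profile-sound ts (proj₁ (∧-elim {profile ts} checked))

    private
      ts-member : ∀ t → member (false ∷ ts) t ≡ true → U₁ t ≡ true
      ts-member (suc t) h = lem (suc t <? 5)
        where
        lem : Dec (suc t < 5) → U₁ (suc t) ≡ true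
        lem (yes lt) = below-intro {5} {U} (trans (sym (member-bits U 1 4 t (≤-pred lt))) h) lt
        lem (no ≮) = ⊥-elim (true≢false h (member-long ts t (≤-pred (≮⇒≥ ≮))))

      base : ∀ x → x ≤ σ₄ → Ordinary q x σ₄ → Sum U₁ x
      base x x≤ ord = build (any-lists-sound 4 (λ vs → (vs ⊆ˡ ts) ∧ (weightˡ 1 vs ≡ᵇ x))
          (∨-not {ordinaryˡ q x σ₄} (∨-not {x ≤ᵇ σ₄} (up-to-sound 11 (representable ts) (proj₂ (∧-elim {profile ts} checked)) x
            (≤-<-trans x≤ (<ᵇ-sound (all-lists-sound 4 (λ ts → weightˡ 1 ts <ᵇ 11) weightˡ-max ts refl)))) (≤ᵇ-true x≤)) (ordinaryˡ-complete q x σ₄ ord)))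
        where
        build : (∃ λ vs → length vs ≡ 4 × (vs ⊆ˡ ts) ∧ (weightˡ 1 vs ≡ᵇ x) ≡ true) → Sum U₁ x
        build (vs , len , h) = member (false ∷ vs) ,
          (λ t m → ts-member t (⊆ˡ-sound (false ∷ vs) (false ∷ ts) (proj₁ (∧-elim {vs ⊆ˡ ts} h)) t m)) ,
          trans (wt-member N vs (≤-trans (s≤s (≤-reflexive len)) 5≤N)) (≡ᵇ-sound (proj₂ (∧-elim {vs ⊆ˡ ts} h)))

      ct-U₂ : ∀ m → 5 ≤ m → m ≤ suc M → m + miss ≤ ct m U₂ + 7
      ct-U₂ m 5≤m m≤ = linarith 7 (λ m s c u n b d → u ⊕ n ≐ m ⇒ n ⊴ κ 3 ⇒ u ≐ b ⊕ c ⇒ b ⊕ d ≐ κ 5 ⇒ d ≐ κ 1 ⊕ s ⇒ ⊢ m ⊕ s ⊴ c ⊕ κ 7)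
        m miss (ct m U₂) (ct m U) (ct m (not ∘ U)) (ct m U₁) (ct 5 (not ∘ U)) (ct+missing m U) (few m m≤) (ct-below-above m 5 U)
        (trans (cong (_+ ct 5 (not ∘ U)) (ct-below m 5 U 5≤m)) (ct+missing 5 U)) miss≡

      U₂-≥ : ∀ t → U₂ t ≡ true → 5 ≤ t
      U₂-≥ t h = proj₂ (above-elim {5} {U} h)

      wt-U₂ : ∀ m → ct m U₂ * 5 ≤ wt m U₂
      wt-U₂ m = linarith 3 (λ c w cc → c ⊗ (κ 2 ⊗ κ 5) ⊕ cc ⊴ κ 2 ⊗ w ⊕ c ⇒ c ⊴ cc ⇒ ⊢ c ⊗ κ 5 ⊴ w) (ct m U₂) (wt m U₂) (ct m U₂ * ct m U₂) (wt-lower m 5 U₂ U₂-≥) (sq (ct m U₂))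
        where
        sq : ∀ c → c ≤ c * c
        sq zero = z≤n
        sq (suc c) = m≤m*n (suc c) (suc c)

      far : ∀ t → U₂ t ≡ true → M < t → t + 10 ≤ wt t U₂
      far t h M<t = linarith 7 (λ t w w′ c M r cc → w′ ⊴ w ⇒ cc ⊕ c ⊴ κ 2 ⊗ w′ ⇒ c ⊗ κ 90000 ⊴ cc ⇒ κ 1 ⊕ M ⊴ c ⊕ κ 7 ⇒ t ⊴ r ⊗ κ 3 ⇒ r ⊲ M ⊗ κ 5 ⊕ κ 5 ⇒ κ 100000 ⊴ M ⇒ ⊢ t ⊕ κ 10 ⊴ w)
        t (wt t U₂) (wt (suc M) U₂) c M r (c * c) (sumTo-≤ {suc M} {t} (λ t → t * 𝟙 (U₂ t)) M<t) (triangular (suc M) U₂ (¬true⇒false λ h → <⇒≱ (s≤s z≤n) (U₂-≥ 0 h)))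
        (*-monoʳ-≤ c (linarith 2 (λ c M → κ 1 ⊕ M ⊴ c ⊕ κ 7 ⇒ κ 100000 ⊴ M ⇒ ⊢ κ 90000 ⊴ c) c M c≥ M-large)) c≥ (max t (proj₁ (above-elim {5} {U} h))) r<5M+5 M-large
        where
        c : ℕ
        c = ct (suc M) U₂
        c≥ : suc M ≤ c + 7
        c≥ = ≤-trans (m≤m+n (suc M) miss) (ct-U₂ (suc M) (≤-trans (≤-trans (m≤m+n 5 99995) M-large) (n≤1+n M)) ≤-refl)

      wt-none : ∀ m V → ct m V ≡ 0 → wt m V ≡ 0
      wt-none zero V _ = refl
      wt-none (suc m) V e = cong₂ _+_ (wt-none m V (m+n≡0⇒m≡0 (ct m V) e)) (lem (V m) (m+n≡0⇒n≡0 (ct m V) e))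
        where
        lem : ∀ b → 𝟙 b ≡ 0 → m * 𝟙 b ≡ 0
        lem false _ = *-zeroʳ m

      -- When t is adjoined, the shift must fill the old hole σ - q, and the old sums must fill the
      -- shifted hole t + q. Both fail exactly when these holes coincide, that is when t + 2q = σ; t
      -- + q ≤ σ keeps the two ranges overlapping.
      Fits : ℕ → ℕ → ℕ → Set
      Fits q σ t = (q ≡ 0 × t ≤ suc σ) ⊎ (t + q ≤ σ × ¬ t + 2 * q ≡ σ)

      fits : ∀ t → U₂ t ≡ true → Fits q (σ₄ + wt t U₂) t
      fits t h = split gap-profile (≤-<-connex t M)
        where
        w c : ℕ
        w = wt t U₂
        c = ct t U₂
        5≤t : 5 ≤ t
        5≤t = U₂-≥ t h
        split : Profile q σ₄ miss → (t ≤ M) ⊎ (M < t) → Fits q (σ₄ + w) t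
        split (inj₁ (q0 , le)) (inj₁ t≤M) = inj₁ (q0 , linarith 5 (λ t s w c m → t ⊕ m ⊴ c ⊕ κ 7 ⇒ c ⊗ κ 5 ⊴ w ⇒ κ 6 ⊴ s ⊕ m ⇒ ⊢ t ⊴ κ 1 ⊕ (s ⊕ w))
          t σ₄ w c miss (ct-U₂ t 5≤t (m≤n⇒m≤1+n t≤M)) (wt-U₂ t) le)
        split (inj₁ (q0 , le)) (inj₂ M<t) = inj₁ (q0 , linarith 3 (λ t s w → t ⊕ κ 10 ⊴ w ⇒ ⊢ t ⊴ κ 1 ⊕ (s ⊕ w)) t σ₄ w (far t h M<t))
        split (inj₂ (_ , inj₁ (q1 , _))) (inj₂ M<t) = inj₂ (linarith 4 (λ t s w q → t ⊕ κ 10 ⊴ w ⇒ q ≐ κ 1 ⇒ ⊢ t ⊕ q ⊴ s ⊕ w) t σ₄ w q (far t h M<t) q1 ,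
          λ e → linarith 4 (λ t s w q → t ⊕ κ 10 ⊴ w ⇒ q ≐ κ 1 ⇒ t ⊕ κ 2 ⊗ q ≐ s ⊕ w ⇒ ⊢⊥) t σ₄ w q (far t h M<t) q1 e)
        split (inj₂ (_ , inj₂ (q2 , _))) (inj₂ M<t) = inj₂ (linarith 4 (λ t s w q → t ⊕ κ 10 ⊴ w ⇒ q ≐ κ 2 ⇒ ⊢ t ⊕ q ⊴ s ⊕ w) t σ₄ w q (far t h M<t) q2 ,
          λ e → linarith 4 (λ t s w q → t ⊕ κ 10 ⊴ w ⇒ q ≐ κ 2 ⇒ t ⊕ κ 2 ⊗ q ≐ s ⊕ w ⇒ ⊢⊥) t σ₄ w q (far t h M<t) q2 e)
        split (inj₂ (m1 , inj₁ (q1 , σ9))) (inj₁ t≤M) = inj₂ (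
          linarith 6 (λ t s w q c m → t ⊕ m ⊴ c ⊕ κ 7 ⇒ c ⊗ κ 5 ⊴ w ⇒ m ≐ κ 1 ⇒ q ≐ κ 1 ⇒ s ≐ κ 9 ⇒ ⊢ t ⊕ q ⊴ s ⊕ w) t σ₄ w q c miss (ct-U₂ t 5≤t (m≤n⇒m≤1+n t≤M)) (wt-U₂ t) m1 q1 σ9 ,
          λ e → linarith 6 (λ t s w q c m → t ⊕ m ⊴ c ⊕ κ 7 ⇒ c ⊗ κ 5 ⊴ w ⇒ m ≐ κ 1 ⇒ q ≐ κ 1 ⇒ s ≐ κ 9 ⇒ t ⊕ κ 2 ⊗ q ≐ s ⊕ w ⇒ ⊢⊥) t σ₄ w q c miss (ct-U₂ t 5≤t (m≤n⇒m≤1+n t≤M)) (wt-U₂ t) m1 q1 σ9 e)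
        split (inj₂ (m1 , inj₂ (q2 , σ8))) (inj₁ t≤M) = inj₂ (
          linarith 6 (λ t s w q c m → t ⊕ m ⊴ c ⊕ κ 7 ⇒ c ⊗ κ 5 ⊴ w ⇒ m ≐ κ 1 ⇒ q ≐ κ 2 ⇒ s ≐ κ 8 ⇒ ⊢ t ⊕ q ⊴ s ⊕ w) t σ₄ w q c miss (ct-U₂ t 5≤t (m≤n⇒m≤1+n t≤M)) (wt-U₂ t) m1 q2 σ8 ,
          differ (c ≟ 0))
          where
          differ : Dec (c ≡ 0) → ¬ t + 2 * q ≡ σ₄ + w
          -- For the first element above 4 adjoined to {1, 3, 4}, coinciding holes would mean t + 4
          -- = 8, against t ≥ 5.
          differ (yes c0) e = linarith 4 (λ t s w q → κ 5 ⊴ t ⇒ q ≐ κ 2 ⇒ s ≐ κ 8 ⇒ w ≐ κ 0 ⇒ t ⊕ κ 2 ⊗ q ≐ s ⊕ w ⇒ ⊢⊥) t σ₄ w q 5≤t q2 σ8 (wt-none t U₂ c0) e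
          differ (no c≢0) e = linarith 6 (λ t s w q c m → t ⊕ m ⊴ c ⊕ κ 7 ⇒ c ⊗ κ 5 ⊴ w ⇒ m ≐ κ 1 ⇒ q ≐ κ 2 ⇒ s ≐ κ 8 ⇒ κ 1 ⊴ c ⇒ t ⊕ κ 2 ⊗ q ≐ s ⊕ w ⇒ ⊢⊥) t σ₄ w q c miss (ct-U₂ t 5≤t (m≤n⇒m≤1+n t≤M)) (wt-U₂ t) m1 q2 σ8 (n≢0⇒n>0 c≢0) e

      C : ℕ → ℕ → Set
      C w x = x ≤ σ₄ + w × Ordinary q x (σ₄ + w)

      next : ∀ t → U₂ t ≡ true → t < N → ∀ x → C (wt t U₂ + t) x → C (wt t U₂) x ⊎ ∃ λ y → y + t ≡ x × C (wt t U₂) y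
      next t h _ x (x≤ , ord) = split (fits t h) ord (x ≤? σ)
        where
        σ : ℕ
        σ = σ₄ + wt t U₂
        σ+t : σ₄ + (wt t U₂ + t) ≡ σ + t
        σ+t = sym (+-assoc σ₄ (wt t U₂) t)
        Next : Set
        Next = C (wt t U₂) x ⊎ ∃ λ y → y + t ≡ x × C (wt t U₂) y
        lower : t ≤ x → Ordinary q (x ∸ t) σ → Next
        lower t≤x o = inj₂ (x ∸ t , m∸n+n≡m t≤x , linarith 4 (λ x t y s → x ⊴ s ⊕ t ⇒ y ⊕ t ≐ x ⇒ ⊢ y ⊴ s) x t (x ∸ t) σ (≤-trans x≤ (≤-reflexive σ+t)) (m∸n+n≡m t≤x) , o)
        split : Fits q σ t → Ordinary q x (σ₄ + (wt t U₂ + t)) → Dec (x ≤ σ) → Next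
        split (inj₁ (q0 , _)) _ (yes le) = inj₁ (le , inj₁ q0)
        split (inj₁ (q0 , t≤)) _ (no gt) = lower (≤-trans t≤ (≰⇒> gt)) (inj₁ q0)
        split (inj₂ _) (inj₁ q0) (yes le) = inj₁ (le , inj₁ q0)
        split (inj₂ (t+q≤ , _)) (inj₁ q0) (no gt) = lower (≤-trans (≤-trans (m≤m+n t q) t+q≤) (<⇒≤ (≰⇒> gt))) (inj₁ q0)
        split (inj₂ (t+q≤ , t+2q≢)) (inj₂ (x≢q , x+q≢)) (yes le) = decide (x + q ≟ σ)
          where
          decide : Dec (x + q ≡ σ) → Next
          decide (no ne) = inj₁ (le , inj₂ (x≢q , ne))
          decide (yes e) = lower t≤x (inj₂ ((λ y≡q → t+2q≢ (linarith 5 (λ t q s x y → y ≐ q ⇒ y ⊕ t ≐ x ⇒ x ⊕ q ≐ s ⇒ ⊢ t ⊕ κ 2 ⊗ q ≐ s) t q σ x (x ∸ t) y≡q (m∸n+n≡m t≤x) e)) ,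
              λ y+q≡ → linarith 5 (λ t q s x y → y ⊕ q ≐ s ⇒ y ⊕ t ≐ x ⇒ x ⊕ q ≐ s ⇒ κ 5 ⊴ t ⇒ ⊢⊥) t q σ x (x ∸ t) y+q≡ (m∸n+n≡m t≤x) e (U₂-≥ t h)))
            where
            t≤x : t ≤ x
            t≤x = +-cancelʳ-≤ q t x (≤-trans t+q≤ (≤-reflexive (sym e)))
        split (inj₂ (t+q≤ , t+2q≢)) (inj₂ (x≢q , x+q≢)) (no gt) = lower t≤x (inj₂ (
            (λ y≡q → linarith 5 (λ t q s x y → y ≐ q ⇒ y ⊕ t ≐ x ⇒ t ⊕ q ⊴ s ⇒ s ⊲ x ⇒ ⊢⊥) t q σ x (x ∸ t) y≡q (m∸n+n≡m t≤x) t+q≤ (≰⇒> gt)) ,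
            λ y+q≡ → x+q≢ (linarith 6 (λ t q s x y z → y ⊕ q ≐ s ⇒ y ⊕ t ≐ x ⇒ z ≐ s ⊕ t ⇒ ⊢ x ⊕ q ≐ z) t q σ x (x ∸ t) (σ₄ + (wt t U₂ + t)) y+q≡ (m∸n+n≡m t≤x) σ+t)))
          where
          t≤x : t ≤ x
          t≤x = ≤-trans (≤-trans (m≤m+n t q) t+q≤) (<⇒≤ (≰⇒> gt))

      total : wt N U ≡ σ₄ + wt N U₂
      total = trans (wt-below-above N 5 U) (cong (_+ wt N U₂) (trans (wt-below N 5 U 5≤N) σ₄≡))

    covers : ∀ x → x ≤ wt N U → Ordinary q x (wt N U) → Sum U x
    covers x x≤ ord = Sum-mono (λ t h → [ (λ h₁ → proj₁ (below-elim {5} {U} h₁)) , (λ h₂ → proj₁ (above-elim {5} {U} h₂)) ]′ (∨-elim {U₁ t} h))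
      (adjoin U₁ U₂ C (λ t h₁ h₂ → <⇒≱ (proj₂ (below-elim {5} {U} h₁)) (U₂-≥ t h₂))
        (λ x (le , o) → base x (≤-trans le (≤-reflexive (+-identityʳ σ₄))) (subst (Ordinary q x) (+-identityʳ σ₄) o)) next x
        (≤-trans x≤ (≤-reflexive total) , subst (Ordinary q x) total ord))

  ⊆ˡ-complete : ∀ as bs → length as ≡ length bs → (∀ t → member as t ≡ true → member bs t ≡ true) → as ⊆ˡ bs ≡ true
  ⊆ˡ-complete [] [] _ _ = refl
  ⊆ˡ-complete (a ∷ as) (b ∷ bs) e h = ∧-intro (imp a (h 0)) (⊆ˡ-complete as bs (suc-injective e) (h ∘ suc))
    where
    imp : ∀ a → (a ≡ true → b ≡ true) → not a ∨ b ≡ true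
    imp true h = h refl
    imp false _ = refl

  ct-member : ∀ N bs → length bs < N → ct N (member (false ∷ bs)) ≡ countˡ bs
  ct-member N bs lt = trans (sumTo-below N (suc (length bs)) f f lt (λ _ _ → refl)
      λ t le → cong 𝟙 (member-long (false ∷ bs) t le))
    (trans (sumTo-suc (length bs) f) (countˡ-member bs))
    where
    f : ℕ → ℕ
    f t = 𝟙 (member (false ∷ bs) t)

  dichotomy-all : ∀ δ → δ ≤ 1 → all-lists 7 (λ ts → all-lists 4 (dichotomy δ ts)) ≡ true
  dichotomy-all zero _ = dichotomy₀
  dichotomy-all (suc zero) _ = dichotomy₁
  dichotomy-all (suc (suc δ)) (s≤s ())

  module Final (p N : ℕ) (0<p : 0 < p) (Pos Neg : NSet)
    (disjoint : ∀ t → Pos t ≡ true → Neg t ≡ true → ⊥)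
    (bounded : ∀ t → (Pos ⊔ⁿ Neg) t ≡ true → t < N)
    (zero-free : ∀ V → V ⊑ (Pos ⊔ⁿ Neg) → wt N V ≡[ p ] wt N Neg → ∀ t → V t ≡ Neg t)
    (r k δ M : ℕ) (k+δ : k + δ ≡ r) (δ≤1 : δ ≤ 1) (T0 : (Pos ⊔ⁿ Neg) 0 ≡ false) (#T : ct N (Pos ⊔ⁿ Neg) ≡ k)
    (weight : wt N (Pos ⊔ⁿ Neg) ≤ p + 33000) (p-upper : p * 2 ≤ r * r + r * 2) (p-lower : r * r ≤ p * 2) (N≡ : N * 2 ≡ p + 1)
    (5M≤r : M * 5 ≤ r) (r<5M+5 : r < M * 5 + 5) (M-large : 100000 ≤ M) (sign : wt N Neg ≤ wt N Pos) where

    open Signed p N 0<p Pos Neg disjoint bounded zero-free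
    open Sums N

    private
      r≤rr : r * 500000 ≤ r * r
      r≤rr = *-monoʳ-≤ r (≤-trans (*-monoˡ-≤ 5 M-large) 5M≤r)

      M<N : M < N
      M<N = linarith 4 (λ M N r p → M ⊗ κ 5 ⊴ r ⇒ r ⊗ κ 500000 ⊴ r ⊗ r ⇒ r ⊗ r ⊴ p ⊗ κ 2 ⇒ N ⊗ κ 2 ≐ p ⊕ κ 1 ⇒ ⊢ M ⊲ N) M N r p 5M≤r r≤rr p-lower N≡

      e : ℕ
      e = M ∸ ct (suc M) T

      missing : Missing T M e
      missing = T0 , m+[n∸m]≡n (linarith 3 (λ c m K → c ⊕ m ≐ κ 1 ⊕ K ⇒ κ 1 ⊴ m ⇒ ⊢ c ⊴ K) (ct (suc M) T) (ct (suc M) (not ∘ T)) M (ct+missing (suc M) T)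
          (≤-trans (≤-reflexive (sym (cong (𝟙 ∘ not) T0))) (sumTo-≤ {1} {suc M} (𝟙 ∘ not ∘ T) (s≤s z≤n))))

      -- Here the fraction 1/5 enters. Missing e elements up to M ≤ r/5 costs about 4ek/5 in weight,
      -- while p exceeds k(k + 1)/2 by at most about k/2 if δ = 0 and 3k/2 if δ = 1. The tight case
      -- is e = 2, δ = 1, where any fraction below 1/4 suffices.
      e≤δ : e ≤ δ
      e≤δ = ≮⇒≥ (bound δ δ≤1 k+δ)
        where
        lower : k * k + k + 2 * e * k + 2 * e * e ≤ 2 * wt N T + 2 * e * M
        lower = wt-missing N T M e k M<N T0 #T (proj₂ missing)
        bound : ∀ δ → δ ≤ 1 → k + δ ≡ r → ¬ δ < e
        bound zero _ k≡r 0<e = linarith 6 (λ k e M w p r →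
            k ⊗ k ⊕ k ⊕ κ 2 ⊗ e ⊗ k ⊕ κ 2 ⊗ e ⊗ e ⊴ κ 2 ⊗ w ⊕ κ 2 ⊗ e ⊗ M ⇒ w ⊴ p ⊕ κ 33000 ⇒ p ⊗ κ 2 ⊴ k ⊗ k ⊕ k ⊗ κ 2 ⇒
            e ⊗ (M ⊗ κ 5) ⊴ e ⊗ k ⇒ κ 1 ⊗ k ⊴ e ⊗ k ⇒ κ 100000 ⊴ M ⇒ M ⊗ κ 5 ⊴ k ⇒ ⊢⊥)
          k e M (wt N T) p r lower weight (subst (λ r → p * 2 ≤ r * r + r * 2) r≡k p-upper) (*-monoʳ-≤ e 5M≤k) (*-monoˡ-≤ k 0<e) M-large 5M≤k
          where
          r≡k : r ≡ k
          r≡k = trans (sym k≡r) (+-identityʳ k)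
          5M≤k : M * 5 ≤ k
          5M≤k = ≤-trans 5M≤r (≤-reflexive r≡k)
        bound (suc zero) _ k≡r 1<e = linarith 5 (λ k e M w p →
            k ⊗ k ⊕ k ⊕ κ 2 ⊗ e ⊗ k ⊕ κ 2 ⊗ e ⊗ e ⊴ κ 2 ⊗ w ⊕ κ 2 ⊗ e ⊗ M ⇒ w ⊴ p ⊕ κ 33000 ⇒ p ⊗ κ 2 ⊴ (k ⊕ κ 1) ⊗ (k ⊕ κ 1) ⊕ (k ⊕ κ 1) ⊗ κ 2 ⇒
            e ⊗ (M ⊗ κ 5) ⊴ e ⊗ (k ⊕ κ 1) ⇒ κ 2 ⊗ k ⊴ e ⊗ k ⇒ κ 100000 ⊴ M ⇒ M ⊗ κ 5 ⊴ k ⊕ κ 1 ⇒ e ⊗ κ 100000 ⊴ e ⊗ M ⇒ ⊢⊥)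
          k e M (wt N T) p lower weight (subst (λ r → p * 2 ≤ r * r + r * 2) (sym k≡r) p-upper) (*-monoʳ-≤ e 5M≤k) (*-monoˡ-≤ k 1<e) M-large 5M≤k (*-monoʳ-≤ e M-large)
          where
          5M≤k : M * 5 ≤ k + 1
          5M≤k = ≤-trans 5M≤r (≤-reflexive (sym k≡r))
        bound (suc (suc _)) (s≤s ()) _

    few-missing : ct (suc M) (not ∘ T) ≤ 1 + δ
    few-missing = ≤-trans (≤-reflexive (missing-count {T} missing)) (s≤s e≤δ)

    private
      few-below : ∀ m → m ≤ suc M → ct m (not ∘ T) ≤ 1 + δ
      few-below m le = ≤-trans (sumTo-≤ (𝟙 ∘ not ∘ T) le) few-missing

      ≤sucM : ∀ {m} → m ≤ 100000 → m ≤ suc M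
      ≤sucM le = ≤-trans (≤-trans le M-large) (n≤1+n M)

      -- The other k - 1 ≥ r - 2 elements already weigh about r²/2 - 3r/2, which leaves at most 5r/2
      -- and a constant for t.
      max : ∀ t → T t ≡ true → t ≤ r * 3
      max t Tt = linarith 8 (λ t r p w w′ c k δ → w ≐ w′ ⊕ t ⇒ w ⊴ p ⊕ κ 33000 ⇒ p ⊗ κ 2 ⊴ r ⊗ r ⊕ r ⊗ κ 2 ⇒ c ⊗ c ⊕ c ⊴ κ 2 ⊗ w′ ⇒
          r ⊗ r ⊴ (c ⊕ κ 2) ⊗ (c ⊕ κ 2) ⇒ r ⊴ c ⊕ κ 2 ⇒ c ⊕ κ 1 ≐ k ⇒ k ⊕ δ ≐ r ⇒ κ 500000 ⊴ r ⇒ ⊢ t ⊴ r ⊗ κ 3)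
        t r p (wt N T) (wt N (remove t T)) (ct N (remove t T)) k δ (wt-remove N t T Tt (bounded t Tt)) weight p-upper
        (triangular N (remove t T) (¬true⇒false λ h → true≢false (remove⊑ t 0 h) T0)) (*-mono-≤ r≤ r≤) r≤
        c≡ k+δ (≤-trans (*-monoˡ-≤ 5 M-large) 5M≤r)
        where
        c≡ : ct N (remove t T) + 1 ≡ k
        c≡ = trans (sym (ct-remove N t T Tt (bounded t Tt))) #T
        r≤ : r ≤ ct N (remove t T) + 2
        r≤ = linarith 4 (λ r c k δ → c ⊕ κ 1 ≐ k ⇒ k ⊕ δ ≐ r ⇒ δ ⊴ κ 1 ⇒ ⊢ r ⊴ c ⊕ κ 2) r (ct N (remove t T)) k δ c≡ k+δ δ≤1

      δ+1≤2 : 1 + δ ≤ 2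
      δ+1≤2 = s≤s δ≤1

      module CoverT = Cover N T M r T0 (λ m le → ≤-trans (few-below m le) (≤-trans δ+1≤2 (n≤1+n 2)))
        (≤-trans (few-below 5 (≤sucM (m≤m+n 5 99995))) δ+1≤2) max r<5M+5 M-large M<N

    Q τ⁺ : ℕ
    Q = gap (bits T 1 4)
    τ⁺ = wt N Pos

    covers : ∀ x → x ≤ wt N T → Ordinary Q x (wt N T) → Sum T x
    covers = CoverT.covers

    total : wt N T ≡ τ⁺ + τ
    total = wt-⊔ N Pos Neg disjoint

    private
      covers-remove : ∀ u → 5 ≤ u → ∀ x → x ≤ wt N (remove u T) → Ordinary Q x (wt N (remove u T)) → Sum (remove u T) x
      covers-remove u 5≤u x x≤ ord = CoverU.covers x x≤ (subst (λ q → Ordinary q x (wt N U)) (sym gap≡) ord)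
        where
        U : NSet
        U = remove u T
        same : ∀ t → t < 5 → U t ≡ T t
        same t t<5 = bool-ext (remove⊑ u t) (λ h → remove-intro {u} {T} h λ { refl → <⇒≱ t<5 5≤u })
        gap≡ : gap (bits U 1 4) ≡ Q
        gap≡ = cong gap (cong₂ _∷_ (same 1 (m≤m+n 2 3)) (cong₂ _∷_ (same 2 (m≤m+n 3 2)) (cong₂ _∷_ (same 3 (m≤m+n 4 1)) (cong (_∷ []) (same 4 ≤-refl)))))
        fewU : ∀ m → ct m (not ∘ U) ≤ ct m (not ∘ T) + 1
        fewU m = linarith 5 (λ c c′ d d′ m → c ⊕ d ≐ m ⇒ c′ ⊕ d′ ≐ m ⇒ c ⊴ c′ ⊕ κ 1 ⇒ ⊢ d′ ⊴ d ⊕ κ 1) (ct m T) (ct m U) (ct m (not ∘ T)) (ct m (not ∘ U)) m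
          (ct+missing m T) (ct+missing m U) (ct-remove-≤ m u T)
        module CoverU = Cover N U M r (¬true⇒false λ h → true≢false (remove⊑ u 0 h) T0)
          (λ m le → ≤-trans (fewU m) (≤-trans (+-monoˡ-≤ 1 (≤-trans (few-below m le) δ+1≤2)) ≤-refl))
          (≤-trans (≤-reflexive (ct-cong 5 λ t lt → cong not (same t lt))) (≤-trans (few-below 5 (≤sucM (m≤m+n 5 99995))) δ+1≤2))
          (λ t h → max t (remove⊑ u t h)) r<5M+5 M-large M<N

      exact : ∀ {T′} → T′ ⊑ T → Sum T′ τ → ∀ t → Neg t ≡ true → T′ t ≡ true
      exact sub (V , V⊑ , eq) t Nt = V⊑ t (trans (zero-free V (λ u h → sub u (V⊑ u h)) (0 , inj₁ (trans eq (sym (+-identityʳ τ)))) t) Nt)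

    Q≤2 : Q ≤ 2
    Q≤2 = lem CoverT.gap-profile
      where
      lem : Profile Q (weightˡ 1 (bits T 1 4)) (missingˡ (bits T 1 4)) → Q ≤ 2
      lem (inj₁ (e , _)) = ≤-trans (≤-reflexive e) z≤n
      lem (inj₂ (_ , inj₁ (e , _))) = ≤-trans (≤-reflexive e) (s≤s z≤n)
      lem (inj₂ (_ , inj₂ (e , _))) = ≤-reflexive e

    -- For a negative t ≥ 5 the weight τ would also be a subset sum of T without t, and
    -- zero-freeness would identify that subset with `Neg`. The orientation τ ≤ τ⁺ keeps τ in range
    -- and away from the upper hole.
    negative-small : ∀ t → Neg t ≡ true → t ≤ 4
    negative-small t Nt = ≮⇒≥ λ 4<t → proj₂ (remove-elim {t} {T} (exact (remove⊑ t) (covers-remove t 4<t τ (τ≤ 4<t) (ordinary 4<t)) t Nt)) refl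
      where
      Tt : T t ≡ true
      Tt = ∨-introʳ {Pos t} Nt
      removed : wt N T ≡ wt N (remove t T) + t
      removed = wt-remove N t T Tt (bounded t Tt)
      t≤τ : t ≤ τ
      t≤τ = ≤wt Neg Nt (bounded t Tt)
      τ≤ : 4 < t → τ ≤ wt N (remove t T)
      τ≤ _ = linarith 5 (λ w w′ t a b → w ≐ w′ ⊕ t ⇒ w ≐ a ⊕ b ⇒ t ⊴ b ⇒ b ⊴ a ⇒ ⊢ b ⊴ w′) (wt N T) (wt N (remove t T)) t τ⁺ τ removed total t≤τ sign
      ordinary : 4 < t → Ordinary Q τ (wt N (remove t T))
      ordinary 4<t = inj₂ ((λ e → <⇒≱ (≤-trans (≤-trans (s≤s (≤-trans Q≤2 (m≤m+n 2 2))) 4<t) t≤τ) (≤-reflexive e)) ,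
        λ e → linarith 8 (λ w w′ t a b q r k → w ≐ w′ ⊕ t ⇒ w ≐ a ⊕ b ⇒ b ⊴ a ⇒ b ⊕ q ≐ w′ ⇒ q ⊴ κ 2 ⇒ t ⊴ r ⊗ κ 3 ⇒ k ⊗ k ⊕ k ⊴ κ 2 ⊗ w ⇒ r ⊴ k ⊕ κ 1 ⇒ k ⊗ κ 400000 ⊴ k ⊗ k ⇒ κ 400000 ⊴ k ⇒ ⊢⊥)
          (wt N T) (wt N (remove t T)) t τ⁺ τ Q r k removed total sign e Q≤2 (max t Tt) (subst (λ k → k * k + k ≤ 2 * wt N T) #T (triangular N T T0)) r≤k+1 (*-monoʳ-≤ k k-large) k-large)
        where
        r≤k+1 : r ≤ k + 1
        r≤k+1 = ≤-trans (≤-reflexive (sym k+δ)) (+-monoʳ-≤ k δ≤1)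
        k-large : 400000 ≤ k
        k-large = linarith 3 (λ M r k → κ 100000 ⊴ M ⇒ M ⊗ κ 5 ⊴ r ⇒ r ⊴ k ⊕ κ 1 ⇒ ⊢ κ 400000 ⊴ k) M r k M-large 5M≤r r≤k+1

    private
      ts ns : List Bool
      ts = bits T 1 7
      ns = bits Neg 1 4

      Neg0 : Neg 0 ≡ false
      Neg0 = ¬true⇒false λ h → true≢false (∨-introʳ {Pos 0} h) T0

      Neg-large : ∀ t → 5 ≤ t → Neg t ≡ false
      Neg-large t 5≤t = ¬true⇒false λ h → <⇒≱ 5≤t (negative-small t h)

      Neg-member : ∀ t → Neg t ≡ member (false ∷ pad ns) t
      Neg-member 0 = Neg0
      Neg-member 1 = refl
      Neg-member 2 = refl
      Neg-member 3 = refl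
      Neg-member 4 = refl
      Neg-member 5 = Neg-large 5 ≤-refl
      Neg-member 6 = Neg-large 6 (m≤m+n 5 1)
      Neg-member 7 = Neg-large 7 (m≤m+n 5 2)
      Neg-member (suc (suc (suc (suc (suc (suc (suc (suc t)))))))) = Neg-large _ (m≤m+n 5 (3 + t))

      7<N : 7 < N
      7<N = ≤-trans (≤-trans (m≤m+n 8 99992) M-large) (<⇒≤ M<N)

      τ≡ : τ ≡ weightˡ 1 (pad ns)
      τ≡ = trans (wt-cong N λ t _ → Neg-member t) (wt-member N (pad ns) 7<N)

      #Neg≡ : ct N Neg ≡ countˡ (pad ns)
      #Neg≡ = trans (ct-cong N λ t _ → Neg-member t) (ct-member N (pad ns) 7<N)

      ts-few : missingˡ ts ≤ δ
      ts-few = ≤-pred (≤-trans (≤-reflexive (linarith 8 (λ a b c d e f g h → a ≐ κ 1 ⇒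
          ⊢ κ 1 ⊕ (b ⊕ (c ⊕ (d ⊕ (e ⊕ (f ⊕ (g ⊕ (h ⊕ κ 0))))))) ≐ κ 0 ⊕ a ⊕ b ⊕ c ⊕ d ⊕ e ⊕ f ⊕ g ⊕ h)
        (𝟙 (not (T 0))) (𝟙 (not (T 1))) (𝟙 (not (T 2))) (𝟙 (not (T 3))) (𝟙 (not (T 4))) (𝟙 (not (T 5))) (𝟙 (not (T 6))) (𝟙 (not (T 7))) (cong (𝟙 ∘ not) T0)))
        (few-below 8 (≤sucM (m≤m+n 8 99992))))

      member-ts : ∀ t → member (false ∷ ts) t ≡ true → T t ≡ true
      member-ts (suc t) h = lem (t <? 7)
        where
        lem : Dec (t < 7) → T (suc t) ≡ true
        lem (yes lt) = trans (sym (member-bits T 1 7 t lt)) h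
        lem (no ≮) = ⊥-elim (true≢false h (member-long ts t (≮⇒≥ ≮)))

      ns⊆ts : pad ns ⊆ˡ ts ≡ true
      ns⊆ts = ⊆ˡ-complete (pad ns) ts refl λ t h → inside t h (t <? 7)
        where
        inside : ∀ t → member (pad ns) t ≡ true → Dec (t < 7) → member ts t ≡ true
        inside t h (yes lt) = trans (member-bits T 1 7 t lt) (∨-introʳ {Pos (suc t)} (trans (Neg-member (suc t)) h))
        inside t h (no ≮) = ⊥-elim (true≢false h (member-long (pad ns) t (≮⇒≥ ≮)))

      small : Small δ ts (pad ns) ≡ true
      small = [ (λ h → h) , (λ h → ⊥-elim (unique (any-lists-sound 7 (second-sum ts (pad ns)) h))) ]′
        (∨-elim {Small δ ts (pad ns)} (∨-not {pad ns ⊆ˡ ts} (∨-not {missingˡ ts ≤ᵇ δ}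
          (all-lists-sound 4 (dichotomy δ ts) (all-lists-sound 7 (λ ts → all-lists 4 (dichotomy δ ts)) (dichotomy-all δ δ≤1) ts refl) ns refl)
          (≤ᵇ-true ts-few)) ns⊆ts))
        where
        unique : (∃ λ vs → length vs ≡ 7 × second-sum ts (pad ns) vs ≡ true) → ⊥
        unique (vs , len , h) = true≢false (≡ˡ-complete vs (pad ns) len λ t → trans (V≡Neg (suc t)) (Neg-member (suc t))) (not-elim (proj₂ (∧-elim {weightˡ 1 vs ≡ᵇ weightˡ 1 (pad ns)} h₂)))
          where
          V : NSet
          V = member (false ∷ vs)
          h₂ : (weightˡ 1 vs ≡ᵇ weightˡ 1 (pad ns)) ∧ not (vs ≡ˡ pad ns) ≡ true
          h₂ = proj₂ (∧-elim {vs ⊆ˡ ts} h)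
          V≡Neg : ∀ t → V t ≡ Neg t
          V≡Neg = zero-free V (λ t m → member-ts t (⊆ˡ-sound (false ∷ vs) (false ∷ ts) (proj₁ (∧-elim {vs ⊆ˡ ts} h)) t m))
            (0 , inj₁ (trans (wt-member N vs (≤-trans (s≤s (≤-reflexive len)) 7<N))
              (trans (≡ᵇ-sound (proj₁ (∧-elim {weightˡ 1 vs ≡ᵇ weightˡ 1 (pad ns)} h₂))) (trans (sym τ≡) (sym (+-identityʳ τ))))))

    negative-weight : τ ≤ 2 * (1 + δ)
    negative-weight = ≤-trans (≤-reflexive τ≡) (≤ᵇ-sound (proj₁ (∧-elim {weightˡ 1 (pad ns) ≤ᵇ 2 * (1 + δ)} small)))

    negative-count : ct N Neg ≤ 1 + δ
    negative-count = ≤-trans (≤-reflexive #Neg≡) (≤ᵇ-sound (proj₁ (∧-elim {countˡ (pad ns) ≤ᵇ 1 + δ} (proj₂ (∧-elim {weightˡ 1 (pad ns) ≤ᵇ 2 * (1 + δ)} small)))))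

    private
      gap-2 : ∀ a b cs → gap (a ∷ b ∷ cs) ≡ 2 → a ≡ true × b ≡ false
      gap-2 true false cs e = refl , refl
      gap-2 false _ cs ()
      gap-2 true true cs ()

      gap-1 : ∀ a b cs → gap (a ∷ b ∷ cs) ≡ 1 → a ≡ false
      gap-1 false _ cs e = refl
      gap-1 true false cs ()
      gap-1 true true cs ()

      negative-weight₂ : T 2 ≡ false → τ ≤ 3
      negative-weight₂ T2 = [ (λ h → ⊥-elim (true≢false h T2)) , (λ h → ≤-trans (≤-reflexive τ≡) (≤ᵇ-sound h)) ]′
        (∨-elim {T 2} (proj₂ (∧-elim {countˡ (pad ns) ≤ᵇ 1 + δ} (proj₂ (∧-elim {weightˡ 1 (pad ns) ≤ᵇ 2 * (1 + δ)} small)))))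

    -- A gap requires 1 or 2 to be missing, which uses up δ = 1. Then τ ≤ 4 if Q = 1, and τ ≤ 3 if Q
    -- = 2 because 2 is not in T; 2Q + τ ≤ 7 becomes the 7 in p + 7.
    gap-cases : Q ≡ 0 ⊎ (δ ≡ 1 × 1 ≤ Q × Missing T Q 1 × 2 * Q + τ ≤ 7)
    gap-cases = cases CoverT.gap-profile
      where
      δ≡1 : missingˡ (bits T 1 4) ≡ 1 → δ ≡ 1
      δ≡1 m = ≤-antisym δ≤1 (≤-pred (≤-trans (≤-trans (s≤s (≤-reflexive (sym m))) (≤-reflexive (linarith 5 (λ a b c d e → a ≐ κ 1 ⇒
        ⊢ κ 1 ⊕ (b ⊕ (c ⊕ (d ⊕ (e ⊕ κ 0)))) ≐ κ 0 ⊕ a ⊕ b ⊕ c ⊕ d ⊕ e)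
        (𝟙 (not (T 0))) (𝟙 (not (T 1))) (𝟙 (not (T 2))) (𝟙 (not (T 3))) (𝟙 (not (T 4))) (cong (𝟙 ∘ not) T0)))) (few-below 5 (≤sucM (m≤m+n 5 99995)))))
      τ≤4 : missingˡ (bits T 1 4) ≡ 1 → τ ≤ 4
      τ≤4 m = subst (λ δ → τ ≤ 2 * (1 + δ)) (δ≡1 m) negative-weight
      cases : Profile Q (weightˡ 1 (bits T 1 4)) (missingˡ (bits T 1 4)) → Q ≡ 0 ⊎ (δ ≡ 1 × 1 ≤ Q × Missing T Q 1 × 2 * Q + τ ≤ 7)
      cases (inj₁ (e , _)) = inj₁ e
      cases (inj₂ (m , inj₁ (e , _))) = inj₂ (δ≡1 m , ≤-reflexive (sym e) ,
        (T0 , subst (λ q → ct (suc q) T + 1 ≡ q) (sym e) (cong (_+ 1) (cong₂ _+_ (cong 𝟙 T0) (cong 𝟙 (gap-1 (T 1) (T 2) _ e))))) ,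
        subst (λ q → 2 * q + τ ≤ 7) (sym e) (≤-trans (+-monoʳ-≤ 2 (τ≤4 m)) (n≤1+n 6)))
      cases (inj₂ (m , inj₂ (e , _))) = inj₂ (δ≡1 m , ≤-trans (s≤s z≤n) (≤-reflexive (sym e)) ,
        (T0 , subst (λ q → ct (suc q) T + 1 ≡ q) (sym e) (cong (_+ 1) (cong₂ _+_ (cong₂ _+_ (cong 𝟙 T0) (cong 𝟙 (proj₁ (gap-2 (T 1) (T 2) _ e)))) (cong 𝟙 (proj₂ (gap-2 (T 1) (T 2) _ e)))))) ,
        subst (λ q → 2 * q + τ ≤ 7) (sym e) (+-monoʳ-≤ 4 (negative-weight₂ (proj₂ (gap-2 (T 1) (T 2) _ e)))))

    -- If τ⁺ ≥ p and p + τ is not a hole, some V has weight p + τ and must be `Neg`, whose weight is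
    -- τ. The upper hole wt T - Q equals p + τ exactly when τ⁺ = p + Q.
    positive-weight : (τ⁺ < p) ⊎ (1 ≤ Q × τ⁺ ≡ p + Q)
    positive-weight with τ⁺ <? p
    ... | yes lt = inj₁ lt
    ... | no ≮ = inj₂ (decide (Q ≟ 0) (τ⁺ ≟ p + Q))
      where
      contra : Ordinary Q (p + τ) (wt N T) → ⊥
      contra ord = absurd (covers (p + τ) (≤-trans (+-monoˡ-≤ τ (≮⇒≥ ≮)) (≤-reflexive (sym total))) ord)
        where
        absurd : Sum T (p + τ) → ⊥
        absurd (V , sub , eq) = <-irrefl (trans (sym (wt-cong N λ t _ → zero-free V sub (1 , inj₁ (trans eq (trans (+-comm p τ) (cong (τ +_) (sym (+-identityʳ p)))))) t)) eq)
          (≤-trans (s≤s ≤-refl) (+-monoˡ-≤ τ 0<p))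
      decide : Dec (Q ≡ 0) → Dec (τ⁺ ≡ p + Q) → 1 ≤ Q × τ⁺ ≡ p + Q
      decide (yes q0) _ = ⊥-elim (contra (inj₁ q0))
      decide (no q≢0) (yes e) = n≢0⇒n>0 q≢0 , e
      decide (no q≢0) (no ne) = ⊥-elim (contra (inj₂ ((λ e → linarith 5 (λ p t q r M → p ⊕ t ≐ q ⇒ q ⊴ κ 2 ⇒ r ⊗ r ⊴ p ⊗ κ 2 ⇒ r ⊗ κ 500000 ⊴ r ⊗ r ⇒ M ⊗ κ 5 ⊴ r ⇒ κ 100000 ⊴ M ⇒ ⊢⊥)
          p τ Q r M e Q≤2 p-lower r≤rr 5M≤r M-large) ,
        λ e → ne (+-cancelʳ-≡ τ τ⁺ (p + Q) (trans (sym total) (trans (sym e) (linarith 3 (λ p t q → ⊢ p ⊕ t ⊕ q ≐ p ⊕ q ⊕ t) p τ Q)))))))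

    -- The single missing element Q gives (k + 1)(k + 2)/2 ≤ wt T + Q = p + 2Q + τ by `wt-missing`,
    -- and k + 1 = r.
    triangle-bound : 1 ≤ Q → τ⁺ ≡ p + Q → r * (r + 1) ≤ 2 * (p + 7)
    triangle-bound 1≤Q τ⁺≡ = use gap-cases
      where
      use : Q ≡ 0 ⊎ (δ ≡ 1 × 1 ≤ Q × Missing T Q 1 × 2 * Q + τ ≤ 7) → r * (r + 1) ≤ 2 * (p + 7)
      use (inj₁ q0) = ⊥-elim (<⇒≱ 1≤Q (≤-reflexive q0))
      use (inj₂ (δ1 , _ , miss , small)) = subst (λ r → r * (r + 1) ≤ 2 * (p + 7)) r≡
        (linarith 6 (λ k w q p t a → k ⊗ k ⊕ k ⊕ κ 2 ⊗ κ 1 ⊗ k ⊕ κ 2 ⊗ κ 1 ⊗ κ 1 ⊴ κ 2 ⊗ w ⊕ κ 2 ⊗ κ 1 ⊗ q ⇒ w ≐ a ⊕ t ⇒ a ≐ p ⊕ q ⇒ κ 2 ⊗ q ⊕ t ⊴ κ 7 ⇒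
            ⊢ (k ⊕ κ 1) ⊗ (k ⊕ κ 1 ⊕ κ 1) ⊴ κ 2 ⊗ (p ⊕ κ 7))
          k (wt N T) Q p τ τ⁺ (wt-missing N T Q 1 k (≤-trans (s≤s Q≤2) (≤-trans (m≤m+n 3 4) (<⇒≤ 7<N))) T0 #T (proj₂ miss)) total τ⁺≡ small)
        where
        r≡ : k + 1 ≡ r
        r≡ = trans (cong (k +_) (sym δ1)) k+δ

-- Dilating a zero-free set and passing to absolute values.

module Dilation (p : ℕ) (prime : Prime p) (2<p : 2 < p) (q : ℕ) (p≡ : p ≡ suc (q + q)) where

  open LinearArithmetic
  open FiniteSets
  open NaturalSets
  open SignedSums using (_≡[_]_)
  open Residues p prime 2<p hiding (B; R)

  N : ℕ
  N = suc q

  sum-toℕ : ∀ n (f : ℕ → ℕ) → sum {n} (λ x → f (toℕ x)) ≡ sumTo n f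
  sum-toℕ zero f = refl
  sum-toℕ (suc n) f = trans (cong (f 0 +_) (sum-toℕ n (f ∘ suc))) (sym (sumTo-suc n f))

  sumTo-reverse : ∀ m (f : ℕ → ℕ) → sumTo m f ≡ sumTo m (λ t → f (m ∸ suc t))
  sumTo-reverse zero f = refl
  sumTo-reverse (suc m) f = trans (+-comm (sumTo m f) (f m)) (trans (cong (f m +_) (sumTo-reverse m f)) (sym (sumTo-suc m (λ t → f (m ∸ t)))))

  fold : ∀ (F : ℕ → ℕ) → sum (λ (x : Fin p) → F (toℕ x)) ≡ sumTo N F + sumTo q (λ t → F (p ∸ suc t))
  fold F = trans (sum-toℕ p F) (trans (cong (λ n → sumTo n F) p≡) (trans (sumTo-split N q F) (cong (sumTo N F +_)
    (trans (sumTo-reverse q (λ i → F (N + i))) (sumTo-cong q λ t lt → cong F (trans (sym (+-∸-assoc N lt)) (cong (_∸ suc t) (sym p≡))))))))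

  q<p : q < p
  q<p = ≤-trans (s≤s (m≤m+n q q)) (≤-reflexive (sym p≡))

  N≤p-suc : ∀ {t} → t < q → N ≤ p ∸ suc t
  N≤p-suc {t} lt = +-cancelʳ-≤ (suc t) N (p ∸ suc t) (≤-trans (≤-trans (+-monoʳ-≤ N lt) (≤-reflexive (sym p≡)))
    (≤-reflexive (sym (m∸n+n≡m (<⇒≤ (≤-<-trans lt q<p))))))

  π-neg : ∀ {t} → t < p → π (p ∸ t) ≡ π t ⁻¹
  π-neg lt = cong (λ k → π (p ∸ k)) (sym (toℕ-π-< lt))

  π-sum : ∀ {n} (f g : Fin n → ℕ) → (∀ x → π (f x) ≡ π (g x)) → π (sum f) ≡ π (sum g)
  π-sum {zero} f g h = refl
  π-sum {suc n} f g h = trans (sym (π-∙ (f fzero) (sum (f ∘ fsuc)))) (trans (cong₂ _∙_ (h fzero) (π-sum (f ∘ fsuc) (g ∘ fsuc) (h ∘ fsuc))) (π-∙ (g fzero) (sum (g ∘ fsuc))))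

  module Dilate (A : FSet p) (zf : ZeroFreeᶠ A) (e : Fin p) (e≢ε : ¬ e ≡ ε) where

    φ : Fin p → Fin p
    φ x = π (toℕ x * toℕ e)

    -- A divided by e, so that short multiples of e in A become small residues; the dilation factor
    -- is the inverse of e.
    D : FSet p
    D x = A (φ x)

    φ-π : ∀ y → φ (π y) ≡ π (y * toℕ e)
    φ-π y = trans (cong π (*-comm (toℕ (π y)) (toℕ e))) (trans (π-*ˡ (toℕ e) y) (cong π (*-comm (toℕ e) y)))

    inverse-unit : ∃ λ m → ∃ λ k → m * toℕ e ≡ 1 + k * p
    inverse-unit = unit-inverse (toℕ e) (≢ε⇒pos e≢ε) (toℕ<n e)

    d : Fin p
    d = π (proj₁ inverse-unit)

    ψ : Fin p → Fin p
    ψ x = π (toℕ x * proj₁ inverse-unit)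

    cancel-unit : ∀ y → π (y * proj₁ inverse-unit * toℕ e) ≡ π y
    cancel-unit y = cancel inverse-unit
      where
      cancel : ((m , k , _) : ∃ λ m → ∃ λ k → m * toℕ e ≡ 1 + k * p) → π (y * m * toℕ e) ≡ π y
      cancel (m , k , eq) = trans (cong π (linarith 5 (λ y m e k p → y ⊗ (m ⊗ e) ≐ y ⊗ (κ 1 ⊕ k ⊗ p) ⇒ ⊢ y ⊗ m ⊗ e ≐ y ⊕ y ⊗ k ⊗ p) y m (toℕ e) k p (cong (y *_) eq))) (π-+kp y (y * k))

    φψ : ∀ x → φ (ψ x) ≡ x
    φψ x = trans (φ-π (toℕ x * proj₁ inverse-unit)) (trans (cancel-unit (toℕ x)) (π-toℕ x))

    ψφ : ∀ x → ψ (φ x) ≡ x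
    ψφ x = trans (cong π (*-comm (toℕ (φ x)) (proj₁ inverse-unit))) (trans (π-*ˡ (proj₁ inverse-unit) (toℕ x * toℕ e))
      (trans (cong π (lem (proj₁ inverse-unit) (toℕ x) (toℕ e))) (trans (cancel-unit (toℕ x)) (π-toℕ x))))
      where
      lem : ∀ m x e → m * (x * e) ≡ x * m * e
      lem = linarith 3 λ m x e → ⊢ m ⊗ (x ⊗ e) ≐ x ⊗ m ⊗ e

    #-D : # D ≡ # A
    #-D = sum-bij (𝟙 ∘ A) φ ψ φψ ψφ

    zero-free-D : ZeroFreeᶠ D
    zero-free-D B B⊆D sum≡ε x = trans (cong B (sym (ψφ x))) (zf B′ (λ y hy → trans (cong A (sym (φψ y))) (B⊆D (ψ y) hy)) sum′ (φ x))
      where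
      B′ : FSet p
      B′ y = B (ψ y)
      sum′ : π (gsum B′) ≡ ε
      sum′ = trans (cong π (sym (sum-bij (λ y → toℕ y * 𝟙 (B′ y)) φ ψ φψ ψφ)))
        (trans (π-sum (λ x → toℕ (φ x) * 𝟙 (B (ψ (φ x)))) (λ x → toℕ e * (toℕ x * 𝟙 (B x))) term)
          (trans (cong π (sum-*ˡ (toℕ e) (λ x → toℕ x * 𝟙 (B x)))) (trans (sym (π-*ˡ (toℕ e) (gsum B)))
            (trans (cong (λ z → π (toℕ e * toℕ z)) sum≡ε) (trans (π-*ˡ (toℕ e) 0) (cong π (*-zeroʳ (toℕ e))))))))
        where
        term : ∀ x → π (toℕ (φ x) * 𝟙 (B (ψ (φ x)))) ≡ π (toℕ e * (toℕ x * 𝟙 (B x)))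
        term x = trans (cong π (trans (cong (λ y → toℕ (φ x) * 𝟙 (B y)) (ψφ x)) (*-comm (toℕ (φ x)) (𝟙 (B x)))))
          (trans (π-*ˡ (𝟙 (B x)) (toℕ x * toℕ e)) (cong π (lem (𝟙 (B x)) (toℕ x) (toℕ e))))
          where
          lem : ∀ b x e → b * (x * e) ≡ e * (x * b)
          lem = linarith 3 λ b x e → ⊢ b ⊗ (x ⊗ e) ≐ e ⊗ (x ⊗ b)

    anti-D : Antisymmetric D
    anti-D = zeroSumFree⇒antisymmetric (zeroFree⇒zeroSumFree zero-free-D)

    ε∉D : D ε ≡ false
    ε∉D = ¬true⇒false λ h → ε∉ {D} anti-D ε h refl

    Pos Neg T : NSet
    Pos t = (t <ᵇ N) ∧ D (π t)
    Neg t = (t <ᵇ N) ∧ D (π (p ∸ t))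
    T = Pos ⊔ⁿ Neg

    Pos≡ : ∀ {t} → t < N → Pos t ≡ D (π t)
    Pos≡ {t} lt = cong (_∧ D (π t)) (<ᵇ-true lt)

    Neg≡ : ∀ {t} → t < N → Neg t ≡ D (π (p ∸ t))
    Neg≡ {t} lt = cong (_∧ D (π (p ∸ t))) (<ᵇ-true lt)

    mult-neg : ∀ y → y < p → π ((p ∸ y) * toℕ e) ≡ mult y e ⁻¹
    mult-neg y y<p = ∙-cancelʳ (mult y e) (trans (cong (π ((p ∸ y) * toℕ e) ∙_) (mult-π y e)) (trans (π-∙ ((p ∸ y) * toℕ e) (y * toℕ e))
      (trans (cong π (trans (sym (*-distribʳ-+ (toℕ e) (p ∸ y) y)) (trans (cong (_* toℕ e) (m∸n+n≡m (<⇒≤ y<p))) (*-comm p (toℕ e))))) (trans (π-+kp 0 (toℕ e)) (sym (inverseˡ (mult y e)))))))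

    Pos-mult : ∀ {t} → t < N → Pos t ≡ A (mult t e)
    Pos-mult {t} lt = trans (Pos≡ lt) (cong A (trans (φ-π t) (sym (mult-π t e))))

    Neg-mult : ∀ {t} → t < N → Neg t ≡ A (mult t e ⁻¹)
    Neg-mult {t} lt = trans (Neg≡ lt) (cong A (trans (φ-π (p ∸ t)) (mult-neg t (≤-<-trans (≤-pred lt) q<p))))

    bounded : ∀ t → T t ≡ true → t < N
    bounded t h = [ (λ h → <ᵇ-sound (proj₁ (∧-elim {t <ᵇ N} h))) , (λ h → <ᵇ-sound (proj₁ (∧-elim {t <ᵇ N} h))) ]′ (∨-elim {Pos t} h)

    disjoint : ∀ t → Pos t ≡ true → Neg t ≡ true → ⊥
    disjoint t hP hN = anti-D (π t) (proj₂ (∧-elim {t <ᵇ N} hP))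
      (trans (cong D (sym (π-neg (≤-<-trans (≤-pred (<ᵇ-sound (proj₁ (∧-elim {t <ᵇ N} hP)))) q<p)))) (proj₂ (∧-elim {t <ᵇ N} hN)))

    Pos0 : Pos 0 ≡ false
    Pos0 = ε∉D

    Neg0 : Neg 0 ≡ false
    Neg0 = trans (cong D π-p) ε∉D

    T0 : T 0 ≡ false
    T0 = cong₂ _∨_ Pos0 Neg0

    ct-Neg : ct N Neg ≡ sumTo q (λ t → 𝟙 (Neg (suc t)))
    ct-Neg = trans (sumTo-suc q (𝟙 ∘ Neg)) (cong (λ b → 𝟙 b + sumTo q (λ t → 𝟙 (Neg (suc t)))) Neg0)

    #T : ct N T ≡ # A
    #T = trans (ct-⊔ N Pos Neg disjoint) (trans (cong₂ _+_
        (sumTo-cong N λ t lt → cong 𝟙 (Pos≡ lt))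
        (trans ct-Neg (sumTo-cong q λ t lt → cong 𝟙 (Neg≡ (s≤s lt)))))
      (trans (sym (fold (λ t → 𝟙 (D (π t))))) (trans (sum-cong-≗ λ x → cong (𝟙 ∘ D) (π-toℕ x)) #-D)))

    -- The signed sum of a subset: V selects positive elements, and deselects negative ones.
    module Select (V : NSet) (V⊑T : V ⊑ T) where

      pick : ℕ → Bool
      pick k = if k <ᵇ N then V k else not (V (p ∸ k))

      B : FSet p
      B x = D x ∧ pick (toℕ x)

      B⊆D : B ⊆ D
      B⊆D x = proj₁ ∘ ∧-elim {D x}

      pick-low : ∀ {t} → t < N → pick t ≡ V t
      pick-low {t} lt = cong (if_then V t else not (V (p ∸ t))) (<ᵇ-true lt)

      pick-high : ∀ {t} → suc t ≤ q → pick (p ∸ suc t) ≡ not (V (suc t))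
      pick-high {t} lt = trans (cong (if_then V (p ∸ suc t) else not (V (p ∸ (p ∸ suc t)))) (<ᵇ-false (N≤p-suc lt)))
        (cong (not ∘ V) (m∸[m∸n]≡n (<⇒≤ (≤-<-trans lt q<p))))

      -- A chosen negative element -t enters the sum as p - t; these terms p are counted here.
      lost : ℕ → ℕ
      lost t = 𝟙 (Neg (suc t) ∧ not (V (suc t)))

      private
        F : ℕ → ℕ
        F k = k * 𝟙 (D (π k) ∧ pick k)

        term : ∀ t → t < q → F (suc t) + F (p ∸ suc t) + suc t * 𝟙 (Neg (suc t)) ≡ suc t * 𝟙 (V (suc t)) + p * lost t
        term t lt = trans (cong₂ _+_ (cong₂ _+_
            (cong (λ b → suc t * 𝟙 b) (cong₂ _∧_ (sym (Pos≡ (s≤s lt))) (pick-low (s≤s lt))))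
            (cong (λ b → (p ∸ suc t) * 𝟙 b) (cong₂ _∧_ (sym (Neg≡ (s≤s lt))) (pick-high lt)))) refl)
          (table (Pos (suc t)) (Neg (suc t)) (V (suc t)) (disjoint (suc t)) (V⊑T (suc t)))
          where
          p-t : p ∸ suc t + suc t ≡ p
          p-t = m∸n+n≡m (<⇒≤ (≤-<-trans lt q<p))
          table : ∀ a b v → (a ≡ true → b ≡ true → ⊥) → (v ≡ true → a ∨ b ≡ true) →
            suc t * 𝟙 (a ∧ v) + (p ∸ suc t) * 𝟙 (b ∧ not v) + suc t * 𝟙 b ≡ suc t * 𝟙 v + p * 𝟙 (b ∧ not v)
          table true true v dis _ = ⊥-elim (dis refl refl)
          table true false true _ _ = linarith 3 (λ s d p → ⊢ s ⊗ κ 1 ⊕ d ⊗ κ 0 ⊕ s ⊗ κ 0 ≐ s ⊗ κ 1 ⊕ p ⊗ κ 0) (suc t) (p ∸ suc t) p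
          table true false false _ _ = linarith 3 (λ s d p → ⊢ s ⊗ κ 0 ⊕ d ⊗ κ 0 ⊕ s ⊗ κ 0 ≐ s ⊗ κ 0 ⊕ p ⊗ κ 0) (suc t) (p ∸ suc t) p
          table false true true _ _ = linarith 3 (λ s d p → ⊢ s ⊗ κ 0 ⊕ d ⊗ κ 0 ⊕ s ⊗ κ 1 ≐ s ⊗ κ 1 ⊕ p ⊗ κ 0) (suc t) (p ∸ suc t) p
          table false true false _ _ = linarith 3 (λ s d p → d ⊕ s ≐ p ⇒ ⊢ s ⊗ κ 0 ⊕ d ⊗ κ 1 ⊕ s ⊗ κ 1 ≐ s ⊗ κ 0 ⊕ p ⊗ κ 1) (suc t) (p ∸ suc t) p p-t
          table false false true _ h = ⊥-elim (true≢false (h refl) refl)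
          table false false false _ _ = linarith 3 (λ s d p → ⊢ s ⊗ κ 0 ⊕ d ⊗ κ 0 ⊕ s ⊗ κ 0 ≐ s ⊗ κ 0 ⊕ p ⊗ κ 0) (suc t) (p ∸ suc t) p

        sumTo-*ˡ : ∀ m c (f : ℕ → ℕ) → sumTo m (λ t → c * f t) ≡ c * sumTo m f
        sumTo-*ˡ zero c f = sym (*-zeroʳ c)
        sumTo-*ˡ (suc m) c f = trans (cong (_+ c * f m) (sumTo-*ˡ m c f)) (sym (*-distribˡ-+ c (sumTo m f) (f m)))

        wt-suc : ∀ W → wt N W ≡ sumTo q (λ t → suc t * 𝟙 (W (suc t)))
        wt-suc W = sumTo-suc q (λ t → t * 𝟙 (W t))

      -- Modulo p the sum of B is wt V - wt Neg. Together with `empty⇒Neg` this turns zero-freeness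
      -- into the uniqueness of `Neg` among sets of congruent weight.
      signed-sum : gsum B + wt N Neg ≡ wt N V + p * sumTo q lost
      signed-sum = linarith 9 (λ g τ v c a b d h l → g ≐ a ⊕ b ⇒ τ ≐ d ⇒ v ≐ h ⇒ c ≐ l ⇒ a ⊕ b ⊕ d ≐ h ⊕ l ⇒ ⊢ g ⊕ τ ≐ v ⊕ c)
        (gsum B) (wt N Neg) (wt N V) (p * sumTo q lost) (sumTo q (F ∘ suc)) (sumTo q (λ t → F (p ∸ suc t))) (sumTo q (λ t → suc t * 𝟙 (Neg (suc t))))
        (sumTo q (λ t → suc t * 𝟙 (V (suc t)))) (sumTo q (λ t → p * lost t))
        (trans (sum-cong-≗ λ x → cong (λ b → toℕ x * 𝟙 (b ∧ pick (toℕ x))) (cong D (sym (π-toℕ x)))) (trans (fold F) (cong (_+ sumTo q (λ t → F (p ∸ suc t))) (sumTo-suc q F))))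
        (wt-suc Neg) (wt-suc V) (sym (sumTo-*ˡ q p lost))
        (trans (cong (_+ sumTo q (λ t → suc t * 𝟙 (Neg (suc t)))) (sym (sumTo-distrib-+ q (F ∘ suc) (λ t → F (p ∸ suc t)))))
          (trans (sym (sumTo-distrib-+ q (λ t → F (suc t) + F (p ∸ suc t)) (λ t → suc t * 𝟙 (Neg (suc t)))))
            (trans (sumTo-cong q term) (sumTo-distrib-+ q (λ t → suc t * 𝟙 (V (suc t))) (λ t → p * lost t)))))

      empty⇒Neg : (∀ x → x ∉ B) → ∀ t → V t ≡ Neg t
      empty⇒Neg none t = bool-ext to (λ h → from t h)
        where
        to : V t ≡ true → Neg t ≡ true
        to h = [ (λ hP → ⊥-elim (true≢false (∧-intro {D (π t)} {pick (toℕ (π t))} (proj₂ (∧-elim {t <ᵇ N} hP)) (trans (cong pick (toℕ-π-< t<p)) (trans (pick-low t<N) h))) (none (π t)))) ,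
          (λ hN → hN) ]′ (∨-elim {Pos t} (V⊑T t h))
          where
          t<N : t < N
          t<N = bounded t (V⊑T t h)
          t<p : t < p
          t<p = ≤-<-trans (≤-pred t<N) q<p
        from : ∀ t → Neg t ≡ true → V t ≡ true
        from zero h = ⊥-elim (true≢false h Neg0)
        from (suc t) h = chosen (V (suc t)) refl
          where
          lt : suc t ≤ q
          lt = ≤-pred (<ᵇ-sound (proj₁ (∧-elim {suc t <ᵇ N} h)))
          chosen : ∀ b → V (suc t) ≡ b → V (suc t) ≡ true
          chosen true e = e
          chosen false e = ⊥-elim (true≢false (∧-intro {D (π (p ∸ suc t))} {pick (toℕ (π (p ∸ suc t)))} (proj₂ (∧-elim {suc t <ᵇ N} h))
            (trans (cong pick (toℕ-π-< (∸-monoʳ-< {p} {suc t} {0} (s≤s z≤n) (<⇒≤ (≤-<-trans lt q<p))))) (trans (pick-high lt) (not-true e)))) (none (π (p ∸ suc t))))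

    zero-free : ∀ V → V ⊑ T → wt N V ≡[ p ] wt N Neg → ∀ t → V t ≡ Neg t
    zero-free V V⊑T (c , h) = Select.empty⇒Neg V V⊑T (zero-free-D B (Select.B⊆D V V⊑T) (vanish h))
      where
      B : FSet p
      B = Select.B V V⊑T
      l : ℕ
      l = sumTo q (Select.lost V V⊑T)
      vanish : (wt N V ≡ wt N Neg + c * p) ⊎ (wt N V + c * p ≡ wt N Neg) → π (gsum B) ≡ ε
      vanish (inj₁ eq) = trans (cong π (linarith 6 (λ g τ v c p l → g ⊕ τ ≐ v ⊕ p ⊗ l ⇒ v ≐ τ ⊕ c ⊗ p ⇒ ⊢ g ≐ κ 0 ⊕ (c ⊕ l) ⊗ p) (gsum B) (wt N Neg) (wt N V) c p l (Select.signed-sum V V⊑T) eq)) (π-+kp 0 (c + l))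
      vanish (inj₂ eq) = π-intro c l (linarith 6 (λ g τ v c p l → g ⊕ τ ≐ v ⊕ p ⊗ l ⇒ v ⊕ c ⊗ p ≐ τ ⇒ ⊢ g ⊕ c ⊗ p ≐ κ 0 ⊕ l ⊗ p) (gsum B) (wt N Neg) (wt N V) c p l (Select.signed-sum V V⊑T) eq)

    -- Each x in R is charged to its length y and sign. For a given y either sign is used by at most
    -- one x, and only one of the signs can occur.
    dense : ∀ R Y → R ⊆ A → Y < N → (∀ x → x ∈ R → ∃ λ y → y ≤ Y × Length e x y) → # R ≤ ct (suc Y) T
    dense R Y R⊆A Y<N lengths = ≤-trans (sum-mono covered) (≤-trans (≤-reflexive (sum-sumTo (suc Y) (λ x y → hit x y + hit′ x y)))
      (sumTo-mono (suc Y) λ y lt → ≤-trans (≤-reflexive (∑-distrib-+ (λ x → hit x y) (λ x → hit′ x y)))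
        (≤-trans (+-mono-≤ (one (mult y e) (Pos y)) (one (mult y e ⁻¹) (Neg y))) (≤-reflexive (sym (𝟙-disjoint (Pos y) (Neg y) (disjoint y)))))))
      where
      hit hit′ : Fin p → ℕ → ℕ
      hit x y = 𝟙 (⁅ mult y e ⁆ x ∧ Pos y)
      hit′ x y = 𝟙 (⁅ mult y e ⁻¹ ⁆ x ∧ Neg y)
      one : ∀ a b → sum (λ x → 𝟙 (⁅ a ⁆ x ∧ b)) ≤ 𝟙 b
      one a true = ≤-trans (#-mono (λ x → ⁅ a ⁆ x ∧ true) ⁅ a ⁆ λ x → proj₁ ∘ ∧-elim {⁅ a ⁆ x}) (≤-reflexive (#-⁅⁆ a))
      one a false = ≤-trans (#-mono {p} (λ x → ⁅ a ⁆ x ∧ false) (λ _ → false) λ x → proj₂ ∘ ∧-elim {⁅ a ⁆ x}) (≤-reflexive (#-empty {p} (λ _ → false) λ x ()))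
      covered : ∀ x → 𝟙 (R x) ≤ sumTo (suc Y) (λ y → hit x y + hit′ x y)
      covered x = bound (R x) refl
        where
        bound : ∀ b → R x ≡ b → 𝟙 b ≤ sumTo (suc Y) (λ y → hit x y + hit′ x y)
        bound false _ = z≤n
        bound true hx = witness (lengths x hx)
          where
          at-y : ∀ y → y ≤ Y → 1 ≤ hit x y + hit′ x y → 1 ≤ sumTo (suc Y) (λ y → hit x y + hit′ x y)
          at-y y y≤ le = ≤-trans le (≤-trans (m≤n+m _ (sumTo y (λ y → hit x y + hit′ x y))) (sumTo-≤ {suc y} {suc Y} (λ y → hit x y + hit′ x y) (s≤s y≤)))
          witness : (∃ λ y → y ≤ Y × Length e x y) → 1 ≤ sumTo (suc Y) (λ y → hit x y + hit′ x y)
          witness (y , y≤ , inj₁ eq) = at-y y y≤ (≤-trans (≤-reflexive (sym (cong 𝟙 (∧-intro {⁅ mult y e ⁆ x} {Pos y} (subst (_∈ ⁅ mult y e ⁆) (sym eq) (∈⁅⁆ _)) pos)))) (m≤m+n _ _))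
            where
            pos : Pos y ≡ true
            pos = trans (Pos-mult (≤-<-trans y≤ Y<N)) (trans (cong A (sym eq)) (R⊆A x hx))
          witness (y , y≤ , inj₂ eq) = at-y y y≤ (≤-trans (≤-reflexive (sym (cong 𝟙 (∧-intro {⁅ mult y e ⁻¹ ⁆ x} {Neg y} (subst (_∈ ⁅ mult y e ⁻¹ ⁆) (sym x≡) (∈⁅⁆ _)) neg)))) (m≤n+m _ (hit x y)))
            where
            x≡ : x ≡ mult y e ⁻¹
            x≡ = trans (sym (⁻¹-involutive x)) (cong _⁻¹ eq)
            neg : Neg y ≡ true
            neg = trans (Neg-mult (≤-<-trans y≤ Y<N)) (trans (cong A (sym x≡)) (R⊆A x hx))

-- The inverse theorem for zero-free sets of nearly maximal size.

module LargeZeroFree (p : ℕ) (prime : Prime p) (2<p : 2 < p) (q : ℕ) (p≡ : p ≡ suc (q + q)) where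

  open LinearArithmetic
  open FiniteSets
  open NaturalSets
  open SignedSums
  open Residues p prime 2<p hiding (B; R)
  open Dilation p prime 2<p q p≡
  open Constants

  N*2 : N * 2 ≡ p + 1
  N*2 = trans (linarith 1 (λ q → ⊢ (κ 1 ⊕ q) ⊗ κ 2 ≐ κ 1 ⊕ (q ⊕ q) ⊕ κ 1) q) (cong (_+ 1) (sym p≡))

  Length-⁻¹ : ∀ e x y → Length e x y → Length (e ⁻¹) x y
  Length-⁻¹ e x y (inj₁ eq) = inj₂ (trans (cong _⁻¹ eq) (sym (mult-⁻¹ y e)))
  Length-⁻¹ e x y (inj₂ eq) = inj₁ (trans (sym (⁻¹-involutive x)) (trans (cong _⁻¹ eq) (sym (mult-⁻¹ y e))))

  Good : (A : FSet p) → ZeroFreeᶠ A → Fin p → Set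
  Good A zf e = Σ (¬ e ≡ ε) λ e≢ε → wt N (Dilate.T A zf e e≢ε) ≤ p + 33000 × wt N (Dilate.Neg A zf e e≢ε) ≤ wt N (Dilate.Pos A zf e e≢ε)

  module _ (A : FSet p) (zf : ZeroFreeᶠ A) (k w : ℕ) (#A : # A ≡ k) (8w≤k : w * 8 ≤ k) (k≤8w+7 : k ≤ w * 8 + 7)
    (w-large : 1000000 ≤ w) (p-upper : p * 2 ≤ k * k + k * 4 + 3) (p-lower : k * k ≤ p * 4) (parameters : Params k w) where

    private
      open Params parameters

      k≤9w : k ≤ w * 9
      k≤9w = linarith 2 (λ k w → k ⊴ w ⊗ κ 8 ⊕ κ 7 ⇒ κ 1000000 ⊴ w ⇒ ⊢ k ⊴ w ⊗ κ 9) k w k≤8w+7 w-large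

      zsf : ZeroSumFree A
      zsf = zeroFree⇒zeroSumFree zf

      module R = Run k γ q₀ N₀ h q≡ N≡ 0<γ 15≤h 14k≤hq N-large

      stage : R.Found w 1000q≤w k≤9w A L
      stage = R.found w 1000q≤w k≤9w A zsf #A 8w≤k k≤8w+7 p-upper p-lower L L≡

      open R.Found stage using (s; 6w≤s; s≤7w; large; half; small-out) renaming (stage to st)

      unit : ∃ λ e → ¬ e ≡ ε × (∀ x → x ∈ Stage.R st → ∃ λ y → y ≤ s + E × Length e x y)
      unit = inverse torsion divide w s L E (Stage.R st) (Stage.B st) (Antisymmetric-mono (Stage.R⊆A st) (zeroSumFree⇒antisymmetric zsf))
        (Stage.#R st) 6w≤s s≤7w large half small-out scales

      Y<N : suc (s + E) ≤ N
      Y<N = linarith 7 (λ s E w N p k ww → s ⊴ w ⊗ κ 7 ⇒ E ⊗ κ 1000 ⊴ w ⇒ N ⊗ κ 2 ≐ p ⊕ κ 1 ⇒ k ⊗ k ⊴ p ⊗ κ 4 ⇒ (w ⊗ κ 8) ⊗ (w ⊗ κ 8) ⊴ k ⊗ k ⇒ w ⊗ κ 1000000 ⊴ w ⊗ w ⇒ κ 1000000 ⊴ w ⇒ ⊢ κ 1 ⊕ (s ⊕ E) ⊴ N)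
        s E w N p k 0 s≤7w E-small N*2 p-lower (*-mono-≤ 8w≤k 8w≤k) (*-monoʳ-≤ w w-large) w-large

      bounded-weight : ∀ e (e≢ε : ¬ e ≡ ε) → (∀ x → x ∈ Stage.R st → ∃ λ y → y ≤ s + E × Length e x y) →
        wt N (Dilate.T A zf e e≢ε) ≤ p + 33000
      bounded-weight e e≢ε lengths = weigh (division k 2 (s≤s z≤n))
        where
        open Dilate A zf e e≢ε
        weigh : (∃ λ K → K * 2 ≤ k × k < suc K * 2) → wt N T ≤ p + 33000
        weigh (K , lo , hi) = Signed.FewMissing.few-missing p N 0<p Pos Neg disjoint bounded zero-free k K w s E T0 (trans #T #A)
          (≤-trans (≤-reflexive (sym (Stage.#R st))) (dense (Stage.R st) (s + E) (Stage.R⊆A st) Y<N lengths)) Y<N 8w≤k k≤8w+7 6w≤s s≤7w E-small w-large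
          p-upper (≤-reflexive N*2) lo (linarith 2 (λ k K → k ⊲ (κ 1 ⊕ K) ⊗ κ 2 ⇒ ⊢ k ⊴ K ⊗ κ 2 ⊕ κ 1) k K hi)

      ⁻¹≢ε : ∀ {e} → ¬ e ≡ ε → ¬ e ⁻¹ ≡ ε
      ⁻¹≢ε {e} ne h = ne (trans (sym (⁻¹-involutive e)) (trans (cong _⁻¹ h) ε⁻¹≈ε))

    -- Replacing e by its negative interchanges `Pos` and `Neg`, so the heavier sign may be taken
    -- positive.
    core : ∃ (Good A zf)
    core = orient unit
      where
      orient : (∃ λ e → ¬ e ≡ ε × (∀ x → x ∈ Stage.R st → ∃ λ y → y ≤ s + E × Length e x y)) → ∃ (Good A zf)
      orient (e , e≢ε , lengths) = choose (≤-total (wt N D₊.Neg) (wt N D₊.Pos))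
        where
        e′≢ε : ¬ e ⁻¹ ≡ ε
        e′≢ε = ⁻¹≢ε e≢ε
        module D₊ = Dilate A zf e e≢ε
        module D₋ = Dilate A zf (e ⁻¹) e′≢ε
        swap : ∀ t → t < N → D₋.Pos t ≡ D₊.Neg t × D₋.Neg t ≡ D₊.Pos t
        swap t lt = trans (D₋.Pos-mult lt) (trans (cong A (mult-⁻¹ t e)) (sym (D₊.Neg-mult lt))) ,
          trans (D₋.Neg-mult lt) (trans (cong A (trans (cong _⁻¹ (mult-⁻¹ t e)) (⁻¹-involutive _))) (sym (D₊.Pos-mult lt)))
        choose : (wt N D₊.Neg ≤ wt N D₊.Pos) ⊎ (wt N D₊.Pos ≤ wt N D₊.Neg) → ∃ (Good A zf)
        choose (inj₁ le) = e , e≢ε , bounded-weight e e≢ε lengths , le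
        choose (inj₂ le) = e ⁻¹ , e′≢ε , bounded-weight (e ⁻¹) e′≢ε (λ x hx → let (y , y≤ , len) = lengths x hx in y , y≤ , Length-⁻¹ e x y len) ,
          ≤-trans (≤-reflexive (wt-cong N λ t lt → proj₂ (swap t lt))) (≤-trans le (≤-reflexive (sym (wt-cong N λ t lt → proj₁ (swap t lt)))))

  subset-of-size : ∀ (X : FSet p) m → m ≤ # X → ∃ λ Y → Y ⊆ X × # Y ≡ m
  subset-of-size X m m≤ = shrink (# X ∸ m) X (m+[n∸m]≡n m≤)
    where
    shrink : ∀ d (X : FSet p) → m + d ≡ # X → ∃ λ Y → Y ⊆ X × # Y ≡ m
    shrink zero X e = X , (λ x h → h) , trans (sym e) (+-identityʳ m)
    shrink (suc d) X e = drop (#-pos⇒∃ X (≤-trans (s≤s z≤n) (≤-trans (m≤n+m (suc d) m) (≤-reflexive e))))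
      where
      drop : (∃ λ x → x ∈ X) → ∃ λ Y → Y ⊆ X × # Y ≡ m
      drop (x , hx) = let (Y , Y⊆ , #Y) = shrink d (X ∖ ⁅ x ⁆) (suc-injective (trans (sym (+-suc m d)) (trans e (#-remove X hx)))) in
        Y , (λ y hy → proj₁ (∖-elim X (Y⊆ y hy))) , #Y

-- Integer roots, vectors as Boolean functions, and the model set {1, ..., m}.

module Subsets where

  open LinearArithmetic
  open FiniteSets
  open NaturalSets
  open import Data.Vec using ([]; _∷_)
  open import Data.Vec.Properties using (tabulate∘lookup; lookup-zipWith; []=⇒lookup; lookup⇒[]=)

  isqrtGo-spec : ∀ m k → m < suc k * suc k → isqrtGo m k * isqrtGo m k ≤ m × m < suc (isqrtGo m k) * suc (isqrtGo m k)
  isqrtGo-spec m zero lt = z≤n , lt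
  isqrtGo-spec m (suc k) lt with suc k * suc k ≤? m
  ... | yes le = le , lt
  ... | no gt = isqrtGo-spec m k (≰⇒> gt)

  isqrt-spec : ∀ m → isqrt m * isqrt m ≤ m × m < suc (isqrt m) * suc (isqrt m)
  isqrt-spec m = isqrtGo-spec m m (s≤s (m≤m+n m _))

  sumOver≡sum : ∀ {n} (f : Fin n → ℕ) (V : Subset n) → sumOver f V ≡ sum (λ i → f i * 𝟙 (lookup V i))
  sumOver≡sum f [] = refl
  sumOver≡sum f (true ∷ V) = cong₂ _+_ (sym (*-identityʳ (f fzero))) (sumOver≡sum (f ∘ fsuc) V)
  sumOver≡sum f (false ∷ V) = trans (sumOver≡sum (f ∘ fsuc) V) (cong (_+ sum (λ i → f (fsuc i) * 𝟙 (lookup V i))) (sym (*-zeroʳ (f fzero))))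

  ∣∣≡# : ∀ {n} (V : Subset n) → Sub.∣ V ∣ ≡ # (lookup V)
  ∣∣≡# [] = refl
  ∣∣≡# (true ∷ V) = cong suc (∣∣≡# V)
  ∣∣≡# (false ∷ V) = ∣∣≡# V

  ∈⇒lookup : ∀ {n} {V : Subset n} {x} → x Sub.∈ V → lookup V x ≡ true
  ∈⇒lookup = []=⇒lookup

  lookup⇒∈ : ∀ {n} {V : Subset n} {x} → lookup V x ≡ true → x Sub.∈ V
  lookup⇒∈ {V = V} {x} = lookup⇒[]= x V

  ∈-tabulate : ∀ {n} (X : FSet n) {x} → x ∈ X → x Sub.∈ tabulate X
  ∈-tabulate X {x} h = lookup⇒∈ (trans (lookup∘tabulate X x) h)

  tabulate-∈ : ∀ {n} (X : FSet n) {x} → x Sub.∈ tabulate X → x ∈ X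
  tabulate-∈ X {x} h = trans (sym (lookup∘tabulate X x)) (∈⇒lookup h)

  ∣tabulate∣ : ∀ {n} (X : FSet n) → Sub.∣ tabulate X ∣ ≡ # X
  ∣tabulate∣ X = trans (∣∣≡# (tabulate X)) (#-cong (lookup (tabulate X)) X (lookup∘tabulate X))

  sumOver-tabulate : ∀ {n} (f : Fin n → ℕ) (X : FSet n) → sumOver f (tabulate X) ≡ sum (λ i → f i * 𝟙 (X i))
  sumOver-tabulate f X = trans (sumOver≡sum f (tabulate X)) (sum-cong-≗ λ i → cong (λ b → f i * 𝟙 b) (lookup∘tabulate X i))

  tabulate-∪ : ∀ {n} (X Y : FSet n) → tabulate X Sub.∪ tabulate Y ≡ tabulate (X ∪ Y)
  tabulate-∪ X Y = trans (sym (tabulate∘lookup _)) (tabulate-cong λ x →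
    trans (lookup-zipWith _∨_ x (tabulate X) (tabulate Y)) (cong₂ _∨_ (lookup∘tabulate X x) (lookup∘tabulate Y x)))

  pronic-even : ∀ r → ∃ λ m → r * (r + 1) ≡ m * 2
  pronic-even zero = 0 , refl
  pronic-even (suc r) = let (m , e) = pronic-even r in m + suc r , linarith 2 (λ r m → r ⊗ (r ⊕ κ 1) ≐ m ⊗ κ 2 ⇒ ⊢ (κ 1 ⊕ r) ⊗ (κ 1 ⊕ r ⊕ κ 1) ≐ (m ⊕ (κ 1 ⊕ r)) ⊗ κ 2) r m e

  sumTo-triangle : ∀ m → sumTo (suc m) (λ t → t) * 2 ≡ m * (m + 1)
  sumTo-triangle zero = refl
  sumTo-triangle (suc m) = linarith 2 (λ s m → s ⊗ κ 2 ≐ m ⊗ (m ⊕ κ 1) ⇒ ⊢ (s ⊕ (κ 1 ⊕ m)) ⊗ κ 2 ≐ (κ 1 ⊕ m) ⊗ (κ 1 ⊕ m ⊕ κ 1)) (sumTo (suc m) (λ t → t)) m (sumTo-triangle m)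

  odd-half : ∀ p → Prime p → 2 < p → ∃ λ q → p ≡ suc (q + q)
  odd-half p isPrime 2<p = halve (division p 2 (s≤s z≤n))
    where
    halve : (∃ λ q → q * 2 ≤ p × p < suc q * 2) → ∃ λ q → p ≡ suc (q + q)
    halve (q , lo , hi) = [ (λ lt → q , linarith 2 (λ p q → q ⊗ κ 2 ⊲ p ⇒ p ⊲ (κ 1 ⊕ q) ⊗ κ 2 ⇒ ⊢ p ≐ κ 1 ⊕ (q ⊕ q)) p q lt hi) ,
      (λ eq → ⊥-elim (even (prime⇒irreducible isPrime (divides q (sym eq))))) ]′ (m≤n⇒m<n∨m≡n lo)
      where
      even : 2 ≡ 1 ⊎ 2 ≡ p → ⊥
      even (inj₁ ())
      even (inj₂ eq) = <-irrefl eq 2<p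

  isqrt-large : ∀ p → 10 ^ 55 * 10 ^ 55 ≤ p → 10 ^ 55 ≤ isqrt (2 * p)
  isqrt-large p p-large = ≮⇒≥ λ lt → linarith 2 (λ p r → (κ 1 ⊕ r) ⊗ (κ 1 ⊕ r) ⊴ κ (10 ^ 55) ⊗ κ (10 ^ 55) ⇒ κ 2 ⊗ p ⊲ (κ 1 ⊕ r) ⊗ (κ 1 ⊕ r) ⇒ κ (10 ^ 55) ⊗ κ (10 ^ 55) ⊴ p ⇒ ⊢⊥)
    p (isqrt (2 * p)) (*-mono-≤ lt lt) (proj₂ (isqrt-spec (2 * p))) p-large

  module Base (p : ℕ) (prime : Prime p) (2<p : 2 < p) (q : ℕ) (p≡ : p ≡ suc (q + q)) where

    open Residues p prime 2<p hiding (B; R)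
    open Dilation p prime 2<p q p≡

    zeroFree⇒ : ∀ A → ZeroFree p A → ZeroFreeᶠ (lookup A)
    zeroFree⇒ A zf B B⊆ sum≡ε x = ¬true⇒false λ hx → zf (tabulate B ,
      (λ {y} hy → lookup⇒∈ (B⊆ y (tabulate-∈ B hy))) , (x , ∈-tabulate B hx) ,
      π-elim (trans (cong π (sumOver-tabulate toℕ B)) sum≡ε))

    ⇒zeroFree : ∀ X → ZeroFreeᶠ X → ZeroFree p (tabulate X)
    ⇒zeroFree X zf (B , B⊆ , (x , hx) , k , l , e) = true≢false (∈⇒lookup hx) (zf (lookup B) (λ y hy → tabulate-∈ X (B⊆ (lookup⇒∈ hy)))
      (trans (cong π (sym (sumOver≡sum toℕ B))) (π-intro k l e)) x)

    initial : ℕ → FSet p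
    initial m x = below (suc m) (not ∘ single 0) (toℕ x)

    initial-elim : ∀ m x → x ∈ initial m → toℕ x ≤ m × ¬ toℕ x ≡ 0
    initial-elim m x h = ≤-pred (proj₂ (below-elim {suc m} {not ∘ single 0} h)) ,
      λ e → true≢false (trans (cong (single 0) e) refl) (not-elim (proj₁ (below-elim {suc m} {not ∘ single 0} {toℕ x} h)))

    #-initial : ∀ m → m < p → # (initial m) ≡ m
    #-initial m lt = trans (sum-toℕ p (λ t → 𝟙 (below (suc m) (not ∘ single 0) t))) (trans (ct-below p (suc m) (not ∘ single 0) lt)
      (linarith 3 (λ c d m → c ⊕ d ≐ κ 1 ⊕ m ⇒ c ≐ κ 1 ⇒ ⊢ d ≐ m) (ct (suc m) (single 0)) (ct (suc m) (not ∘ single 0)) m (ct+missing (suc m) (single 0)) (ct-single (suc m) 0 (s≤s z≤n))))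

    -- Every subset sum is at most m(m + 1)/2 < p, so none wraps around.
    initial-zeroFree : ∀ m → m < p → m * (m + 1) < p * 2 → ZeroFreeᶠ (initial m)
    initial-zeroFree m m<p small B B⊆ sum≡ε x = ¬true⇒false λ hx → proj₂ (initial-elim m x (B⊆ x hx)) (n≤0⇒n≡0 (≤-trans (x≤ hx) (≤-reflexive gsum≡0)))
      where
      I : NSet
      I = below (suc m) (not ∘ single 0)
      gsum≤ : gsum B ≤ sumTo (suc m) (λ t → t)
      gsum≤ = ≤-trans (sum-mono λ y → *-monoʳ-≤ (toℕ y) (𝟙-mono (B⊆ y))) (≤-trans (≤-reflexive (trans (sum-toℕ p (λ t → t * 𝟙 (I t))) (wt-below p (suc m) (not ∘ single 0) m<p)))
        (sumTo-mono (suc m) λ t _ → ≤-trans (*-monoʳ-≤ t (𝟙≤1 (not (single 0 t)))) (≤-reflexive (*-identityʳ t))))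
      gsum<p : gsum B < p
      gsum<p = linarith 4 (λ g s mm p → g ⊴ s ⇒ s ⊗ κ 2 ≐ mm ⇒ mm ⊲ p ⊗ κ 2 ⇒ ⊢ g ⊲ p) (gsum B) (sumTo (suc m) (λ t → t)) (m * (m + 1)) p gsum≤ (sumTo-triangle m) small
      gsum≡0 : gsum B ≡ 0
      gsum≡0 = trans (sym (toℕ-π-< gsum<p)) (trans (cong toℕ sum≡ε) (toℕ-π-< 0<p))
      x≤ : x ∈ B → toℕ x ≤ gsum B
      x≤ hx = ≤-trans (≤-reflexive (trans (sym (*-identityʳ (toℕ x))) (cong (λ b → toℕ x * 𝟙 b) (sym hx)))) (term≤sum (λ x → toℕ x * 𝟙 (B x)) x)

-- Maximal zero-free sets: cardinality, decomposition and exceptions.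

module Extremal (p : ℕ) (prime : Prime p) (2<p : 2 < p) (q : ℕ) (p≡ : p ≡ suc (q + q)) (A : Subset p) (max : MaxZeroFree p A)
  (r : ℕ) (r²≤2p : r * r ≤ p * 2) (2p<r+1² : p * 2 < suc r * suc r) (r-large : 10 ^ 55 ≤ r) where

  open LinearArithmetic
  open FiniteSets
  open NaturalSets
  open SignedSums
  open Endgame
  open Constants
  open Subsets
  open Residues p prime 2<p hiding (B; R)
  open Dilation p prime 2<p q p≡
  open LargeZeroFree p prime 2<p q p≡
  open Base p prime 2<p q p≡
  open import Data.Nat.DivMod using (m*n/n≡m)
  open import Data.Fin.Subset.Properties using (∣⊥∣≡0; ∣⁅x⁆∣≡1; x∈⁅x⁆)

  X : FSet p
  X = lookup A

  zf : ZeroFreeᶠ X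
  zf = zeroFree⇒ A (proj₁ max)

  k : ℕ
  k = Sub.∣ A ∣

  10≤r : 10 ≤ r
  10≤r = ≤-trans (≤ᵇ⇒≤ 10 (10 ^ 55) _) r-large

  10r≤rr : r * 10 ≤ r * r
  10r≤rr = *-monoʳ-≤ r 10≤r

  r+2<p : r + 2 < p
  r+2<p = linarith 2 (λ r p → r ⊗ κ 10 ⊴ r ⊗ r ⇒ r ⊗ r ⊴ p ⊗ κ 2 ⇒ κ 10 ⊴ r ⇒ ⊢ r ⊕ κ 2 ⊲ p) r p 10r≤rr r²≤2p 10≤r

  zeroFree-size : ∀ Y → ZeroFreeᶠ Y → # Y ≤ k
  zeroFree-size Y zfY = ≤-trans (≤-reflexive (sym (∣tabulate∣ Y))) (proj₂ max (tabulate Y) (⇒zeroFree Y zfY))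

  initial-size : ∀ m → m < p → m * (m + 1) < p * 2 → m ≤ k
  initial-size m m<p small = ≤-trans (≤-reflexive (sym (#-initial m m<p))) (zeroFree-size (initial m) (initial-zeroFree m m<p small))

  -- {1, ..., r - 1} is zero-free, as (r - 1)r < r² ≤ 2p.
  r≤k+1 : r ≤ k + 1
  r≤k+1 = lem r r²≤2p 10≤r (≤-<-trans (m≤m+n r 2) r+2<p)
    where
    lem : ∀ r → r * r ≤ p * 2 → 10 ≤ r → r < p → r ≤ k + 1
    lem (suc r) le ten lt = ≤-trans (s≤s (initial-size r (<-trans ≤-refl lt)
      (linarith 2 (λ r p → (κ 1 ⊕ r) ⊗ (κ 1 ⊕ r) ⊴ p ⊗ κ 2 ⇒ ⊢ r ⊗ (r ⊕ κ 1) ⊲ p ⊗ κ 2) r p le))) (≤-reflexive (+-comm 1 k))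

  -- `w` is an eighth of m rounded down, so r ≥ 10^55 yields the w ≥ 10^54 required by the
  -- constants.
  near-extremal : ∀ Y (zfY : ZeroFreeᶠ Y) m → # Y ≡ m → r ≤ m + 1 → m ≤ r + 1 → ∃ (Good Y zfY)
  near-extremal Y zfY m #Y r≤ m≤ = choose (division m 8 (s≤s z≤n))
    where
    choose : (∃ λ w → w * 8 ≤ m × m < suc w * 8) → ∃ (Good Y zfY)
    choose (w , lo , hi) = core Y zfY m w #Y lo
      (linarith 2 (λ m w → m ⊲ (κ 1 ⊕ w) ⊗ κ 8 ⇒ ⊢ m ⊴ w ⊗ κ 8 ⊕ κ 7) m w hi)
      (≤-trans (≤ᵇ⇒≤ 1000000 (10 ^ 54) _) w-large)
      (linarith 3 (λ p r m → p ⊗ κ 2 ⊲ (κ 1 ⊕ r) ⊗ (κ 1 ⊕ r) ⇒ (κ 1 ⊕ r) ⊗ (κ 1 ⊕ r) ⊴ (κ 1 ⊕ (m ⊕ κ 1)) ⊗ (κ 1 ⊕ (m ⊕ κ 1)) ⇒ ⊢ p ⊗ κ 2 ⊴ m ⊗ m ⊕ m ⊗ κ 4 ⊕ κ 3) p r m 2p<r+1² (*-mono-≤ (s≤s r≤) (s≤s r≤)))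
      (≤-trans (*-mono-≤ m≤ m≤) (linarith 2 (λ r p → r ⊗ κ 10 ⊴ r ⊗ r ⇒ r ⊗ r ⊴ p ⊗ κ 2 ⇒ κ 10 ⊴ r ⇒ ⊢ (r ⊕ κ 1) ⊗ (r ⊕ κ 1) ⊴ p ⊗ κ 4) r p 10r≤rr r²≤2p 10≤r))
      (params-large m w (linarith 2 (λ m w → m ⊲ (κ 1 ⊕ w) ⊗ κ 8 ⇒ κ 1000000 ⊴ w ⇒ ⊢ m ⊴ w ⊗ κ 9) m w hi
        (≤-trans (≤ᵇ⇒≤ 1000000 (10 ^ 54) _) w-large)) w-large)
      where
      w-large : 10 ^ 54 ≤ w
      w-large = linarith 3 (λ m w r → m ⊲ (κ 1 ⊕ w) ⊗ κ 8 ⇒ r ⊴ m ⊕ κ 1 ⇒ κ (10 ^ 55) ⊴ r ⇒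
        ⊢ κ (10 ^ 54) ⊴ w) m w r hi r≤ r-large

  -- The argument is run on a subset of exactly r + 1 elements, since the inverse theorem asks for a
  -- size close to √(2p). Its absolute values weigh at least (r + 1)(r + 2)/2, and 2p < (r + 1)²
  -- puts this above p + 33000.
  k≤r : k ≤ r
  k≤r = ≮⇒≥ λ r<k → absurd (subset-of-size X (suc r) (≤-trans r<k (≤-reflexive (∣∣≡# A))))
    where
    absurd : (∃ λ Y → Y ⊆ X × # Y ≡ suc r) → ⊥
    absurd (Y , Y⊆ , #Y) = heavy (near-extremal Y zfY (suc r) #Y (≤-trans (n≤1+n r) (m≤m+n (suc r) 1)) (≤-reflexive (+-comm 1 r)))
      where
      zfY : ZeroFreeᶠ Y
      zfY B B⊆ = zf B λ x h → Y⊆ x (B⊆ x h)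
      heavy : ∃ (Good Y zfY) → ⊥
      heavy (e , e≢ε , weight , _) = linarith 3 (λ r p w → (κ 1 ⊕ r) ⊗ (κ 1 ⊕ r) ⊕ (κ 1 ⊕ r) ⊴ κ 2 ⊗ w ⇒ w ⊴ p ⊕ κ 33000 ⇒ p ⊗ κ 2 ⊲ (κ 1 ⊕ r) ⊗ (κ 1 ⊕ r) ⇒ κ 100000 ⊴ r ⇒ ⊢⊥)
          r p (wt N (Dilate.T Y zfY e e≢ε))
          (subst (λ c → c * c + c ≤ 2 * wt N (Dilate.T Y zfY e e≢ε)) (trans (Dilate.#T Y zfY e e≢ε) #Y) (triangular N (Dilate.T Y zfY e e≢ε) (Dilate.T0 Y zfY e e≢ε)))
          weight 2p<r+1² (≤-trans (≤ᵇ⇒≤ 100000 (10 ^ 55) _) r-large)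

  δ : ℕ
  δ = r ∸ k

  k+δ : k + δ ≡ r
  k+δ = m+[n∸m]≡n k≤r

  δ≤1 : δ ≤ 1
  δ≤1 = linarith 3 (λ k d r → k ⊕ d ≐ r ⇒ r ⊴ k ⊕ κ 1 ⇒ ⊢ d ⊴ κ 1) k δ r k+δ r≤k+1

  Structure : Set
  Structure = ∃ λ (d : Fin p) → ¬ toℕ d ≡ 0 × ∃ λ (D : Subset p) → IsDilate p d A D ×
    ∃ λ (A′ : Subset p) → ∃ λ (A″ : Subset p) → D ≡ A′ Sub.∪ A″ ×
    (∀ (y : Fin p) → y Sub.∈ A′ → InNegRange p (2 * (1 + δ)) y) ×
    (∀ (y : Fin p) → y Sub.∈ A″ → InRangeHalf p y) ×
    (∀ (y : Fin p) → y Sub.∈ A″ → ¬ InNeg p A′ y) ×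
    Sub.∣ A′ ∣ ≤ 1 + δ ×
    ContainsExcept p (InRangeSqrt p) (λ y → y Sub.∈ A″) δ ×
    ContainsExcept p (InRange p 1 4) (λ y → InNeg p A′ y ⊎ y Sub.∈ A″) δ ×
    ContainsExcept p (InRange p 3 (absSum p A″)) (λ y → InSharp p D (toℕ y)) δ ×
    absSum p A′ ≤ 2 * (1 + δ) ×
    absSum p A″ ≤ p ∸ 1 + 3 * δ ×
    (p ∸ 1 < absSum p A″ → p + 2 ≤ (r * (r + 1)) / 2 × (r * (r + 1)) / 2 ≤ p + 7)

  module Dilated (e : Fin p) (e≢ε : ¬ e ≡ ε) (weight : wt N (Dilate.T X zf e e≢ε) ≤ p + 33000)
    (sign : wt N (Dilate.Neg X zf e e≢ε) ≤ wt N (Dilate.Pos X zf e e≢ε))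
    (M : ℕ) (5M≤r : M * 5 ≤ r) (r<5M+5 : r < M * 5 + 5) where

    open Dilate X zf e e≢ε

    M-large : 100000 ≤ M
    M-large = linarith 2 (λ M r → r ⊲ M ⊗ κ 5 ⊕ κ 5 ⇒ κ 1000000 ⊴ r ⇒ ⊢ κ 100000 ⊴ M) M r r<5M+5
      (≤-trans (≤ᵇ⇒≤ 1000000 (10 ^ 55) _) r-large)

    module F = Final p N 0<p Pos Neg disjoint bounded zero-free r k δ M k+δ δ≤1 T0 (trans #T (sym (∣∣≡# A))) weight
      (linarith 2 (λ r p → p ⊗ κ 2 ⊲ (κ 1 ⊕ r) ⊗ (κ 1 ⊕ r) ⇒ ⊢ p ⊗ κ 2 ⊴ r ⊗ r ⊕ r ⊗ κ 2) r p 2p<r+1²) r²≤2p N*2 5M≤r r<5M+5 M-large sign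

    open F using (Q; τ⁺)

    τ : ℕ
    τ = wt N Neg

    N≤p : N ≤ p
    N≤p = q<p

    M<p : suc M ≤ p
    M<p = ≤-trans (s≤s (≤-trans (m≤m*n M 5) 5M≤r)) (≤-trans (s≤s (m≤m+n r 2)) r+2<p)

    Low High : FSet p
    Low x = D x ∧ (toℕ x <ᵇ N)
    High x = D x ∧ not (toℕ x <ᵇ N)

    A′ A″ : Subset p
    A′ = tabulate High
    A″ = tabulate Low

    partition : tabulate D ≡ A′ Sub.∪ A″
    partition = sym (trans (tabulate-∪ High Low) (tabulate-cong λ x → lem (D x) (toℕ x <ᵇ N)))
      where
      lem : ∀ a b → (a ∧ not b) ∨ (a ∧ b) ≡ a
      lem true true = refl
      lem true false = refl
      lem false _ = refl

    Low⇒Pos : ∀ {y} → y ∈ Low → Pos (toℕ y) ≡ true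
    Low⇒Pos {y} h = ∧-intro {toℕ y <ᵇ N} (proj₂ (∧-elim {D y} h)) (trans (cong D (π-toℕ y)) (proj₁ (∧-elim {D y} h)))

    Pos⇒Low : ∀ {t} → Pos t ≡ true → π t ∈ Low
    Pos⇒Low {t} h = ∧-intro {D (π t)} (proj₂ (∧-elim {t <ᵇ N} h)) (trans (cong (_<ᵇ N) (toℕ-π-< (<-≤-trans (<ᵇ-sound (proj₁ (∧-elim {t <ᵇ N} h))) N≤p))) (proj₁ (∧-elim {t <ᵇ N} h)))

    High⇒≥ : ∀ {y} → y ∈ High → N ≤ toℕ y
    High⇒≥ {y} h = ≮⇒≥ λ lt → true≢false (<ᵇ-true lt) (not-elim (proj₂ (∧-elim {D y} h)))

    High⇒Neg : ∀ {y} → y ∈ High → Neg (p ∸ toℕ y) ≡ true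
    High⇒Neg {y} h = ∧-intro {(p ∸ toℕ y) <ᵇ N} (<ᵇ-true lt) (trans (cong (D ∘ π) (m∸[m∸n]≡n (<⇒≤ (toℕ<n y)))) (trans (cong D (π-toℕ y)) (proj₁ (∧-elim {D y} h))))
      where
      lt : p ∸ toℕ y < N
      lt = linarith 5 (λ c y p q N → c ⊕ y ≐ p ⇒ κ 1 ⊕ q ⊴ y ⇒ p ≐ κ 1 ⊕ (q ⊕ q) ⇒ ⊢ c ⊲ κ 1 ⊕ q) (p ∸ toℕ y) (toℕ y) p q 0 (m∸n+n≡m (<⇒≤ (toℕ<n y))) (High⇒≥ {y} h) p≡

    Neg⇒High : ∀ {t} → Neg t ≡ true → π (p ∸ t) ∈ High
    Neg⇒High {zero} h = ⊥-elim (true≢false h Neg0)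
    Neg⇒High {suc t} h = ∧-intro {D (π (p ∸ suc t))} (proj₂ (∧-elim {suc t <ᵇ N} h)) (not-true (<ᵇ-false (≤-trans (N≤p-suc t<q)
        (≤-reflexive (sym (toℕ-π-< (∸-monoʳ-< {p} {suc t} {0} (s≤s z≤n) (≤-trans t<q (<⇒≤ q<p)))))))))
      where
      t<q : t < q
      t<q = ≤-pred (<ᵇ-sound (proj₁ (∧-elim {suc t <ᵇ N} h)))

    isDilate : IsDilate p d A (tabulate D)
    isDilate x = mk⇔ (λ h → φ x , lookup⇒∈ (tabulate-∈ D h) , π-elim (trans (scaled (φ x)) (trans (ψφ x) (sym (π-toℕ x)))))
      λ (a , ha , i , j , eq) → ∈-tabulate D (trans (cong D (sym (trans (sym (scaled a)) (trans (π-intro i j eq) (π-toℕ x))))) (trans (cong X (φψ a)) (∈⇒lookup ha)))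
      where
      scaled : ∀ a → π (toℕ d * toℕ a) ≡ ψ a
      scaled a = trans (cong π (*-comm (toℕ d) (toℕ a))) (π-*ˡ (toℕ a) (proj₁ inverse-unit))

    d≢0 : ¬ toℕ d ≡ 0
    d≢0 e≡ = e≢ε (trans (sym (φψ e)) (trans (cong φ ψe≡ε) (cong (λ c → π (c * toℕ e)) (toℕ-π-< 0<p))))
      where
      ψe≡ε : ψ e ≡ ε
      ψe≡ε = trans (sym (π-*ˡ (toℕ e) (proj₁ inverse-unit))) (trans (cong (λ c → π (toℕ e * c)) e≡) (cong π (*-zeroʳ (toℕ e))))

    A′-range : ∀ y → y Sub.∈ A′ → InNegRange p (2 * (1 + δ)) y
    A′-range y h = p ∸ toℕ y , m<n⇒0<n∸m (toℕ<n y) , ≤-trans (≤wt Neg neg (bounded (p ∸ toℕ y) (∨-introʳ {Pos (p ∸ toℕ y)} neg))) F.negative-weight ,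
      0 , 1 , trans (+-identityʳ _) (trans (m+[n∸m]≡n (<⇒≤ (toℕ<n y))) (sym (+-identityʳ p)))
      where
      neg : Neg (p ∸ toℕ y) ≡ true
      neg = High⇒Neg {y} (tabulate-∈ High h)

    A″-range : ∀ y → y Sub.∈ A″ → InRangeHalf p y
    A″-range y h = toℕ y , n≢0⇒n>0 (λ e → true≢false (Low⇒Pos {y} low) (trans (cong Pos e) Pos0)) ,
      linarith 3 (λ y q p → y ⊲ κ 1 ⊕ q ⇒ p ≐ κ 1 ⊕ (q ⊕ q) ⇒ ⊢ κ 2 ⊗ y ⊴ p) (toℕ y) q p (<ᵇ-sound (proj₂ (∧-elim {D y} low))) p≡ , 0 , 0 , refl
      where
      low : y ∈ Low
      low = tabulate-∈ Low h

    A″-not-negated : ∀ y → y Sub.∈ A″ → ¬ InNeg p A′ y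
    A″-not-negated y h (a , ha , i , j , eq) = anti-D y (proj₁ (∧-elim {D y} (tabulate-∈ Low h)))
      (trans (cong D (sym (∙-cancelʳ y (trans (∙-comm a y) (trans (π-intro i j eq) (sym (inverseˡ y))))))) (proj₁ (∧-elim {D a} (tabulate-∈ High ha))))

    sum-Low : ∀ (f : ℕ → ℕ) → sum (λ x → f (toℕ x) * 𝟙 (Low x)) ≡ sumTo N (λ t → f t * 𝟙 (Pos t))
    sum-Low f = trans (sum-cong-≗ λ x → cong (λ b → f (toℕ x) * 𝟙 (b ∧ (toℕ x <ᵇ N))) (cong D (sym (π-toℕ x))))
      (trans (fold G) (trans (cong₂ _+_ (sumTo-cong N λ t lt → cong (λ b → f t * 𝟙 b) (Bool.∧-comm (D (π t)) (t <ᵇ N)))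
        (trans (sumTo-cong q λ t lt → trans (cong (λ b → f (p ∸ suc t) * 𝟙 (D (π (p ∸ suc t)) ∧ b)) (<ᵇ-false (N≤p-suc lt)))
          (trans (cong (λ b → f (p ∸ suc t) * 𝟙 b) (Bool.∧-zeroʳ (D (π (p ∸ suc t))))) (*-zeroʳ (f (p ∸ suc t))))) (sumTo-zero q))) (+-identityʳ _)))
      where
      G : ℕ → ℕ
      G t = f t * 𝟙 (D (π t) ∧ (t <ᵇ N))

    sum-High : ∀ (f : ℕ → ℕ) → sum (λ x → f (toℕ x) * 𝟙 (High x)) ≡ sumTo q (λ t → f (p ∸ suc t) * 𝟙 (Neg (suc t)))
    sum-High f = trans (sum-cong-≗ λ x → cong (λ b → f (toℕ x) * 𝟙 (b ∧ not (toℕ x <ᵇ N))) (cong D (sym (π-toℕ x))))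
      (trans (fold G) (trans (cong₂ _+_ (trans (sumTo-cong N λ t lt → trans (cong (λ b → f t * 𝟙 (D (π t) ∧ not b)) (<ᵇ-true lt))
          (trans (cong (λ b → f t * 𝟙 b) (Bool.∧-zeroʳ (D (π t)))) (*-zeroʳ (f t)))) (sumTo-zero N))
        (sumTo-cong q λ t lt → cong (λ b → f (p ∸ suc t) * 𝟙 b) (trans (cong (λ b → D (π (p ∸ suc t)) ∧ not b) (<ᵇ-false (N≤p-suc lt)))
          (trans (Bool.∧-identityʳ (D (π (p ∸ suc t)))) (sym (Neg≡ (s≤s lt))))))) refl))
      where
      G : ℕ → ℕ
      G t = f t * 𝟙 (D (π t) ∧ not (t <ᵇ N))

    #A′ : Sub.∣ A′ ∣ ≡ ct N Neg
    #A′ = trans (∣tabulate∣ High) (trans (sum-cong-≗ λ x → sym (*-identityˡ (𝟙 (High x)))) (trans (sum-High (λ _ → 1))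
      (trans (sumTo-cong q λ t _ → *-identityˡ (𝟙 (Neg (suc t)))) (sym ct-Neg))))

    small-half : ∀ {t} → t ≤ q → t ≤ p ∸ t
    small-half {t} le = linarith 4 (λ t c p q → c ⊕ t ≐ p ⇒ t ⊴ q ⇒ p ≐ κ 1 ⊕ (q ⊕ q) ⇒ ⊢ t ⊴ c) t (p ∸ t) p q (m∸n+n≡m (≤-trans le (<⇒≤ q<p))) le p≡

    absSum-A′ : absSum p A′ ≡ τ
    absSum-A′ = trans (sumOver-tabulate (absp p) High) (trans (sum-High (λ t → t ⊓ (p ∸ t))) (trans
      (sumTo-cong q λ t lt → cong (_* 𝟙 (Neg (suc t))) (trans (cong ((p ∸ suc t) ⊓_) (m∸[m∸n]≡n (≤-trans lt (<⇒≤ q<p)))) (m≥n⇒m⊓n≡n (small-half lt))))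
      (sym (sumTo-suc q (λ t → t * 𝟙 (Neg t))))))

    absSum-A″ : absSum p A″ ≡ τ⁺
    absSum-A″ = trans (sumOver-tabulate (absp p) Low) (trans (sum-Low (λ t → t ⊓ (p ∸ t)))
      (sumTo-cong N λ t lt → cong (_* 𝟙 (Pos t)) (m≤n⇒m⊓n≡m (small-half (≤-pred lt)))))

    holes : NSet
    holes = below (suc M) (remove 0 (not ∘ T))

    -- The missing absolute values up to M. The same exceptions serve for [5, √(2p)/5] and for
    -- [1, 4].
    E : Subset p
    E = tabulate {n = p} (holes ∘ toℕ)

    ∣E∣≤δ : Sub.∣ E ∣ ≤ δ
    ∣E∣≤δ = linarith 4 (λ E c c′ d → E ≐ c′ ⇒ c ≐ c′ ⊕ κ 1 ⇒ c ⊴ κ 1 ⊕ d ⇒ ⊢ E ⊴ d) Sub.∣ E ∣ (ct (suc M) (not ∘ T)) (ct (suc M) (remove 0 (not ∘ T))) δ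
      (trans (∣tabulate∣ {p} (holes ∘ toℕ)) (trans (sum-toℕ p (𝟙 ∘ holes)) (ct-below p (suc M) (remove 0 (not ∘ T)) M<p)))
      (ct-remove (suc M) 0 (not ∘ T) (not-true T0) (s≤s z≤n)) F.few-missing

    T-outside-E : ∀ n → 1 ≤ n → n ≤ M → ¬ π n Sub.∈ E → T n ≡ true
    T-outside-E n 1≤n n≤M n∉E = decide (T n) refl
      where
      decide : ∀ b → T n ≡ b → T n ≡ true
      decide true e = e
      decide false e = ⊥-elim (n∉E (∈-tabulate {p} (holes ∘ toℕ) (trans (cong holes (toℕ-π-< (≤-trans (s≤s n≤M) M<p)))
        (below-intro {suc M} {remove 0 (not ∘ T)} (remove-intro {0} {not ∘ T} {n} (not-true e) λ { refl → <-irrefl refl 1≤n }) (s≤s n≤M)))))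

    reduce : ∀ {n y} → ModEq p n (toℕ y) → π n ≡ y
    reduce {n} {y} (i , j , eq) = trans (π-intro i j eq) (π-toℕ y)

    Pos⇒A″ : ∀ {n y} → π n ≡ y → Pos n ≡ true → y Sub.∈ A″
    Pos⇒A″ {n} e h = subst (Sub._∈ A″) e (∈-tabulate Low (Pos⇒Low {n} h))

    contains-long : ContainsExcept p (InRangeSqrt p) (λ y → y Sub.∈ A″) δ
    contains-long = E , ∣E∣≤δ , λ y (n , 5≤n , 25nn≤2p , eq) y∉E →
      [ Pos⇒A″ {n} (reduce eq) , (λ neg → ⊥-elim (<⇒≱ 5≤n (F.negative-small n neg))) ]′
        (∨-elim {Pos n} (T-outside-E n (≤-trans (s≤s z≤n) 5≤n) (n≤M n 25nn≤2p) (subst (λ z → ¬ z Sub.∈ E) (sym (reduce {n} eq)) y∉E)))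
      where
      n≤M : ∀ n → 25 * (n * n) ≤ 2 * p → n ≤ M
      n≤M n le = linarith 3 (λ n M r → n ⊗ κ 5 ⊴ r ⇒ r ⊲ M ⊗ κ 5 ⊕ κ 5 ⇒ ⊢ n ⊴ M) n M r (≮⇒≥ too-long) r<5M+5
        where
        too-long : ¬ r < n * 5
        too-long lt = linarith 3 (λ n p r → (κ 1 ⊕ r) ⊗ (κ 1 ⊕ r) ⊴ (n ⊗ κ 5) ⊗ (n ⊗ κ 5) ⇒ κ 25 ⊗ (n ⊗ n) ⊴ κ 2 ⊗ p ⇒ p ⊗ κ 2 ⊲ (κ 1 ⊕ r) ⊗ (κ 1 ⊕ r) ⇒ ⊢⊥)
          n p r (*-mono-≤ lt lt) le 2p<r+1²

    contains-short : ContainsExcept p (InRange p 1 4) (λ y → InNeg p A′ y ⊎ y Sub.∈ A″) δ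
    contains-short = E , ∣E∣≤δ , λ y (n , 1≤n , n≤4 , eq) y∉E →
      [ (λ pos → inj₂ (Pos⇒A″ {n} (reduce eq) pos)) , (λ neg → inj₁ (π (p ∸ n) , ∈-tabulate High (Neg⇒High {n} neg) , π-elim (cancels n y (≤-trans n≤4 4≤p) (reduce eq)))) ]′
        (∨-elim {Pos n} (T-outside-E n 1≤n (≤-trans n≤4 4≤M) (subst (λ z → ¬ z Sub.∈ E) (sym (reduce {n} eq)) y∉E)))
      where
      4≤M : 4 ≤ M
      4≤M = ≤-trans (m≤m+n 4 99996) M-large
      4≤p : 4 ≤ p
      4≤p = ≤-trans 4≤M (<⇒≤ M<p)
      cancels : ∀ n y → n ≤ p → π n ≡ y → π (toℕ y + toℕ (π (p ∸ n))) ≡ π 0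
      cancels n y n≤p refl = trans (π-∙ n (p ∸ n)) (trans (cong π (m+[n∸m]≡n n≤p)) π-p)

    -- A residue n is a subset sum of `D` as soon as n + τ is one of `T`. For n ≥ 3 this lies beyond
    -- the lower hole Q ≤ 2, and the upper hole wt T - Q corresponds to n = τ⁺ - Q alone.
    exceptional : ∃ λ (E : Subset p) → Sub.∣ E ∣ ≤ δ × (∀ n → 3 ≤ n → ¬ π n Sub.∈ E → Ordinary Q (n + τ) (wt N T))
    exceptional = [ (λ Q≡0 → Sub.⊥ , ≤-trans (≤-reflexive (∣⊥∣≡0 p)) z≤n , λ _ _ _ → inj₁ Q≡0) ,
        (λ (δ≡1 , _) → Sub.⁅ π (τ⁺ ∸ Q) ⁆ , ≤-reflexive (trans (∣⁅x⁆∣≡1 (π (τ⁺ ∸ Q))) (sym δ≡1)) , λ n 3≤n n∉ →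
          inj₂ ((λ e → <⇒≱ (≤-trans (s≤s F.Q≤2) 3≤n) (≤-trans (m≤m+n n τ) (≤-reflexive e))) ,
            λ e → n∉ (subst (λ m → π n Sub.∈ Sub.⁅ π m ⁆) (sym (trans (cong (_∸ Q) (τ⁺≡ n e)) (m+n∸n≡m n Q))) (x∈⁅x⁆ (π n))))) ]′ F.gap-cases
      where
      τ⁺≡ : ∀ n → n + τ + Q ≡ wt N T → τ⁺ ≡ n + Q
      τ⁺≡ n e = linarith 5 (λ n t q w a → n ⊕ t ⊕ q ≐ w ⇒ w ≐ a ⊕ t ⇒ ⊢ a ≐ n ⊕ q) n τ Q (wt N T) τ⁺ e F.total

    contains-sums : ContainsExcept p (InRange p 3 (absSum p A″)) (λ y → InSharp p (tabulate D) (toℕ y)) δ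
    contains-sums = proj₁ exceptional , proj₁ (proj₂ exceptional) , λ y (n , 3≤n , n≤ , eq) y∉ →
      represent n y 3≤n (reduce eq) (F.covers (n + τ) (≤-trans (+-monoˡ-≤ τ (≤-trans n≤ (≤-reflexive absSum-A″))) (≤-reflexive (sym F.total)))
        (proj₂ (proj₂ exceptional) n 3≤n (subst (λ z → ¬ z Sub.∈ proj₁ exceptional) (sym (reduce {n} eq)) y∉)))
      where
      represent : ∀ n y → 3 ≤ n → π n ≡ y → Sums.Sum N T (n + τ) → InSharp p (tabulate D) (toℕ y)
      represent n y 3≤n n≡ (V , V⊑T , wtV) = tabulate S.B , (λ h → ∈-tabulate D (S.B⊆D _ (tabulate-∈ S.B h))) ,
        inhabited (#-pos⇒∃ S.B (n≢0⇒n>0 nonempty)) ,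
        π-elim (trans (cong π (trans (sumOver-tabulate toℕ S.B) gsum≡)) (trans (π-+kp n l) (trans n≡ (sym (π-toℕ y)))))
        where
        module S = Select V V⊑T
        l : ℕ
        l = sumTo q S.lost
        gsum≡ : gsum S.B ≡ n + l * p
        gsum≡ = linarith 6 (λ g t v p l n → g ⊕ t ≐ v ⊕ p ⊗ l ⇒ v ≐ n ⊕ t ⇒ ⊢ g ≐ n ⊕ l ⊗ p) (gsum S.B) τ (wt N V) p l n S.signed-sum wtV
        inhabited : (∃ λ x → x ∈ S.B) → Sub.Nonempty (tabulate S.B)
        inhabited (x , hx) = x , ∈-tabulate S.B hx
        nonempty : ¬ # S.B ≡ 0
        nonempty none = <⇒≱ (≤-trans (s≤s z≤n) 3≤n) (+-cancelʳ-≤ τ n 0 (≤-reflexive (trans (sym wtV) (wt-cong N λ t _ →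
          S.empty⇒Neg (λ x → ¬true⇒false λ h → <⇒≱ (∈⇒#-pos S.B h) (≤-reflexive none)) t))))

    p∸1+1 : p ∸ 1 + 1 ≡ p
    p∸1+1 = m∸n+n≡m 0<p

    gap-excess : 1 ≤ Q → δ ≡ 1
    gap-excess 1≤Q = [ (λ Q≡0 → ⊥-elim (<⇒≱ 1≤Q (≤-reflexive Q≡0))) , proj₁ ]′ F.gap-cases

    A″-weight : absSum p A″ ≤ p ∸ 1 + 3 * δ
    A″-weight = ≤-trans (≤-reflexive absSum-A″) ([ (λ lt → ≤-trans (∸-monoˡ-≤ 1 lt) (m≤m+n (p ∸ 1) (3 * δ))) ,
      (λ (1≤Q , e) → linarith 5 (λ a p q d o → a ≐ p ⊕ q ⇒ q ⊴ κ 2 ⇒ d ≐ κ 1 ⇒ o ⊕ κ 1 ≐ p ⇒ ⊢ a ⊴ o ⊕ κ 3 ⊗ d) τ⁺ p Q δ (p ∸ 1) e F.Q≤2 (gap-excess 1≤Q) p∸1+1) ]′ F.positive-weight)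

    triangle : p ∸ 1 < absSum p A″ → p + 2 ≤ (r * (r + 1)) / 2 × (r * (r + 1)) / 2 ≤ p + 7
    triangle excess = [ (λ lt → ⊥-elim (<⇒≱ excess (≤-trans (≤-reflexive absSum-A″) (∸-monoˡ-≤ 1 lt)))) , (λ (1≤Q , e) → bounds 1≤Q e (pronic-even r)) ]′ F.positive-weight
      where
      bounds : 1 ≤ Q → τ⁺ ≡ p + Q → (∃ λ m → r * (r + 1) ≡ m * 2) → p + 2 ≤ (r * (r + 1)) / 2 × (r * (r + 1)) / 2 ≤ p + 7
      bounds 1≤Q e (m , pronic) = subst (λ x → p + 2 ≤ x × x ≤ p + 7) (sym (trans (cong (_/ 2) pronic) (m*n/n≡m m 2)))
        (≮⇒≥ lower , linarith 3 (λ m s p → s ≐ m ⊗ κ 2 ⇒ s ⊴ κ 2 ⊗ (p ⊕ κ 7) ⇒ ⊢ m ⊴ p ⊕ κ 7) m (r * (r + 1)) p pronic (F.triangle-bound 1≤Q e))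
        where
        r≢k : ¬ r ≤ k
        r≢k r≤k = linarith 3 (λ k d r → k ⊕ d ≐ r ⇒ d ≐ κ 1 ⇒ r ⊴ k ⇒ ⊢⊥) k δ r k+δ (gap-excess 1≤Q) r≤k
        -- δ = 1 means that no r elements are zero-free. In particular {1, ..., r} is not, so its
        -- total r(r + 1)/2 cannot be below p.
        p≤m : p ≤ m
        p≤m = ≮⇒≥ λ lt → r≢k (initial-size r (≤-<-trans (m≤m+n r 2) r+2<p)
          (linarith 3 (λ s m p → s ≐ m ⊗ κ 2 ⇒ m ⊲ p ⇒ ⊢ s ⊲ p ⊗ κ 2) (r * (r + 1)) m p pronic lt))
        not-both : ∀ a b → 0 < a → 0 < b → a < p → b < p → ¬ a * b ≡ 2 * p
        not-both a b 0<a 0<b a<p b<p eq = [ (λ p∣a → <⇒≱ a<p (∣⇒≤ {{>-nonZero 0<a}} p∣a)) , (λ p∣b → <⇒≱ b<p (∣⇒≤ {{>-nonZero 0<b}} p∣b)) ]′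
          (euclidsLemma a b prime (divides 2 eq))
        predecessor : ∃ λ s → r ≡ suc s
        predecessor = r ∸ 1 , trans (sym (m∸n+n≡m (≤-trans (s≤s z≤n) 10≤r))) (+-comm (r ∸ 1) 1)
        -- r(r + 1) = 2p + 2 is the same as (r - 1)(r + 2) = 2p.
        m≢p+1 : (∃ λ s → r ≡ suc s) → ¬ m ≡ suc p
        m≢p+1 (s , r≡) m≡ = not-both s (s + 3) 0<s (≤-trans 0<s (m≤m+n s 3)) (≤-<-trans (m≤n+m s 3) s+3<p) (subst (_< p) (+-comm 3 s) s+3<p)
          (linarith 4 (λ s r m p → r ≐ κ 1 ⊕ s ⇒ (κ 1 ⊕ s) ⊗ (κ 1 ⊕ s ⊕ κ 1) ≐ m ⊗ κ 2 ⇒ m ≐ κ 1 ⊕ p ⇒ ⊢ s ⊗ (s ⊕ κ 3) ≐ κ 2 ⊗ p) s r m p r≡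
            (subst (λ r → r * (r + 1) ≡ m * 2) r≡ pronic) m≡)
          where
          0<s : 0 < s
          0<s = linarith 2 (λ s r → r ≐ κ 1 ⊕ s ⇒ κ 10 ⊴ r ⇒ ⊢ κ 0 ⊲ s) s r r≡ 10≤r
          s+3<p : 3 + s < p
          s+3<p = linarith 3 (λ s r p → r ≐ κ 1 ⊕ s ⇒ r ⊕ κ 2 ⊲ p ⇒ ⊢ κ 3 ⊕ s ⊲ p) s r p r≡ r+2<p
        m≢p : ¬ m ≡ p
        m≢p m≡ = not-both r (r + 1) (≤-trans (s≤s z≤n) 10≤r) (≤-trans (s≤s z≤n) (m≤n+m 1 r)) (≤-<-trans (m≤m+n r 2) r+2<p) (≤-<-trans (+-monoʳ-≤ r (s≤s z≤n)) r+2<p)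
          (trans pronic (trans (cong (_* 2) m≡) (*-comm p 2)))
        lower : ¬ m < p + 2
        lower lt = [ (λ lt′ → m≢p (≤-antisym (≤-pred lt′) p≤m)) , m≢p+1 predecessor ]′ (m≤n⇒m<n∨m≡n (≤-pred (≤-trans lt (≤-reflexive (+-comm p 2)))))

    result : Structure
    result = d , d≢0 , tabulate D , isDilate , A′ , A″ , partition , A′-range , A″-range , A″-not-negated ,
      ≤-trans (≤-reflexive #A′) F.negative-count , contains-long , contains-short , contains-sums ,
      ≤-trans (≤-reflexive absSum-A′) F.negative-weight , A″-weight , triangle

  structure : Structure
  structure = choose (near-extremal X zf k (sym (∣∣≡# A)) r≤k+1 (≤-trans k≤r (m≤m+n r 1))) (division r 5 (s≤s z≤n))
    where
    choose : ∃ (Good X zf) → (∃ λ M → M * 5 ≤ r × r < suc M * 5) → Structure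
    choose (e , e≢ε , weight , sign) (M , lo , hi) = Dilated.result e e≢ε weight sign M lo (subst (r <_) (+-comm 5 (M * 5)) hi)

open Subsets using (isqrt-spec; isqrt-large; odd-half)
open Sub using (_∈_; _∪_; ∣_∣)

theorem7 : ∃ λ (P₀ : ℕ) → ∀ (p : ℕ) → Prime p → P₀ ≤ p →
  ∀ (A : Subset p) → MaxZeroFree p A →
  let r = isqrt (2 * p)
      δ = r ∸ ∣ A ∣
  in (∣ A ∣ ≤ r × δ ≤ 1) ×
     (∃ λ (d : Fin p) → toℕ d ≢ 0 × ∃ λ (D : Subset p) → IsDilate p d A D ×
      ∃ λ (A′ : Subset p) → ∃ λ (A″ : Subset p) → D ≡ A′ ∪ A″ ×
        -- (i)
        (∀ (y : Fin p) → y ∈ A′ → InNegRange p (2 * (1 + δ)) y) ×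
        (∀ (y : Fin p) → y ∈ A″ → InRangeHalf p y) ×
        (∀ (y : Fin p) → y ∈ A″ → ¬ InNeg p A′ y) ×
        ∣ A′ ∣ ≤ 1 + δ ×
        -- (ii)
        ContainsExcept p (InRangeSqrt p) (λ y → y ∈ A″) δ ×
        -- (iii)
        ContainsExcept p (InRange p 1 4) (λ y → InNeg p A′ y ⊎ y ∈ A″) δ ×
        -- (iv)
        ContainsExcept p (InRange p 3 (absSum p A″)) (λ y → InSharp p D (toℕ y)) δ ×
        -- (v)
        absSum p A′ ≤ 2 * (1 + δ) ×
        absSum p A″ ≤ p ∸ 1 + 3 * δ ×
        -- further
        (p ∸ 1 < absSum p A″ → p + 2 ≤ (r * (r + 1)) / 2 × (r * (r + 1)) / 2 ≤ p + 7))
theorem7 = 10 ^ 55 * 10 ^ 55 , λ p isPrime p-large A max →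
  let 2<p = ≤-trans (≤ᵇ⇒≤ 3 (10 ^ 55 * 10 ^ 55) _) p-large
      (q , p≡) = odd-half p isPrime 2<p
      r = isqrt (2 * p)
      (r² , r+1²) = isqrt-spec (2 * p)
      module E = Extremal p isPrime 2<p q p≡ A max r (subst (r * r ≤_) (*-comm 2 p) r²) (subst (_< suc r * suc r) (*-comm 2 p) r+1²) (isqrt-large p p-large)
  in (E.k≤r , E.δ≤1) , E.structure
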